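{- Directed Token Sliding on polytrees $T=(V,A)$ can be solved in $\mathrm{O}(|V|)$ time; that is, there is an algorithm which, given a polytree $T=(V,A)$ and independent sets $I^{\mathtt{s}},I^{\mathtt{t}}$ in $T$ with $|I^{\mathtt{s}}|=|I^{\mathtt{t}}|$, decides in $\mathrm{O}(|V|)$ time whether $I^{\mathtt{s}}$ is reconfigurable into $I^{\mathtt{t}}$ in $T$. Moreover, if the answer is affirmative, then all reconfiguration sequences from $I^{\mathtt{s}}$ to $I^{\mathtt{t}}$ in $T$ have the same length, and one of them can be constructed in $\mathrm{O}(|V|^2)$ time.
   Context: All digraphs are finite. A polytree is a digraph (without antiparallel arcs $(u,v),(v,u)$) whose underlying undirected graph, obtained by ignoring arc directions, is a tree. A set of vertices is an independent set in a digraph if it is an independent set in the underlying undirected graph. Let $I^{\mathtt{s}}, I^{\mathtt{t}}$ be independent sets in a digraph $G$ with $|I^{\mathtt{s}}|=|I^{\mathtt{t}}|$. A reconfiguration sequence from $I^{\mathtt{s}}$ to $I^{\mathtt{t}}$ in $G$ is a sequence $\langle I_0,\dots,I_\ell\rangle$ of independent sets of $G$ with $I_0=I^{\mathtt{s}}$, $I_\ell=I^{\mathtt{t}}$ such that for every $i\in\{1,\dots,\ell\}$ we have $I_{i-1}\setminus I_i=\{u\}$ and $I_i\setminus I_{i-1}=\{v\}$ for some arc $(u,v)\in A(G)$; its length is $\ell$. The set $I^{\mathtt{s}}$ is reconfigurable into $I^{\mathtt{t}}$ in $G$ if such a sequence exists. Directed Token Sliding: given a triple $(G,I^{\mathtt{s}},I^{\mathtt{t}})$,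 where $G$ is a digraph and $I^{\mathtt{s}},I^{\mathtt{t}}\subseteq V(G)$ are independent sets in $G$ with $|I^{\mathtt{s}}|=|I^{\mathtt{t}}|$, decide whether $I^{\mathtt{s}}$ is reconfigurable into $I^{\mathtt{t}}$. -}

module Defs where

open import Data.Bool.Base using (Bool; true; false; if_then_else_)
open import Data.Fin.Base using (Fin; toℕ; fromℕ; inject₁) renaming (zero to fzero; suc to fsuc)
open import Data.Fin.Subset using (Subset; ⁅_⁆; _─_; ∣_∣) renaming (_∈_ to _∈ˢ_)
open import Data.List.Base using (List; []; _∷_; length; map; _∷ʳ_)
open import Data.List.Membership.Propositional using (_∈_; _∉_)
open import Data.List.Relation.Unary.Linked using (Linked)
open import Data.List.Relation.Unary.Unique.Propositional using (Unique)
open import Data.Nat.Base using (ℕ; zero; suc; _+_; _∸_; _≤_; _<_; NonZero)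
open import Data.Nat.Properties using (_≟_)
open import Data.Product.Base using (Σ-syntax; ∃-syntax; _×_; _,_; proj₁; proj₂)
open import Data.Sum.Base using (_⊎_)
open import Data.Vec.Base using (toList)
open import Relation.Binary.Construct.Closure.ReflexiveTransitive using (Star)
open import Relation.Binary.PropositionalEquality using (_≡_; _≢_)
open import Relation.Nullary using (¬_; does)

------------------------------------------------------------------------
-- Digraphs and polytrees

-- The order of the arc list carries no graph-theoretic meaning; it is the
-- order in which the arcs are presented to an algorithm.
record Digraph (n : ℕ) : Set where
  field
    arcs     : List (Fin n × Fin n)
    unique   : Unique arcs
    loopless : ∀ v → (v , v) ∉ arcs

open Digraph public

Adjacent : ∀ {n} → Digraph n → Fin n → Fin n → Set
Adjacent G u v = ((u , v) ∈ arcs G) ⊎ ((v , u) ∈ arcs G)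

-- A cycle is v ∷ vs with at least three distinct vertices, consecutive ones
-- adjacent, including the last one and v.
IsCycle : ∀ {n} → Digraph n → Fin n → List (Fin n) → Set
IsCycle G v vs =
  2 ≤ length vs × Unique (v ∷ vs) × Linked (Adjacent G) ((v ∷ vs) ∷ʳ v)

record IsPolytree {n : ℕ} (G : Digraph n) : Set where
  field
    no-antiparallel : ∀ u v → (u , v) ∈ arcs G → (v , u) ∉ arcs G
    nonempty        : NonZero n
    connected       : ∀ u v → Star (Adjacent G) u v
    acyclic         : ∀ v vs → ¬ IsCycle G v vs

------------------------------------------------------------------------
-- Directed Token Sliding

Independent : ∀ {n} → Digraph n → Subset n → Set
Independent G I = ∀ u v → u ∈ˢ I → v ∈ˢ I → ¬ Adjacent G u v

record Instance (n : ℕ) : Set where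
  field
    graph              : Digraph n
    source target      : Subset n
    source-independent : Independent graph source
    target-independent : Independent graph target
    same-size          : ∣ source ∣ ≡ ∣ target ∣

open Instance public

Slide : ∀ {n} → Digraph n → Fin n × Fin n → Subset n → Subset n → Set
Slide G (u , v) I J =
  ((u , v) ∈ arcs G) × (I ─ J ≡ ⁅ u ⁆) × (J ─ I ≡ ⁅ v ⁆)

record ReconfigurationSequence {n : ℕ} (X : Instance n) (ℓ : ℕ) : Set where
  field
    sets        : Fin (suc ℓ) → Subset n
    independent : ∀ i → Independent (graph X) (sets i)
    start       : sets fzero ≡ source X
    end         : sets (fromℕ ℓ) ≡ target X
    move        : Fin ℓ → Fin n × Fin n
    slide       : ∀ i → Slide (graph X) (move i) (sets (inject₁ i)) (sets (fsuc i))

open ReconfigurationSequence public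

Reconfigurable : ∀ {n} → Instance n → Set
Reconfigurable X = ∃[ ℓ ] ReconfigurationSequence X ℓ

------------------------------------------------------------------------
-- A word RAM, programmed in a structured language
--
-- Programs are syntax, so every elementary operation is charged for.  The
-- memory consists of scalar variables and arrays, all named by literals in
-- the program; the only arithmetic is addition and truncated subtraction.

infix  8 _!_
infixl 7 _⊕_ _⊖_
infix  5 _≔_ _[_]≔_
infix  4 IfNonzero_Then_Else_ WhileNonzero_Do_
infixr 3 _⨾_
infix  2 _⊢_,_⇓[_]_

data Exp : Set where
  lit     : ℕ → Exp
  var     : ℕ → Exp
  _!_     : ℕ → Exp → Exp
  _⊕_ _⊖_ : Exp → Exp → Exp

data Cmd : Set where
  skip                 : Cmd
  _≔_                  : ℕ → Exp → Cmd
  _[_]≔_               : ℕ → Exp → Exp → Cmd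
  _⨾_                  : Cmd → Cmd → Cmd
  IfNonzero_Then_Else_ : Exp → Cmd → Cmd → Cmd
  WhileNonzero_Do_     : Exp → Cmd → Cmd

record State : Set where
  constructor ⟨_,_⟩
  field
    scalar : ℕ → ℕ
    array  : ℕ → ℕ → ℕ

open State public

update : {A : Set} → (ℕ → A) → ℕ → A → ℕ → A
update f x a y = if does (y ≟ x) then a else f y

⟦_⟧ : Exp → State → ℕ
⟦ lit k ⟧  s = k
⟦ var x ⟧  s = scalar s x
⟦ a ! e ⟧  s = array s a (⟦ e ⟧ s)
⟦ e ⊕ f ⟧  s = ⟦ e ⟧ s + ⟦ f ⟧ s
⟦ e ⊖ f ⟧  s = ⟦ e ⟧ s ∸ ⟦ f ⟧ s

cost : Exp → ℕ
cost (lit _)  = 1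
cost (var _)  = 1
cost (_ ! e)  = 1 + cost e
cost (e ⊕ f)  = 1 + cost e + cost f
cost (e ⊖ f)  = 1 + cost e + cost f

-- W ⊢ C , s ⇓[ t ] s′ : on a machine whose memory words hold numbers below W,
-- C started in s halts in s′ after t elementary operations.  A command that
-- would store a number, or use a store address, not fitting into a word has
-- no derivation.  Unstored intermediate values exceed W by at most a factor
-- depending only on the program, so they need no separate bound.
data _⊢_,_⇓[_]_ (W : ℕ) : Cmd → State → ℕ → State → Set where

  skip : ∀ {s} → W ⊢ skip , s ⇓[ 1 ] s

  assign : ∀ {s x e} → ⟦ e ⟧ s < W →
    W ⊢ x ≔ e , s ⇓[ 1 + cost e ]
      ⟨ update (scalar s) x (⟦ e ⟧ s) , array s ⟩

  store : ∀ {s a e f} → ⟦ e ⟧ s < W → ⟦ f ⟧ s < W →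
    W ⊢ a [ e ]≔ f , s ⇓[ 1 + cost e + cost f ]
      ⟨ scalar s , update (array s) a (update (array s a) (⟦ e ⟧ s) (⟦ f ⟧ s)) ⟩

  seq : ∀ {s s′ s″ C D t t′} →
    W ⊢ C , s ⇓[ t ] s′ → W ⊢ D , s′ ⇓[ t′ ] s″ →
    W ⊢ C ⨾ D , s ⇓[ t + t′ ] s″

  if-nonzero : ∀ {s s′ e C D t} → ⟦ e ⟧ s ≢ 0 → W ⊢ C , s ⇓[ t ] s′ →
    W ⊢ IfNonzero e Then C Else D , s ⇓[ 1 + cost e + t ] s′

  if-zero : ∀ {s s′ e C D t} → ⟦ e ⟧ s ≡ 0 → W ⊢ D , s ⇓[ t ] s′ →
    W ⊢ IfNonzero e Then C Else D , s ⇓[ 1 + cost e + t ] s′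

  while-nonzero : ∀ {s s′ s″ e C t t′} → ⟦ e ⟧ s ≢ 0 →
    W ⊢ C , s ⇓[ t ] s′ → W ⊢ WhileNonzero e Do C , s′ ⇓[ t′ ] s″ →
    W ⊢ WhileNonzero e Do C , s ⇓[ 1 + cost e + t + t′ ] s″

  while-zero : ∀ {s e C} → ⟦ e ⟧ s ≡ 0 →
    W ⊢ WhileNonzero e Do C , s ⇓[ 1 + cost e ] s

HaltsWithin : (W bound : ℕ) → Cmd → State → (State → Set) → Set
HaltsWithin W bound C s Post =
  ∃[ t ] ∃[ s′ ] (W ⊢ C , s ⇓[ t ] s′) × t ≤ bound × Post s′

------------------------------------------------------------------------
-- Input and output conventions

entry : List ℕ → ℕ → ℕ
entry []       _       = 0
entry (x ∷ _)  zero    = x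
entry (_ ∷ xs) (suc i) = entry xs i

indicator : ∀ {n} → Subset n → List ℕ
indicator I = map (λ b → if b then 1 else 0) (toList I)

-- Scalar 0 holds the number of vertices and scalar 1 the number of arcs.
-- Arrays 0 and 1 list the tails and the heads of the arcs; arrays 2 and 3 are
-- the characteristic vectors of the two independent sets.  All other words
-- are zero.
input : ∀ {n} → Instance n → State
input {n} X = ⟨ scalars , arrays ⟩
  where
  scalars : ℕ → ℕ
  scalars 0 = n
  scalars 1 = length (arcs (graph X))
  scalars _ = 0

  arrays : ℕ → ℕ → ℕ
  arrays 0 = entry (map (λ a → toℕ (proj₁ a)) (arcs (graph X)))
  arrays 1 = entry (map (λ a → toℕ (proj₂ a)) (arcs (graph X)))
  arrays 2 = entry (indicator (source X))
  arrays 3 = entry (indicator (target X))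
  arrays _ = λ _ → 0

AnswersReconfigurability : ∀ {n} → Instance n → State → Set
AnswersReconfigurability X s =
  (scalar s 0 ≡ 1 × Reconfigurable X) ⊎ (scalar s 0 ≡ 0 × ¬ Reconfigurable X)

-- A reconfiguration sequence is output as its length, in scalar 0, together
-- with the arcs along which the tokens slide: tails in array 0 and heads in
-- array 1.  These determine the sets; writing every set out in full could
-- already take more than quadratic time.
OutputsSequence : ∀ {n} → Instance n → State → Set
OutputsSequence X s =
  Σ[ ℓ ∈ ℕ ] Σ[ R ∈ ReconfigurationSequence X ℓ ]
    scalar s 0 ≡ ℓ ×
    (∀ (i : Fin ℓ) → array s 0 (toℕ i) ≡ toℕ (proj₁ (move R i))
                   × array s 1 (toℕ i) ≡ toℕ (proj₂ (move R i)))

{-# OPTIONS --safe #-}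
module Submission where

-- Peeling off leaves shows that the flow over every arc (the number of tokens
-- sliding along it) is determined by the two sets; hence all sequences have
-- the same length.
--
-- A sequence exists iff this flow is nonnegative and there are two matchings
-- S and T of arcs: S holds the arc along which each token of the initial set
-- that moves makes its first move, T the arc by which a token arrives at each
-- final vertex that is entered.  An arc that carries a single token and is in
-- both must carry the only unit leaving its tail and the only one entering its
-- head, and no token passes a neighbour of a token that never moves.
-- Necessity is a backward induction on the sequence.  Both matchings are
-- forced or best chosen greedily along the order of elimination.
--
-- Conversely, adding the arcs in the reverse order one can maintain a path
-- along which some token can slide all the way to its final vertex, with the
-- conditions holding again afterwards.  Each such round takes linear time and
-- there is at most one round per token.
--
-- The programs are analysed on unbounded words.  As values grow slowly with
-- time, words of logarithmically many bits suffice.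
open import Defs
open import Data.Bool.Base using (Bool; true; false; if_then_else_; _∨_; not) renaming (T to True)
open import Data.Empty using (⊥; ⊥-elim)
open import Data.Fin.Base using (Fin; toℕ; fromℕ; fromℕ<; inject₁) renaming (zero to fzero; suc to fsuc)
import Data.Fin.Properties as Fin
open import Data.Fin.Subset using (Subset; ⁅_⁆; _─_; _⊆_) renaming (_∈_ to _∈ˢ_; _∉_ to _∉ˢ_)
open import Data.Fin.Subset.Properties using (x∈⁅x⁆; x∈⁅y⁆⇒x≡y; x∈p∧x∉q⇒x∈p─q; p─q⊆p; ⊆-antisym; _∈?_)
open import Data.List.Base using (List; []; _∷_; _∷ʳ_; _++_; length; map; lookup)
open import Data.List.Membership.Propositional using (_∈_; _∉_)
open import Data.List.Membership.Propositional.Properties using (∈-∃++; ∈-lookup)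
open import Data.List.Relation.Unary.All as All using (All; []; _∷_)
import Data.List.Relation.Unary.All.Properties as All
open import Data.List.Relation.Unary.AllPairs using ([]; _∷_)
open import Data.List.Relation.Unary.Any as Any using (Any; here; there)
import Data.List.Relation.Unary.Any.Properties as Any
open import Data.List.Relation.Unary.Linked using (Linked; []; [-]; _∷_)
open import Data.List.Relation.Unary.Unique.Propositional using (Unique)
open import Data.Nat.Base
open import Data.Nat.Induction using (<-rec)
open import Data.Nat.Properties
open import Data.Product.Base using (Σ-syntax; ∃-syntax; _×_; _,_; proj₁; proj₂)
open import Data.Sum.Base using (_⊎_; inj₁; inj₂)
open import Data.Unit.Base using (⊤; tt)
open import Data.Vec.Base using ([]; _∷_; here; there; tabulate)
open import Data.Vec.Properties using ([]=⇒lookup; lookup⇒[]=; lookup∘tabulate)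
open import Relation.Binary.Definitions using (tri<; tri≈; tri>)
open import Relation.Binary.PropositionalEquality hiding (J)
open import Relation.Nullary using (¬_; yes; no; does)

-- The two matchings reflect blocking. A token waiting at the tail of an arc keeps the head empty,
-- so if it starts along that arc it is the first to enter the head. With time reversed, a token
-- arriving for good along an arc bars the tail from then on, so it is the last to leave the tail. A
-- single unit on an arc with both labels is therefore first and last at both ends.
--
-- The obstacle in the converse is that these conditions are local, whereas finding a token that can
-- run through to its final vertex is not. A partial path may thus be open at either end, an open
-- end being the promise of a suitable arc among those still to come; and the path may be abandoned
-- for one through the new leaf. Once no arc is to come, no promise can be outstanding, so the path
-- is complete.
--
-- For the greedy matchings, the label asked for by the child of an arc is forced, as this is its
-- last arc; the other choices are compared with those of an arbitrary plan. The positive answer of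
-- the decision procedure is justified by the terminating run of the constructing loop.

branch : {A : Set} → ℕ → A → A → A
branch zero    z _ = z
branch (suc _) _ s = s

branch-zero : ∀ {A : Set} {d} {x y : A} → d ≡ 0 → branch d x y ≡ x
branch-zero refl = refl

branch-pos : ∀ {A : Set} {d} {x y : A} → 1 ≤ d → branch d x y ≡ y
branch-pos (s≤s _) = refl

update-elim : ∀ {A : Set} {f : ℕ → A} {x a} (P : A → Set) y →
  (y ≡ x → P a) → (y ≢ x → P (f y)) → P (update f x a y)
update-elim {x = x} P y p q with y ≡ᵇ x in eq
... | true  = p (≡ᵇ⇒≡ y x (subst True (sym eq) tt))
... | false = q (λ y≡x → subst True eq (≡⇒≡ᵇ y x y≡x))

update-same : ∀ {A : Set} (f : ℕ → A) x {a} y → y ≡ x → update f x a y ≡ a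
update-same f x y y≡x = update-elim {f = f} (_≡ _) y (λ _ → refl) (λ y≢x → ⊥-elim (y≢x y≡x))

update-other : ∀ {A : Set} (f : ℕ → A) x {a} y → y ≢ x → update f x a y ≡ f y
update-other f x y y≢x = update-elim {f = f} (_≡ _) y (λ y≡x → ⊥-elim (y≢x y≡x)) (λ _ → refl)

-- Execution on a machine with unbounded words.
infix 2 _⇓_[_]_
data _⇓_[_]_ : State → Cmd → ℕ → State → Set where

  skip : ∀ {s} → s ⇓ skip [ 1 ] s

  assign : ∀ {s x e} →
    s ⇓ x ≔ e [ 1 + cost e ] ⟨ update (scalar s) x (⟦ e ⟧ s) , array s ⟩

  store : ∀ {s a e f} → s ⇓ a [ e ]≔ f [ 1 + cost e + cost f ]
    ⟨ scalar s , update (array s) a (update (array s a) (⟦ e ⟧ s) (⟦ f ⟧ s)) ⟩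

  seq : ∀ {s s′ s″ C D t t′} → s ⇓ C [ t ] s′ → s′ ⇓ D [ t′ ] s″ → s ⇓ C ⨾ D [ t + t′ ] s″

  if-nonzero : ∀ {s s′ e C D t} → ⟦ e ⟧ s ≢ 0 → s ⇓ C [ t ] s′ →
    s ⇓ IfNonzero e Then C Else D [ 1 + cost e + t ] s′

  if-zero : ∀ {s s′ e C D t} → ⟦ e ⟧ s ≡ 0 → s ⇓ D [ t ] s′ →
    s ⇓ IfNonzero e Then C Else D [ 1 + cost e + t ] s′

  while-nonzero : ∀ {s s′ s″ e C t t′} → ⟦ e ⟧ s ≢ 0 →
    s ⇓ C [ t ] s′ → s′ ⇓ WhileNonzero e Do C [ t′ ] s″ →
    s ⇓ WhileNonzero e Do C [ 1 + cost e + t + t′ ] s″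

  while-zero : ∀ {s e C} → ⟦ e ⟧ s ≡ 0 → s ⇓ WhileNonzero e Do C [ 1 + cost e ] s

-- Timed total correctness, loops and framing

Ends : Cmd → State → ℕ → (State → Set) → Set
Ends C s b P = ∃[ t ] ∃[ s′ ] (s ⇓ C [ t ] s′) × t ≤ b × P s′

ends-seq : ∀ {C D s b b′} {P Q : State → Set} → Ends C s b P →
  (∀ s′ → P s′ → Ends D s′ b′ Q) → Ends (C ⨾ D) s (b + b′) Q
ends-seq (t , s′ , d , p , q) k with k s′ q
... | t′ , s″ , d′ , p′ , q′ = _ , s″ , seq d d′ , +-mono-≤ p p′ , q′

ends-weaken : ∀ {C s b b′} {P Q : State → Set} → b ≤ b′ → (∀ s′ → P s′ → Q s′) →
  Ends C s b P → Ends C s b′ Q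
ends-weaken b≤ k (t , s′ , d , p , q) = t , s′ , d , ≤-trans p b≤ , k s′ q

-- The measure `k` may fall by more than one, hence the recursion on a fuel above it. The extra
-- round in `suc k` pays for the final test.
ends-while : ∀ {e C b} (Inv : ℕ → State → Set) →
  (∀ k s → Inv k s → ⟦ e ⟧ s ≢ 0 → Ends C s b (λ s′ → ∃[ k′ ] k′ < k × Inv k′ s′)) →
  ∀ k s → Inv k s →
  Ends (WhileNonzero e Do C) s (suc k * (1 + cost e + b)) (λ s′ → ∃[ k′ ] Inv k′ s′ × ⟦ e ⟧ s′ ≡ 0)
ends-while {e} {C} {b} Inv body k s inv = go k k ≤-refl s inv
  where
  go : ∀ fuel k → k ≤ fuel → ∀ s → Inv k s →
    Ends (WhileNonzero e Do C) s (suc fuel * (1 + cost e + b)) (λ s′ → ∃[ k′ ] Inv k′ s′ × ⟦ e ⟧ s′ ≡ 0)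
  go fuel k k≤ s inv with ⟦ e ⟧ s ≟ 0
  ... | yes z = _ , s , while-zero z , ≤-trans (m≤m+n _ b) (m≤m+n _ (fuel * (1 + cost e + b))) , k , inv , z
  ... | no nz with body k s inv nz
  ... | t , s′ , d , p , k′ , k′< , inv′ with fuel | ≤-trans k′< k≤
  ... | suc fuel | s≤s k′≤ with go fuel k′ k′≤ s′ inv′
  ... | t′ , s″ , d′ , p′ , q′ =
    _ , s″ , while-nonzero nz d d′ , +-mono-≤ (+-monoʳ-≤ (1 + cost e) p) p′ , q′

writesA : ℕ → Cmd → Bool
writesA a (b [ _ ]≔ _)                = does (a ≟ b)
writesA a (C ⨾ D)                     = writesA a C ∨ writesA a D
writesA a (IfNonzero _ Then C Else D) = writesA a C ∨ writesA a D
writesA a (WhileNonzero _ Do C)       = writesA a C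
writesA a _                           = false

writesS : ℕ → Cmd → Bool
writesS x (y ≔ _)                     = does (x ≟ y)
writesS x (C ⨾ D)                     = writesS x C ∨ writesS x D
writesS x (IfNonzero _ Then C Else D) = writesS x C ∨ writesS x D
writesS x (WhileNonzero _ Do C)       = writesS x C
writesS x _                           = false

∨-false : ∀ {a b} → a ∨ b ≡ false → a ≡ false × b ≡ false
∨-false {false} {false} _ = refl , refl

frameA : ∀ {a C s t s′} → s ⇓ C [ t ] s′ → writesA a C ≡ false → array s′ a ≡ array s a
frameA skip w = refl
frameA assign w = refl
frameA (store {a = b}) w rewrite w = refl
frameA (seq d d′) w = let (p , q) = ∨-false w in trans (frameA d′ q) (frameA d p)
frameA (if-nonzero _ d) w = frameA d (proj₁ (∨-false w))
frameA (if-zero {C = C} _ d) w = frameA d (proj₂ (∨-false {writesA _ C} w))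
frameA (while-nonzero _ d d′) w = trans (frameA d′ w) (frameA d w)
frameA (while-zero _) w = refl

frameS : ∀ {x C s t s′} → s ⇓ C [ t ] s′ → writesS x C ≡ false → scalar s′ x ≡ scalar s x
frameS skip w = refl
frameS (assign {x = y}) w rewrite w = refl
frameS store w = refl
frameS (seq d d′) w = let (p , q) = ∨-false w in trans (frameS d′ q) (frameS d p)
frameS (if-nonzero _ d) w = frameS d (proj₁ (∨-false w))
frameS (if-zero {C = C} _ d) w = frameS d (proj₂ (∨-false {writesS _ C} w))
frameS (while-nonzero _ d d′) w = trans (frameS d′ w) (frameS d w)
frameS (while-zero _) w = refl

Framed : Cmd → State → State → Set
Framed C s s′ = (∀ a → writesA a C ≡ false → array s′ a ≡ array s a)
              × (∀ x → writesS x C ≡ false → scalar s′ x ≡ scalar s x)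

ends-framed : ∀ {C s b P} → Ends C s b P → Ends C s b (λ s′ → P s′ × Framed C s s′)
ends-framed (t , s′ , d , p , q) = t , s′ , d , p , q , (λ a → frameA d) , (λ x → frameS d)

-- Word sizes.  Names are split into slow ones, only ever incremented by
-- literals, and others, to which slow values may be added; so within time t
-- slow values stay linear and all others quadratic in t.

slowA slowS : ℕ → Bool
-- Array 9 is the flow, which the program caps by scalar 0. Scalars 0 to 2 hold the sizes and the
-- loop counter, and scalar 17 counts the slides.
slowA a = does (a ≟ 9)
slowS x = not (2 <ᵇ x) ∨ does (x ≟ 17)

Slow : Exp → Set
Slow (lit k) = True (k ≤ᵇ 1)
Slow (var x) = True (slowS x)
Slow (a ! _) = True (slowA a)
Slow (e ⊕ lit k) = Slow e × True (k ≤ᵇ 1)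
Slow (e ⊕ _) = ⊥
Slow (e ⊖ _) = Slow e

-- Only additions make values grow, so their right operands are restricted. A subtrahend is free:
-- the difference never exceeds its minuend, and unstored values need no bound.
Tame : Exp → Set
Tame (lit k) = True (k ≤ᵇ 1)
Tame (var x) = ⊤
Tame (a ! _) = ⊤
Tame (e ⊕ f) = Tame e × Slow f
Tame (e ⊖ _) = Tame e

SlowIf : Bool → Exp → Set
SlowIf true  e = Slow e
SlowIf false e = ⊤

slow-if : ∀ {b e} → SlowIf b e → True b → Slow e
slow-if {true} s _ = s

TameCmd : Cmd → Set
TameCmd skip = ⊤
TameCmd (x ≔ e) = Tame e × SlowIf (slowS x) e
TameCmd (a [ e ]≔ f) = Tame e × Tame f × SlowIf (slowA a) f
TameCmd (C ⨾ D) = TameCmd C × TameCmd D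
TameCmd (IfNonzero e Then C Else D) = TameCmd C × TameCmd D
TameCmd (WhileNonzero e Do C) = TameCmd C

module Growth (B A : ℕ) where

  record Bounded (t : ℕ) (s : State) : Set where
    field
      slow-scalar : ∀ x → True (slowS x) → scalar s x ≤ B + t
      slow-array  : ∀ a → True (slowA a) → ∀ i → array s a i ≤ B + t
      any-scalar  : ∀ x → scalar s x ≤ B + t * A
      any-array   : ∀ a i → array s a i ≤ B + t * A
  open Bounded

  bounded-later : ∀ {t t′ s} → t ≤ t′ → Bounded t s → Bounded t′ s
  bounded-later p b .slow-scalar x l = ≤-trans (slow-scalar b x l) (+-monoʳ-≤ B p)
  bounded-later p b .slow-array a l i = ≤-trans (slow-array b a l i) (+-monoʳ-≤ B p)
  bounded-later p b .any-scalar x = ≤-trans (any-scalar b x) (+-monoʳ-≤ B (*-monoˡ-≤ A p))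
  bounded-later p b .any-array a i = ≤-trans (any-array b a i) (+-monoʳ-≤ B (*-monoˡ-≤ A p))

  slow-≤ : ∀ e {t s} → Slow e → Bounded t s → ⟦ e ⟧ s ≤ B + (t + cost e)
  slow-≤ (lit k) {t} l b = ≤-trans (≤ᵇ⇒≤ k 1 l) (≤-trans (m≤n+m 1 t) (m≤n+m (t + 1) B))
  slow-≤ (var x) {t} l b = ≤-trans (slow-scalar b x l) (+-monoʳ-≤ B (m≤m+n t 1))
  slow-≤ (a ! e) {t} l b = ≤-trans (slow-array b a l _) (+-monoʳ-≤ B (m≤m+n t _))
  slow-≤ (e ⊕ lit k) {t} (l , q) b = begin
    _ ≤⟨ +-mono-≤ (slow-≤ e l b) (≤ᵇ⇒≤ k 1 q) ⟩
    B + (t + cost e) + 1 ≡⟨ +-assoc B (t + cost e) 1 ⟩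
    B + (t + cost e + 1) ≡⟨ cong (B +_) (+-assoc t (cost e) 1) ⟩
    B + (t + (cost e + 1)) ≤⟨ +-monoʳ-≤ B (+-monoʳ-≤ t (+-monoˡ-≤ 1 (n≤1+n (cost e)))) ⟩
    B + (t + (1 + cost e + 1)) ∎
    where open ≤-Reasoning
  slow-≤ (e ⊖ f) {t} l b = ≤-trans (m∸n≤m _ (⟦ f ⟧ _)) (≤-trans (slow-≤ e l b)
    (+-monoʳ-≤ B (+-monoʳ-≤ t (≤-trans (n≤1+n _) (m≤m+n (1 + cost e) (cost f))))))

  -- An addition contributes a slow value, hence at most `A`; the unit of time charged for `_⊕_`
  -- pays for it.
  tame-≤ : ∀ e {t s} → Tame e → B + (t + cost e) ≤ A → Bounded t s →
    ⟦ e ⟧ s ≤ B + (t + cost e) * A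
  tame-≤ (lit k) {t} l fits b = ≤-trans (slow-≤ (lit k) {t} l b) (≤-trans fits
    (≤-trans (m≤n*m A (t + 1) {{>-nonZero (m≤n+m 1 t)}}) (m≤n+m _ B)))
  tame-≤ (var x) {t} l fits b = ≤-trans (any-scalar b x) (+-monoʳ-≤ B (*-monoˡ-≤ A (m≤m+n t 1)))
  tame-≤ (a ! e) {t} l fits b = ≤-trans (any-array b a _) (+-monoʳ-≤ B (*-monoˡ-≤ A (m≤m+n t _)))
  tame-≤ (e ⊕ f) {t} (l , q) fits b = begin
    _ ≤⟨ +-mono-≤ (tame-≤ e l (≤-trans (+-monoʳ-≤ B (+-monoʳ-≤ t ce≤)) fits) b)
                  (≤-trans (slow-≤ f q b) (≤-trans (+-monoʳ-≤ B (+-monoʳ-≤ t cf≤)) fits)) ⟩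
    B + (t + cost e) * A + A ≡⟨ +-assoc B _ A ⟩
    B + ((t + cost e) * A + A) ≡⟨ cong (B +_) (+-comm _ A) ⟩
    B + suc (t + cost e) * A ≡⟨ cong (λ z → B + z * A) (sym (+-suc t (cost e))) ⟩
    B + (t + suc (cost e)) * A ≤⟨ +-monoʳ-≤ B (*-monoˡ-≤ A (+-monoʳ-≤ t (m≤m+n (suc (cost e)) (cost f)))) ⟩
    B + (t + (1 + cost e + cost f)) * A ∎
    where
    open ≤-Reasoning
    ce≤ : cost e ≤ 1 + cost e + cost f
    ce≤ = ≤-trans (n≤1+n _) (m≤m+n (1 + cost e) (cost f))
    cf≤ : cost f ≤ 1 + cost e + cost f
    cf≤ = m≤n+m (cost f) (1 + cost e)
  tame-≤ (e ⊖ f) {t} l fits b = ≤-trans (m∸n≤m _ (⟦ f ⟧ _)) (≤-trans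
    (tame-≤ e l (≤-trans (+-monoʳ-≤ B (+-monoʳ-≤ t ce≤)) fits) b)
    (+-monoʳ-≤ B (*-monoˡ-≤ A (+-monoʳ-≤ t ce≤))))
    where
    ce≤ : cost e ≤ 1 + cost e + cost f
    ce≤ = ≤-trans (n≤1+n _) (m≤m+n (1 + cost e) (cost f))

  -- The run starts at time t₀ and is over before slow values can reach A.
  word-run : ∀ {W C s t s′} t₀ → TameCmd C → B + (t₀ + t) ≤ A → B + (t₀ + t) * A < W →
    s ⇓ C [ t ] s′ → Bounded t₀ s → (W ⊢ C , s ⇓[ t ] s′) × Bounded (t₀ + t) s′
  word-run t₀ _ _ _ skip b = skip , bounded-later (m≤m+n t₀ 1) b
  word-run {W} {s = s} t₀ (tm , sl) fits big (assign {x = x} {e}) b =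
    assign (≤-<-trans v≤ big) , record
      { slow-scalar = λ y l → ss y l
      ; slow-array = slow-array b′
      ; any-scalar = λ y → as y
      ; any-array = any-array b′ }
    where
    t≤ : cost e ≤ 1 + cost e
    t≤ = n≤1+n _
    b′ : Bounded (t₀ + (1 + cost e)) s
    b′ = bounded-later (m≤m+n t₀ _) b
    v≤ : ⟦ e ⟧ s ≤ B + (t₀ + (1 + cost e)) * A
    v≤ = ≤-trans (tame-≤ e tm (≤-trans (+-monoʳ-≤ B (+-monoʳ-≤ t₀ t≤)) fits) b)
         (+-monoʳ-≤ B (*-monoˡ-≤ A (+-monoʳ-≤ t₀ t≤)))
    ss : ∀ y → True (slowS y) → update (scalar s) x (⟦ e ⟧ s) y ≤ B + (t₀ + (1 + cost e))
    ss y l = update-elim {f = scalar s} (_≤ _) y (λ { refl → ≤-trans (slow-≤ e (slow-if sl l) b) (+-monoʳ-≤ B (+-monoʳ-≤ t₀ t≤)) })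
      (λ _ → slow-scalar b′ y l)
    as : ∀ y → update (scalar s) x (⟦ e ⟧ s) y ≤ B + (t₀ + (1 + cost e)) * A
    as y = update-elim {f = scalar s} (_≤ _) y (λ _ → v≤) (λ _ → any-scalar b′ y)
  word-run {W} {s = s} t₀ (te , tf , sl) fits big (store {a = a} {e} {f}) b =
    store (≤-<-trans e≤ big) (≤-<-trans f≤ big) , record
      { slow-scalar = slow-scalar b′
      ; slow-array = sa
      ; any-scalar = any-scalar b′
      ; any-array = aa }
    where
    c≤ : cost e ≤ 1 + cost e + cost f
    c≤ = ≤-trans (n≤1+n _) (m≤m+n (1 + cost e) (cost f))
    d≤ : cost f ≤ 1 + cost e + cost f
    d≤ = m≤n+m (cost f) (1 + cost e)
    b′ : Bounded (t₀ + (1 + cost e + cost f)) s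
    b′ = bounded-later (m≤m+n t₀ _) b
    e≤ : ⟦ e ⟧ s ≤ B + (t₀ + (1 + cost e + cost f)) * A
    e≤ = ≤-trans (tame-≤ e te (≤-trans (+-monoʳ-≤ B (+-monoʳ-≤ t₀ c≤)) fits) b)
         (+-monoʳ-≤ B (*-monoˡ-≤ A (+-monoʳ-≤ t₀ c≤)))
    f≤ : ⟦ f ⟧ s ≤ B + (t₀ + (1 + cost e + cost f)) * A
    f≤ = ≤-trans (tame-≤ f tf (≤-trans (+-monoʳ-≤ B (+-monoʳ-≤ t₀ d≤)) fits) b)
         (+-monoʳ-≤ B (*-monoˡ-≤ A (+-monoʳ-≤ t₀ d≤)))
    sa : ∀ c → True (slowA c) → ∀ i →
      update (array s) a (update (array s a) (⟦ e ⟧ s) (⟦ f ⟧ s)) c i ≤ B + (t₀ + (1 + cost e + cost f))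
    sa c l i = update-elim {f = array s} (λ g → g i ≤ _) c
      (λ { refl → update-elim {f = array s c} (_≤ _) i
        (λ _ → ≤-trans (slow-≤ f (slow-if sl l) b) (+-monoʳ-≤ B (+-monoʳ-≤ t₀ d≤)))
        (λ _ → slow-array b′ c l i) })
      (λ _ → slow-array b′ c l i)
    aa : ∀ c i → update (array s) a (update (array s a) (⟦ e ⟧ s) (⟦ f ⟧ s)) c i
      ≤ B + (t₀ + (1 + cost e + cost f)) * A
    aa c i = update-elim {f = array s} (λ g → g i ≤ _) c
      (λ { refl → update-elim {f = array s c} (_≤ _) i (λ _ → f≤) (λ _ → any-array b′ c i) })
      (λ _ → any-array b′ c i)
  word-run {W} {s′ = s″} t₀ (tC , tD) fits big (seq {t = t} {t′} d d′) b =
    seq (proj₁ r) (proj₁ r′) , subst (λ z → Bounded z s″) (+-assoc t₀ t t′) (proj₂ r′)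
    where
    t≤ : t₀ + t ≤ t₀ + (t + t′)
    t≤ = +-monoʳ-≤ t₀ (m≤m+n t t′)
    r = word-run t₀ tC (≤-trans (+-monoʳ-≤ B t≤) fits)
          (≤-<-trans (+-monoʳ-≤ B (*-monoˡ-≤ A t≤)) big) d b
    r′ = word-run (t₀ + t) tD (subst (λ z → B + z ≤ A) (sym (+-assoc t₀ t t′)) fits)
          (subst (λ z → B + z * A < W) (sym (+-assoc t₀ t t′)) big) d′ (proj₂ r)
  word-run t₀ (tC , tD) fits big (if-nonzero {e = e} {t = t} p d) b =
    if-nonzero p (proj₁ r) , bounded-later t≤ (proj₂ r)
    where
    t≤ : t₀ + t ≤ t₀ + (1 + cost e + t)
    t≤ = +-monoʳ-≤ t₀ (m≤n+m t (1 + cost e))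
    r = word-run t₀ tC (≤-trans (+-monoʳ-≤ B t≤) fits)
          (≤-<-trans (+-monoʳ-≤ B (*-monoˡ-≤ A t≤)) big) d b
  word-run t₀ (tC , tD) fits big (if-zero {e = e} {t = t} p d) b =
    if-zero p (proj₁ r) , bounded-later t≤ (proj₂ r)
    where
    t≤ : t₀ + t ≤ t₀ + (1 + cost e + t)
    t≤ = +-monoʳ-≤ t₀ (m≤n+m t (1 + cost e))
    r = word-run t₀ tD (≤-trans (+-monoʳ-≤ B t≤) fits)
          (≤-<-trans (+-monoʳ-≤ B (*-monoˡ-≤ A t≤)) big) d b
  word-run t₀ tC fits big (while-nonzero {e = e} {t = t} {t′} p d d′) b =
    while-nonzero p (proj₁ r) (proj₁ r′) , bounded-later t₂≤ (proj₂ r′)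
    where
    t₂≤ : t₀ + t + t′ ≤ t₀ + (1 + cost e + t + t′)
    t₂≤ = ≤-trans (≤-reflexive (+-assoc t₀ t t′)) (+-monoʳ-≤ t₀ (+-monoˡ-≤ t′ (m≤n+m t (1 + cost e))))
    t₁≤ : t₀ + t ≤ t₀ + (1 + cost e + t + t′)
    t₁≤ = ≤-trans (m≤m+n (t₀ + t) t′) t₂≤
    r = word-run t₀ tC (≤-trans (+-monoʳ-≤ B t₁≤) fits)
          (≤-<-trans (+-monoʳ-≤ B (*-monoˡ-≤ A t₁≤)) big) d b
    r′ = word-run (t₀ + t) tC (≤-trans (+-monoʳ-≤ B t₂≤) fits)
          (≤-<-trans (+-monoʳ-≤ B (*-monoˡ-≤ A t₂≤)) big) d′ (proj₂ r)
  word-run t₀ tC fits big (while-zero p) b = while-zero p , bounded-later (m≤m+n t₀ _) b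

-- Polynomial word sizes

n<2^n : ∀ n → n < 2 ^ n
n<2^n zero = s≤s z≤n
n<2^n (suc n) = ≤-trans (s≤s (n<2^n n)) (≤-trans (+-monoˡ-≤ (2 ^ n) (m^n>0 2 n))
  (≤-reflexive (cong (2 ^ n +_) (sym (+-identityʳ (2 ^ n))))))

-- With `N = suc n`, at least 2, the chain `c ≤ 2 ^ c ≤ N ^ c` turns the constant into a power, so
-- `P = N ^ (c + 2)` dominates both `n` and `c * (n * n)`. The left side is at most `4 * (P * P)`;
-- the 4 costs two factors `N` and strictness a third, and the exponent `2 * c + 7` is rounded up.
poly-bound : ∀ c n → 1 ≤ n →
  n + (c * (n * n)) * (n + c * (n * n)) < suc n ^ (2 * c + 8)
poly-bound c n 1≤n = begin-strict
  n + R * (n + R)                 ≤⟨ +-mono-≤ n≤ (*-mono-≤ R≤ (+-mono-≤ n≤ R≤)) ⟩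
  P + P * (P + P)                 ≤⟨ +-mono-≤ (≤-trans (m≤m*n P P) (m≤m+n _ _)) ≤-refl ⟩
  (P * P + P * P) + P * (P + P)   ≡⟨ cong ((P * P + P * P) +_) (*-distribˡ-+ P P P) ⟩
  (P * P + P * P) + (P * P + P * P) ≤⟨ double (P * P + P * P) ⟩
  N * (P * P + P * P)             ≤⟨ *-monoʳ-≤ N (double (P * P)) ⟩
  N * (N * (P * P))               <⟨ m<m*n _ N {{m*n≢0 N (N * (P * P)) {{_}} {{m*n≢0 N (P * P) {{_}} {{m*n≢0 P P}}}}}} (s≤s 1≤n) ⟩
  N * (N * (P * P)) * N           ≡⟨ *-comm _ N ⟩
  N * (N * (N * (P * P)))         ≡⟨ cong (λ z → N * (N * (N * z))) (sym (^-distribˡ-+-* N (c + 2) (c + 2))) ⟩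
  N ^ (3 + ((c + 2) + (c + 2)))   ≤⟨ ^-monoʳ-≤ N e≤ ⟩
  N ^ (2 * c + 8)                 ∎
  where
  open ≤-Reasoning
  N = suc n
  R = c * (n * n)
  P = N ^ (c + 2)
  instance
    P≢0 : NonZero P
    P≢0 = >-nonZero (m^n>0 N (c + 2))
  double : ∀ x → x + x ≤ N * x
  double x = ≤-trans (≤-reflexive (cong (x +_) (sym (+-identityʳ x)))) (*-monoˡ-≤ x (s≤s 1≤n))
  n≤N : n ≤ N
  n≤N = n≤1+n n
  c≤ : c ≤ N ^ c
  c≤ = ≤-trans (<⇒≤ (n<2^n c)) (^-monoˡ-≤ c (s≤s 1≤n))
  R≤ : R ≤ P
  R≤ = begin
    c * (n * n) ≤⟨ *-mono-≤ c≤ (*-mono-≤ n≤N n≤N) ⟩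
    N ^ c * (N * N) ≡⟨ cong (λ z → N ^ c * (N * z)) (sym (*-identityʳ N)) ⟩
    N ^ c * N ^ 2 ≡⟨ sym (^-distribˡ-+-* N c 2) ⟩
    P ∎
  n≤ : n ≤ P
  n≤ = ≤-trans n≤N (≤-trans (≤-reflexive (sym (*-identityʳ N))) (^-monoʳ-≤ N (≤-trans (s≤s z≤n) (m≤n+m 2 c))))
  e≤ : 3 + ((c + 2) + (c + 2)) ≤ 2 * c + 8
  e≤ = ≤-trans (m≤m+n _ 1) (≤-reflexive (eq c))
    where
    eq : ∀ c → 3 + ((c + 2) + (c + 2)) + 1 ≡ 2 * c + 8
    eq c = trans (cong (λ z → 3 + z + 1) (trans (cong (_+ (c + 2)) (+-comm c 2)) (trans (cong (2 +_) (sym (+-assoc c c 2))) refl)))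
      (trans (cong (λ z → 5 + z + 1) (+-comm (c + c) 2)) (trans (+-comm (7 + (c + c)) 1) (trans (cong (λ z → 8 + (c + z)) (sym (+-identityʳ c))) (+-comm 8 (2 * c)))))

-- The time bound also bounds the slow values: they start at `n` or less and rise by at most one per
-- unit of time, so they stay within `A`.
halts-within : ∀ {C s n c P} → TameCmd C → 1 ≤ n →
  (∀ x → scalar s x ≤ n) → (∀ a i → array s a i ≤ n) → ∀ {b} → b ≤ c * (n * n) →
  Ends C s b P → HaltsWithin (suc n ^ (2 * c + 8)) b C s P
halts-within {C} {s} {n} {c} tame 1≤n sc ar b≤ (t , s′ , d , p , q) =
  t , s′ , proj₁ (word-run 0 tame (+-monoʳ-≤ n t≤) big d bounded) , p , q
  where
  A = n + c * (n * n)
  open Growth n A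
  t≤ : t ≤ c * (n * n)
  t≤ = ≤-trans p b≤
  big : n + t * A < suc n ^ (2 * c + 8)
  big = ≤-<-trans (+-monoʳ-≤ n (*-monoˡ-≤ A t≤)) (poly-bound c n 1≤n)
  bounded : Bounded 0 s
  bounded = record
    { slow-scalar = λ x _ → ≤-trans (sc x) (m≤m+n n 0)
    ; slow-array = λ a _ i → ≤-trans (ar a i) (m≤m+n n 0)
    ; any-scalar = λ x → ≤-trans (sc x) (m≤m+n n 0)
    ; any-array = λ a i → ≤-trans (ar a i) (m≤m+n n 0) }

-- Finite sums

sum< : ℕ → (ℕ → ℕ) → ℕ
sum< zero    f = 0
sum< (suc k) f = sum< k f + f k

sum-cong : ∀ k {f g} → (∀ {i} → i < k → f i ≡ g i) → sum< k f ≡ sum< k g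
sum-cong zero    _ = refl
sum-cong (suc k) p = cong₂ _+_ (sum-cong k (λ i< → p (<-trans i< (n<1+n k)))) (p (n<1+n k))

sum-mono : ∀ k {f g} → (∀ {i} → i < k → f i ≤ g i) → sum< k f ≤ sum< k g
sum-mono zero    _ = z≤n
sum-mono (suc k) p = +-mono-≤ (sum-mono k (λ i< → p (<-trans i< (n<1+n k)))) (p (n<1+n k))

sum-mono-< : ∀ k {f g j} → (∀ {i} → i < k → f i ≤ g i) → j < k → f j < g j → sum< k f < sum< k g
sum-mono-< (suc k) {j = j} p j< lt with m≤n⇒m<n∨m≡n (≤-pred j<)
... | inj₁ j<k = +-mono-<-≤ (sum-mono-< k (λ i< → p (<-trans i< (n<1+n k))) j<k lt) (p (n<1+n k))
... | inj₂ refl = +-mono-≤-< (sum-mono k (λ i< → p (<-trans i< (n<1+n k)))) lt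

sum-zero : ∀ k {f} → (∀ {i} → i < k → f i ≡ 0) → sum< k f ≡ 0
sum-zero zero    _ = refl
sum-zero (suc k) p = cong₂ _+_ (sum-zero k (λ i< → p (<-trans i< (n<1+n k)))) (p (n<1+n k))

sum-bound : ∀ k {f} → (∀ i → f i ≤ 1) → sum< k f ≤ k
sum-bound zero    _ = z≤n
sum-bound (suc k) p = ≤-trans (+-mono-≤ (sum-bound k p) (p k)) (≤-reflexive (+-comm k 1))

sum-truncate : ∀ {j} m {f} → j ≤ m → (∀ {i} → j ≤ i → i < m → f i ≡ 0) → sum< m f ≡ sum< j f
sum-truncate zero z≤n _ = refl
sum-truncate {j} (suc m) j≤ p with m≤n⇒m<n∨m≡n j≤
... | inj₂ refl = refl
... | inj₁ (s≤s j≤m) = trans (cong₂ _+_ (sum-truncate m j≤m (λ a b → p a (<-trans b (n<1+n m)))) (p j≤m (n<1+n m)))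
  (+-identityʳ _)

-- The old term is added on the left instead of being subtracted on the right, where subtraction
-- would truncate.
sum-update : ∀ k {j} f x → j < k → sum< k (update f j x) + f j ≡ sum< k f + x
sum-update (suc k) {j} f x j< with m≤n⇒m<n∨m≡n (≤-pred j<)
... | inj₂ refl = trans (cong (_+ f k) (cong₂ _+_
        (sum-cong k (λ {i} i< → update-other f k i (<⇒≢ i<))) (update-same f k k refl)))
      (trans (+-assoc (sum< k f) x (f k)) (trans (cong (sum< k f +_) (+-comm x (f k)))
        (sym (+-assoc (sum< k f) (f k) x))))
... | inj₁ j<k = begin
  sum< k (update f j x) + update f j x k + f j
    ≡⟨ cong (λ z → sum< k (update f j x) + z + f j) (update-other f j k (≢-sym (<⇒≢ j<k))) ⟩
  sum< k (update f j x) + f k + f j ≡⟨ swap (sum< k (update f j x)) (f k) (f j) ⟩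
  sum< k (update f j x) + f j + f k ≡⟨ cong (_+ f k) (sum-update k f x j<k) ⟩
  sum< k f + x + f k ≡⟨ swap (sum< k f) x (f k) ⟩
  sum< k f + f k + x ∎
  where
  open ≡-Reasoning
  swap : ∀ a b c → a + b + c ≡ a + c + b
  swap a b c = trans (+-assoc a b c) (trans (cong (a +_) (+-comm b c)) (sym (+-assoc a c b)))

sum-positive : ∀ k {f} → 1 ≤ sum< k f → ∃[ i ] i < k × 1 ≤ f i
sum-positive (suc k) {f} p with f k in eq
... | suc _ = k , n<1+n k , subst (1 ≤_) (sym eq) (s≤s z≤n)
... | zero with sum-positive k (subst (1 ≤_) (+-identityʳ _) p)
... | i , i< , q = i , <-trans i< (n<1+n k) , q

term≤sum : ∀ k {f i} → i < k → f i ≤ sum< k f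
term≤sum (suc k) {f} {i} i< with m≤n⇒m<n∨m≡n (≤-pred i<)
... | inj₁ i<k = ≤-trans (term≤sum k i<k) (m≤m+n _ _)
... | inj₂ refl = m≤n+m _ _

sum-other : ∀ k {f} e → e < k → f e < sum< k f → ∃[ i ] i < k × i ≢ e × 1 ≤ f i
sum-other k {f} e e< lt with sum-positive k {update f e 0} pos
  where
  pos : 1 ≤ sum< k (update f e 0)
  pos = +-cancelʳ-≤ (f e) _ _ (≤-trans lt (≤-reflexive (trans (sym (+-identityʳ _)) (sym (sum-update k f 0 e<)))))
... | i , i< , q = i , i< , i≢e , subst (1 ≤_) (update-other f e i i≢e) q
  where
  i≢e : i ≢ e
  i≢e i≡e = <⇒≢ q (sym (update-same f e i i≡e))

sum-pair : ∀ k {f i j} → i < k → j < k → i ≢ j → f i + f j ≤ sum< k f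
sum-pair k {f} {i} {j} i< j< i≢j = begin
  f i + f j ≡⟨ cong (_+ f j) (sym (update-other f j i i≢j)) ⟩
  update f j 0 i + f j ≤⟨ +-monoˡ-≤ (f j) (term≤sum k i<) ⟩
  sum< k (update f j 0) + f j ≡⟨ sum-update k f 0 j< ⟩
  sum< k f + 0 ≡⟨ +-identityʳ _ ⟩
  sum< k f ∎
  where open ≤-Reasoning

sum-+ : ∀ k f g → sum< k (λ i → f i + g i) ≡ sum< k f + sum< k g
sum-+ zero f g = refl
sum-+ (suc k) f g = begin
  sum< k (λ i → f i + g i) + (f k + g k) ≡⟨ cong (_+ (f k + g k)) (sum-+ k f g) ⟩
  sum< k f + sum< k g + (f k + g k) ≡⟨ +-assoc (sum< k f) _ _ ⟩
  sum< k f + (sum< k g + (f k + g k)) ≡⟨ cong (sum< k f +_) (trans (sym (+-assoc (sum< k g) (f k) (g k)))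
     (trans (cong (_+ g k) (+-comm (sum< k g) (f k))) (+-assoc (f k) (sum< k g) (g k)))) ⟩
  sum< k f + (f k + (sum< k g + g k)) ≡⟨ sym (+-assoc (sum< k f) (f k) _) ⟩
  sum< k f + f k + (sum< k g + g k) ∎
  where open ≡-Reasoning

pick : ℕ → ℕ → ℕ → ℕ
pick a v x = if does (a ≟ v) then x else 0

pick-same : ∀ {a v} x → a ≡ v → pick a v x ≡ x
pick-same {a} {v} x p with a ≡ᵇ v in eq
... | true  = refl
... | false = ⊥-elim (subst True eq (≡⇒≡ᵇ a v p))

pick-other : ∀ {a v} x → a ≢ v → pick a v x ≡ 0
pick-other {a} {v} x p with a ≡ᵇ v in eq
... | true  = ⊥-elim (p (≡ᵇ⇒≡ a v (subst True (sym eq) tt)))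
... | false = refl

pick-≤ : ∀ a v x → pick a v x ≤ x
pick-≤ a v x with a ≡ᵇ v
... | true  = ≤-refl
... | false = z≤n

pick-positive : ∀ {a v x} → 1 ≤ pick a v x → a ≡ v × 1 ≤ x
pick-positive {a} {v} p with a ≡ᵇ v in eq
... | true = ≡ᵇ⇒≡ a v (subst True (sym eq) tt) , p

sum-pick : ∀ k a x → a < k → sum< k (λ v → pick a v x) ≡ x
sum-pick (suc k) a x a< with m≤n⇒m<n∨m≡n (≤-pred a<)
... | inj₁ a<k = trans (cong₂ _+_ (sum-pick k a x a<k) (pick-other x (<⇒≢ a<k))) (+-identityʳ x)
... | inj₂ refl = cong₂ _+_ (sum-zero k (λ i< → pick-other x (≢-sym (<⇒≢ i<)))) (pick-same {a} x refl)

-- Flow at a vertex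

flow : ℕ → (h F : ℕ → ℕ) → ℕ → ℕ
flow k h F v = sum< k (λ i → pick (h i) v (F i))

flow-update : ∀ {m h} F v {j} y → j < m →
  flow m h (update F j y) v + pick (h j) v (F j) ≡ flow m h F v + pick (h j) v y
flow-update {m} {h} F v {j} y j< = trans
  (cong (_+ pick (h j) v (F j)) (sum-cong m (λ {i} _ → eq i)))
  (sum-update m (λ i → pick (h i) v (F i)) (pick (h j) v y) j<)
  where
  eq : ∀ i → pick (h i) v (update F j y i) ≡ update (λ i → pick (h i) v (F i)) j (pick (h j) v y) i
  eq i with i ≟ j
  ... | yes refl = trans (cong (pick (h i) v) (update-same F i i refl)) (sym (update-same (λ i → pick (h i) v (F i)) i i refl))
  ... | no i≢j = trans (cong (pick (h i) v) (update-other F j i i≢j)) (sym (update-other (λ i → pick (h i) v (F i)) j i i≢j))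

flow-witness : ∀ k {h F v} → 1 ≤ flow k h F v → ∃[ i ] i < k × h i ≡ v × 1 ≤ F i
flow-witness k p with sum-positive k p
... | i , i< , q = i , i< , pick-positive q

≤flow : ∀ k {h F v i} → i < k → h i ≡ v → F i ≤ flow k h F v
≤flow k {h} {F} {v} {i} i< p = ≤-trans (≤-reflexive (sym (pick-same (F i) p))) (term≤sum k i<)

≤flow₂ : ∀ k {h F v i j} → i < k → j < k → i ≢ j → h i ≡ v → h j ≡ v → F i + F j ≤ flow k h F v
≤flow₂ k {h} {F} {v} {i} {j} i< j< i≢j p q =
  ≤-trans (≤-reflexive (sym (cong₂ _+_ (pick-same (F i) p) (pick-same (F j) q)))) (sum-pair k i< j< i≢j)

-- A matching L uses at most one arc at v, so two units of flow at v are not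
-- carried by a single unit on an arc of L.
flow-unmatched : ∀ k {h F v} (L : ℕ → ℕ) → 2 ≤ flow k h F v →
  (∀ {i j} → i < k → j < k → 1 ≤ L i → 1 ≤ L j → 1 ≤ F i → 1 ≤ F j → h i ≡ h j → i ≡ j) →
  ∃[ i ] i < k × h i ≡ v × 1 ≤ F i × (1 ≤ L i → 2 ≤ F i)
flow-unmatched k {h} {F} {v} L p match with flow-witness k {h} {F} {v} (≤-trans (s≤s z≤n) p)
... | i , i< , e , q with 2 ≤? F i
... | yes r = i , i< , e , q , λ _ → r
... | no ¬r with sum-other k i i< (≤-<-trans (pick-≤ (h i) v (F i)) (≤-trans (≰⇒> ¬r) p))
... | j , j< , j≢i , r with pick-positive {h j} {v} r
... | e′ , q′ with L i in eq
... | zero = i , i< , e , q , λ l → ⊥-elim (<⇒≢ l (sym eq))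
... | suc _ = j , j< , e′ , q′ , λ l → ⊥-elim (j≢i (sym
  (match i< j< (subst (1 ≤_) (sym eq) (s≤s z≤n)) l q q′ (trans e (sym e′)))))

-- Elimination orders

head-of tail-of : (X Q D : ℕ → ℕ) → ℕ → ℕ
head-of X Q D i = branch (D i) (X i) (Q i)
tail-of X Q D i = branch (D i) (Q i) (X i)

-- Arc i joins the child X i to its parent Q i, and points to the parent iff
-- D i is nonzero.  Children are leaves of what remains after the arcs before.
record Order (n m : ℕ) (X Q : ℕ → ℕ) : Set where
  field
    X<n   : ∀ {i} → i < m → X i < n
    Q<n   : ∀ {i} → i < m → Q i < n
    X≢Q   : ∀ {i} → i < m → X i ≢ Q i
    X≢X   : ∀ {i j} → i < j → j < m → X i ≢ X j
    X≢Q>  : ∀ {i j} → i < j → j < m → X i ≢ Q j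

module Ends-of {n m X Q} (O : Order n m X Q) (D : ℕ → ℕ) where
  open Order O
  hd tl : ℕ → ℕ
  hd = head-of X Q D
  tl = tail-of X Q D

  hd<n : ∀ {i} → i < m → hd i < n
  hd<n {i} p with D i
  ... | zero  = X<n p
  ... | suc _ = Q<n p

  tl<n : ∀ {i} → i < m → tl i < n
  tl<n {i} p with D i
  ... | zero  = Q<n p
  ... | suc _ = X<n p

  tl≢hd : ∀ {i} → i < m → tl i ≢ hd i
  tl≢hd {i} p with D i
  ... | zero  = ≢-sym (X≢Q p)
  ... | suc _ = X≢Q p

  X≢hd : ∀ {i j} → i < j → j < m → X i ≢ hd j
  X≢hd {i} {j} p q with D j
  ... | zero  = X≢X p q
  ... | suc _ = X≢Q> p q

  X≢tl : ∀ {i j} → i < j → j < m → X i ≢ tl j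
  X≢tl {i} {j} p q with D j
  ... | zero  = X≢Q> p q
  ... | suc _ = X≢X p q

  -- The children are distinct vertices, one for each arc.
  m≤n : m ≤ n
  m≤n = Fin.injective⇒≤ {f = λ i → fromℕ< (X<n (Fin.toℕ<n i))} inj
    where
    inj : ∀ {i j : Fin m} → fromℕ< (X<n (Fin.toℕ<n i)) ≡ fromℕ< (X<n (Fin.toℕ<n j)) → i ≡ j
    inj {i} {j} e with <-cmp (toℕ i) (toℕ j)
    ... | tri< lt _ _ = ⊥-elim (X≢X lt (Fin.toℕ<n j) (Fin.fromℕ<-injective _ _ _ _ e))
    ... | tri≈ _ eq _ = Fin.toℕ-injective eq
    ... | tri> _ _ gt = ⊥-elim (X≢X gt (Fin.toℕ<n i) (Fin.fromℕ<-injective _ _ _ _ (sym e)))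

  -- Arc `j` is the last one at its child, so the law at `X j` relates `F j` to earlier arcs only.
  flow-at-child : ∀ {h F j} → (∀ {i} → j < i → i < m → X j ≢ h i) → j < m →
    flow m h F (X j) ≡ flow j h F (X j) + pick (h j) (X j) (F j)
  flow-at-child {h} {F} {j} later j< = sum-truncate m j<
    (λ {i} j<i i<m → pick-other (F i) (≢-sym (later j<i i<m)))

  Conserved : (I J F : ℕ → ℕ) → Set
  Conserved I J F = ∀ {v} → v < n → I v + flow m hd F v ≡ J v + flow m tl F v

  -- Accumulating flow at parents and discarding eliminated children never
  -- increases the total mass.
  flow-≤-mass : ∀ {h I F} → (∀ {i} → i < m → h i < n) → (∀ {i j} → i < j → j < m → X i ≢ h j) →
    (∀ {i} → i < m → h i ≢ X i → F i ≤ I (X i) + flow i h F (X i)) →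
    ∀ {j} → j < m → h j ≢ X j → F j ≤ sum< n I
  flow-≤-mass {h} {I} {F} h< later law {j} j< hj = begin
    F j ≤⟨ law j< hj ⟩
    I (X j) + flow j h F (X j) ≡⟨ sym (mass-live j (<⇒≤ j<) (λ i<j → X≢X i<j j<)) ⟩
    mass j (X j) ≤⟨ term≤sum n (X<n j<) ⟩
    sum< n (mass j) ≤⟨ mass-falls j (<⇒≤ j<) ⟩
    sum< n I ∎
    where
    open ≤-Reasoning
    mass : ℕ → ℕ → ℕ
    mass zero    = I
    mass (suc k) = update (λ v → mass k v + pick (h k) v (F k)) (X k) 0

    mass-live : ∀ k → k ≤ m → ∀ {v} → (∀ {i} → i < k → X i ≢ v) → mass k v ≡ I v + flow k h F v
    mass-live zero k≤ live = sym (+-identityʳ _)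
    mass-live (suc k) k≤ {v} live = trans
      (update-other (λ v → mass k v + pick (h k) v (F k)) (X k) v (λ e → live (n<1+n k) (sym e)))
      (trans (cong (_+ pick (h k) v (F k)) (mass-live k (<⇒≤ k≤) (λ i< → live (<-trans i< (n<1+n k)))))
        (+-assoc (I v) _ _))

    mass-falls : ∀ k → k ≤ m → sum< n (mass k) ≤ sum< n I
    mass-falls zero k≤ = ≤-refl
    mass-falls (suc k) k≤ = ≤-trans (+-cancelʳ-≤ (F k) _ _ (begin
      sum< n (mass (suc k)) + F k
        ≤⟨ +-monoʳ-≤ (sum< n (mass (suc k))) F≤ ⟩
      sum< n (mass (suc k)) + (mass k (X k) + pick (h k) (X k) (F k))
        ≡⟨ sum-update n (λ v → mass k v + pick (h k) v (F k)) 0 (X<n k≤) ⟩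
      sum< n (λ v → mass k v + pick (h k) v (F k)) + 0
        ≡⟨ +-identityʳ _ ⟩
      sum< n (λ v → mass k v + pick (h k) v (F k))
        ≡⟨ sum-+ n (mass k) (λ v → pick (h k) v (F k)) ⟩
      sum< n (mass k) + sum< n (λ v → pick (h k) v (F k))
        ≡⟨ cong (sum< n (mass k) +_) (sum-pick n (h k) (F k) (h< k≤)) ⟩
      sum< n (mass k) + F k ∎)) (mass-falls k (<⇒≤ k≤))
      where
      F≤ : F k ≤ mass k (X k) + pick (h k) (X k) (F k)
      F≤ with h k ≟ X k
      ... | yes e = ≤-trans (≤-reflexive (sym (pick-same (F k) e))) (m≤n+m _ (mass k (X k)))
      ... | no ne = ≤-trans (law k≤ ne) (≤-trans (≤-reflexive
        (sym (mass-live k (<⇒≤ k≤) (λ i< → X≢X i< k≤)))) (m≤m+n _ _))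

  -- This makes the cap by `n` in `demand` harmless. An arc to the parent carries at most what the
  -- child can collect from `I`; for an arc to the child, time is reversed and the supply is `J`,
  -- collected along tails.
  flow-bounded : ∀ {I J F} → (∀ v → I v ≤ 1) → (∀ v → J v ≤ 1) → Conserved I J F →
    ∀ {j} → j < m → F j ≤ n
  flow-bounded {I} {J} {F} I≤ J≤ c {j} j< with hd j ≟ X j
  ... | no ne = ≤-trans (flow-≤-mass hd<n X≢hd law j< ne) (sum-bound n I≤)
    where
    law : ∀ {i} → i < m → hd i ≢ X i → F i ≤ I (X i) + flow i hd F (X i)
    law {i} i< ne with c (X<n i<)
    ... | e rewrite flow-at-child {hd} {F} X≢hd i< | flow-at-child {tl} {F} X≢tl i< with D i
    ... | zero = ⊥-elim (ne refl)
    ... | suc _ rewrite pick-other {Q i} {X i} (F i) ne | pick-same {X i} (F i) refl | +-identityʳ (flow i hd F (X i)) =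
      ≤-trans (m≤n+m (F i) _) (≤-trans (m≤n+m _ (J (X i))) (≤-reflexive (sym e)))
  ... | yes hX = ≤-trans (flow-≤-mass tl<n X≢tl law j< (λ tX → tl≢hd j< (trans tX (sym hX)))) (sum-bound n J≤)
    where
    law : ∀ {i} → i < m → tl i ≢ X i → F i ≤ J (X i) + flow i tl F (X i)
    law {i} i< ne with c (X<n i<)
    ... | e rewrite flow-at-child {hd} {F} X≢hd i< | flow-at-child {tl} {F} X≢tl i< with D i
    ... | suc _ = ⊥-elim (ne refl)
    ... | zero rewrite pick-other {Q i} {X i} (F i) ne | pick-same {X i} (F i) refl | +-identityʳ (flow i tl F (X i)) =
      ≤-trans (m≤n+m (F i) _) (≤-trans (m≤n+m _ (I (X i))) (≤-reflexive e))

-- Plans, the certificates of reconfigurability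

-- I and J are the characteristic functions of the current and the final set,
-- F i is the number of tokens that will slide along arc i.  A token that moves
-- on starts along an arc labelled by S, being then the first to enter its head;
-- a token that comes to a final vertex does so along an arc labelled by T,
-- being then the last to leave its tail.  Labels on arcs without flow and
-- labels S at tails outside I are stale.
record Plan (n m : ℕ) (t h I J F IN OUT S T : ℕ → ℕ) : Set where
  field
    I≤1      : ∀ v → I v ≤ 1
    J≤1      : ∀ v → J v ≤ 1
    I-free   : ∀ {i} → i < m → 1 ≤ I (t i) → 1 ≤ I (h i) → ⊥
    J-free   : ∀ {i} → i < m → 1 ≤ J (t i) → 1 ≤ J (h i) → ⊥
    law      : ∀ {v} → v < n → I v + IN v ≡ J v + OUT v
    IN-sum   : ∀ {v} → v < n → IN v ≡ flow m h F v
    OUT-sum  : ∀ {v} → v < n → OUT v ≡ flow m t F v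
    S-head   : ∀ {i j} → i < m → j < m → 1 ≤ S i → 1 ≤ S j → 1 ≤ I (t i) → 1 ≤ I (t j) →
               1 ≤ F i → 1 ≤ F j → h i ≡ h j → i ≡ j
    S-tail   : ∀ {i j} → i < m → j < m → 1 ≤ S i → 1 ≤ S j → t i ≡ t j → i ≡ j
    S-any    : ∀ {v} → v < n → 1 ≤ I v → 1 ≤ OUT v → ∃[ i ] i < m × t i ≡ v × 1 ≤ S i × 1 ≤ F i
    T-target : ∀ {i} → i < m → 1 ≤ T i → 1 ≤ F i → 1 ≤ J (h i)
    T-head   : ∀ {i j} → i < m → j < m → 1 ≤ T i → 1 ≤ T j → 1 ≤ F i → 1 ≤ F j → h i ≡ h j → i ≡ j
    T-tail   : ∀ {i j} → i < m → j < m → 1 ≤ T i → 1 ≤ T j → 1 ≤ F i → 1 ≤ F j → t i ≡ t j → i ≡ j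
    T-any    : ∀ {v} → v < n → 1 ≤ J v → 1 ≤ IN v → ∃[ i ] i < m × h i ≡ v × 1 ≤ T i × 1 ≤ F i
    both     : ∀ {i} → i < m → 1 ≤ S i → 1 ≤ I (t i) → 1 ≤ T i → F i ≡ 1 → IN (h i) ≤ 1 × OUT (t i) ≤ 1
    still-h  : ∀ {i} → i < m → 1 ≤ I (t i) → 1 ≤ J (t i) → IN (t i) ≡ 0 → IN (h i) + OUT (h i) ≡ 0
    still-t  : ∀ {i} → i < m → 1 ≤ I (h i) → 1 ≤ J (h i) → IN (h i) ≡ 0 → IN (t i) + OUT (t i) ≡ 0

record Graph (n m : ℕ) (t h : ℕ → ℕ) : Set where
  field
    t<n : ∀ {i} → i < m → t i < n
    h<n : ∀ {i} → i < m → h i < n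
    t≢h : ∀ {i} → i < m → t i ≢ h i

record Move (j : ℕ) (t h I I′ : ℕ → ℕ) : Set where
  field
    from  : I (t j) ≡ 1
    left  : I′ (t j) ≡ 0
    to    : I (h j) ≡ 0
    come  : I′ (h j) ≡ 1
    other : ∀ v → v ≢ t j → v ≢ h j → I v ≡ I′ v

zero⊎pos : ∀ x → x ≡ 0 ⊎ 1 ≤ x
zero⊎pos zero    = inj₁ refl
zero⊎pos (suc x) = inj₂ (s≤s z≤n)

≡1⇒≥1 : ∀ {x} → x ≡ 1 → 1 ≤ x
≡1⇒≥1 refl = ≤-refl

≥1⇒≢0 : ∀ {x} → 1 ≤ x → x ≡ 0 → ⊥
≥1⇒≢0 (s≤s _) ()

-- Necessity: putting one slide in front of a plan

module Backward {n m t h I I′ J F IN OUT S T j} (G : Graph n m t h)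
  (P : Plan n m t h I′ J F IN OUT S T) (j< : j < m) (M : Move j t h I I′)
  (I≤1 : ∀ v → I v ≤ 1)
  (I-free : ∀ {i} → i < m → 1 ≤ I (t i) → 1 ≤ I (h i) → ⊥) where
  open Graph G
  open Move M
  private module P = Plan P
  a = t j
  b = h j

  -- The token on `a` now starts along `j`, so `j` replaces all older S-labels at this tail, which
  -- were stale while `a` was empty. T is put on `j` if the token stays at `b` for good. Otherwise a
  -- T-label on `j` without flow is cleared, since the new unit would revive it.
  F₊ IN₊ OUT₊ S₊ T₊ : ℕ → ℕ
  F₊ = update F j (suc (F j))
  IN₊ v = IN v + pick b v 1
  OUT₊ v = OUT v + pick a v 1
  S₊ i with i ≟ j
  ... | yes _ = 1
  ... | no _ with t i ≟ a
  ...   | yes _ = 0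
  ...   | no _ = S i
  T₊ i with i ≟ j
  ... | no _ = T i
  ... | yes _ with J b | IN b | F j
  ...   | suc _ | zero | _ = 1
  ...   | _ | _ | zero = 0
  ...   | _ | _ | suc _ = T j

  data SLabel i : Set where
    new : i ≡ j → SLabel i
    old : i ≢ j → t i ≢ a → 1 ≤ S i → SLabel i

  S₊-cases : ∀ i → 1 ≤ S₊ i → SLabel i
  S₊-cases i p with i ≟ j
  ... | yes e = new e
  ... | no ne with t i ≟ a
  ...   | no na = old ne na p

  S₊-old : ∀ {i} → t i ≢ a → 1 ≤ S i → 1 ≤ S₊ i
  S₊-old {i} na p with i ≟ j
  ... | yes _ = s≤s z≤n
  ... | no ne with t i ≟ a
  ...   | yes e = ⊥-elim (na e)
  ...   | no _ = p

  S₊-new : 1 ≤ S₊ j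
  S₊-new with j ≟ j
  ... | yes _ = s≤s z≤n
  ... | no ne = ⊥-elim (ne refl)

  F₊≥ : ∀ {i} → 1 ≤ F i → 1 ≤ F₊ i
  F₊≥ {i} p = update-elim {f = F} (1 ≤_) i (λ _ → s≤s z≤n) (λ _ → p)

  data TLabel i : Set where
    final : i ≡ j → 1 ≤ J b → IN b ≡ 0 → TLabel i
    old   : 1 ≤ T i → 1 ≤ F i → TLabel i

  T₊-cases : ∀ i → 1 ≤ T₊ i → 1 ≤ F₊ i → TLabel i
  T₊-cases i p q with i ≟ j
  ... | no ne = old p (subst (1 ≤_) (update-other F j i ne) q)
  ... | yes refl with J b in e₁ | IN b in e₂ | F j in e₃
  ...   | suc _ | zero | _ = final refl (subst (1 ≤_) (sym e₁) (s≤s z≤n)) e₂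
  ...   | zero | _ | suc _ = old p (subst (1 ≤_) (sym e₃) (s≤s z≤n))
  ...   | suc _ | suc _ | suc _ = old p (subst (1 ≤_) (sym e₃) (s≤s z≤n))

  T₊-old : ∀ {i} → 1 ≤ T i → 1 ≤ F i → 1 ≤ T₊ i
  T₊-old {i} p q with i ≟ j
  ... | no _ = p
  ... | yes refl with J b | IN b | F j | q
  ...   | zero | _ | suc _ | _ = p
  ...   | suc _ | zero | suc _ | _ = s≤s z≤n
  ...   | suc _ | suc _ | suc _ | _ = p

  T₊-final : 1 ≤ J b → IN b ≡ 0 → 1 ≤ T₊ j
  T₊-final p q with j ≟ j
  ... | no ne = ⊥-elim (ne refl)
  ... | yes _ with J b | IN b
  ...   | suc _ | zero = s≤s z≤n

  a≢b : a ≢ b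
  a≢b = t≢h j<

  Ia : 1 ≤ I a
  Ia = ≡1⇒≥1 from

  I′b : 1 ≤ I′ b
  I′b = ≡1⇒≥1 come

  I≢b : ∀ {v} → 1 ≤ I v → v ≢ b
  I≢b p refl = ≥1⇒≢0 p to

  I⇒I′ : ∀ {v} → 1 ≤ I v → v ≢ a → 1 ≤ I′ v
  I⇒I′ p na = subst (1 ≤_) (other _ na (I≢b p)) p

  -- Otherwise arc `i` would join two tokens of `I′`.
  b-alone : ∀ {i} → i < m → 1 ≤ I (t i) → t i ≢ a → h i ≢ b
  b-alone {i} i< p na e = P.I-free i< (I⇒I′ p na) (subst (λ v → 1 ≤ I′ v) (sym e) I′b)

  b-alone′ : ∀ {i} → i < m → 1 ≤ I (h i) → h i ≢ a → t i ≢ b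
  b-alone′ {i} i< p na e = P.I-free i< (subst (λ v → 1 ≤ I′ v) (sym e) I′b) (I⇒I′ p na)

  IN₊-other : ∀ {v} → v ≢ b → IN₊ v ≡ IN v
  IN₊-other {v} ne = trans (cong (IN v +_) (pick-other 1 (≢-sym ne))) (+-identityʳ _)

  OUT₊-other : ∀ {v} → v ≢ a → OUT₊ v ≡ OUT v
  OUT₊-other {v} ne = trans (cong (OUT v +_) (pick-other 1 (≢-sym ne))) (+-identityʳ _)

  IN₊b : IN₊ b ≡ IN b + 1
  IN₊b = cong (IN b +_) (pick-same {b} 1 refl)

  OUT₊a : OUT₊ a ≡ OUT a + 1
  OUT₊a = cong (OUT a +_) (pick-same {a} 1 refl)

  F≤IN : ∀ {i} → i < m → F i ≤ IN (h i)
  F≤IN i< = ≤-trans (≤flow m {h} {F} i< refl) (≤-reflexive (sym (P.IN-sum (h<n i<))))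

  F≤OUT : ∀ {i} → i < m → F i ≤ OUT (t i)
  F≤OUT i< = ≤-trans (≤flow m {t} {F} i< refl) (≤-reflexive (sym (P.OUT-sum (t<n i<))))

  law₊ : ∀ {v} → v < n → I v + IN₊ v ≡ J v + OUT₊ v
  law₊ {v} v< with v ≟ a | v ≟ b
  ... | yes refl | _ = begin
    I a + IN₊ a ≡⟨ cong₂ _+_ from (IN₊-other a≢b) ⟩
    1 + IN a ≡⟨ cong suc (trans (cong (_+ IN a) (sym left)) (P.law v<)) ⟩
    suc (J a + OUT a) ≡⟨ trans (+-comm 1 _) (+-assoc (J a) (OUT a) 1) ⟩
    J a + (OUT a + 1) ≡⟨ cong (J a +_) (sym OUT₊a) ⟩
    J a + OUT₊ a ∎
    where open ≡-Reasoning
  ... | no na | yes refl = begin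
    I b + IN₊ b ≡⟨ cong₂ _+_ to (trans IN₊b (+-comm (IN b) 1)) ⟩
    1 + IN b ≡⟨ cong (_+ IN b) (sym come) ⟩
    I′ b + IN b ≡⟨ P.law v< ⟩
    J b + OUT b ≡⟨ cong (J b +_) (sym (OUT₊-other na)) ⟩
    J b + OUT₊ b ∎
    where open ≡-Reasoning
  ... | no na | no nb rewrite IN₊-other nb | OUT₊-other na | other v na nb = P.law v<

  sum₊ : ∀ (k : ℕ → ℕ) {N : ℕ → ℕ} v → N v ≡ flow m k F v → N v + pick (k j) v 1 ≡ flow m k F₊ v
  sum₊ k {N} v e with k j ≟ v
  ... | yes kj = +-cancelʳ-≡ (F j) _ _ (begin
    N v + pick (k j) v 1 + F j ≡⟨ cong₂ (λ x y → x + y + F j) e (pick-same 1 kj) ⟩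
    flow m k F v + 1 + F j ≡⟨ +-assoc _ 1 (F j) ⟩
    flow m k F v + suc (F j) ≡⟨ cong (flow m k F v +_) (sym (pick-same _ kj)) ⟩
    flow m k F v + pick (k j) v (suc (F j)) ≡⟨ sym (flow-update {h = k} F v (suc (F j)) j<) ⟩
    flow m k F₊ v + pick (k j) v (F j) ≡⟨ cong (flow m k F₊ v +_) (pick-same _ kj) ⟩
    flow m k F₊ v + F j ∎)
    where open ≡-Reasoning
  ... | no ne = begin
    N v + pick (k j) v 1 ≡⟨ cong₂ _+_ e (trans (pick-other 1 ne) (sym (pick-other (suc (F j)) ne))) ⟩
    flow m k F v + pick (k j) v (suc (F j)) ≡⟨ sym (flow-update {h = k} F v (suc (F j)) j<) ⟩
    flow m k F₊ v + pick (k j) v (F j) ≡⟨ trans (cong (flow m k F₊ v +_) (pick-other (F j) ne)) (+-identityʳ _) ⟩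
    flow m k F₊ v ∎
    where open ≡-Reasoning

  -- The condition "still" at b makes a a dead end once b is final.
  b-final : 1 ≤ J b → IN b ≡ 0 → OUT a ≡ 0
  b-final p q = m+n≡0⇒n≡0 (IN a) (P.still-t j< I′b p q)

  -- The token on `a` leaves at once; for `a` to be final, another would have to come, which takes
  -- inflow.
  still≢a : ∀ {v} → v < n → 1 ≤ I v → 1 ≤ J v → IN₊ v ≡ 0 → v ≢ a
  still≢a v< p q r refl = m+1+n≢0 (OUT a) (begin
    OUT a + 1 ≡⟨ sym OUT₊a ⟩
    OUT₊ a ≡⟨ +-cancelˡ-≡ 1 _ _ (begin
      1 + OUT₊ a ≡⟨ cong (_+ OUT₊ a) (sym (≤-antisym (P.J≤1 a) q)) ⟩
      J a + OUT₊ a ≡⟨ sym (law₊ v<) ⟩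
      I a + IN₊ a ≡⟨ cong₂ _+_ from r ⟩
      1 + 0 ∎) ⟩
    0 ∎)
    where open ≡-Reasoning

  plan : Plan n m t h I J F₊ IN₊ OUT₊ S₊ T₊
  plan = record
    { I≤1 = I≤1 ; J≤1 = P.J≤1 ; I-free = I-free ; J-free = P.J-free ; law = law₊
    ; IN-sum = λ {v} v< → sum₊ h {IN} v (P.IN-sum v<)
    ; OUT-sum = λ {v} v< → sum₊ t {OUT} v (P.OUT-sum v<)
    ; S-head = S-head ; S-tail = S-tail ; S-any = S-any
    ; T-target = T-target ; T-head = T-head ; T-tail = T-tail ; T-any = T-any
    ; both = both ; still-h = still-h ; still-t = still-t }
    where
    F₊-old : ∀ {i} → i ≢ j → 1 ≤ F₊ i → 1 ≤ F i
    F₊-old {i} ne p = subst (1 ≤_) (update-other F j i ne) p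

    S-head : ∀ {i k} → i < m → k < m → 1 ≤ S₊ i → 1 ≤ S₊ k → 1 ≤ I (t i) → 1 ≤ I (t k) →
      1 ≤ F₊ i → 1 ≤ F₊ k → h i ≡ h k → i ≡ k
    S-head {i} {k} i< k< p q r s f f′ e with S₊-cases i p | S₊-cases k q
    ... | new refl | new refl = refl
    ... | new refl | old _ na _ = ⊥-elim (b-alone k< s na (sym e))
    ... | old _ na _ | new refl = ⊥-elim (b-alone i< r na e)
    ... | old ne na x | old ne′ na′ y =
      P.S-head i< k< x y (I⇒I′ r na) (I⇒I′ s na′) (F₊-old ne f) (F₊-old ne′ f′) e

    S-tail : ∀ {i k} → i < m → k < m → 1 ≤ S₊ i → 1 ≤ S₊ k → t i ≡ t k → i ≡ k
    S-tail {i} {k} i< k< p q e with S₊-cases i p | S₊-cases k q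
    ... | new refl | new refl = refl
    ... | new refl | old _ na _ = ⊥-elim (na (sym e))
    ... | old _ na _ | new refl = ⊥-elim (na e)
    ... | old _ na x | old _ na′ y = P.S-tail i< k< x y e

    S-any : ∀ {v} → v < n → 1 ≤ I v → 1 ≤ OUT₊ v → ∃[ i ] i < m × t i ≡ v × 1 ≤ S₊ i × 1 ≤ F₊ i
    S-any {v} v< p q with v ≟ a
    ... | yes refl = j , j< , refl , S₊-new , subst (1 ≤_) (sym (update-same F j j refl)) (s≤s z≤n)
    ... | no na with P.S-any v< (I⇒I′ p na) (subst (1 ≤_) (OUT₊-other na) q)
    ... | i , i< , refl , s , f = i , i< , refl , S₊-old na s , F₊≥ f

    T-target : ∀ {i} → i < m → 1 ≤ T₊ i → 1 ≤ F₊ i → 1 ≤ J (h i)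
    T-target {i} i< p q with T₊-cases i p q
    ... | final refl x _ = x
    ... | old x y = P.T-target i< x y

    T-head : ∀ {i k} → i < m → k < m → 1 ≤ T₊ i → 1 ≤ T₊ k → 1 ≤ F₊ i → 1 ≤ F₊ k → h i ≡ h k → i ≡ k
    T-head {i} {k} i< k< p q r s e with T₊-cases i p r | T₊-cases k q s
    ... | final refl _ _ | final refl _ _ = refl
    ... | final refl _ x | old _ y = ⊥-elim (≥1⇒≢0 (≤-trans y (F≤IN k<)) (trans (cong IN (sym e)) x))
    ... | old _ y | final refl _ x = ⊥-elim (≥1⇒≢0 (≤-trans y (F≤IN i<)) (trans (cong IN e) x))
    ... | old x y | old x′ y′ = P.T-head i< k< x x′ y y′ e

    T-tail : ∀ {i k} → i < m → k < m → 1 ≤ T₊ i → 1 ≤ T₊ k → 1 ≤ F₊ i → 1 ≤ F₊ k → t i ≡ t k → i ≡ k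
    T-tail {i} {k} i< k< p q r s e with T₊-cases i p r | T₊-cases k q s
    ... | final refl _ _ | final refl _ _ = refl
    ... | final refl w x | old _ y = ⊥-elim (≥1⇒≢0 (≤-trans y (F≤OUT k<)) (trans (cong OUT (sym e)) (b-final w x)))
    ... | old _ y | final refl w x = ⊥-elim (≥1⇒≢0 (≤-trans y (F≤OUT i<)) (trans (cong OUT e) (b-final w x)))
    ... | old x y | old x′ y′ = P.T-tail i< k< x x′ y y′ e

    T-any : ∀ {v} → v < n → 1 ≤ J v → 1 ≤ IN₊ v → ∃[ i ] i < m × h i ≡ v × 1 ≤ T₊ i × 1 ≤ F₊ i
    T-any {v} v< p q with 1 ≤? IN v
    ... | yes r = let (i , i< , e , x , y) = P.T-any v< p r in i , i< , e , T₊-old x y , F₊≥ y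
    ... | no ¬r with v ≟ b
    ...   | yes refl = j , j< , refl , T₊-final p (n<1⇒n≡0 (≰⇒> ¬r)) ,
            subst (1 ≤_) (sym (update-same F j j refl)) (s≤s z≤n)
    ...   | no nb = ⊥-elim (¬r (subst (1 ≤_) (IN₊-other nb) q))

    both : ∀ {i} → i < m → 1 ≤ S₊ i → 1 ≤ I (t i) → 1 ≤ T₊ i → F₊ i ≡ 1 → IN₊ (h i) ≤ 1 × OUT₊ (t i) ≤ 1
    both {i} i< p q r e with S₊-cases i p | T₊-cases i r (≡1⇒≥1 e)
    -- An older unit on `j` together with the new one makes two. And if the new one is final, there
    -- is no other unit at either end: `IN b` was 0, and `b-final` settles `a`.
    ... | new refl | old _ y = ⊥-elim (≥1⇒≢0 y (suc-injective (trans (sym (update-same F j j refl)) e)))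
    ... | new refl | final _ w x =
      ≤-reflexive (trans IN₊b (cong (_+ 1) x)) , ≤-reflexive (trans OUT₊a (cong (_+ 1) (b-final w x)))
    ... | old ne _ _ | final e′ _ _ = ⊥-elim (ne e′)
    ... | old ne na s | old x y
      rewrite IN₊-other (b-alone i< q na) | OUT₊-other na | update-other F j {suc (F j)} i ne =
        P.both i< s (I⇒I′ q na) x e

    still-h : ∀ {i} → i < m → 1 ≤ I (t i) → 1 ≤ J (t i) → IN₊ (t i) ≡ 0 → IN₊ (h i) + OUT₊ (h i) ≡ 0
    still-h {i} i< p q r
      rewrite IN₊-other (b-alone i< p (still≢a (t<n i<) p q r)) | OUT₊-other {h i} (λ e → I-free i< p (subst (λ v → 1 ≤ I v) (sym e) Ia)) =
        P.still-h i< (I⇒I′ p (still≢a (t<n i<) p q r)) q (trans (sym (IN₊-other (I≢b p))) r)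

    still-t : ∀ {i} → i < m → 1 ≤ I (h i) → 1 ≤ J (h i) → IN₊ (h i) ≡ 0 → IN₊ (t i) + OUT₊ (t i) ≡ 0
    still-t {i} i< p q r
      rewrite IN₊-other (b-alone′ i< p (still≢a (h<n i<) p q r)) | OUT₊-other {t i} (λ e → I-free i< (subst (λ v → 1 ≤ I v) (sym e) Ia) p) =
        P.still-t i< (I⇒I′ p (still≢a (h<n i<) p q r)) q (trans (sym (IN₊-other (I≢b p))) r)

plan-final : ∀ {n m t h J} → Graph n m t h → (∀ v → J v ≤ 1) → (∀ {i} → i < m → 1 ≤ J (t i) → 1 ≤ J (h i) → ⊥) →
  Plan n m t h J J (λ _ → 0) (λ _ → 0) (λ _ → 0) (λ _ → 0) (λ _ → 0)
plan-final {m = m} {t} {h} G J≤1 J-free = record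
  { I≤1 = J≤1 ; J≤1 = J≤1 ; I-free = J-free ; J-free = J-free ; law = λ _ → refl
  ; IN-sum = λ {v} _ → sym (zero-flow h v) ; OUT-sum = λ {v} _ → sym (zero-flow t v)
  ; S-head = λ _ _ () ; S-tail = λ _ _ () ; S-any = λ _ _ ()
  ; T-target = λ _ () ; T-head = λ _ _ () ; T-tail = λ _ _ () ; T-any = λ _ _ ()
  ; both = λ _ () ; still-h = λ _ _ _ _ → refl ; still-t = λ _ _ _ _ → refl }
  where
  zero-flow : ∀ k v → flow m k (λ _ → 0) v ≡ 0
  zero-flow k v = sum-zero m (λ {i} _ → n≤0⇒n≡0 (pick-≤ (k i) v 0))

-- Sufficiency: the invariant of a growing path

unique-∷ʳ : ∀ {as : List ℕ} {j} → All (_≢ j) as → Unique as → Unique (as ∷ʳ j)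
unique-∷ʳ [] [] = [] ∷ []
unique-∷ʳ (p ∷ ps) (q ∷ qs) = All.∷ʳ⁺ q p ∷ unique-∷ʳ ps qs

module Paths (t h : ℕ → ℕ) where

  data Path : ℕ → List ℕ → ℕ → Set where
    []  : ∀ {u} → Path u [] u
    _∷_ : ∀ {u i as w} → t i ≡ u → Path (h i) as w → Path u (i ∷ as) w

  On : ℕ → List ℕ → ℕ → Set
  On u as v = v ≡ u ⊎ Any (λ i → v ≡ h i) as

  path-∷ʳ : ∀ {u as w j} → Path u as w → t j ≡ w → Path u (as ∷ʳ j) (h j)
  path-∷ʳ [] e = e ∷ []
  path-∷ʳ (e ∷ p) e′ = e ∷ path-∷ʳ p e′

  on-last : ∀ {u as w} → Path u as w → On u as w
  on-last [] = inj₁ refl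
  on-last (_ ∷ p) with on-last p
  ... | inj₁ e = inj₂ (here e)
  ... | inj₂ e = inj₂ (there e)

  on-tail : ∀ {u as w} → Path u as w → All (λ i → On u as (t i)) as
  on-tail [] = []
  on-tail (e ∷ p) = inj₁ e ∷ All.map (λ { (inj₁ r) → inj₂ (here r) ; (inj₂ r) → inj₂ (there r) }) (on-tail p)

  on-head : ∀ {u as} → All (λ i → On u as (h i)) as
  on-head {as = []} = []
  on-head {u} {i ∷ as} = inj₂ (here refl) ∷ All.map (λ { (inj₁ r) → inj₂ (here r) ; (inj₂ r) → inj₂ (there r) }) (on-head {h i} {as})

  last-≢ : ∀ {u as w} {R : ℕ → Set} → Path u as w → as ≢ [] → All (λ i → R (h i)) as → R w
  last-≢ [] ne _ = ⊥-elim (ne refl)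
  last-≢ (_ ∷ []) ne (r ∷ []) = r
  last-≢ (_ ∷ p@(_ ∷ _)) ne (_ ∷ rs) = last-≢ p (λ ()) rs

module Walk {n m X Q D I J F IN OUT S T} (O : Order n m X Q)
  (P : Plan n m (tail-of X Q D) (head-of X Q D) I J F IN OUT S T) where
  open Order O
  open Ends-of O D
  open Plan P
  open Paths tl hd public

  F≤IN : ∀ {i v} → i < m → hd i ≡ v → F i ≤ IN v
  F≤IN {i} i< refl = ≤-trans (≤flow m {hd} {F} i< refl) (≤-reflexive (sym (IN-sum (hd<n i<))))

  F≤OUT : ∀ {i v} → i < m → tl i ≡ v → F i ≤ OUT v
  F≤OUT {i} i< refl = ≤-trans (≤flow m {tl} {F} i< refl) (≤-reflexive (sym (OUT-sum (tl<n i<))))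

  FF≤IN : ∀ {i j v} → i < m → j < m → i ≢ j → hd i ≡ v → hd j ≡ v → F i + F j ≤ IN v
  FF≤IN {i} i< j< ne refl e = ≤-trans (≤flow₂ m {hd} {F} i< j< ne refl e) (≤-reflexive (sym (IN-sum (hd<n i<))))

  -- A slide takes one unit off an arc. `Enterable` makes sure that this does not deprive a final
  -- vertex of its T-arc while further units have to come in. `Leavable` makes sure that a token
  -- entering a dead end does not bar a tail which others have still to leave.
  Enterable Leavable : ℕ → Set
  Enterable i = 1 ≤ F i × (1 ≤ T i → 2 ≤ F i ⊎ IN (hd i) ≤ 1)
  Leavable i = 1 ≤ F i × (OUT (hd i) ≡ 0 → OUT (tl i) ≤ 1)

  labelled-enterable : ∀ {i} → i < m → 1 ≤ S i → 1 ≤ I (tl i) → 1 ≤ F i → Enterable i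
  labelled-enterable {i} i< s p f = f , go
    where
    go : 1 ≤ T i → 2 ≤ F i ⊎ IN (hd i) ≤ 1
    go q with 2 ≤? F i
    ... | yes r = inj₁ r
    ... | no ¬r = inj₂ (proj₁ (both i< s p q (≤-antisym (≤-pred (≰⇒> ¬r)) f)))

  -- `S-tail` holds for stale labels as well, so the carrying arc supplied by `S-any` can only be
  -- this one.
  labelled-flow : ∀ {i} → i < m → 1 ≤ S i → 1 ≤ I (tl i) → 1 ≤ OUT (tl i) → 1 ≤ F i
  labelled-flow i< s p o with S-any (tl<n i<) p o
  ... | i′ , i′< , e , s′ , f with S-tail i< i′< s s′ (sym e)
  ...   | refl = f

  -- Without outflow the law reads `I w + IN w ≡ J w`, at most 1. So the unit on `i` is the only one
  -- to enter, and the T-label demanded by `T-any` must be on `i`.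
  dead-end : ∀ {i} → i < m → 1 ≤ F i → OUT (hd i) ≡ 0 →
    1 ≤ T i × F i ≤ 1 × IN (hd i) ≤ 1 × 1 ≤ J (hd i) × I (hd i) ≡ 0
  dead-end {i} i< f e = T-i , ≤-trans (F≤IN i< refl) IN≤1 , IN≤1 , 1≤J , n≤0⇒n≡0 (+-cancelʳ-≤ 1 _ 0 I+1≤1)
    where
    w = hd i
    sum≡J : I w + IN w ≡ J w
    sum≡J = trans (law (hd<n i<)) (trans (cong (J w +_) e) (+-identityʳ _))
    IN≤J : IN w ≤ J w
    IN≤J = ≤-trans (m≤n+m (IN w) (I w)) (≤-reflexive sum≡J)
    IN≤1 : IN w ≤ 1
    IN≤1 = ≤-trans IN≤J (J≤1 w)
    1≤IN : 1 ≤ IN w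
    1≤IN = ≤-trans f (F≤IN i< refl)
    1≤J : 1 ≤ J w
    1≤J = ≤-trans 1≤IN IN≤J
    I+1≤1 : I w + 1 ≤ 1
    I+1≤1 = ≤-trans (+-monoʳ-≤ (I w) 1≤IN) (≤-trans (≤-reflexive sum≡J) (J≤1 w))
    T-i : 1 ≤ T i
    T-i with T-any (hd<n i<) 1≤J 1≤IN
    ... | i′ , i′< , e′ , τ , f′ with i ≟ i′
    ...   | yes refl = τ
    ...   | no ne = ⊥-elim (1+n≰n (≤-trans (+-mono-≤ f f′) (≤-trans (FF≤IN i< i′< ne refl e′) IN≤1)))

  -- Of two units leaving `v`, one is not a single unit on a T-arc, because T is a matching at
  -- tails; by `dead-end`, only single units on T-arcs lead to dead ends.
  leave-any : ∀ {k v} → k ≤ m → v < n → flow k tl F v ≡ OUT v → 1 ≤ OUT v →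
    ∃[ i ] i < k × tl i ≡ v × Leavable i
  leave-any {k} {v} k≤ v< e p with 2 ≤? OUT v
  ... | no ¬r with flow-witness k {tl} {F} {v} (subst (1 ≤_) (sym e) p)
  ...   | i , i< , refl , f = i , i< , refl , f , λ _ → ≤-pred (≰⇒> ¬r)
  leave-any {k} {v} k≤ v< e p | yes r
    with flow-unmatched k {tl} {F} {v} T (subst (2 ≤_) (sym e) r)
      (λ i< j< → T-tail (<-≤-trans i< k≤) (<-≤-trans j< k≤))
  ... | i , i< , refl , f , g = i , i< , refl , f , λ z →
    let (τ , F≤1 , _) = dead-end (<-≤-trans i< k≤) f z in ⊥-elim (1+n≰n (≤-trans (g τ) F≤1))

  enter-two : ∀ {k v} → k ≤ m → 2 ≤ flow k hd F v → ∃[ i ] i < k × hd i ≡ v × Enterable i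
  enter-two {k} {v} k≤ r
    with flow-unmatched k {hd} {F} {v} T r (λ i< j< → T-head (<-≤-trans i< k≤) (<-≤-trans j< k≤))
  ... | i , i< , refl , f , g = i , i< , refl , f , λ τ → inj₁ (g τ)

  enter-any : ∀ {k v} → k ≤ m → flow k hd F v ≡ IN v → 1 ≤ IN v → ∃[ i ] i < k × hd i ≡ v × Enterable i
  enter-any {k} {v} k≤ e p with 2 ≤? IN v
  ... | yes r = enter-two k≤ (subst (2 ≤_) (sym e) r)
  ... | no ¬r with flow-witness k {hd} {F} {v} (subst (1 ≤_) (sym e) p)
  ...   | i , i< , refl , f = i , i< , refl , f , λ _ → inj₂ (≤-pred (≰⇒> ¬r))

  -- The arcs k, k+1, ... have been added.  In the forest they form, the first
  -- token to move on follows the path p₀ ─ as ⟶ p₁; it comes from, or goes on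
  -- through, an arc yet to be added if so, respectively eo, is nonzero.
  record First (k p₀ p₁ so eo : ℕ) (as : List ℕ) : Set where
    field
      path    : Path p₀ as p₁
      added   : All (λ i → k ≤ i × i < m) as
      enters  : All Enterable as
      distinct : Unique as
      simple  : All (λ i → hd i ≢ p₀) as
      born    : ∀ {v} → On p₀ as v → ∀ {i} → i < k → X i ≢ v
      on<n    : ∀ {v} → On p₀ as v → v < n
      closed  : so ≡ 0 → 1 ≤ I p₀
      open-   : 1 ≤ so → I p₀ ≡ 0
      alone   : ∀ {v} → On p₀ as v → 1 ≤ I v → v ≡ p₀
      alone-h : ∀ {i} → k ≤ i → i < m → On p₀ as (tl i) → 1 ≤ I (hd i) → hd i ≡ p₀
      alone-t : ∀ {i} → k ≤ i → i < m → On p₀ as (hd i) → 1 ≤ I (tl i) → tl i ≡ p₀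
      first   : so ≡ 0 →
                (as ≡ [] × 1 ≤ eo × ∃[ i ] i < k × tl i ≡ p₀ × 1 ≤ S i × 1 ≤ F i)
              ⊎ (as ≢ [] × (∀ {i} → i < k → tl i ≡ p₀ → 1 ≤ S i → ⊥))
      enter   : 1 ≤ so → ∃[ i ] i < k × hd i ≡ p₀ × Enterable i
      leave   : 1 ≤ eo → 1 ≤ so ⊎ as ≢ [] → ∃[ i ] i < k × tl i ≡ p₁ × Leavable i
      last    : eo ≡ 0 → OUT p₁ ≡ 0 × IN p₁ ≤ 1 × 1 ≤ J p₁
      last-h  : eo ≡ 0 → ∀ {i} → k ≤ i → i < m → hd i ≡ p₁ → OUT (tl i) ≤ F i
      last-t  : eo ≡ 0 → ∀ {i} → k ≤ i → i < m → tl i ≡ p₁ → OUT (hd i) ≡ 0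
      -- A live S-labelled arc must be the first into its head. If it is still to come, its head can
      -- only be the start of the path, and the path must be open there.
      claim   : ∀ {v} → On p₀ as v → ∀ {i} → i < k → hd i ≡ v → 1 ≤ S i → 1 ≤ I (tl i) → 1 ≤ F i →
                v ≡ p₀ × 1 ≤ so

  module _ {k v} {so eo : ℕ} (k≤ : k ≤ m) (v< : v < n) (b : ∀ {i} → i < k → X i ≢ v)
    (alone-h : ∀ {i} → k ≤ i → i < m → tl i ≡ v → 1 ≤ I (hd i) → ⊥)
    (alone-t : ∀ {i} → k ≤ i → i < m → hd i ≡ v → 1 ≤ I (tl i) → ⊥) where

    single-closed : so ≡ 0 → 1 ≤ eo → 1 ≤ I v → (∃[ i ] i < k × tl i ≡ v × 1 ≤ S i × 1 ≤ F i) → First k v v so eo []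
    single-closed so≡0 eo≥1 Iv w = record
      { path = [] ; added = [] ; enters = [] ; distinct = [] ; simple = []
      ; born = λ { (inj₁ refl) → b } ; on<n = λ { (inj₁ refl) → v< }
      ; closed = λ _ → Iv ; open- = λ p → ⊥-elim (≥1⇒≢0 p so≡0)
      ; alone = λ { (inj₁ e) _ → e }
      ; alone-h = λ { a c (inj₁ e) p → ⊥-elim (alone-h a c e p) }
      ; alone-t = λ { a c (inj₁ e) p → ⊥-elim (alone-t a c e p) }
      ; first = λ _ → inj₁ (refl , eo≥1 , w)
      ; enter = λ p → ⊥-elim (≥1⇒≢0 p so≡0)
      ; leave = λ { _ (inj₁ p) → ⊥-elim (≥1⇒≢0 p so≡0) ; _ (inj₂ p) → ⊥-elim (p refl) }
      ; last = λ e → ⊥-elim (≥1⇒≢0 eo≥1 e)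
      ; last-h = λ e → ⊥-elim (≥1⇒≢0 eo≥1 e)
      ; last-t = λ e → ⊥-elim (≥1⇒≢0 eo≥1 e)
      ; claim = λ { (inj₁ refl) i< refl s p f → ⊥-elim (I-free (<-≤-trans i< k≤) p Iv) } }

    single-open : 1 ≤ so → I v ≡ 0 → (∃[ i ] i < k × hd i ≡ v × Enterable i) →
      (1 ≤ eo → ∃[ i ] i < k × tl i ≡ v × Leavable i) →
      (eo ≡ 0 → OUT v ≡ 0 × IN v ≤ 1 × 1 ≤ J v) →
      (eo ≡ 0 → ∀ {i} → k ≤ i → i < m → hd i ≡ v → OUT (tl i) ≤ F i) →
      (eo ≡ 0 → ∀ {i} → k ≤ i → i < m → tl i ≡ v → OUT (hd i) ≡ 0) → First k v v so eo []
    single-open so≥1 Iv w l a₁ a₂ a₃ = record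
      { path = [] ; added = [] ; enters = [] ; distinct = [] ; simple = []
      ; born = λ { (inj₁ refl) → b } ; on<n = λ { (inj₁ refl) → v< }
      ; closed = λ p → ⊥-elim (≥1⇒≢0 so≥1 p) ; open- = λ _ → Iv
      ; alone = λ { (inj₁ e) _ → e }
      ; alone-h = λ { a c (inj₁ e) p → ⊥-elim (alone-h a c e p) }
      ; alone-t = λ { a c (inj₁ e) p → ⊥-elim (alone-t a c e p) }
      ; first = λ e → ⊥-elim (≥1⇒≢0 so≥1 e)
      ; enter = λ _ → w
      ; leave = λ p _ → l p
      ; last = a₁ ; last-h = a₂ ; last-t = a₃
      ; claim = λ { (inj₁ e) _ _ _ _ _ → e , so≥1 } }

  module Step {j} (j< : j < m) where
    x = X j
    q = Q j

    in-x : flow m hd F x ≡ IN x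
    in-x = sym (IN-sum (X<n j<))

    in-child : flow j hd F x + pick (hd j) x (F j) ≡ IN x
    in-child = trans (sym (flow-at-child {hd} {F} X≢hd j<)) in-x

    out-child : flow j tl F x + pick (tl j) x (F j) ≡ OUT x
    out-child = trans (sym (flow-at-child {tl} {F} X≢tl j<)) (sym (OUT-sum (X<n j<)))

    -- In the forest formed by the arcs from `j` on, `x` is a leaf.
    only-h : ∀ {i} → j ≤ i → i < m → hd i ≡ x → i ≡ j
    only-h {i} a i< e with m≤n⇒m<n∨m≡n a
    ... | inj₁ j<i = ⊥-elim (X≢hd j<i i< (sym e))
    ... | inj₂ refl = refl

    only-t : ∀ {i} → j ≤ i → i < m → tl i ≡ x → i ≡ j
    only-t {i} a i< e with m≤n⇒m<n∨m≡n a
    ... | inj₁ j<i = ⊥-elim (X≢tl j<i i< (sym e))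
    ... | inj₂ refl = refl

    x-born : ∀ {i} → i < j → X i ≢ x
    x-born i< = X≢X i< j<

    module _ {p₀ p₁ so eo as} (A : First (suc j) p₀ p₁ so eo as) where
      open First A

      x-off : On p₀ as x → ⊥
      x-off o = born o (n<1+n j) refl

      on-p₁ : On p₀ as p₁
      on-p₁ = on-last path

      -- Every vertex of the path is an end of a path arc or of a promised one, and these carry
      -- flow. Hence the path keeps away from the idle neighbours of resting tokens.
      on-active : ∀ {v} → On p₀ as v → IN v + OUT v ≡ 0 → ⊥
      on-active (inj₁ refl) e with zero⊎pos so
      ... | inj₂ p = let (i , i< , e′ , f , _) = enter p in
        ≥1⇒≢0 (≤-trans f (F≤IN (<-≤-trans i< j<) e′)) (m+n≡0⇒m≡0 _ e)
      ... | inj₁ z with first z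
      ...   | inj₁ (_ , _ , i , i< , refl , s , f) =
        ≥1⇒≢0 (≤-trans f (F≤OUT (<-≤-trans i< j<) refl)) (m+n≡0⇒n≡0 (IN _) e)
      ...   | inj₂ (ne , _) = begins path enters added ne
        where
        begins : ∀ {as w} → Path p₀ as w → All Enterable as → All (λ i → suc j ≤ i × i < m) as → as ≢ [] → ⊥
        begins [] _ _ ne = ne refl
        begins (e′ ∷ _) ((f , _) ∷ _) ((_ , i<) ∷ _) _ = ≥1⇒≢0 (≤-trans f (F≤OUT i< e′)) (m+n≡0⇒n≡0 (IN _) e)
      on-active (inj₂ o) e = go o enters added
        where
        go : ∀ {as} → Any (λ i → _ ≡ hd i) as → All Enterable as → All (λ i → suc j ≤ i × i < m) as → ⊥
        go (here refl) ((f , _) ∷ _) ((_ , i<) ∷ _) = ≥1⇒≢0 (≤-trans f (F≤IN i< refl)) (m+n≡0⇒m≡0 _ e)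
        go (there o) (_ ∷ es) (_ ∷ is) = go o es is

      -- A token on the path can only be at its start, and a path closed at both ends is not a
      -- single vertex.
      last-unoccupied : eo ≡ 0 → I p₁ ≡ 0
      last-unoccupied e with zero⊎pos (I p₁)
      ... | inj₁ z = z
      ... | inj₂ p with alone on-p₁ p | zero⊎pos so
      ...   | r | inj₂ p′ = ⊥-elim (≥1⇒≢0 p (trans (cong I r) (open- p′)))
      ...   | r | inj₁ z with first z
      ...     | inj₁ (_ , p′ , _) = ⊥-elim (≥1⇒≢0 p′ e)
      ...     | inj₂ (ne , _) = ⊥-elim (last-≢ {R = _≢ p₀} path ne simple r)

      below : ∀ {R : ℕ → Set} → (R j → ⊥) → (∃[ i ] i < suc j × R i) → ∃[ i ] i < j × R i
      below ¬Rj (i , i< , r) with m≤n⇒m<n∨m≡n (≤-pred i<)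
      ... | inj₁ lt = i , lt , r
      ... | inj₂ refl = ⊥-elim (¬Rj r)

      -- The new leaf is left off the path. The hypotheses list what arc `j` could spoil: a token
      -- next to the path, a promise that was to be kept by `j` itself, or the seclusion of a closed
      -- end.
      stay : (On p₀ as (tl j) → 1 ≤ I (hd j) → hd j ≡ p₀) →
             (On p₀ as (hd j) → 1 ≤ I (tl j) → tl j ≡ p₀) →
             (so ≡ 0 → as ≡ [] → tl j ≡ p₀ → 1 ≤ S j → ⊥) →
             (1 ≤ so → ∃[ i ] i < j × hd i ≡ p₀ × Enterable i) →
             (1 ≤ eo → 1 ≤ so ⊎ as ≢ [] → tl j ≡ p₁ × Leavable j → ⊥) →
             (eo ≡ 0 → hd j ≡ p₁ → OUT (tl j) ≤ F j) →
             (eo ≡ 0 → tl j ≡ p₁ → OUT (hd j) ≡ 0) → First j p₀ p₁ so eo as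
      stay c₁ c₂ c₃ c₄ c₅ c₆ c₇ = record
        { path = path ; added = All.map (λ { (a , b) → <⇒≤ a , b }) added
        ; enters = enters ; distinct = distinct ; simple = simple
        ; born = λ o i< → born o (<-trans i< (n<1+n j)) ; on<n = on<n ; closed = closed ; open- = open-
        ; alone = alone
        ; alone-h = λ a i< → split a (alone-h′ i<) c₁
        ; alone-t = λ a i< → split a (alone-t′ i<) c₂
        ; first = first′
        ; enter = c₄
        ; leave = λ p r → below (c₅ p r) (leave p r)
        ; last = last
        ; last-h = λ e a i< → split a (λ b → last-h e b i<) (c₆ e)
        ; last-t = λ e a i< → split a (λ b → last-t e b i<) (c₇ e)
        ; claim = λ o i< → claim o (<-trans i< (n<1+n j)) }
        where
        split : ∀ {i} {R : ℕ → Set} → j ≤ i → (suc j ≤ i → R i) → R j → R i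
        split a f g with m≤n⇒m<n∨m≡n a
        ... | inj₁ lt = f lt
        ... | inj₂ refl = g
        alone-h′ : ∀ {i} → i < m → suc j ≤ i → On p₀ as (tl i) → 1 ≤ I (hd i) → hd i ≡ p₀
        alone-h′ i< a = alone-h a i<
        alone-t′ : ∀ {i} → i < m → suc j ≤ i → On p₀ as (hd i) → 1 ≤ I (tl i) → tl i ≡ p₀
        alone-t′ i< a = alone-t a i<
        first′ : so ≡ 0 →
                (as ≡ [] × 1 ≤ eo × ∃[ i ] i < j × tl i ≡ p₀ × 1 ≤ S i × 1 ≤ F i)
              ⊎ (as ≢ [] × (∀ {i} → i < j → tl i ≡ p₀ → 1 ≤ S i → ⊥))
        first′ e with first e
        ... | inj₁ (z , p , w) = inj₁ (z , p , below (λ { (e′ , s , _) → c₃ e z e′ s }) w)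
        ... | inj₂ (ne , f) = inj₂ (ne , λ i< → f (<-trans i< (n<1+n j)))

      stay-off : (On p₀ as (tl j) → ⊥) → (On p₀ as (hd j) → ⊥) → First j p₀ p₁ so eo as
      stay-off a b = stay (λ o _ → ⊥-elim (a o)) (λ o _ → ⊥-elim (b o)) (λ _ _ e _ → a (inj₁ e))
        (λ p → below (λ { (e , _) → b (inj₁ e) }) (enter p))
        (λ _ _ → λ { (e , _) → a (subst (On p₀ as) (sym e) on-p₁) })
        (λ _ e → ⊥-elim (b (subst (On p₀ as) (sym e) on-p₁)))
        (λ _ e → ⊥-elim (a (subst (On p₀ as) (sym e) on-p₁)))

      x≢p₀ : x ≢ p₀
      x≢p₀ e = x-off (inj₁ e)

      x≢p₁ : x ≢ p₁
      x≢p₁ e = x-off (subst (On p₀ as) (sym e) on-p₁)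

    -- By the law, a token on a vertex without outflow is one that never moves.
    parent-idle : 1 ≤ I x → OUT x ≡ 0 → IN q + OUT q ≡ 0
    parent-idle Ix e = go
      where
      IN≡0 : IN x ≡ 0
      IN≡0 = n≤0⇒n≡0 (+-cancelˡ-≤ 1 _ _ (≤-trans (+-monoˡ-≤ (IN x) Ix) (≤-trans (≤-reflexive
        (trans (law (X<n j<)) (trans (cong (J x +_) e) (+-identityʳ _)))) (J≤1 x))))
      J≥1 : 1 ≤ J x
      J≥1 = ≤-trans (≤-trans Ix (m≤m+n _ _)) (≤-reflexive (trans (law (X<n j<)) (trans (cong (J x +_) e) (+-identityʳ _))))
      go : IN q + OUT q ≡ 0
      go with D j | still-h j< | still-t j<
      ... | zero  | _ | st = st Ix J≥1 IN≡0
      ... | suc _ | sh | _ = sh Ix J≥1 IN≡0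

-- Extending or replacing the path at a new leaf

module Rules {n m X Q D I J F IN OUT S T} (O : Order n m X Q)
  (P : Plan n m (tail-of X Q D) (head-of X Q D) I J F IN OUT S T) where
  open Order O
  open Ends-of O D
  open Plan P
  open Walk O P public

  module Arc {j} (j< : j < m) where
    open Step j< public

    flow-from-x : tl j ≢ x → flow j tl F x ≡ OUT x
    flow-from-x ne = trans (sym (trans (cong (flow j tl F x +_) (pick-other (F j) ne)) (+-identityʳ _))) out-child

    flow-into-x : hd j ≢ x → flow j hd F x ≡ IN x
    flow-into-x ne = trans (sym (trans (cong (flow j hd F x +_) (pick-other (F j) ne)) (+-identityʳ _))) in-child

    later : ∀ {i} {R : ℕ → Set} → j ≤ i → R j → (suc j ≤ i → R i) → R i
    later a r f with m≤n⇒m<n∨m≡n a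
    ... | inj₁ lt = f lt
    ... | inj₂ refl = r

    idle-side : 1 ≤ J q → J x ≡ 0
    idle-side p with zero⊎pos (J x)
    ... | inj₁ z = z
    ... | inj₂ p′ with D j | J-free j<
    ...   | zero  | f = ⊥-elim (f p p′)
    ...   | suc _ | f = ⊥-elim (f p′ p)

    -- Arc `j` keeps the promise made by the open start. The new start is closed if a token on `x`
    -- has its S-label on `j`, and open if `x` is merely passed through.
    grow-front : ∀ {p₀ p₁ so so′ eo as} → First (suc j) p₀ p₁ so eo as →
      tl j ≡ x → p₀ ≡ hd j → 1 ≤ so → Enterable j →
      (so′ ≡ 0 → 1 ≤ I x × 1 ≤ S j) →
      (1 ≤ so′ → I x ≡ 0 × 1 ≤ OUT x) →
      (eo ≡ 0 → hd j ≡ p₁ → OUT x ≤ F j) →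
      (∀ {i} → i < j → hd i ≡ hd j → 1 ≤ S i → 1 ≤ I (tl i) → 1 ≤ F i → ⊥) →
      First j x p₁ so′ eo (j ∷ as)
    grow-front {p₁ = p₁} {so} {so′} {eo} {as} A up refl so≥1 ej closed′ open′ last′ unclaimed = record
      { path = up ∷ path
      ; added = (≤-refl , j<) ∷ All.map (λ { (a , b) → <⇒≤ a , b }) added
      ; enters = ej ∷ enters
      ; distinct = All.map (λ { (a , _) refl → 1+n≰n a }) added ∷ distinct
      ; simple = (λ e → tl≢hd j< (trans up (sym e))) ∷ All.map (λ o e → x-off A (subst (On (hd j) as) e o)) on-head
      ; born = λ { (inj₁ refl) i< → x-born i<
                 ; (inj₂ o) i< → born (old o) (<-trans i< (n<1+n j)) }
      ; on<n = λ { (inj₁ refl) → X<n j< ; (inj₂ o) → on<n (old o) }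
      ; closed = λ e → proj₁ (closed′ e)
      ; open- = λ p → proj₁ (open′ p)
      ; alone = λ { (inj₁ e) _ → e ; (inj₂ o) p → ⊥-elim (none-old (old o) p) }
      ; alone-h = λ {i} a → later {i} {λ i → i < m → On x (j ∷ as) (tl i) → 1 ≤ I (hd i) → hd i ≡ x} a
          (λ _ _ p → ⊥-elim (none-old (inj₁ refl) p))
          (λ { lt i< (inj₁ e) _ → ⊥-elim (X≢tl lt i< (sym e))
             ; lt i< (inj₂ o) p → ⊥-elim (free (alone-h lt i< (old o) p) p) })
      ; alone-t = λ {i} a → later {i} {λ i → i < m → On x (j ∷ as) (hd i) → 1 ≤ I (tl i) → tl i ≡ x} a
          (λ _ _ _ → up)
          (λ { lt i< (inj₁ e) _ → ⊥-elim (X≢hd lt i< (sym e))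
             ; lt i< (inj₂ o) p → ⊥-elim (free (alone-t lt i< (old o) p) p) })
      ; first = λ e → inj₂ ((λ ()) , λ i< e′ s → let (Ix , sj) = closed′ e in
          <⇒≢ i< (S-tail (<-trans i< j<) j< s sj (trans e′ (sym up))))
      ; enter = λ p → let (Ix , ox) = open′ p in
          enter-any (<⇒≤ j<) (flow-into-x (λ e → tl≢hd j< (trans up (sym e))))
            (≤-trans ox (≤-trans (m≤n+m (OUT x) (J x)) (≤-reflexive
              (trans (sym (law (X<n j<))) (cong (_+ IN x) Ix)))))
      ; leave = λ p _ → below A (λ { (e , _) → x≢p₁ A (trans (sym up) e) }) (leave p (inj₁ so≥1))
      ; last = last
      ; last-h = λ e {i} a → later {i} {λ i → i < m → hd i ≡ p₁ → OUT (tl i) ≤ F i} a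
          (λ _ e′ → subst (λ v → OUT v ≤ F j) (sym up) (last′ e e′)) (λ lt → last-h e lt)
      ; last-t = λ e {i} a → later {i} {λ i → i < m → tl i ≡ p₁ → OUT (hd i) ≡ 0} a
          (λ _ e′ → ⊥-elim (x≢p₁ A (trans (sym up) e′))) (λ lt → last-t e lt)
      ; claim = λ { (inj₁ refl) i< e s p f → refl , so′≥1 i< e p
                  ; (inj₂ o) i< refl s p f → ⊥-elim (unclaimed i<
                      (proj₁ (claim (old o) (<-trans i< (n<1+n j)) refl s p f)) s p f) } }
      where
      open First A
      old : ∀ {v} → Any (λ i → v ≡ hd i) (j ∷ as) → On (hd j) as v
      old (here e) = inj₁ e
      old (there o) = inj₂ o
      free : ∀ {v} → v ≡ hd j → 1 ≤ I v → ⊥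
      free refl p = ≥1⇒≢0 p (open- so≥1)
      none-old : ∀ {v} → On (hd j) as v → 1 ≤ I v → ⊥
      none-old o p = free (alone o p) p
      so′≥1 : ∀ {i} → i < j → hd i ≡ x → 1 ≤ I (tl i) → 1 ≤ so′
      so′≥1 i< e p with zero⊎pos so′
      ... | inj₂ q = q
      ... | inj₁ z = ⊥-elim (I-free (<-trans i< j<) p (subst (λ v → 1 ≤ I v) (sym e) (proj₁ (closed′ z))))

    -- Arc `j` keeps the promise made by the open end. `OUT x` itself serves as the flag of the new
    -- end: if it is 0, then `dead-end` shows that the token is final at `x`.
    grow-back : ∀ {p₀ p₁ so eo as} → First (suc j) p₀ p₁ so eo as →
      hd j ≡ x → p₁ ≡ tl j → 1 ≤ eo → Enterable j → I x ≡ 0 →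
      (OUT x ≡ 0 → OUT (tl j) ≤ 1) →
      (so ≡ 0 → as ≡ [] → 1 ≤ S j) →
      (∀ {i} → i < j → hd i ≡ x → 1 ≤ S i → 1 ≤ I (tl i) → 1 ≤ F i → ⊥) →
      First j p₀ x so (OUT x) (as ∷ʳ j)
    grow-back {p₀} {so = so} {eo} {as} A down refl eo≥1 ej Ix leaves uses unclaimed = record
      { path = subst (Path p₀ (as ∷ʳ j)) down (path-∷ʳ path refl)
      ; added = All.∷ʳ⁺ (All.map (λ { (a , b) → <⇒≤ a , b }) added) (≤-refl , j<)
      ; enters = All.∷ʳ⁺ enters ej
      ; distinct = unique-∷ʳ (All.map (λ { (a , _) refl → 1+n≰n a }) added) distinct
      ; simple = All.∷ʳ⁺ simple (λ e → x≢p₀ A (trans (sym down) e))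
      ; born = λ o i< e → born′ (old o) i< e
      ; on<n = λ o → on<n′ (old o)
      ; closed = closed ; open- = open-
      ; alone = λ o p → alone′ (old o) p
      ; alone-h = λ {i} a → later {i} {λ i → i < m → On p₀ (as ∷ʳ j) (tl i) → 1 ≤ I (hd i) → hd i ≡ p₀} a
          (λ _ _ p → ⊥-elim (free down p))
          (λ lt i< o p → alone-h lt i< (notx (X≢tl lt i<) (old o)) p)
      ; alone-t = λ {i} a → later {i} {λ i → i < m → On p₀ (as ∷ʳ j) (hd i) → 1 ≤ I (tl i) → tl i ≡ p₀} a
          (λ _ _ p → alone (on-p₁ A) p)
          (λ lt i< o p → alone-t lt i< (notx (X≢hd lt i<) (old o)) p)
      ; first = λ e → inj₂ ((λ z → snoc≢[] as z) , first′ e)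
      ; enter = λ p → below A (λ { (e , _) → x≢p₀ A (trans (sym down) e) }) (enter p)
      ; leave = λ p _ → leave-any (<⇒≤ j<) (X<n j<) (flow-from-x tj≢x) p
      ; last = λ e → let (_ , _ , a , b , _) = dead-end j< (proj₁ ej) (trans (cong OUT down) e) in
          e , subst (λ v → IN v ≤ 1) down a , subst (λ v → 1 ≤ J v) down b
      ; last-h = λ e {i} a i< e′ → subst (λ i → OUT (tl i) ≤ F i) (sym (only-h a i< e′))
          (≤-trans (leaves e) (proj₁ ej))
      ; last-t = λ e {i} a i< e′ → ⊥-elim (tj≢x (subst (λ i → tl i ≡ x) (only-t a i< e′) e′))
      ; claim = λ o i< e s p f → claim′ (old o) i< e s p f }
      where
      open First A
      tj≢x : tl j ≢ x
      tj≢x e = tl≢hd j< (trans e (sym down))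
      snoc≢[] : ∀ (as : List ℕ) → as ∷ʳ j ≡ [] → ⊥
      snoc≢[] [] ()
      snoc≢[] (_ ∷ _) ()
      old : ∀ {v} → On p₀ (as ∷ʳ j) v → On p₀ as v ⊎ v ≡ x
      old (inj₁ e) = inj₁ (inj₁ e)
      old (inj₂ o) with Any.++⁻ as o
      ... | inj₁ o′ = inj₁ (inj₂ o′)
      ... | inj₂ (here e) = inj₂ (trans e down)
      notx : ∀ {v} → x ≢ v → On p₀ as v ⊎ v ≡ x → On p₀ as v
      notx ne (inj₁ o) = o
      notx ne (inj₂ e) = ⊥-elim (ne (sym e))
      free : ∀ {v} → v ≡ x → 1 ≤ I v → ⊥
      free refl p = ≥1⇒≢0 p Ix
      born′ : ∀ {v} → On p₀ as v ⊎ v ≡ x → ∀ {i} → i < j → X i ≢ v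
      born′ (inj₁ o) i< = born o (<-trans i< (n<1+n j))
      born′ (inj₂ refl) i< = x-born i<
      on<n′ : ∀ {v} → On p₀ as v ⊎ v ≡ x → v < n
      on<n′ (inj₁ o) = on<n o
      on<n′ (inj₂ refl) = X<n j<
      alone′ : ∀ {v} → On p₀ as v ⊎ v ≡ x → 1 ≤ I v → v ≡ p₀
      alone′ (inj₁ o) p = alone o p
      alone′ (inj₂ e) p = ⊥-elim (free e p)
      claim′ : ∀ {v} → On p₀ as v ⊎ v ≡ x → ∀ {i} → i < j → hd i ≡ v → 1 ≤ S i → 1 ≤ I (tl i) → 1 ≤ F i → v ≡ p₀ × 1 ≤ so
      claim′ (inj₁ o) i< e s p f = claim o (<-trans i< (n<1+n j)) e s p f
      claim′ (inj₂ refl) i< e s p f = ⊥-elim (unclaimed i< e s p f)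
      first′ : so ≡ 0 → ∀ {i} → i < j → tl i ≡ p₀ → 1 ≤ S i → ⊥
      first′ e i< e′ s with first e
      ... | inj₂ (_ , f) = f (<-trans i< (n<1+n j)) e′ s
      ... | inj₁ (refl , _) with path
      ...   | [] = <⇒≢ i< (S-tail (<-trans i< j<) j< s (uses e refl) e′)

    -- The token on `x` starts along an arc still to come, so a path for it can be sought behind
    -- `x`, and the old path is given up.
    switch-closed : ∀ {so eo} → 1 ≤ I x → 1 ≤ OUT x → (tl j ≡ x → S j ≡ 0) → so ≡ 0 → 1 ≤ eo → First j x x so eo []
    switch-closed Ix ox ns so≡0 eo≥1 = single-closed (<⇒≤ j<) (X<n j<) x-born
      (λ {i} a i< e p → I-free i< (subst (λ v → 1 ≤ I v) (sym e) Ix) p)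
      (λ {i} a i< e p → I-free i< p (subst (λ v → 1 ≤ I v) (sym e) Ix))
      so≡0 eo≥1 Ix witness
      where
      witness : ∃[ i ] i < j × tl i ≡ x × 1 ≤ S i × 1 ≤ F i
      witness with S-any (X<n j<) Ix ox
      ... | i , i< , e , s , f with i <? j
      ...   | yes lt = i , lt , e , s , f
      ...   | no ge with only-t (≮⇒≥ ge) i< e
      ...     | refl = ⊥-elim (≥1⇒≢0 s (ns e))

    nbr-h : I q ≡ 0 → I x ≡ 0 → ∀ {i} → j ≤ i → i < m → tl i ≡ x → 1 ≤ I (hd i) → ⊥
    nbr-h Iq Ix a i< e p with only-t a i< e
    ... | refl with D j
    ...   | zero  = ≥1⇒≢0 p Ix
    ...   | suc _ = ≥1⇒≢0 p Iq

    nbr-t : I q ≡ 0 → I x ≡ 0 → ∀ {i} → j ≤ i → i < m → hd i ≡ x → 1 ≤ I (tl i) → ⊥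
    nbr-t Iq Ix a i< e p with only-h a i< e
    ... | refl with D j
    ...   | zero  = ≥1⇒≢0 p Iq
    ...   | suc _ = ≥1⇒≢0 p Ix

    -- Some unit enters `x` from below without being the one reserved by T. All outflow of `x` goes
    -- below as well, so a path through `x` can be completed there at both ends.
    switch-down : ∀ {so eo} → hd j ≡ x → tl j ≡ q → I x ≡ 0 → I q ≡ 0 → 1 ≤ OUT x →
      1 ≤ IN x ∸ F j → (IN x ∸ F j ≤ 1 → 1 ≤ J x → 1 ≤ T j × 1 ≤ F j) →
      1 ≤ so → 1 ≤ eo → First j x x so eo []
    switch-down down tj Ix Iq ox spare one so≥1 eo≥1 = single-open (<⇒≤ j<) (X<n j<) x-born
      (nbr-h Iq Ix) (nbr-t Iq Ix) so≥1 Ix witness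
      (λ _ → leave-any (<⇒≤ j<) (X<n j<) (flow-from-x (λ e → tl≢hd j< (trans e (sym down)))) ox)
      (λ z → ⊥-elim (≥1⇒≢0 eo≥1 z)) (λ z → ⊥-elim (≥1⇒≢0 eo≥1 z)) (λ z → ⊥-elim (≥1⇒≢0 eo≥1 z))
      where
      rest : flow j hd F x ≡ IN x ∸ F j
      rest = trans (sym (m+n∸n≡m _ (F j))) (cong (_∸ F j)
        (trans (cong (flow j hd F x +_) (sym (pick-same (F j) down))) in-child))
      witness : ∃[ i ] i < j × hd i ≡ x × Enterable i
      witness with 2 ≤? IN x ∸ F j
      ... | yes r = enter-two (<⇒≤ j<) (subst (2 ≤_) (sym rest) r)
      ... | no ¬r with flow-witness j {hd} {F} {x} (subst (1 ≤_) (sym rest) spare)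
      ...   | i , i< , e , f = i , i< , e , f , λ τ → ⊥-elim (go τ)
        where
        go : 1 ≤ T i → ⊥
        go τ with one (≤-pred (≰⇒> ¬r)) (subst (λ v → 1 ≤ J v) e (T-target (<-trans i< j<) τ f))
        ... | τ′ , f′ = <⇒≢ i< (T-head (<-trans i< j<) j< τ τ′ f f′ (trans e (sym down)))

    -- A token stopping for good at `q` would bar `x`, which has units to release other than along
    -- `j`. So a unit passing through `x` goes first; it enters and leaves by arcs still to come.
    switch-up : ∀ {p₀ p₁ so eo so′ eo′ as} → First (suc j) p₀ p₁ so eo as →
      tl j ≡ x → hd j ≡ q → I x ≡ 0 → eo ≡ 0 → p₁ ≡ q → F j < OUT x →
      1 ≤ so′ → 1 ≤ eo′ → First j x x so′ eo′ []
    switch-up A up hj Ix eo≡0 refl more so≥1 eo≥1 = single-open (<⇒≤ j<) (X<n j<) x-born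
      (nbr-h Iq Ix) (nbr-t Iq Ix) so≥1 Ix
      (enter-any (<⇒≤ j<) (flow-into-x (λ e → tl≢hd j< (trans up (sym e)))) (≤-trans (≤-trans (s≤s z≤n) more) (≤-reflexive (sym IN≡OUT))))
      (λ _ → leave-x)
      (λ z → ⊥-elim (≥1⇒≢0 eo≥1 z)) (λ z → ⊥-elim (≥1⇒≢0 eo≥1 z)) (λ z → ⊥-elim (≥1⇒≢0 eo≥1 z))
      where
      open First A
      Iq = last-unoccupied A eo≡0
      IN≤1 = proj₁ (proj₂ (last eo≡0))
      J≥1 = proj₂ (proj₂ (last eo≡0))
      IN≡OUT : IN x ≡ OUT x
      IN≡OUT = trans (cong (_+ IN x) (sym Ix)) (trans (law (X<n j<)) (cong (_+ OUT x) (idle-side J≥1)))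
      rest : flow j tl F x + F j ≡ OUT x
      rest = trans (cong (flow j tl F x +_) (sym (pick-same (F j) up))) out-child
      leave-x : ∃[ i ] i < j × tl i ≡ x × Leavable i
      leave-x with zero⊎pos (F j)
      ... | inj₁ z = leave-any (<⇒≤ j<) (X<n j<) (trans (sym (trans (cong (flow j tl F x +_) z) (+-identityʳ _))) rest) (≤-trans (s≤s z≤n) more)
      ... | inj₂ f with flow-witness j {tl} {F} {x} (+-cancelʳ-≤ (F j) _ _ (≤-trans more (≤-reflexive (sym rest))))
      ...   | i , i< , e , f′ = i , i< , e , f′ , λ z → ⊥-elim (go (dead-end (<-trans i< j<) f′ z))
        where
        -- Only one unit enters `q`, and it is on `j`; so `j` has the T-label of `q`, and no other
        -- carrying arc out of `x` can have one.
        Tj : 1 ≤ T j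
        Tj with T-any (Q<n j<) J≥1 (≤-trans f (F≤IN j< hj))
        ... | i′ , i′< , e′ , τ , f″ with i′ ≟ j
        ...   | yes refl = τ
        ...   | no ne = ⊥-elim (1+n≰n (≤-trans (+-mono-≤ f″ f) (≤-trans (FF≤IN i′< j< ne e′ hj) IN≤1)))
        go : 1 ≤ T i × F i ≤ 1 × IN (hd i) ≤ 1 × 1 ≤ J (hd i) × I (hd i) ≡ 0 → ⊥
        go (τ , _) = <⇒≢ i< (T-tail (<-trans i< j<) j< τ Tj f′ f (trans e (sym up)))

-- The cases met when an arc is added

module Cases {n m X Q D I J F IN OUT S T} (O : Order n m X Q)
  (P : Plan n m (tail-of X Q D) (head-of X Q D) I J F IN OUT S T) where
  open Order O
  open Ends-of O D
  open Plan P
  open Rules O P public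

  module ArcCases {j} (j< : j < m) where
    open Arc j< public

    off : ∀ {p₀ p₁ so eo as} → First (suc j) p₀ p₁ so eo as → (On p₀ as q → ⊥) → First j p₀ p₁ so eo as
    off A nq with D j | stay-off A
    ... | zero  | f = f nq (x-off A)
    ... | suc _ | f = f (x-off A) nq

    stay-idle : ∀ {p₀ p₁ so eo as} → First (suc j) p₀ p₁ so eo as → 1 ≤ I x → OUT x ≡ 0 → First j p₀ p₁ so eo as
    stay-idle A Ix e = off A (λ o → on-active A o (parent-idle Ix e))

    -- By `claim`, a labelled arc meets the path only at an open start; this being excluded, the
    -- path avoids `q`.
    stay-labelled : ∀ {p₀ p₁ so eo as} → First (suc j) p₀ p₁ so eo as → tl j ≡ x → hd j ≡ q →
      1 ≤ I x → 1 ≤ OUT x → 1 ≤ S j → (1 ≤ so → p₀ ≡ q → ⊥) → First j p₀ p₁ so eo as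
    stay-labelled A up hj Ix ox s ban = off A (λ o →
      let Ij = subst (λ v → 1 ≤ I v) (sym up) Ix
          (e , p) = First.claim A o (n<1+n j) hj s Ij (labelled-flow j< s Ij (subst (λ v → 1 ≤ OUT v) (sym up) ox))
      in ban p (sym e))

    grow-labelled : ∀ {p₀ p₁ so so′ eo as} → First (suc j) p₀ p₁ so eo as → tl j ≡ x → hd j ≡ q →
      1 ≤ I x → 1 ≤ OUT x → 1 ≤ S j → 1 ≤ so → p₀ ≡ q → so′ ≡ 0 → First j x p₁ so′ eo (j ∷ as)
    grow-labelled {eo = eo} {as} A up hj Ix ox s so≥1 p₀≡q so′≡0 = grow-front A up (trans p₀≡q (sym hj)) so≥1 ej
      (λ _ → Ix , s) (λ p → ⊥-elim (≥1⇒≢0 p so′≡0)) last′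
      (λ i< e s′ p f → <⇒≢ i< (S-head (<-trans i< j<) j< s′ s p Ij f (proj₁ ej) e))
      where
      open First A
      Ij = subst (λ v → 1 ≤ I v) (sym up) Ix
      Fj = labelled-flow j< s Ij (subst (λ v → 1 ≤ OUT v) (sym up) ox)
      ej = labelled-enterable j< s Ij Fj
      -- If the path ends for good at `q`, then the one unit entering `q` is on `j`, together with
      -- the T-label, and `both` limits the outflow of `x`.
      last′ : eo ≡ 0 → hd j ≡ _ → OUT x ≤ F j
      last′ e e′ with last e
      ... | _ , IN≤1 , J≥1 with T-any (hd<n j<) (subst (λ v → 1 ≤ J v) (sym e′) J≥1) (≤-trans Fj (F≤IN j< refl))
      ...   | i′ , i′< , e″ , τ , f with i′ ≟ j
      ...     | no ne = ⊥-elim (1+n≰n (≤-trans (+-mono-≤ f Fj) (≤-trans (FF≤IN i′< j< ne (trans e″ e′) e′) IN≤1)))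
      ...     | yes refl = ≤-trans (subst (λ v → OUT v ≤ 1) up (proj₂ (both j< s Ij τ
                  (≤-antisym (≤-trans (F≤IN j< e′) IN≤1) Fj)))) Fj

    stay-token : ∀ {p₀ p₁ so eo as} → First (suc j) p₀ p₁ so eo as → hd j ≡ x → tl j ≡ q →
      I x ≡ 0 → 1 ≤ I q → (1 ≤ S j → p₀ ≡ q → ⊥) → First j p₀ p₁ so eo as
    stay-token {p₀} {p₁} {so} {eo} {as} A down tj Ix Iq ban = stay A
      (λ _ p → ⊥-elim (≥1⇒≢0 p (trans (cong I down) Ix)))
      (λ o → ⊥-elim (x-off A (subst (On p₀ as) down o)))
      (λ _ _ e s → ban s (trans (sym e) tj))
      (λ p → below A (λ { (e , _) → x≢p₀ A (trans (sym down) e) }) (enter p))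
      (λ { _ r (e , _) → ends-here r (trans (sym e) tj) })
      (λ _ e → ⊥-elim (x≢p₁ A (trans (sym down) e)))
      (λ z e → ⊥-elim (≥1⇒≢0 Iq (trans (cong I (trans (sym tj) e)) (last-unoccupied A z))))
      where
      open First A
      ends-here : 1 ≤ so ⊎ as ≢ [] → p₁ ≡ q → ⊥
      ends-here r e with alone (on-p₁ A) (subst (λ v → 1 ≤ I v) (sym e) Iq) | zero⊎pos so
      ... | e′ | inj₂ p = ≥1⇒≢0 Iq (trans (cong I (trans (sym e) e′)) (open- p))
      ... | e′ | inj₁ z with r
      ...   | inj₁ p = ≥1⇒≢0 p z
      ...   | inj₂ ne = last-≢ {R = _≢ p₀} path ne simple e′

    -- A token on `q` excludes an open start, and a nonempty path with a closed start has no S-label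
    -- of its start still to come. So the path is the single vertex `q`.
    grow-token : ∀ {p₀ p₁ so eo as} → First (suc j) p₀ p₁ so eo as → hd j ≡ x → tl j ≡ q →
      I x ≡ 0 → 1 ≤ I q → 1 ≤ S j → p₀ ≡ q → p₁ ≡ q × First j p₀ x so (OUT x) (as ∷ʳ j)
    grow-token {p₀} {p₁} {so} {eo} {as} A down tj Ix Iq s p₀≡q with zero⊎pos so
    ... | inj₂ p = ⊥-elim (≥1⇒≢0 Iq (trans (cong I (sym p₀≡q)) (First.open- A p)))
    ... | inj₁ z with First.first A z
    ...   | inj₂ (_ , f) = ⊥-elim (f (n<1+n j) (trans tj (sym p₀≡q)) s)
    ...   | inj₁ (refl , eo≥1 , i , i< , e , s′ , f) with First.path A
    ...     | [] with S-tail (<-≤-trans i< j<) j< s′ s (trans e (trans p₀≡q (sym tj)))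
    ...       | refl = p₀≡q , grow-back A down (trans p₀≡q (sym tj)) eo≥1 ej Ix leaves (λ _ _ → s)
                (λ i< e s′ p f′ → <⇒≢ i< (S-head (<-trans i< j<) j< s′ s p Ij f′ f (trans e (sym down))))
      where
      Ij = subst (λ v → 1 ≤ I v) (sym tj) Iq
      ej = labelled-enterable j< s Ij f
      leaves : OUT x ≡ 0 → OUT (tl j) ≤ 1
      leaves z with dead-end j< f (trans (cong OUT down) z)
      ... | τ , F≤1 , _ = proj₂ (both j< s Ij τ (≤-antisym F≤1 f))

    -- A unit enters `x` from below, and it is not reserved: if it is the only one there and `x` is
    -- final, then the T-label of `x` lies on `j`.
    Spare : Set
    Spare = 1 ≤ IN x ∸ F j × (IN x ∸ F j ≤ 1 → 1 ≤ J x → 1 ≤ T j × 1 ≤ F j)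

    IN∸F : I x ≡ 0 → IN x ≡ J x + OUT x
    IN∸F Ix = trans (cong (_+ IN x) (sym Ix)) (law (X<n j<))

    stay-down : ∀ {p₀ p₁ so eo as} → First (suc j) p₀ p₁ so eo as → hd j ≡ x → tl j ≡ q →
      I x ≡ 0 → I q ≡ 0 → (1 ≤ OUT x → Spare → ⊥) →
      (1 ≤ eo → p₁ ≡ q → 1 ≤ F j → (OUT x ≡ 0 → OUT q ≤ 1) → ⊥) → First j p₀ p₁ so eo as
    stay-down {p₀} {p₁} {so} {eo} {as} A down tj Ix Iq nospare ban = stay A
      (λ _ p → ⊥-elim (≥1⇒≢0 p (trans (cong I down) Ix)))
      (λ o → ⊥-elim (x-off A (subst (On p₀ as) down o)))
      (λ z _ e _ → ≥1⇒≢0 (closed z) (trans (cong I (trans (sym e) tj)) Iq))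
      (λ p → below A (λ { (e , _) → x≢p₀ A (trans (sym down) e) }) (enter p))
      (λ { p _ (e , f , g) → ban p (trans (sym e) tj) f
             (λ z → subst (λ v → OUT v ≤ 1) tj (g (trans (cong OUT down) z))) })
      (λ _ e → ⊥-elim (x≢p₁ A (trans (sym down) e)))
      (λ z e → trans (cong OUT down) (idle z (trans (sym e) tj)))
      where
      open First A
      -- Nothing leaves the closed end `q`, so outflow of `x` would have to be supplied from below,
      -- by a spare unit.
      idle : eo ≡ 0 → p₁ ≡ q → OUT x ≡ 0
      idle z e with zero⊎pos (OUT x)
      ... | inj₁ r = r
      ... | inj₂ o = ⊥-elim (nospare o (subst (λ f → 1 ≤ IN x ∸ f) (sym F≡0) 1≤IN ,
              λ _ p → ⊥-elim (≥1⇒≢0 p (idle-side J≥1))))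
        where
        J≥1 : 1 ≤ J q
        J≥1 = subst (λ v → 1 ≤ J v) e (proj₂ (proj₂ (last z)))
        F≡0 : F j ≡ 0
        F≡0 = n≤0⇒n≡0 (≤-trans (F≤OUT j< (trans tj (sym e))) (≤-reflexive (proj₁ (last z))))
        1≤IN : 1 ≤ IN x
        1≤IN = ≤-trans o (≤-trans (m≤n+m (OUT x) (J x)) (≤-reflexive (sym (IN∸F Ix))))

    -- The absence of a spare unit is what makes `j` enterable and rules out that the first entry
    -- into `x` is claimed by an arc from below.
    grow-down : ∀ {p₀ p₁ so eo as} → First (suc j) p₀ p₁ so eo as → hd j ≡ x → tl j ≡ q →
      I x ≡ 0 → I q ≡ 0 → (1 ≤ OUT x → Spare → ⊥) →
      1 ≤ eo → p₁ ≡ q → 1 ≤ F j → (OUT x ≡ 0 → OUT q ≤ 1) → First j p₀ x so (OUT x) (as ∷ʳ j)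
    grow-down {p₀} {p₁} {so} {eo} {as} A down tj Ix Iq nospare eo≥1 p₁≡q f leaves =
      grow-back A down (trans p₁≡q (sym tj)) eo≥1 (f , enters-x) Ix
        (λ z → subst (λ v → OUT v ≤ 1) (sym tj) (leaves z))
        (λ z e → ⊥-elim (closed-here z e))
        unclaimed
      where
      open First A
      p₀≡p₁ : ∀ {p₀ p₁} → Path p₀ as p₁ → as ≡ [] → p₀ ≡ p₁
      p₀≡p₁ [] _ = refl
      closed-here : so ≡ 0 → as ≡ [] → ⊥
      closed-here z e = ≥1⇒≢0 (closed z) (trans (cong I (trans (p₀≡p₁ path e) p₁≡q)) Iq)
      crowded : 1 ≤ IN x ∸ F j → OUT x ≡ 0 → ⊥
      crowded p z = 1+n≰n (≤-trans (+-mono-≤ p f) (≤-trans (≤-reflexive (m∸n+n≡m (F≤IN j< down)))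
        (≤-trans (≤-reflexive (trans (IN∸F Ix) (trans (cong (J x +_) z) (+-identityʳ _)))) (J≤1 x))))
      exact : (1 ≤ J x → 1 ≤ T j) → IN x ∸ F j ≤ 0
      exact τ with zero⊎pos (IN x ∸ F j) | zero⊎pos (OUT x)
      ... | inj₁ z | _ = ≤-reflexive z
      ... | inj₂ p | inj₁ z = ⊥-elim (crowded p z)
      ... | inj₂ p | inj₂ o = ⊥-elim (nospare o (p , λ _ q → τ q , f))
      enters-x : 1 ≤ T j → 2 ≤ F j ⊎ IN (hd j) ≤ 1
      enters-x τ with 2 ≤? F j
      ... | yes r = inj₁ r
      ... | no ¬r = inj₂ (≤-trans (≤-reflexive (cong IN down)) (≤-trans (m≤n+m∸n (IN x) (F j))
              (+-mono-≤ (≤-pred (≰⇒> ¬r)) (exact (λ _ → τ)))))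
      unclaimed : ∀ {i} → i < j → hd i ≡ x → 1 ≤ S i → 1 ≤ I (tl i) → 1 ≤ F i → ⊥
      unclaimed {i} i< e s p f′ with zero⊎pos (OUT x)
      ... | inj₁ z = crowded spare z
        where
        spare : 1 ≤ IN x ∸ F j
        spare = ≤-trans f′ (≤-trans (≤-reflexive (sym (m+n∸n≡m (F i) (F j))))
          (∸-monoˡ-≤ (F j) (FF≤IN (<-trans i< j<) j< (<⇒≢ i<) e down)))
      ... | inj₂ o = nospare o (≤-trans f′ spare , λ le J≥1 → τ le J≥1 , f)
        where
        i<m : i < m
        i<m = <-trans i< j<
        spare : F i ≤ IN x ∸ F j
        spare = ≤-trans (≤-reflexive (sym (m+n∸n≡m (F i) (F j))))
          (∸-monoˡ-≤ (F j) (FF≤IN i<m j< (<⇒≢ i<) e down))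
        -- The T-label of `x` is on `j`: on `i`, `both` would admit a single unit into `x` although
        -- `i` and `j` carry two; on a third arc, two units would come from below.
        τ : IN x ∸ F j ≤ 1 → 1 ≤ J x → 1 ≤ T j
        τ le J≥1 with T-any (X<n j<) J≥1 (≤-trans f (F≤IN j< down))
        ... | i′ , i′< , e′ , τ′ , f″ with i′ ≟ j
        ...   | yes refl = τ′
        ...   | no ne with i′ ≟ i
        ...     | yes refl = ⊥-elim (1+n≰n (≤-trans (+-mono-≤ f′ f) (≤-trans (FF≤IN i<m j< (<⇒≢ i<) e down)
                    (subst (λ v → IN v ≤ 1) e (proj₁ (both i<m s p τ′ (≤-antisym (≤-trans spare le) f′)))))))
        ...     | no ne′ = ⊥-elim (1+n≰n (≤-trans (≤-trans (+-mono-≤ f′ f″) three) le))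
          where
          three : F i + F i′ ≤ IN x ∸ F j
          three = +-cancelʳ-≤ (F j) _ _ (≤-trans (three-flows i<m i′< j< (≢-sym ne′) (<⇒≢ i<) ne e e′ down)
            (≤-reflexive (sym (m∸n+n≡m (F≤IN j< down)))))
            where
            three-flows : ∀ {a b c v} → a < m → b < m → c < m → a ≢ b → a ≢ c → b ≢ c →
              hd a ≡ v → hd b ≡ v → hd c ≡ v → F a + F b + F c ≤ IN v
            three-flows {a} {b} {c} {v} a< b< c< ab ac bc refl e₂ e₃ = begin
              F a + F b + F c ≡⟨ cong₂ (λ y z → y + z + F c) (sym (zeroed ac)) (sym (zeroed bc)) ⟩
              update F c 0 a + update F c 0 b + F c ≤⟨ +-monoˡ-≤ (F c) (≤flow₂ m {hd} {update F c 0} a< b< ab refl e₂) ⟩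
              flow m hd (update F c 0) (hd a) + F c ≡⟨ cong (flow m hd (update F c 0) (hd a) +_) (sym (pick-same (F c) e₃)) ⟩
              flow m hd (update F c 0) (hd a) + pick (hd c) (hd a) (F c) ≡⟨ flow-update {h = hd} F (hd a) 0 c< ⟩
              flow m hd F (hd a) + pick (hd c) (hd a) 0 ≤⟨ +-monoʳ-≤ (flow m hd F (hd a)) (pick-≤ (hd c) (hd a) 0) ⟩
              flow m hd F (hd a) + 0 ≡⟨ trans (+-identityʳ _) (sym (IN-sum (hd<n a<))) ⟩
              IN (hd a) ∎
              where
              open ≤-Reasoning
              zeroed : ∀ {i} → i ≢ c → update F c 0 i ≡ F i
              zeroed {i} ne = update-other F c i ne

    Claimed : ℕ → Set
    Claimed v = ∃[ i ] i < m × hd i ≡ v × 1 ≤ S i × 1 ≤ I (tl i)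

    -- If the start relied on `j` for its entry, a substitute is needed. A claimed arc is one; and
    -- if `j` is a T-arc with a single unit among several into `q`, it was not enterable in the
    -- first place.
    stay-up : ∀ {p₀ p₁ so eo as} → First (suc j) p₀ p₁ so eo as → tl j ≡ x → hd j ≡ q → I x ≡ 0 →
      (eo ≡ 0 → p₁ ≡ q → OUT x ≤ F j) →
      (1 ≤ so → p₀ ≡ q → 1 ≤ F j → Claimed q ⊎ (1 ≤ T j × F j ≤ 1 × 2 ≤ IN q)) → First j p₀ p₁ so eo as
    stay-up {p₀} {p₁} {so} {eo} {as} A up hj Ix few ban = stay A
      (λ o → ⊥-elim (x-off A (subst (On p₀ as) up o)))
      (λ _ p → ⊥-elim (≥1⇒≢0 p (trans (cong I up) Ix)))
      (λ _ _ e _ → x≢p₀ A (trans (sym up) e))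
      enter′
      (λ { _ _ (e , _) → x≢p₁ A (trans (sym up) e) })
      (λ z e → subst (λ v → OUT v ≤ F j) (sym up) (few z (trans (sym e) hj)))
      (λ _ e → ⊥-elim (x≢p₁ A (trans (sym up) e)))
      where
      open First A
      enter′ : 1 ≤ so → ∃[ i ] i < j × hd i ≡ p₀ × Enterable i
      enter′ p with enter p
      ... | i , i< , e , f , g with m≤n⇒m<n∨m≡n (≤-pred i<)
      ...   | inj₁ lt = i , lt , e , f , g
      ...   | inj₂ refl with ban p (trans (sym e) hj) f
      ...     | inj₂ (τ , F≤1 , IN≥2) with g τ
      ...       | inj₁ F≥2 = ⊥-elim (1+n≰n (≤-trans F≥2 F≤1))
      ...       | inj₂ IN≤1 = ⊥-elim (1+n≰n (≤-trans IN≥2 (subst (λ v → IN v ≤ 1) hj IN≤1)))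
      enter′ p | i , i< , e , f , g | inj₂ refl | inj₁ (c , c< , ec , s , pc) = c , c<j , ec′ , labelled-enterable c< s pc Fc
        where
        ec′ : hd c ≡ p₀
        ec′ = trans ec (trans (sym hj) e)
        c<j : c < j
        c<j with <-cmp c j
        ... | tri< lt _ _ = lt
        ... | tri≈ _ refl _ = ⊥-elim (≥1⇒≢0 pc (trans (cong I up) Ix))
        ... | tri> _ _ gt = ⊥-elim (tl≢hd c< (trans (alone-t gt c< (inj₁ ec′) pc) (sym ec′)))
        -- Without flow on `c`, the token at its tail would never move and `q` would be idle.
        Fc : 1 ≤ F c
        Fc with zero⊎pos (OUT (tl c))
        ... | inj₂ o = labelled-flow c< s pc o
        ... | inj₁ z = ⊥-elim (on-active A (inj₁ refl) (subst (λ v → IN v + OUT v ≡ 0) ec′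
                (still-h c< pc J≥1 IN≡0)))
          where
          bal : I (tl c) + IN (tl c) ≡ J (tl c)
          bal = trans (law (tl<n c<)) (trans (cong (J (tl c) +_) z) (+-identityʳ _))
          J≥1 : 1 ≤ J (tl c)
          J≥1 = ≤-trans (≤-trans pc (m≤m+n _ _)) (≤-reflexive bal)
          IN≡0 : IN (tl c) ≡ 0
          IN≡0 = n≤0⇒n≡0 (+-cancelˡ-≤ 1 _ _ (≤-trans (+-monoˡ-≤ _ pc) (≤-trans (≤-reflexive bal) (J≤1 _))))

    grow-up : ∀ {p₀ p₁ so eo as} → First (suc j) p₀ p₁ so eo as → tl j ≡ x → hd j ≡ q → I x ≡ 0 →
      (eo ≡ 0 → p₁ ≡ q → OUT x ≤ F j) →
      1 ≤ so → p₀ ≡ q → 1 ≤ F j → (Claimed q → ⊥) → (1 ≤ T j → F j ≤ 1 → IN q ≤ 1) →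
      First j x p₁ so eo (j ∷ as)
    grow-up {eo = eo} A up hj Ix few so≥1 p₀≡q f unclaimed g = grow-front A up (trans p₀≡q (sym hj)) so≥1 (f , enters-q)
      (λ z → ⊥-elim (≥1⇒≢0 so≥1 z)) (λ _ → Ix , ≤-trans f (F≤OUT j< up))
      (λ z e → few z (trans (sym e) hj))
      (λ i< e s p _ → unclaimed (_ , <-trans i< j< , trans e hj , s , p))
      where
      enters-q : 1 ≤ T j → 2 ≤ F j ⊎ IN (hd j) ≤ 1
      enters-q τ with 2 ≤? F j
      ... | yes r = inj₁ r
      ... | no ¬r = inj₂ (subst (λ v → IN v ≤ 1) (sym hj) (g τ (≤-pred (≰⇒> ¬r))))

-- The start of the path, and the plan after a run

-- Summed over all vertices this gives the number of tokens still to move, which limits the number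
-- of rounds.
movable : (I OUT : ℕ → ℕ) → ℕ → ℕ
movable I OUT v = branch (I v) 0 (branch (OUT v) 0 1)

movable≤1 : ∀ I OUT v → movable I OUT v ≤ 1
movable≤1 I OUT v with I v | OUT v
... | zero  | _     = z≤n
... | suc _ | zero  = z≤n
... | suc _ | suc _ = ≤-refl

module Roots {n m X Q D I J F IN OUT S T} (O : Order n m X Q)
  (P : Plan n m (tail-of X Q D) (head-of X Q D) I J F IN OUT S T) where
  open Order O
  open Ends-of O D
  open Plan P
  open Cases O P public

  -- The path is still to begin.
  Idle : ℕ → Set
  Idle k = ∀ {i} → k ≤ i → i < m → IN (Q i) + OUT (Q i) ≡ 0

  idle-step : ∀ {j} → IN (Q j) + OUT (Q j) ≡ 0 → Idle (suc j) → Idle j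
  idle-step e a b with m≤n⇒m<n∨m≡n b
  ... | inj₁ lt = a lt
  ... | inj₂ refl = λ _ → e

  idle-F : ∀ {k} → Idle k → ∀ {i} → k ≤ i → i < m → F i ≡ 0
  idle-F a {i} k≤ i< with zero⊎pos (F i)
  ... | inj₁ z = z
  ... | inj₂ f = ⊥-elim go
    where
    go : ⊥
    go with a k≤ i< | F≤IN i< refl | F≤OUT i< refl
    ... | z | p | r with D i
    ...   | zero  = ≥1⇒≢0 (≤-trans f r) (m+n≡0⇒n≡0 (IN _) z)
    ...   | suc _ = ≥1⇒≢0 (≤-trans f p) (m+n≡0⇒m≡0 _ z)

  module Root {j} (j< : j < m) (a : Idle (suc j)) (busy : 1 ≤ IN (Q j) + OUT (Q j)) where
    q = Q j

    q-born : ∀ {i} → i < suc j → X i ≢ q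
    q-born i< with m≤n⇒m<n∨m≡n (≤-pred i<)
    ... | inj₁ lt = X≢Q> lt j<
    ... | inj₂ refl = X≢Q j<

    -- The parent of arc `i` is idle and `q` is busy, so `q` is the child and the other end is the
    -- parent.
    other-h : ∀ {i} → suc j ≤ i → i < m → tl i ≡ q → IN (hd i) + OUT (hd i) ≡ 0
    other-h {i} k≤ i< e with a k≤ i<
    ... | z with D i
    ...   | suc _ = z
    ...   | zero  = ⊥-elim (≥1⇒≢0 busy (trans (cong (λ v → IN v + OUT v) (sym e)) z))

    other-t : ∀ {i} → suc j ≤ i → i < m → hd i ≡ q → IN (tl i) + OUT (tl i) ≡ 0
    other-t {i} k≤ i< e with a k≤ i<
    ... | z with D i
    ...   | zero  = z
    ...   | suc _ = ⊥-elim (≥1⇒≢0 busy (trans (cong (λ v → IN v + OUT v) (sym e)) z))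

    settled : ∀ {v} → v < n → 1 ≤ I v → IN v + OUT v ≡ 0 → 1 ≤ J v
    settled {v} v< p z = ≤-trans p (≤-trans (m≤m+n _ _) (≤-reflexive
      (trans (law v<) (trans (cong (J v +_) (m+n≡0⇒n≡0 (IN v) z)) (+-identityʳ _)))))

    alone-h′ : ∀ {i} → suc j ≤ i → i < m → tl i ≡ q → 1 ≤ I (hd i) → ⊥
    alone-h′ {i} k≤ i< e p = ≥1⇒≢0 busy (trans (cong (λ v → IN v + OUT v) (sym e))
      (still-t i< p (settled (hd<n i<) p z) (m+n≡0⇒m≡0 _ z)))
      where z = other-h k≤ i< e

    alone-t′ : ∀ {i} → suc j ≤ i → i < m → hd i ≡ q → 1 ≤ I (tl i) → ⊥
    alone-t′ {i} k≤ i< e p = ≥1⇒≢0 busy (trans (cong (λ v → IN v + OUT v) (sym e))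
      (still-h i< p (settled (tl<n i<) p z) (m+n≡0⇒m≡0 _ z)))
      where z = other-t k≤ i< e

    -- The arcs after `j` have idle parents and carry nothing.
    all-flow : ∀ h → flow (suc j) h F q ≡ flow m h F q
    all-flow h = sym (sum-truncate m j< (λ {i} k≤ i< → n≤0⇒n≡0
      (≤-trans (pick-≤ (h i) q (F i)) (≤-reflexive (idle-F a k≤ i<)))))

    OUT-flow : flow (suc j) tl F q ≡ OUT q
    OUT-flow = trans (all-flow tl) (sym (OUT-sum (Q<n j<)))

    root-closed : ∀ {so} → so ≡ 0 → 1 ≤ I q → First (suc j) q q so (OUT q) []
    root-closed so≡0 p = single-closed j< (Q<n j<) q-born alone-h′ alone-t′ so≡0 ox p witness
      where
      ox : 1 ≤ OUT q
      ox with zero⊎pos (OUT q)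
      ... | inj₂ o = o
      ... | inj₁ z = ⊥-elim (1+n≰n (≤-trans (+-mono-≤ p (≤-trans busy (≤-reflexive (trans (cong (IN q +_) z) (+-identityʳ _)))))
              (≤-trans (≤-reflexive (trans (law (Q<n j<)) (trans (cong (J q +_) z) (+-identityʳ _)))) (J≤1 q))))
      witness : ∃[ i ] i < suc j × tl i ≡ q × 1 ≤ S i × 1 ≤ F i
      witness with S-any (Q<n j<) p ox
      ... | i , i< , e , s , f with i <? suc j
      ...   | yes lt = i , lt , e , s , f
      ...   | no ge = ⊥-elim (≥1⇒≢0 f (idle-F a (≮⇒≥ ge) i<))

    root-open : ∀ {so} → 1 ≤ so → I q ≡ 0 → First (suc j) q q so (OUT q) []
    root-open so≥1 z = single-open j< (Q<n j<) q-born alone-h′ alone-t′ so≥1 z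
      (enter-any j< (trans (all-flow hd) (sym (IN-sum (Q<n j<)))) IN≥1)
      (leave-any j< (Q<n j<) OUT-flow)
      (λ o → o , ≤-trans (≤-reflexive (IN≡J o)) (J≤1 q) , ≤-trans IN≥1 (≤-reflexive (IN≡J o)))
      (λ o k≤ i< e → ≤-trans (≤-reflexive (m+n≡0⇒n≡0 (IN _) (other-t k≤ i< e))) z≤n)
      (λ o k≤ i< e → m+n≡0⇒n≡0 (IN _) (other-h k≤ i< e))
      where
      bal : IN q ≡ J q + OUT q
      bal = trans (cong (_+ IN q) (sym z)) (law (Q<n j<))
      IN≡J : OUT q ≡ 0 → IN q ≡ J q
      IN≡J o = trans bal (trans (cong (J q +_) o) (+-identityʳ _))
      IN≥1 : 1 ≤ IN q
      IN≥1 with zero⊎pos (IN q)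
      ... | inj₂ p = p
      ... | inj₁ e = ⊥-elim (≥1⇒≢0 busy (trans (cong (_+ OUT q) e)
              (m+n≡0⇒n≡0 (J q) (trans (sym bal) e))))

  module Along {p₀ p₁ so eo as} (A : First 0 p₀ p₁ so eo as) where
    open First A

    -- An open start would promise an arc with an index below 0. The same argument closes the other
    -- end and excludes the empty path.
    so≡0 : so ≡ 0
    so≡0 with zero⊎pos so
    ... | inj₁ z = z
    ... | inj₂ p with enter p
    ...   | _ , () , _

    as≢[] : as ≢ []
    as≢[] with first so≡0
    ... | inj₁ (_ , _ , _ , () , _)
    ... | inj₂ (ne , _) = ne

    eo≡0 : eo ≡ 0
    eo≡0 with zero⊎pos eo
    ... | inj₁ z = z
    ... | inj₂ p with leave p (inj₂ as≢[])
    ...   | _ , () , _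

    p₁≢p₀ : p₁ ≢ p₀
    p₁≢p₀ = last-≢ {R = _≢ p₀} path as≢[] simple

    OUT≡0 : OUT p₁ ≡ 0
    OUT≡0 = proj₁ (last eo≡0)

    tl-on : ∀ {i} → Any (i ≡_) as → On p₀ as (tl i)
    tl-on o = go o (on-tail path)
      where
      go : ∀ {i bs} → Any (i ≡_) bs → All (λ i → On p₀ as (tl i)) bs → On p₀ as (tl i)
      go (here refl) (p ∷ _) = p
      go (there o) (_ ∷ ps) = go o ps

    hd-on : ∀ {i} → Any (i ≡_) as → On p₀ as (hd i)
    hd-on o = go o on-head
      where
      go : ∀ {i bs} → Any (i ≡_) bs → All (λ i → On p₀ as (hd i)) bs → On p₀ as (hd i)
      go (here refl) (p ∷ _) = p
      go (there o) (_ ∷ ps) = go o ps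

    enters-on : ∀ {i} → Any (i ≡_) as → Enterable i
    enters-on o = go o enters
      where
      go : ∀ {i bs} → Any (i ≡_) bs → All Enterable bs → Enterable i
      go (here refl) (p ∷ _) = p
      go (there o) (_ ∷ ps) = go o ps

    last-arc : ∃[ i ] Any (i ≡_) as × i < m × hd i ≡ p₁
    last-arc = go path added as≢[]
      where
      go : ∀ {u bs w} → Path u bs w → All (λ i → 0 ≤ i × i < m) bs → bs ≢ [] → ∃[ i ] Any (i ≡_) bs × i < m × hd i ≡ w
      go [] _ ne = ⊥-elim (ne refl)
      go (_ ∷ []) ((_ , i<) ∷ _) _ = _ , here refl , i< , refl
      go (_ ∷ p@(_ ∷ _)) (_ ∷ ps) _ with go p ps (λ ())
      ... | i , o , r = i , there o , r

    module After {I′ F′ IN′ OUT′ : ℕ → ℕ}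
      (source : I′ p₀ ≡ 0) (dest : I′ p₁ ≡ 1) (same : ∀ v → v ≢ p₀ → v ≢ p₁ → I′ v ≡ I v)
      (used : ∀ {i} → Any (i ≡_) as → F i ≡ suc (F′ i))
      (unused : ∀ {i} → i < m → (Any (i ≡_) as → ⊥) → F i ≡ F′ i)
      (law′ : ∀ {v} → v < n → I′ v + IN′ v ≡ J v + OUT′ v)
      (IN-sum′ : ∀ {v} → v < n → IN′ v ≡ flow m hd F′ v)
      (OUT-sum′ : ∀ {v} → v < n → OUT′ v ≡ flow m tl F′ v) where

      onPath? : ∀ i → Any (i ≡_) as ⊎ (Any (i ≡_) as → ⊥)
      onPath? i with Any.any? (i ≟_) as
      ... | yes o = inj₁ o
      ... | no ¬o = inj₂ ¬o

      F′≤F : ∀ {i} → i < m → F′ i ≤ F i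
      F′≤F {i} i< with onPath? i
      ... | inj₁ o = ≤-trans (n≤1+n _) (≤-reflexive (sym (used o)))
      ... | inj₂ ¬o = ≤-reflexive (sym (unused i< ¬o))

      pick-mono : ∀ a v {x y} → x ≤ y → pick a v x ≤ pick a v y
      pick-mono a v p with a ≡ᵇ v
      ... | true  = p
      ... | false = z≤n

      flow-≤ : ∀ h v → flow m h F′ v ≤ flow m h F v
      flow-≤ h v = sum-mono m (λ {i} i< → pick-mono (h i) v (F′≤F i<))

      flow-< : ∀ h {i v} → i < m → Any (i ≡_) as → h i ≡ v → flow m h F′ v < flow m h F v
      flow-< h {i} {v} i< o e = sum-mono-< m (λ {i} i< → pick-mono (h i) v (F′≤F i<)) i<
        (≤-trans (s≤s (≤-reflexive (pick-same (F′ i) e))) (≤-reflexive (trans (sym (used o)) (sym (pick-same (F i) e)))))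

      IN≥ : ∀ {v} → v < n → IN′ v ≤ IN v
      IN≥ {v} v< = ≤-trans (≤-reflexive (IN-sum′ v<)) (≤-trans (flow-≤ hd v) (≤-reflexive (sym (IN-sum v<))))

      OUT≥ : ∀ {v} → v < n → OUT′ v ≤ OUT v
      OUT≥ {v} v< = ≤-trans (≤-reflexive (OUT-sum′ v<)) (≤-trans (flow-≤ tl v) (≤-reflexive (sym (OUT-sum v<))))

      IN> : ∀ {i v} → i < m → Any (i ≡_) as → hd i ≡ v → IN′ v < IN v
      IN> i< o refl = ≤-trans (s≤s (≤-reflexive (IN-sum′ (hd<n i<)))) (≤-trans (flow-< hd i< o refl) (≤-reflexive (sym (IN-sum (hd<n i<)))))

      OUT> : ∀ {i v} → i < m → Any (i ≡_) as → tl i ≡ v → OUT′ v < OUT v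
      OUT> i< o refl = ≤-trans (s≤s (≤-reflexive (OUT-sum′ (tl<n i<)))) (≤-trans (flow-< tl i< o refl) (≤-reflexive (sym (OUT-sum (tl<n i<)))))

      F′≤OUT′ : ∀ {i} → i < m → F′ i ≤ OUT′ (tl i)
      F′≤OUT′ i< = ≤-trans (≤flow m {tl} {F′} i< refl) (≤-reflexive (sym (OUT-sum′ (tl<n i<))))

      p₁<n : p₁ < n
      p₁<n = on<n (on-last path)

      OUT′≡0 : OUT′ p₁ ≡ 0
      OUT′≡0 = n≤0⇒n≡0 (≤-trans (OUT≥ p₁<n) (≤-reflexive OUT≡0))

      data Token (v : ℕ) : Set where
        arrived : v ≡ p₁ → Token v
        resting : v ≢ p₁ → 1 ≤ I v → (On p₀ as v → ⊥) → Token v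

      token : ∀ {v} → 1 ≤ I′ v → Token v
      token {v} p with v ≟ p₁
      ... | yes e = arrived e
      ... | no ne with v ≟ p₀
      ...   | yes refl = ⊥-elim (≥1⇒≢0 p source)
      ...   | no ne′ = resting ne p′ (λ o → ne′ (alone o p′))
        where
        p′ : 1 ≤ I v
        p′ = subst (1 ≤_) (same v ne′ ne) p

      -- The token that has arrived has no outflow; a token with outflow is thus one that the run
      -- did not touch.
      leaving : ∀ {v} → v < n → 1 ≤ I′ v → 1 ≤ OUT′ v → 1 ≤ I v × (On p₀ as v → ⊥)
      leaving v< p o with token p
      ... | arrived refl = ⊥-elim (≥1⇒≢0 o OUT′≡0)
      ... | resting _ p′ no′ = p′ , no′

      off-unused : ∀ {i} → (On p₀ as (tl i) → ⊥) → Any (i ≡_) as → ⊥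
      off-unused f o = f (tl-on o)

      I′-free : ∀ {i} → i < m → 1 ≤ I′ (tl i) → 1 ≤ I′ (hd i) → ⊥
      I′-free i< p r with token p | token r
      ... | arrived e | arrived e′ = tl≢hd i< (trans e (sym e′))
      ... | arrived e | resting _ r′ no′ = no′ (inj₁ (alone-h z≤n i< (subst (On p₀ as) (sym e) (on-last path)) r′))
      ... | resting _ p′ no′ | arrived e = no′ (inj₁ (alone-t z≤n i< (subst (On p₀ as) (sym e) (on-last path)) p′))
      ... | resting _ p′ _ | resting _ r′ _ = I-free i< p′ r′

      quiet : ∀ {v} → v < n → OUT′ v ≡ 0 → J v ≡ 0 → IN′ v + OUT′ v ≡ 0
      quiet {v} v< o z = cong₂ _+_ (m+n≡0⇒n≡0 (I′ v) (trans (law′ v<) (cong₂ _+_ z o))) o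

      idle-J : ∀ {i} → i < m → hd i ≡ p₁ → J (tl i) ≡ 0
      idle-J {i} i< e with zero⊎pos (J (tl i))
      ... | inj₁ z = z
      ... | inj₂ p = ⊥-elim (J-free i< p (subst (λ v → 1 ≤ J v) (sym e) (proj₂ (proj₂ (last eo≡0)))))

      idle-J′ : ∀ {i} → i < m → tl i ≡ p₁ → J (hd i) ≡ 0
      idle-J′ {i} i< e with zero⊎pos (J (hd i))
      ... | inj₁ z = z
      ... | inj₂ p = ⊥-elim (J-free i< (subst (λ v → 1 ≤ J v) (sym e) (proj₂ (proj₂ (last eo≡0)))) p)

      IN-kept : ∀ {v} → v < n → (On p₀ as v → ⊥) → IN v ≡ IN′ v
      IN-kept {v} v< ¬o = trans (IN-sum v<) (trans (sum-cong m eq) (sym (IN-sum′ v<)))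
        where
        eq : ∀ {i} → i < m → pick (hd i) v (F i) ≡ pick (hd i) v (F′ i)
        eq {i} i< with hd i ≟ v
        ... | no ne = trans (pick-other (F i) ne) (sym (pick-other (F′ i) ne))
        ... | yes e = cong (pick (hd i) v) (unused i< (λ o → ¬o (subst (On p₀ as) e (hd-on o))))

      -- The matchings are kept unchanged. Labels merely go stale as their arcs run out of flow or
      -- their tails lose the token.
      plan′ : Plan n m tl hd I′ J F′ IN′ OUT′ S T
      plan′ = record
        { I≤1 = I′≤1 ; J≤1 = J≤1 ; I-free = I′-free ; J-free = J-free ; law = law′ ; IN-sum = IN-sum′ ; OUT-sum = OUT-sum′
        ; S-head = λ i< j< s s′ p p′ f f′ → S-head i< j< s s′
            (proj₁ (leaving (tl<n i<) p (≤-trans f (F′≤OUT′ i<)))) (proj₁ (leaving (tl<n j<) p′ (≤-trans f′ (F′≤OUT′ j<))))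
            (≤-trans f (F′≤F i<)) (≤-trans f′ (F′≤F j<))
        ; S-tail = S-tail
        ; S-any = S-any′
        ; T-target = λ i< τ f → T-target i< τ (≤-trans f (F′≤F i<))
        ; T-head = λ i< j< τ τ′ f f′ → T-head i< j< τ τ′ (≤-trans f (F′≤F i<)) (≤-trans f′ (F′≤F j<))
        ; T-tail = λ i< j< τ τ′ f f′ → T-tail i< j< τ τ′ (≤-trans f (F′≤F i<)) (≤-trans f′ (F′≤F j<))
        ; T-any = T-any′
        ; both = both′ ; still-h = still-h′ ; still-t = still-t′ }
        where
        I′≤1 : ∀ v → I′ v ≤ 1
        I′≤1 v with v ≟ p₀ | v ≟ p₁
        ... | yes refl | _ = ≤-trans (≤-reflexive source) z≤n
        ... | no _ | yes refl = ≤-reflexive dest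
        ... | no a | no b = ≤-trans (≤-reflexive (same v a b)) (I≤1 v)
        S-any′ : ∀ {v} → v < n → 1 ≤ I′ v → 1 ≤ OUT′ v → ∃[ i ] i < m × tl i ≡ v × 1 ≤ S i × 1 ≤ F′ i
        S-any′ v< p o with leaving v< p o
        ... | p′ , ¬on with S-any v< p′ (≤-trans o (OUT≥ v<))
        ...   | i , i< , refl , s , f = i , i< , refl , s , subst (1 ≤_) (unused i< (off-unused ¬on)) f
        T-any′ : ∀ {v} → v < n → 1 ≤ J v → 1 ≤ IN′ v → ∃[ i ] i < m × hd i ≡ v × 1 ≤ T i × 1 ≤ F′ i
        T-any′ {v} v< p r with T-any v< p (≤-trans r (IN≥ v<))
        ... | i , i< , e , τ , f with onPath? i
        ...   | inj₂ ¬o = i , i< , e , τ , subst (1 ≤_) (unused i< ¬o) f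
        -- `Enterable` is made for this point: a T-arc on the path keeps a unit unless its head has
        -- no further inflow.
        ...   | inj₁ o with proj₂ (enters-on o) τ
        ...     | inj₁ F≥2 = i , i< , e , τ , ≤-pred (≤-trans F≥2 (≤-reflexive (used o)))
        ...     | inj₂ IN≤1 = ⊥-elim (1+n≰n (≤-trans (s≤s r) (≤-trans (IN> i< o e) (subst (λ v → IN v ≤ 1) e IN≤1))))
        both′ : ∀ {i} → i < m → 1 ≤ S i → 1 ≤ I′ (tl i) → 1 ≤ T i → F′ i ≡ 1 → IN′ (hd i) ≤ 1 × OUT′ (tl i) ≤ 1
        both′ i< s p τ e with leaving (tl<n i<) p (≤-trans (≤-reflexive (sym e)) (F′≤OUT′ i<))
        ... | p′ , ¬on with both i< s p′ τ (trans (unused i< (off-unused ¬on)) e)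
        ...   | a , b = ≤-trans (IN≥ (hd<n i<)) a , ≤-trans (OUT≥ (tl<n i<)) b
        still-h′ : ∀ {i} → i < m → 1 ≤ I′ (tl i) → 1 ≤ J (tl i) → IN′ (tl i) ≡ 0 → IN′ (hd i) + OUT′ (hd i) ≡ 0
        still-h′ {i} i< p r e with token p
        ... | arrived e′ = quiet (hd<n i<) (n≤0⇒n≡0 (≤-trans (OUT≥ (hd<n i<)) (≤-reflexive (last-t eo≡0 z≤n i< e′)))) (idle-J′ i< e′)
        ... | resting _ p′ ¬on = n≤0⇒n≡0 (≤-trans (+-mono-≤ (IN≥ (hd<n i<)) (OUT≥ (hd<n i<)))
                (≤-reflexive (still-h i< p′ r (trans (IN-kept (tl<n i<) ¬on) e))))
        still-t′ : ∀ {i} → i < m → 1 ≤ I′ (hd i) → 1 ≤ J (hd i) → IN′ (hd i) ≡ 0 → IN′ (tl i) + OUT′ (tl i) ≡ 0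
        still-t′ {i} i< p r e with token p
        ... | resting _ p′ ¬on = n≤0⇒n≡0 (≤-trans (+-mono-≤ (IN≥ (tl<n i<)) (OUT≥ (tl<n i<)))
                (≤-reflexive (still-t i< p′ r (trans (IN-kept (hd<n i<) ¬on) e))))
        ... | arrived e′ = quiet (tl<n i<) (n≤0⇒n≡0 OUT′≤0) (idle-J i< e′)
          where
          few : OUT (tl i) ≤ F i
          few = last-h eo≡0 z≤n i< e′
          OUT′≤0 : OUT′ (tl i) ≤ 0
          OUT′≤0 with onPath? i
          ... | inj₁ o = ≤-pred (≤-trans (OUT> i< o refl) (≤-trans few (≤-trans (F≤IN i< e′) (proj₁ (proj₂ (last eo≡0))))))
          -- The single unit entering `p₁` was on another arc, so `i` carries nothing and, by
          -- `last-h`, nothing leaves its tail.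
          ... | inj₂ ¬o with last-arc
          ...   | i′ , o′ , i′< , e″ = ≤-trans (OUT≥ (tl<n i<)) (≤-trans few (+-cancelʳ-≤ 1 _ 0 (≤-trans
                  (+-monoʳ-≤ (F i) (proj₁ (enters-on o′)))
                  (≤-trans (FF≤IN i< i′< (λ { refl → ¬o o′ }) e′ e″) (proj₁ (proj₂ (last eo≡0)))))))

      -- The run empties `p₀`, and at `p₁` nothing flows out; elsewhere no token is added and no
      -- outflow grows.
      fewer-movable : sum< n (movable I′ OUT′) < sum< n (movable I OUT)
      fewer-movable = sum-mono-< n (λ {v} v< → le v v<) (on<n (inj₁ refl)) lt
        where
        le : ∀ v → v < n → movable I′ OUT′ v ≤ movable I OUT v
        le v v< with zero⊎pos (I′ v) | zero⊎pos (OUT′ v)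
        ... | inj₁ z | _ rewrite z = z≤n
        ... | inj₂ p | inj₁ z with I′ v
        ...   | suc _ rewrite z = z≤n
        le v v< | inj₂ p | inj₂ o with leaving v< p o | OUT≥ v<
        ... | p′ , _ | r with I v | OUT v | p′ | ≤-trans o r
        ...   | suc _ | suc _ | _ | _ = movable≤1 I′ OUT′ v
        lt : movable I′ OUT′ p₀ < movable I OUT p₀
        lt rewrite source with first-arc path added as≢[]
          where
          first-arc : ∀ {u bs w} → Path u bs w → All (λ i → 0 ≤ i × i < m) bs → bs ≢ [] → ∃[ i ] Any (i ≡_) bs × i < m × tl i ≡ u
          first-arc [] _ ne = ⊥-elim (ne refl)
          first-arc (e ∷ _) ((_ , i<) ∷ _) _ = _ , here refl , i< , e
        ... | i , o , i< , e with I p₀ | OUT p₀ | closed so≡0 | OUT> i< o e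
        ...   | suc _ | suc _ | _ | _ = s≤s z≤n

-- Every nonempty forest has a leaf

lookup-injective : ∀ {A : Set} {xs : List A} → Unique xs → ∀ i j → lookup xs i ≡ lookup xs j → i ≡ j
lookup-injective (p ∷ u) fzero    fzero    e = refl
lookup-injective (p ∷ u) fzero    (fsuc j) e = ⊥-elim (All.lookup p (∈-lookup j) e)
lookup-injective (p ∷ u) (fsuc i) fzero    e = ⊥-elim (All.lookup p (∈-lookup i) (sym e))
lookup-injective (p ∷ u) (fsuc i) (fsuc j) e = cong fsuc (lookup-injective u i j e)

unique-length : ∀ {n} {xs : List (Fin n)} → Unique xs → length xs ≤ n
unique-length {xs = xs} u = Fin.injective⇒≤ {f = lookup xs} (λ {i} {j} → lookup-injective u i j)

linked-prefix : ∀ {A : Set} {R : A → A → Set} xs {w ys} → Linked R (xs ++ w ∷ ys) → Linked R (xs ∷ʳ w)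
linked-prefix []           _       = [-]
linked-prefix (x ∷ [])     (r ∷ _) = r ∷ [-]
linked-prefix (x ∷ y ∷ xs) (r ∷ l) = r ∷ linked-prefix (y ∷ xs) l

unique-prefix : ∀ {A : Set} xs {w : A} {ys} → Unique (xs ++ w ∷ ys) → Unique (w ∷ xs)
unique-prefix []       _       = [] ∷ []
unique-prefix (x ∷ xs) {w} {ys} (p ∷ u) with unique-prefix xs u
... | q ∷ r = ((λ e → All.head (All.++⁻ʳ xs p) (sym e)) ∷ q) ∷ All.++⁻ˡ xs p ∷ r

adjacent-sym : ∀ {n} {G : Digraph n} {u v} → Adjacent G u v → Adjacent G v u
adjacent-sym (inj₁ p) = inj₂ p
adjacent-sym (inj₂ p) = inj₁ p

module _ {n} {G : Digraph n} (polytree : IsPolytree G) where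
  open IsPolytree polytree

  adjacent-irreflexive : ∀ {v} → Adjacent G v v → ⊥
  adjacent-irreflexive (inj₁ p) = loopless G _ p
  adjacent-irreflexive (inj₂ p) = loopless G _ p

  -- A return to an earlier vertex other than `u` closes a cycle through `v` and `u`, which has at
  -- least three vertices.
  simple-path-grows : ∀ {u v w rest} → Unique (v ∷ u ∷ rest) → Linked (Adjacent G) (v ∷ u ∷ rest) →
    Adjacent G w v → w ≢ u → w ∉ (v ∷ u ∷ rest)
  simple-path-grows un li a ne (here refl) = adjacent-irreflexive a
  simple-path-grows un li a ne (there (here e)) = ne e
  simple-path-grows {u} {v} {w} un li a ne (there (there o)) with ∈-∃++ o
  ... | pre , post , refl = acyclic w (v ∷ u ∷ pre)
        (s≤s (s≤s z≤n) , unique-prefix (v ∷ u ∷ pre) un , a ∷ linked-prefix (v ∷ u ∷ pre) li)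

  -- A path of arcs that can always be prolonged without turning back would
  -- visit more than n vertices.
  leafless-empty : (B : Fin n → Fin n → Set) → (∀ {u v} → B u v → Adjacent G u v) →
    (∀ {u v} → B u v → ∃[ w ] w ≢ u × B v w) → ∀ {u v} → B u v → ⊥
  leafless-empty B adj further {u} {v} b = let (_ , _ , xs , _ , un , _ , len) = long n in
    1+n≰n (≤-trans len (unique-length un))
    where
    long : ∀ k → ∃[ u ] ∃[ v ] ∃[ xs ] B u v × Unique xs ×
      (∃[ rest ] xs ≡ v ∷ u ∷ rest × Linked (Adjacent G) xs) × k < length xs
    long zero = u , v , v ∷ u ∷ [] , b , (ne ∷ []) ∷ [] ∷ [] ,
      ([] , refl , adjacent-sym {G = G} (adj b) ∷ [-]) , s≤s z≤n
      where
      ne : v ≢ u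
      ne refl = adjacent-irreflexive (adj b)
    long (suc k) with long k
    ... | u , v , _ , b , un , (rest , refl , li) , len with further b
    ...   | w , ne , b′ = v , w , w ∷ v ∷ u ∷ rest , b′ ,
            All.tabulate (λ o e → fresh (subst (_∈ _) (sym e) o)) ∷ un ,
            (u ∷ rest , refl , a ∷ li) , s≤s len
      where
      a : Adjacent G w v
      a = adjacent-sym {G = G} (adj b′)
      fresh : w ∉ (v ∷ u ∷ rest)
      fresh = simple-path-grows un li a ne

entry-lookup : ∀ {A : Set} (f : A → ℕ) xs (i : Fin (length xs)) → entry (map f xs) (toℕ i) ≡ f (lookup xs i)
entry-lookup f (x ∷ xs) fzero    = refl
entry-lookup f (x ∷ xs) (fsuc i) = entry-lookup f xs i

module Arcs {n} (G : Digraph n) where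
  m : ℕ
  m = length (arcs G)

  src dst : ℕ → ℕ
  src = entry (map (λ a → toℕ (proj₁ a)) (arcs G))
  dst = entry (map (λ a → toℕ (proj₂ a)) (arcs G))

  src-lookup : ∀ i → src (toℕ i) ≡ toℕ (proj₁ (lookup (arcs G) i))
  src-lookup = entry-lookup _ (arcs G)

  dst-lookup : ∀ i → dst (toℕ i) ≡ toℕ (proj₂ (lookup (arcs G) i))
  dst-lookup = entry-lookup _ (arcs G)

  record ArcAt (e : ℕ) : Set where
    field
      {u v} : Fin n
      arc   : (u , v) ∈ arcs G
      srce  : src e ≡ toℕ u
      dste  : dst e ≡ toℕ v

  arc-at : ∀ {e} → e < m → ArcAt e
  arc-at {e} e< = record { arc = ∈-lookup (fromℕ< e<)
    ; srce = subst (λ k → src k ≡ toℕ (proj₁ (lookup (arcs G) (fromℕ< e<)))) (Fin.toℕ-fromℕ< e<) (src-lookup (fromℕ< e<))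
    ; dste = subst (λ k → dst k ≡ toℕ (proj₂ (lookup (arcs G) (fromℕ< e<)))) (Fin.toℕ-fromℕ< e<) (dst-lookup (fromℕ< e<)) }

  arc-index : ∀ {u v} → (u , v) ∈ arcs G → ∃[ e ] e < m × src e ≡ toℕ u × dst e ≡ toℕ v
  arc-index {u} {v} o = toℕ (Any.index o) , Fin.toℕ<n (Any.index o) ,
    trans (src-lookup (Any.index o)) (cong (λ a → toℕ (proj₁ a)) (sym (lookup-index o))) ,
    trans (dst-lookup (Any.index o)) (cong (λ a → toℕ (proj₂ a)) (sym (lookup-index o)))
    where
    open import Data.List.Relation.Unary.Any.Properties using (lookup-index)

  src<n : ∀ {e} → e < m → src e < n
  src<n e< = subst (_< n) (sym (ArcAt.srce (arc-at e<))) (Fin.toℕ<n _)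

  dst<n : ∀ {e} → e < m → dst e < n
  dst<n e< = subst (_< n) (sym (ArcAt.dste (arc-at e<))) (Fin.toℕ<n _)

  src≢dst : ∀ {e} → e < m → src e ≢ dst e
  src≢dst e< p =
    loopless G u (subst (λ w → (u , w) ∈ arcs G) (Fin.toℕ-injective (trans (sym dste) (trans (sym p) srce))) arc)
    where
    open ArcAt (arc-at e<)

  same-arc : ∀ {e e′} → e < m → e′ < m → src e ≡ src e′ → dst e ≡ dst e′ → e ≡ e′
  same-arc {e} {e′} e< e′< p q = begin
    e ≡⟨ sym (Fin.toℕ-fromℕ< e<) ⟩
    toℕ (fromℕ< e<) ≡⟨ cong toℕ (lookup-injective (unique G) _ _ eq) ⟩
    toℕ (fromℕ< e′<) ≡⟨ Fin.toℕ-fromℕ< e′< ⟩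
    e′ ∎
    where
    open ≡-Reasoning
    open ArcAt
    eq : lookup (arcs G) (fromℕ< e<) ≡ lookup (arcs G) (fromℕ< e′<)
    eq = cong₂ _,_ (Fin.toℕ-injective (trans (sym (srce (arc-at e<))) (trans p (srce (arc-at e′<)))))
                   (Fin.toℕ-injective (trans (sym (dste (arc-at e<))) (trans q (dste (arc-at e′<)))))

  module _ (polytree : IsPolytree G) where
    open IsPolytree polytree

    not-antiparallel : ∀ {e e′} → e < m → e′ < m → src e ≡ dst e′ → dst e ≡ src e′ → ⊥
    not-antiparallel e< e′< p q = no-antiparallel A.u A.v A.arc
      (subst₂ (λ a b → (a , b) ∈ arcs G)
        (Fin.toℕ-injective (trans (sym B.srce) (trans (sym q) A.dste)))
        (Fin.toℕ-injective (trans (sym B.dste) (trans (sym p) A.srce))) B.arc)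
      where
      module A = ArcAt (arc-at e<)
      module B = ArcAt (arc-at e′<)

    degree : (ℕ → ℕ) → ℕ → ℕ
    degree al v = flow m src al v + flow m dst al v

    -- Without vertices of degree one, each present arc reaching `v` is followed by another. That
    -- one does not lead back, since arcs are neither repeated nor antiparallel.
    leafless-dead : ∀ {al} → (∀ e → al e ≤ 1) → (∀ {v} → v < n → degree al v ≢ 1) → ∀ {e} → e < m → al e ≡ 0
    leafless-dead {al} al≤1 noleaf {e} e< with zero⊎pos (al e)
    ... | inj₁ z = z
    ... | inj₂ p = ⊥-elim (leafless-empty polytree B adj further
            {ArcAt.u (arc-at e<)} {ArcAt.v (arc-at e<)}
            (e , e< , p , inj₁ (ArcAt.srce (arc-at e<) , ArcAt.dste (arc-at e<))))
      where
      B : Fin n → Fin n → Set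
      B u v = ∃[ e ] e < m × 1 ≤ al e × ((src e ≡ toℕ u × dst e ≡ toℕ v) ⊎ (src e ≡ toℕ v × dst e ≡ toℕ u))
      at : ∀ {e u v} → e < m → src e ≡ toℕ u → dst e ≡ toℕ v → (u , v) ∈ arcs G
      at e< p q = subst₂ (λ a b → (a , b) ∈ arcs G)
        (Fin.toℕ-injective (trans (sym srce) p)) (Fin.toℕ-injective (trans (sym dste) q)) arc
        where
        open ArcAt (arc-at e<)
      adj : ∀ {u v} → B u v → Adjacent G u v
      adj (e , e< , _ , inj₁ (p , q)) = inj₁ (at e< p q)
      adj (e , e< , _ , inj₂ (p , q)) = inj₂ (at e< p q)
      term : ℕ → ℕ → ℕ
      term v e = pick (src e) v (al e) + pick (dst e) v (al e)
      term≤1 : ∀ {v e} → e < m → term v e ≤ 1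
      term≤1 {v} {e} e< with src e ≟ v
      ... | yes p rewrite pick-other {dst e} {v} (al e) (λ q → src≢dst e< (trans p (sym q))) | +-identityʳ (pick (src e) v (al e)) =
        ≤-trans (pick-≤ (src e) v (al e)) (al≤1 e)
      ... | no ne rewrite pick-other {src e} {v} (al e) ne = ≤-trans (pick-≤ (dst e) v (al e)) (al≤1 e)
      term≥1 : ∀ {v e} → 1 ≤ term v e → (src e ≡ v ⊎ dst e ≡ v) × 1 ≤ al e
      term≥1 {v} {e} p with zero⊎pos (pick (src e) v (al e))
      ... | inj₂ q = let (a , b) = pick-positive {src e} {v} q in inj₁ a , b
      ... | inj₁ z = let (a , b) = pick-positive {dst e} {v} (subst (λ k → 1 ≤ k + pick (dst e) v (al e)) z p) in inj₂ a , b
      further : ∀ {u v} → B u v → ∃[ w ] w ≢ u × B v w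
      further {u} {v} (e , e< , p , end) with sum-other m {term (toℕ v)} e e< (≤-<-trans (term≤1 {toℕ v} e<) two)
        where
        one : 1 ≤ term (toℕ v) e
        one = go end
          where
          go : (src e ≡ toℕ u × dst e ≡ toℕ v) ⊎ (src e ≡ toℕ v × dst e ≡ toℕ u) → 1 ≤ term (toℕ v) e
          go (inj₁ (_ , q)) = ≤-trans p (≤-trans (≤-reflexive (sym (pick-same (al e) q))) (m≤n+m _ (pick (src e) (toℕ v) (al e))))
          go (inj₂ (q , _)) = ≤-trans p (≤-trans (≤-reflexive (sym (pick-same (al e) q))) (m≤m+n _ _))
        total : degree al (toℕ v) ≡ sum< m (term (toℕ v))
        total = sym (sum-+ m _ _)
        two : 2 ≤ sum< m (term (toℕ v))
        two = ≤∧≢⇒< (≤-trans one (term≤sum m e<)) (λ q → noleaf (Fin.toℕ<n v) (trans total (sym q)))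
      ... | e′ , e′< , ne , q with term≥1 {toℕ v} {e′} q
      ...   | inj₁ s , al′ = ArcAt.v (arc-at e′<) , distinct , e′ , e′< , al′ , inj₁ (s , ArcAt.dste (arc-at e′<))
        where
        distinct : ArcAt.v (arc-at e′<) ≢ u
        distinct eq = go end
          where
          to-u : dst e′ ≡ toℕ u
          to-u = trans (ArcAt.dste (arc-at e′<)) (cong toℕ eq)
          go : (src e ≡ toℕ u × dst e ≡ toℕ v) ⊎ (src e ≡ toℕ v × dst e ≡ toℕ u) → ⊥
          go (inj₁ (a , b)) = not-antiparallel e< e′< (trans a (sym to-u)) (trans b (sym s))
          go (inj₂ (a , b)) = ne (same-arc e′< e< (trans s (sym a)) (trans to-u (sym b)))
      ...   | inj₂ s , al′ = ArcAt.u (arc-at e′<) , distinct , e′ , e′< , al′ , inj₂ (ArcAt.srce (arc-at e′<) , s)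
        where
        distinct : ArcAt.u (arc-at e′<) ≢ u
        distinct eq = go end
          where
          from-u : src e′ ≡ toℕ u
          from-u = trans (ArcAt.srce (arc-at e′<)) (cong toℕ eq)
          go : (src e ≡ toℕ u × dst e ≡ toℕ v) ⊎ (src e ≡ toℕ v × dst e ≡ toℕ u) → ⊥
          go (inj₁ (a , b)) = ne (same-arc e′< e< (trans from-u (sym a)) (trans s (sym b)))
          go (inj₂ (a , b)) = not-antiparallel e< e′< (trans a (sym s)) (trans b (sym from-u))

-- Weakest preconditions of loop-free commands

-- Defined by copatterns, so that states stay small terms.
assigned : ℕ → Exp → State → State
scalar (assigned x e s) = update (scalar s) x (⟦ e ⟧ s)
array  (assigned x e s) = array s

stored : ℕ → Exp → Exp → State → State
scalar (stored a e f s) = scalar s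
array  (stored a e f s) = update (array s) a (update (array s a) (⟦ e ⟧ s) (⟦ f ⟧ s))

wp : Cmd → (State → Set) → State → Set
wp skip                          P s = P s
wp (x ≔ e)                       P s = P (assigned x e s)
wp (a [ e ]≔ f)                  P s = P (stored a e f s)
wp (C ⨾ D)                       P s = wp C (wp D P) s
wp (IfNonzero e Then C Else D)   P s = (1 ≤ ⟦ e ⟧ s → wp C P s) × (⟦ e ⟧ s ≡ 0 → wp D P s)
wp (WhileNonzero e Do C)         P s = ⊥

-- A conditional is charged for both branches, so that the bound does not depend on the state.
steps : Cmd → ℕ
steps skip                        = 1
steps (x ≔ e)                     = 1 + cost e
steps (a [ e ]≔ f)                = 1 + cost e + cost f
steps (C ⨾ D)                     = steps C + steps D
steps (IfNonzero e Then C Else D) = 1 + cost e + (steps C + steps D)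
steps (WhileNonzero e Do C)       = 0

ends-wp : ∀ C {P s} → wp C P s → Ends C s (steps C) P
ends-wp skip p = _ , _ , skip , ≤-refl , p
ends-wp (x ≔ e) p = _ , _ , assign , ≤-refl , p
ends-wp (a [ e ]≔ f) p = _ , _ , store , ≤-refl , p
ends-wp (C ⨾ D) p = ends-seq (ends-wp C p) (λ s′ → ends-wp D)
ends-wp (IfNonzero e Then C Else D) {s = s} (f , g) with zero⊎pos (⟦ e ⟧ s)
... | inj₁ z = let (t , s′ , d , p , q) = ends-wp D (g z) in
  _ , s′ , if-zero z d , +-monoʳ-≤ (1 + cost e) (≤-trans p (m≤n+m _ (steps C))) , q
... | inj₂ z = let (t , s′ , d , p , q) = ends-wp C (f z) in
  _ , s′ , if-nonzero (≥1⇒≢0 z) d , +-monoʳ-≤ (1 + cost e) (≤-trans p (m≤m+n _ (steps D))) , q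

-- Conditions: nonzero means true.
infixr 6 _∧ᴱ_
infix  7 _≠ᴱ_

_∧ᴱ_ _≠ᴱ_ : Exp → Exp → Exp
-- The minimum of the two values; in the next line, their distance.
e ∧ᴱ f = e ⊖ (e ⊖ f)
e ≠ᴱ f = (e ⊖ f) ⊕ (f ⊖ e)

notᴱ : Exp → Exp
notᴱ e = lit 1 ⊖ e

∧-true : ∀ a b → 1 ≤ a ∸ (a ∸ b) → 1 ≤ a × 1 ≤ b
∧-true a zero p = ⊥-elim (≥1⇒≢0 p (n∸n≡0 a))
∧-true a (suc b) p = ≤-trans p (m∸n≤m a (a ∸ suc b)) , s≤s z≤n

∧-false : ∀ a b → a ∸ (a ∸ b) ≡ 0 → 1 ≤ a → 1 ≤ b → ⊥
∧-false (suc a) (suc b) e _ _ = 1+n≰n (≤-trans (m∸n≡0⇒m≤n e) (m∸n≤m a b))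

≠-false : ∀ a b → (a ∸ b) + (b ∸ a) ≡ 0 → a ≡ b
≠-false a b e = ≤-antisym (m∸n≡0⇒m≤n (m+n≡0⇒m≡0 _ e)) (m∸n≡0⇒m≤n (m+n≡0⇒n≡0 (a ∸ b) e))

≠-true : ∀ a b → 1 ≤ (a ∸ b) + (b ∸ a) → a ≢ b
≠-true a b p refl = ≥1⇒≢0 p (cong₂ _+_ (n∸n≡0 a) (n∸n≡0 a))

not-true : ∀ a → 1 ≤ 1 ∸ a → a ≡ 0
not-true zero p = refl
not-true (suc a) p = ⊥-elim (≥1⇒≢0 p (0∸n≡0 a))

not-false : ∀ a → 1 ∸ a ≡ 0 → 1 ≤ a
not-false (suc a) _ = s≤s z≤n

-- The programs

-- Memory: scalars 0 and 1 are n and m; arrays 0–3 are the input, then come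
-- the degrees (4) and index sums (5) of incident arcs, the elimination order
-- (6, 7, 8 for X, Q, D), the flow F (9) with its sums IN (10) and OUT (11),
-- the labels S (12) and T (13) with the flags "labelled at the token's end"
-- (14, 16) and "labelled at the other end" (15, 17), and the path (18).
initialize peelStep peelBody peel : Cmd
initialize = 2 ≔ lit 0 ⨾ WhileNonzero var 1 ⊖ var 2 Do
  (4 [ 0 ! var 2 ]≔ 4 ! (0 ! var 2) ⊕ lit 1
  ⨾ 4 [ 1 ! var 2 ]≔ 4 ! (1 ! var 2) ⊕ lit 1
  ⨾ 5 [ 0 ! var 2 ]≔ 5 ! (0 ! var 2) ⊕ var 2
  ⨾ 5 [ 1 ! var 2 ]≔ 5 ! (1 ! var 2) ⊕ var 2
  ⨾ 2 ≔ var 2 ⊕ lit 1)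

-- min n (a ∸ b), where the minimum is for the sake of the word size only
excess : Exp → Exp → Exp
excess e f = var 0 ⊖ (var 0 ⊖ (e ⊖ f))

peelStep =
  5 ≔ 5 ! var 3
  ⨾ (IfNonzero (0 ! var 5) ≠ᴱ var 3
     Then (6 ≔ 0 ! var 5
        ⨾ 8 [ var 4 ]≔ lit 0
        ⨾ 9 [ var 4 ]≔ excess (3 ! var 3 ⊕ 11 ! var 3) (2 ! var 3 ⊕ 10 ! var 3)
        ⨾ 11 [ var 6 ]≔ 11 ! var 6 ⊕ 9 ! var 4
        ⨾ 10 [ var 3 ]≔ 10 ! var 3 ⊕ 9 ! var 4)
     Else (6 ≔ 1 ! var 5
        ⨾ 8 [ var 4 ]≔ lit 1
        ⨾ 9 [ var 4 ]≔ excess (2 ! var 3 ⊕ 10 ! var 3) (3 ! var 3 ⊕ 11 ! var 3)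
        ⨾ 11 [ var 3 ]≔ 11 ! var 3 ⊕ 9 ! var 4
        ⨾ 10 [ var 6 ]≔ 10 ! var 6 ⊕ 9 ! var 4))
  ⨾ 6 [ var 4 ]≔ var 3
  ⨾ 7 [ var 4 ]≔ var 6
  ⨾ 4 [ 0 ! var 5 ]≔ 4 ! (0 ! var 5) ⊖ lit 1
  ⨾ 4 [ 1 ! var 5 ]≔ 4 ! (1 ! var 5) ⊖ lit 1
  ⨾ 5 [ 0 ! var 5 ]≔ 5 ! (0 ! var 5) ⊖ var 5
  ⨾ 5 [ 1 ! var 5 ]≔ 5 ! (1 ! var 5) ⊖ var 5
  ⨾ 4 ≔ var 4 ⊕ lit 1
  ⨾ 3 ≔ var 6

-- Removing a leaf can turn only its neighbour into a new leaf, and that neighbour becomes the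
-- current vertex at once. Hence one scan over the vertices suffices.
peelBody = IfNonzero 4 ! var 3 ≠ᴱ lit 1
  Then (3 ≔ var 2 ⨾ 2 ≔ var 2 ⊕ lit 1)
  Else peelStep

-- Follow chains of leaves, starting from vertices 0, 1, … in turn.
peel = 2 ≔ lit 0 ⨾ 3 ≔ lit 0 ⨾ 4 ≔ lit 0 ⨾ WhileNonzero (var 0 ⊕ lit 1) ⊖ var 2 Do peelBody

-- `taken` stores the served vertex plus one, keeping 0 for "free". The last conjunct denies a
-- second label to an arc with a single unit, unless inflow of the head and outflow of the tail
-- total at most 2, so that the unit is alone at both ends.
label : (set sat taken lab other : ℕ) → Exp → Exp → Cmd
label set sat taken lab other a b =
  IfNonzero (set ! a) ∧ᴱ notᴱ (sat ! a) ∧ᴱ notᴱ (taken ! b)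
    ∧ᴱ notᴱ ((other ! var 2) ∧ᴱ notᴱ (9 ! var 2 ⊖ lit 1) ∧ᴱ ((10 ! var 6 ⊕ 11 ! var 5) ⊖ lit 1 ⊖ lit 1))
  Then (lab [ var 2 ]≔ lit 1 ⨾ sat [ a ]≔ lit 1 ⨾ taken [ b ]≔ a ⊕ lit 1)
  Else skip

labelS labelT labelStep labelling : Cmd
labelS = label 2 14 15 12 13 (var 5) (var 6)
labelT = label 3 16 17 13 12 (var 6) (var 5)

loadEnds : Cmd
loadEnds = IfNonzero 8 ! var 2
  Then (5 ≔ 6 ! var 2 ⨾ 6 ≔ 7 ! var 2)
  Else (5 ≔ 7 ! var 2 ⨾ 6 ≔ 6 ! var 2)

labelStep =
  loadEnds
  ⨾ (IfNonzero 9 ! var 2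
     -- The label demanded by the child comes first because it is forced; the other one gives way in
     -- case of conflict.
     Then (IfNonzero 8 ! var 2 Then (labelS ⨾ labelT) Else (labelT ⨾ labelS))
     Else skip)
  ⨾ 2 ≔ var 2 ⊕ lit 1

labelling = 2 ≔ lit 0 ⨾ WhileNonzero var 1 ⊖ var 2 Do labelStep

-- Scalar 7 is a sticky flag: after any nonzero `e` it remains 1.
test : Exp → Cmd
test e = 7 ≔ notᴱ (notᴱ (var 7) ⊖ e)

vertexStep arcStep checkVertices checkArcs checks decide : Cmd
vertexStep =
  test ((2 ! var 2 ⊕ 10 ! var 2) ≠ᴱ (3 ! var 2 ⊕ 11 ! var 2))
  ⨾ test ((2 ! var 2) ∧ᴱ (11 ! var 2) ∧ᴱ notᴱ (14 ! var 2))
  ⨾ test ((3 ! var 2) ∧ᴱ (10 ! var 2) ∧ᴱ notᴱ (16 ! var 2))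
  ⨾ 2 ≔ var 2 ⊕ lit 1
checkVertices = 2 ≔ lit 0 ⨾ WhileNonzero var 0 ⊖ var 2 Do vertexStep

still : Exp → Exp → Exp
still a b = (2 ! a) ∧ᴱ (3 ! a) ∧ᴱ notᴱ (10 ! a) ∧ᴱ (10 ! b ⊕ 11 ! b)

arcStep = test (still (6 ! var 2) (7 ! var 2)) ⨾ test (still (7 ! var 2) (6 ! var 2)) ⨾ 2 ≔ var 2 ⊕ lit 1
checkArcs = 2 ≔ lit 0 ⨾ WhileNonzero var 1 ⊖ var 2 Do arcStep
checks = checkVertices ⨾ checkArcs ⨾ 0 ≔ lit 1 ⊖ var 7

decide = initialize ⨾ peel ⨾ labelling ⨾ checks

-- The walk: scalar 4 is the current arc, joining child to parent.  The path
-- runs from vertex 10 to vertex 11 and consists of the arcs stored in array 18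
-- between the indices 14 and 15; scalars 12 and 13 tell whether it is open at
-- the start and at the end, and 16 whether it exists.
child parent : Exp
child = 6 ! var 4
parent = 7 ! var 4

-- The stored path grows at both ends. It begins at index `m`, which leaves a cell in front for
-- every arc.
restart : Exp → Exp → Exp → Cmd
restart v so eo = 10 ≔ v ⨾ 11 ≔ v ⨾ 12 ≔ so ⨾ 13 ≔ eo ⨾ 14 ≔ var 1 ⨾ 15 ≔ var 1 ⨾ 16 ≔ lit 1

pushFront pushBack : Exp → Cmd
pushFront so = 14 ≔ var 14 ⊖ lit 1 ⨾ 18 [ var 14 ]≔ var 4 ⨾ 10 ≔ child ⨾ 12 ≔ so
pushBack eo = 18 [ var 15 ]≔ var 4 ⨾ 15 ≔ var 15 ⊕ lit 1 ⨾ 11 ≔ child ⨾ 13 ≔ eo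

sameᴱ : Exp → Exp → Exp
sameᴱ e f = notᴱ (e ≠ᴱ f)

walkToken walkDown walkUp walkRoot walkArc walkStep : Cmd
walkToken = IfNonzero 11 ! child
  Then (IfNonzero (8 ! var 4) ∧ᴱ (12 ! var 4)
    Then (IfNonzero (var 12) ∧ᴱ sameᴱ (var 10) parent Then pushFront (lit 0) Else skip)
    Else restart child (lit 0) (lit 1))
  Else skip
walkDown = IfNonzero 2 ! parent
  Then (IfNonzero (12 ! var 4) ∧ᴱ sameᴱ (var 10) parent Then pushBack (11 ! child) Else skip)
  Else (IfNonzero (11 ! child)
      -- Of the units from below, one is withheld for the T-label of a final child, unless that
      -- label is on the present arc.
      ∧ᴱ ((10 ! child ⊖ 9 ! var 4) ⊖ ((3 ! child) ∧ᴱ notᴱ ((13 ! var 4) ∧ᴱ (9 ! var 4))))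
    Then restart child (lit 1) (lit 1)
    Else (IfNonzero (var 13) ∧ᴱ sameᴱ (var 11) parent ∧ᴱ (9 ! var 4)
        ∧ᴱ notᴱ (notᴱ (11 ! child) ∧ᴱ (11 ! parent ⊖ lit 1))
      Then pushBack (11 ! child)
      Else skip))
walkUp = IfNonzero notᴱ (var 13) ∧ᴱ sameᴱ (var 11) parent ∧ᴱ (11 ! child ⊖ 9 ! var 4)
  Then restart child (lit 1) (lit 1)
  Else (IfNonzero (var 12) ∧ᴱ sameᴱ (var 10) parent ∧ᴱ (9 ! var 4)
      -- Array 15 gives a tail plus one: the parent is claimed if a token is still waiting at that
      -- tail.
      ∧ᴱ notᴱ ((15 ! parent) ∧ᴱ (2 ! (15 ! parent ⊖ lit 1)))
      ∧ᴱ notᴱ ((13 ! var 4) ∧ᴱ notᴱ (9 ! var 4 ⊖ lit 1) ∧ᴱ (10 ! parent ⊖ lit 1))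
    Then pushFront (var 12)
    Else skip)
walkRoot = IfNonzero var 16 Then skip Else
  (IfNonzero 10 ! parent ⊕ 11 ! parent
   Then restart parent (notᴱ (2 ! parent)) (11 ! parent)
   Else skip)
walkArc = IfNonzero var 16
  Then (IfNonzero 2 ! child
    Then walkToken
    Else (IfNonzero 8 ! var 4 Then walkUp Else walkDown))
  Else skip
walkStep = 4 ≔ var 4 ⊖ lit 1 ⨾ walkRoot ⨾ walkArc

slideStep round construct : Cmd
slideStep =
  4 ≔ 18 ! var 14
  ⨾ (IfNonzero 8 ! var 4
     Then (5 ≔ 6 ! var 4 ⨾ 6 ≔ 7 ! var 4)
     Else (5 ≔ 7 ! var 4 ⨾ 6 ≔ 6 ! var 4))
  -- From the end of peeling on, arcs are read from arrays 6 to 8, so arrays 0 and 1 can take the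
  -- output.
  ⨾ 0 [ var 17 ]≔ var 5
  ⨾ 1 [ var 17 ]≔ var 6
  ⨾ 17 ≔ var 17 ⊕ lit 1
  ⨾ 2 [ var 5 ]≔ lit 0
  ⨾ 2 [ var 6 ]≔ lit 1
  ⨾ 9 [ var 4 ]≔ 9 ! var 4 ⊖ lit 1
  ⨾ 11 [ var 5 ]≔ 11 ! var 5 ⊖ lit 1
  ⨾ 10 [ var 6 ]≔ 10 ! var 6 ⊖ lit 1
  ⨾ 14 ≔ var 14 ⊕ lit 1

round =
  16 ≔ lit 0 ⨾ 14 ≔ lit 0 ⨾ 15 ≔ lit 0 ⨾ 4 ≔ var 1
  ⨾ (WhileNonzero var 4 Do walkStep)
  ⨾ (WhileNonzero var 15 ⊖ var 14 Do slideStep)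

construct = initialize ⨾ peel ⨾ labelling
  ⨾ 17 ≔ lit 0 ⨾ 16 ≔ lit 1 ⨾ (WhileNonzero var 16 Do round) ⨾ 0 ≔ var 17

decide-tame : TameCmd decide
decide-tame = _

construct-tame : TameCmd construct
construct-tame = _

ends-for : ∀ N {C b} (Inv : ℕ → State → Set) M →
  (∀ i s → i < M → scalar s 2 ≡ i → scalar s N ≡ M → Inv i s →
    Ends C s b (λ s′ → scalar s′ 2 ≡ suc i × scalar s′ N ≡ M × Inv (suc i) s′)) →
  ∀ s → scalar s 2 ≡ 0 → scalar s N ≡ M → Inv 0 s →
  Ends (WhileNonzero var N ⊖ var 2 Do C) s (suc M * (4 + b)) (Inv M)
ends-for N {C} {b} Inv M body s e₂ eN inv =
  ends-weaken ≤-refl done (ends-while {var N ⊖ var 2} {C} {b} Inv′ step M s (0 , e₂ , eN , inv , refl))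
  where
  Inv′ : ℕ → State → Set
  Inv′ k s = ∃[ i ] scalar s 2 ≡ i × scalar s N ≡ M × Inv i s × i + k ≡ M
  step : ∀ k s → Inv′ k s → scalar s N ∸ scalar s 2 ≢ 0 → Ends C s b (λ s′ → ∃[ k′ ] k′ < k × Inv′ k′ s′)
  step zero s (i , refl , eN , inv , e) ne = ⊥-elim (ne (trans (cong (_∸ scalar s 2) (trans eN (sym (trans (sym (+-identityʳ _)) e)))) (n∸n≡0 (scalar s 2))))
  step (suc k) s (i , e₂ , eN , inv , e) ne =
    ends-weaken ≤-refl (λ s′ (a , b , c) → k , ≤-refl , suc i , a , b , c , trans (sym (+-suc i k)) e)
      (body i s (≤-trans (m≤m+n (suc i) k) (≤-reflexive (trans (sym (+-suc i k)) e))) e₂ eN inv)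
  done : ∀ s → (∃[ k ] Inv′ k s × scalar s N ∸ scalar s 2 ≡ 0) → Inv M s
  done s (k , (i , refl , eN , inv , e) , z) = subst (λ j → Inv j s)
    (≤-antisym (≤-trans (m≤m+n _ k) (≤-reflexive e)) (≤-trans (≤-reflexive (sym eN)) (m∸n≡0⇒m≤n z))) inv

update-add : ∀ f x c v → update f x (f x + c) v ≡ f v + pick x v c
update-add f x c v with v ≟ x
... | yes refl = trans (update-same f x x refl) (cong (f x +_) (sym (pick-same {x} c refl)))
... | no ne = trans (update-other f x v ne) (trans (sym (+-identityʳ _)) (cong (f v +_) (sym (pick-other c (≢-sym ne)))))

update-sub : ∀ f x c v → update f x (f x ∸ c) v ≡ f v ∸ pick x v c
update-sub f x c v with v ≟ x
... | yes refl = trans (update-same f x x refl) (cong (f x ∸_) (sym (pick-same {x} c refl)))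
... | no ne = trans (update-other f x v ne) (cong (f v ∸_) (sym (pick-other c (≢-sym ne))))

+-shuffle : ∀ a b c d → a + b + c + d ≡ (a + c) + (b + d)
+-shuffle a b c d = trans (cong (_+ d) (trans (+-assoc a b c) (trans (cong (a +_) (+-comm b c)) (sym (+-assoc a c b)))))
  (+-assoc (a + c) b d)

Agree : ℕ → (f g : ℕ → ℕ) → Set
Agree k f g = ∀ {i} → i < k → f i ≡ g i

update-agree : ∀ f k x → Agree k (update f k x) f
update-agree f k x {i} i< = update-other f k i (<⇒≢ i<)

flow-agree : ∀ {k h h′ F F′} v → Agree k h h′ → Agree k F F′ → flow k h F v ≡ flow k h′ F′ v
flow-agree {k} v p q = sum-cong k (λ i< → cong₂ (λ a x → pick a v x) (p i<) (q i<))

branch-agree : ∀ {k D D′ A A′ B B′} → Agree k D D′ → Agree k A A′ → Agree k B B′ →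
  Agree k (λ i → branch (D i) (A i) (B i)) (λ i → branch (D′ i) (A′ i) (B′ i))
branch-agree p q r {i} i< rewrite p i< | q i< | r i< = refl

-- Correctness of peeling

module Peeling {n} {G : Digraph n} (polytree : IsPolytree G) (I J : ℕ → ℕ) where
  open Arcs G

  record Initial (s : State) : Set where
    field
      s0 : scalar s 0 ≡ n
      s1 : scalar s 1 ≡ m
      a0 : array s 0 ≡ src
      a1 : array s 1 ≡ dst
      a2 : array s 2 ≡ I
      a3 : array s 3 ≡ J
      zero-array : ∀ a i → 4 ≤ a → array s a i ≡ 0

  record Initialized (k : ℕ) (s : State) : Set where
    field
      src≡   : array s 0 ≡ src
      dst≡   : array s 1 ≡ dst
      degree≡ : ∀ v → array s 4 v ≡ flow k src (λ _ → 1) v + flow k dst (λ _ → 1) v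
      index≡  : ∀ v → array s 5 v ≡ flow k src (λ e → e) v + flow k dst (λ e → e) v

  initialize-ends : ∀ {s} → Initial s → Ends initialize s (2 + suc m * 40)
    (λ s′ → Initialized m s′ × Framed initialize s s′)
  initialize-ends {s} init = ends-framed (ends-seq {b = 2} {P = λ s′ → s′ ≡ s₁} (ends-wp (2 ≔ lit 0) refl)
    (λ { _ refl → ends-for 1 Initialized m body s₁ refl (Initial.s1 init) start′ }))
    where
    s₁ : State
    s₁ = ⟨ update (scalar s) 2 0 , array s ⟩
    start′ : Initialized 0 s₁
    start′ = record { src≡ = Initial.a0 init ; dst≡ = Initial.a1 init
      ; degree≡ = λ v → Initial.zero-array init 4 v ≤-refl
      ; index≡ = λ v → Initial.zero-array init 5 v (n≤1+n 4) }
    body : ∀ i s → i < m → scalar s 2 ≡ i → scalar s 1 ≡ m → Initialized i s → Ends _ s 36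
      (λ s′ → scalar s′ 2 ≡ suc i × scalar s′ 1 ≡ m × Initialized (suc i) s′)
    body i s i< refl e₁ inv = ends-wp _ (+-comm _ 1 , e₁ , record
      { src≡ = src≡ ; dst≡ = dst≡
      ; degree≡ = λ v → add v (array s 4) (λ _ → 1) (degree≡ v)
      ; index≡ = λ v → add v (array s 5) (λ e → e) (index≡ v) })
      where
      open Initialized inv
      a = array s 0 (scalar s 2)
      b = array s 1 (scalar s 2)
      add : ∀ v (f w : ℕ → ℕ) → f v ≡ flow i src w v + flow i dst w v →
        update (update f a (f a + w i)) b (update f a (f a + w i) b + w i) v ≡ flow (suc i) src w v + flow (suc i) dst w v
      add v f w e = begin
        update (update f a (f a + w i)) b (update f a (f a + w i) b + w i) v
          ≡⟨ update-add (update f a (f a + w i)) b (w i) v ⟩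
        update f a (f a + w i) v + pick b v (w i) ≡⟨ cong (_+ pick b v (w i)) (update-add f a (w i) v) ⟩
        f v + pick a v (w i) + pick b v (w i) ≡⟨ cong (λ z → z + pick a v (w i) + pick b v (w i)) e ⟩
        flow i src w v + flow i dst w v + pick a v (w i) + pick b v (w i)
          ≡⟨ +-shuffle (flow i src w v) _ _ _ ⟩
        (flow i src w v + pick a v (w i)) + (flow i dst w v + pick b v (w i))
          ≡⟨ cong₂ (λ g h → (flow i src w v + pick (g i) v (w i)) + (flow i dst w v + pick (h i) v (w i))) src≡ dst≡ ⟩
        flow (suc i) src w v + flow (suc i) dst w v ∎
        where open ≡-Reasoning

order-snoc : ∀ {n k X Q x q} → Order n k X Q → x < n → q < n → x ≢ q →
  (∀ {i} → i < k → X i ≢ x) → (∀ {i} → i < k → X i ≢ q) → Order n (suc k) (update X k x) (update Q k q)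
order-snoc {n} {k} {X} {Q} {x} {q} O x< q< x≢q fx fq = record
  { X<n = λ i< → cases i< (λ lt → subst (_< n) (sym (oldX lt)) (X<n lt)) (λ { refl → subst (_< n) (sym newX) x< })
  ; Q<n = λ i< → cases i< (λ lt → subst (_< n) (sym (oldQ lt)) (Q<n lt)) (λ { refl → subst (_< n) (sym newQ) q< })
  ; X≢Q = λ i< → cases i< (λ lt e → X≢Q lt (trans (sym (oldX lt)) (trans e (oldQ lt))))
                          (λ { refl e → x≢q (trans (sym newX) (trans e newQ)) })
  ; X≢X = λ i<j j< → cases j< (λ lt e → X≢X i<j lt (trans (sym (oldX (<-trans i<j lt))) (trans e (oldX lt))))
                              (λ { refl e → fx i<j (trans (sym (oldX i<j)) (trans e newX)) })
  ; X≢Q> = λ i<j j< → cases j< (λ lt e → X≢Q> i<j lt (trans (sym (oldX (<-trans i<j lt))) (trans e (oldQ lt))))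
                               (λ { refl e → fq i<j (trans (sym (oldX i<j)) (trans e newQ)) }) }
  where
  open Order O
  oldX : Agree k (update X k x) X
  oldX = update-agree X k x
  oldQ : Agree k (update Q k q) Q
  oldQ = update-agree Q k q
  newX : update X k x k ≡ x
  newX = update-same X k k refl
  newQ : update Q k q k ≡ q
  newQ = update-same Q k k refl
  cases : ∀ {i} {R : Set} → i < suc k → (i < k → R) → (i ≡ k → R) → R
  cases i< f g with m≤n⇒m<n∨m≡n (≤-pred i<)
  ... | inj₁ lt = f lt
  ... | inj₂ e = g e

-- `n ∸ (n ∸ y)` is the smaller of `n` and `y`, as computed by `excess`. All arcs at the child
-- except `j` come before `j`, so the law there leaves only `F j` open. If truncation or the cap
-- alters the value, the law fails at `X j`, which the checks detect.
demand : (n : ℕ) (I J X D : ℕ → ℕ) (tl hd F : ℕ → ℕ) → ℕ → ℕ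
demand n I J X D tl hd F j = n ∸ (n ∸ branch (D j)
  ((J (X j) + flow j tl F (X j)) ∸ (I (X j) + flow j hd F (X j)))
  ((I (X j) + flow j hd F (X j)) ∸ (J (X j) + flow j tl F (X j))))

demand-agree : ∀ {n I J k X X′ D D′ t t′ h h′ F F′} → Agree k X′ X → Agree k D′ D → Agree k t′ t → Agree k h′ h →
  Agree k F′ F → ∀ {j} → j < k → demand n I J X′ D′ t′ h′ F′ j ≡ demand n I J X D t h F j
demand-agree {n} {I} {J} {X = X} {X′} {F = F} {F′} p q r s u {j} j<
  rewrite p j< | q j< | flow-agree {j} (X j) (λ i< → r (<-trans i< j<)) (λ i< → u (<-trans i< j<))
        | flow-agree {j} (X j) (λ i< → s (<-trans i< j<)) (λ i< → u (<-trans i< j<)) = refl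

module PeelLoop {n} {G : Digraph n} (polytree : IsPolytree G) (I J : ℕ → ℕ) where
  open Arcs G
  open Peeling polytree I J

  -- al marks the arcs still present.
  record PeelOf (k : ℕ) (al X Q D F IN OUT deg idx : ℕ → ℕ) : Set where
    field
      aw    : ℕ → ℕ
      al≤1  : ∀ e → al e ≤ 1
      aw≡   : ∀ e → 1 ≤ al e → aw e ≡ e
      aw≡0  : ∀ e → al e ≡ 0 → aw e ≡ 0
      deg≡  : ∀ v → deg v ≡ degree polytree al v
      idx≡  : ∀ v → idx v ≡ flow m src aw v + flow m dst aw v
      order : Order n k X Q
      gone  : ∀ {i} → i < k → degree polytree al (X i) ≡ 0
      back  : ∀ {i} → i < k → ∃[ e ] e < m × tail-of X Q D i ≡ src e × head-of X Q D i ≡ dst e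
      cover : ∀ {e} → e < m → 1 ≤ al e ⊎ (∃[ i ] i < k × tail-of X Q D i ≡ src e × head-of X Q D i ≡ dst e)
      count : k + sum< m al ≡ m
      IN≡   : ∀ v → IN v ≡ flow k (head-of X Q D) F v
      OUT≡  : ∀ v → OUT v ≡ flow k (tail-of X Q D) F v
      F≡    : ∀ {j} → j < k → F j ≡ demand n I J X D (tail-of X Q D) (head-of X Q D) F j

  peel-cong : ∀ {k al X X′ Q Q′ D D′ F F′ N N′ U U′ d d′ i i′} → X ≡ X′ → Q ≡ Q′ → D ≡ D′ → F ≡ F′ → N ≡ N′ → U ≡ U′ →
    d ≡ d′ → i ≡ i′ → PeelOf k al X′ Q′ D′ F′ N′ U′ d′ i′ → PeelOf k al X Q D F N U d i
  peel-cong refl refl refl refl refl refl refl refl p = p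

  record Peel (k : ℕ) (al : ℕ → ℕ) (s : State) : Set where
    field
      s0    : scalar s 0 ≡ n
      src≡  : array s 0 ≡ src
      dst≡  : array s 1 ≡ dst
      I≡    : array s 2 ≡ I
      J≡    : array s 3 ≡ J
      state : PeelOf k al (array s 6) (array s 7) (array s 8) (array s 9) (array s 10) (array s 11) (array s 4) (array s 5)
    open PeelOf state public

  -- The common outcome of the two branches of `peelStep`: leaf `v`, parent `p`, direction `d`, flow
  -- `f` on the new arc.
  record Effects (s s′ : State) (v p d f : ℕ) : Set where
    k : ℕ
    k = scalar s 4
    e : ℕ
    e = array s 5 v
    a : ℕ
    a = array s 0 e
    b : ℕ
    b = array s 1 e
    t : ℕ
    t = branch d p v
    h : ℕ
    h = branch d v p
    field
      s0 : scalar s′ 0 ≡ scalar s 0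
      s4 : scalar s′ 4 ≡ k + 1
      a0 : array s′ 0 ≡ array s 0
      a1 : array s′ 1 ≡ array s 1
      a2 : array s′ 2 ≡ array s 2
      a3 : array s′ 3 ≡ array s 3
      X′ : array s′ 6 ≡ update (array s 6) k v
      Q′ : array s′ 7 ≡ update (array s 7) k p
      D′ : array s′ 8 ≡ update (array s 8) k d
      F′ : array s′ 9 ≡ update (array s 9) k f
      O′ : array s′ 11 ≡ update (array s 11) t (array s 11 t + f)
      N′ : array s′ 10 ≡ update (array s 10) h (array s 10 h + f)
      deg′ : array s′ 4 ≡ update (update (array s 4) a (array s 4 a ∸ 1)) b (update (array s 4) a (array s 4 a ∸ 1) b ∸ 1)
      idx′ : array s′ 5 ≡ update (update (array s 5) a (array s 5 a ∸ e)) b (update (array s 5) a (array s 5 a ∸ e) b ∸ e)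

  -- A vertex of degree one identifies its arc by the sum of the indices.
  module Leaf {s al} (inv : Peel (scalar s 4) al s) {v} (leaf : array s 4 v ≡ 1) where
    open Peel inv
    X Q D F hd tl : ℕ → ℕ
    X = array s 6
    Q = array s 7
    D = array s 8
    F = array s 9
    hd = head-of X Q D
    tl = tail-of X Q D
    e = array s 5 v

    Incident : ℕ → Set
    Incident e = e < m × al e ≡ 1 × ((src e ≡ v × dst e ≢ v) ⊎ (dst e ≡ v × src e ≢ v))

    incident : Incident e
    incident = go (zero⊎pos (flow m src al v))
      where
      deg1 : flow m src al v + flow m dst al v ≡ 1
      deg1 = trans (sym (deg≡ v)) leaf
      alone : ∀ {h} → flow m h al v ≡ 1 → ∀ {e₀} → e₀ < m → h e₀ ≡ v → 1 ≤ al e₀ → flow m h aw v ≡ e₀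
      alone {h} f1 {e₀} e₀< p q = begin
        flow m h aw v ≡⟨ sum-cong m (λ {i} i< → only i<) ⟩
        sum< m (λ i → pick e₀ i e₀) ≡⟨ sum-pick m e₀ e₀ e₀< ⟩
        e₀ ∎
        where
        open ≡-Reasoning
        only : ∀ {i} → i < m → pick (h i) v (aw i) ≡ pick e₀ i e₀
        only {i} i< with e₀ ≟ i
        ... | yes refl = trans (pick-same _ p) (trans (aw≡ i q) (sym (pick-same {i} i refl)))
        ... | no ne with h i ≟ v | zero⊎pos (al i)
        ...   | no nv | _ = trans (pick-other _ nv) (sym (pick-other e₀ ne))
        ...   | yes r | inj₁ z = trans (pick-same _ r) (trans (aw≡0 i z) (sym (pick-other e₀ ne)))
        ...   | yes r | inj₂ q′ = ⊥-elim (1+n≰n (≤-trans (+-mono-≤ q q′)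
                  (≤-trans (≤flow₂ m {h} {al} e₀< i< ne p r) (≤-reflexive f1))))
      none : ∀ {h} → flow m h al v ≡ 0 → flow m h aw v ≡ 0
      none {h} z = sum-zero m zero-term
        where
        zero-term : ∀ {i} → i < m → pick (h i) v (aw i) ≡ 0
        zero-term {i} i< with h i ≟ v
        ... | no ne = pick-other _ ne
        ... | yes r = trans (pick-same _ r) (aw≡0 i (n≤0⇒n≡0 (≤-trans (≤flow m {h} {al} i< r) (≤-reflexive z))))
      go : flow m src al v ≡ 0 ⊎ 1 ≤ flow m src al v → Incident e
      go (inj₁ z) with trans (sym (cong (_+ flow m dst al v) z)) deg1
      ... | f1 with flow-witness m {dst} {al} {v} (≡1⇒≥1 f1)
      ...   | e₀ , e₀< , p , q = subst Incident
              (sym (trans (idx≡ v) (cong₂ _+_ (none {src} z) (alone {dst} f1 e₀< p q))))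
              (e₀< , ≤-antisym (al≤1 e₀) q , inj₂ (p , λ r → src≢dst e₀< (trans r (sym p))))
      go (inj₂ r) with flow-witness m {src} {al} {v} r
      ...   | e₀ , e₀< , p , q = subst Incident
              (sym (trans (idx≡ v) (trans (cong₂ _+_ (alone {src} f1 e₀< p q) (none {dst} f0)) (+-identityʳ e₀))))
              (e₀< , ≤-antisym (al≤1 e₀) q , inj₁ (p , λ r → src≢dst e₀< (trans p (sym r))))
        where
        f1 : flow m src al v ≡ 1
        f1 = ≤-antisym (≤-trans (m≤m+n _ _) (≤-reflexive deg1)) r
        f0 : flow m dst al v ≡ 0
        f0 = +-cancelˡ-≡ 1 _ _ (trans (cong (_+ flow m dst al v) (sym f1)) deg1)

    e<m : e < m
    e<m = proj₁ incident

    alive : al e ≡ 1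
    alive = proj₁ (proj₂ incident)

    module _ {s′ p d f} (dir : (d ≡ 0 × src e ≡ p × dst e ≡ v) ⊎ (d ≡ 1 × src e ≡ v × dst e ≡ p))
      (E : Effects s s′ v p d f)
      (f≡ : f ≡ n ∸ (n ∸ branch d ((J v + array s 11 v) ∸ (I v + array s 10 v))
                                   ((I v + array s 10 v) ∸ (J v + array s 11 v)))) where
      private module E = Effects E
      k = scalar s 4
      X₁ Q₁ D₁ F₁ hd₁ tl₁ al₁ aw₁ : ℕ → ℕ
      X₁ = update X k v
      Q₁ = update Q k p
      D₁ = update D k d
      F₁ = update F k f
      hd₁ = head-of X₁ Q₁ D₁
      tl₁ = tail-of X₁ Q₁ D₁
      al₁ = update al e 0
      aw₁ = update aw e 0

      by-dir : {R : Set} → (d ≡ 0 → src e ≡ p → dst e ≡ v → R) → (1 ≤ d → src e ≡ v → dst e ≡ p → R) → R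
      by-dir f g = go dir
        where
        go : (d ≡ 0 × src e ≡ p × dst e ≡ v) ⊎ (d ≡ 1 × src e ≡ v × dst e ≡ p) → _
        go (inj₁ (a , b , c)) = f a b c
        go (inj₂ (a , b , c)) = g (≡1⇒≥1 a) b c

      h≡ : E.h ≡ dst e
      h≡ = by-dir (λ a _ r → trans (branch-zero a) (sym r)) (λ a _ r → trans (branch-pos a) (sym r))

      t≡ : E.t ≡ src e
      t≡ = by-dir (λ a r _ → trans (branch-zero a) (sym r)) (λ a r _ → trans (branch-pos a) (sym r))

      hd-new : hd₁ k ≡ dst e
      hd-new rewrite update-same X k {v} k refl | update-same Q k {p} k refl | update-same D k {d} k refl = h≡

      tl-new : tl₁ k ≡ src e
      tl-new rewrite update-same X k {v} k refl | update-same Q k {p} k refl | update-same D k {d} k refl = t≡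

      a≡ : E.a ≡ src e
      a≡ = cong (λ g → g e) src≡

      b≡ : E.b ≡ dst e
      b≡ = cong (λ g → g e) dst≡

      X-old : Agree k X₁ X
      X-old = update-agree X k v

      hd-old : Agree k hd₁ hd
      hd-old = branch-agree (update-agree D k d) X-old (update-agree Q k p)

      tl-old : Agree k tl₁ tl
      tl-old = branch-agree (update-agree D k d) (update-agree Q k p) X-old

      F-old : Agree k F₁ F
      F-old = update-agree F k f

      drop : ∀ {h} (w : ℕ → ℕ) u → flow m h (update w e 0) u + pick (h e) u (w e) ≡ flow m h w u
      drop {h} w u = trans (flow-update {h = h} w u 0 e<m)
        (trans (cong (flow m h w u +_) (n≤0⇒n≡0 (pick-≤ (h e) u 0))) (+-identityʳ _))

      subtract : ∀ (g w : ℕ → ℕ) c → w e ≡ c → (∀ u → g u ≡ flow m src w u + flow m dst w u) → ∀ u →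
        update (update g E.a (g E.a ∸ c)) E.b (update g E.a (g E.a ∸ c) E.b ∸ c) u
          ≡ flow m src (update w e 0) u + flow m dst (update w e 0) u
      subtract g w c refl g≡ u = begin
        update (update g E.a (g E.a ∸ c)) E.b (update g E.a (g E.a ∸ c) E.b ∸ c) u
          ≡⟨ update-sub (update g E.a (g E.a ∸ c)) E.b c u ⟩
        update g E.a (g E.a ∸ c) u ∸ pick E.b u c ≡⟨ cong (_∸ pick E.b u c) (update-sub g E.a c u) ⟩
        g u ∸ pick E.a u c ∸ pick E.b u c ≡⟨ cong₂ (λ y z → g u ∸ pick y u c ∸ pick z u c) a≡ b≡ ⟩
        g u ∸ pick (src e) u c ∸ pick (dst e) u c
          ≡⟨ cong (λ z → z ∸ pick (src e) u c ∸ pick (dst e) u c) (trans (g≡ u) (cong₂ _+_ (sym (drop {src} w u)) (sym (drop {dst} w u)))) ⟩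
        (A + pa) + (B + pb) ∸ pa ∸ pb ≡⟨ cong (λ z → z ∸ pa ∸ pb) (trans (cong (_+ (B + pb)) (+-comm A pa)) (+-assoc pa A (B + pb))) ⟩
        pa + (A + (B + pb)) ∸ pa ∸ pb ≡⟨ cong (_∸ pb) (m+n∸m≡n pa (A + (B + pb))) ⟩
        A + (B + pb) ∸ pb ≡⟨ cong (_∸ pb) (sym (+-assoc A B pb)) ⟩
        (A + B) + pb ∸ pb ≡⟨ m+n∸n≡m (A + B) pb ⟩
        A + B ∎
        where
        open ≡-Reasoning
        pa = pick (src e) u c
        pb = pick (dst e) u c
        A = flow m src (update w e 0) u
        B = flow m dst (update w e 0) u

      degree-falls : ∀ u → degree polytree al₁ u + (pick (src e) u 1 + pick (dst e) u 1) ≡ degree polytree al u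
      degree-falls u = trans (sym (+-assoc (degree polytree al₁ u) _ _)) (trans
        (cong₂ (λ y z → degree polytree al₁ u + pick (src e) u y + pick (dst e) u z) (sym alive) (sym alive))
        (trans (+-shuffle (flow m src al₁ u) _ _ _) (cong₂ _+_ (drop {src} al u) (drop {dst} al u))))

      touches : 1 ≤ pick (src e) v 1 + pick (dst e) v 1
      touches = by-dir
        (λ _ _ r → ≤-trans (≤-reflexive (sym (pick-same 1 r))) (m≤n+m _ (pick (src e) v 1)))
        (λ _ r _ → ≤-trans (≤-reflexive (sym (pick-same 1 r))) (m≤m+n _ _))

      touches-p : 1 ≤ pick (src e) p 1 + pick (dst e) p 1
      touches-p = by-dir
        (λ _ r _ → ≤-trans (≤-reflexive (sym (pick-same 1 r))) (m≤m+n _ _))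
        (λ _ _ r → ≤-trans (≤-reflexive (sym (pick-same 1 r))) (m≤n+m _ (pick (src e) p 1)))

      -- A removed child has no present arc left, whereas `u` is an end of `e`.
      fresh : ∀ {u} → 1 ≤ pick (src e) u 1 + pick (dst e) u 1 → ∀ {i} → i < k → X i ≢ u
      fresh {u} t {i} i< refl = ≥1⇒≢0 (≤-trans t (m≤n+m _ (degree polytree al₁ u)))
        (trans (degree-falls u) (gone i<))

      gone-v : degree polytree al₁ v ≡ 0
      gone-v = n≤0⇒n≡0 (+-cancelʳ-≤ 1 _ 0 (≤-trans (+-monoʳ-≤ (degree polytree al₁ v) touches)
        (≤-reflexive (trans (degree-falls v) (trans (sym (deg≡ v)) leaf)))))

      v<n : v < n
      v<n = by-dir (λ _ _ r → subst (_< n) r (dst<n e<m)) (λ _ r _ → subst (_< n) r (src<n e<m))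

      p<n : p < n
      p<n = by-dir (λ _ r _ → subst (_< n) r (src<n e<m)) (λ _ _ r → subst (_< n) r (dst<n e<m))

      v≢p : v ≢ p
      v≢p = by-dir (λ _ r r′ eq → src≢dst e<m (trans r (trans (sym eq) (sym r′))))
        (λ _ r r′ eq → src≢dst e<m (trans r (trans eq (sym r′))))

      sums : ∀ {h h₁ : ℕ → ℕ} {g : ℕ → ℕ} {w} → (∀ u → g u ≡ flow k h F u) → Agree k h₁ h → w ≡ h₁ k →
        ∀ u → update g w (g w + f) u ≡ flow (suc k) h₁ F₁ u
      sums {h} {h₁} {g} {w} g≡ ag refl u = trans (update-add g w f u) (cong₂ _+_
        (trans (g≡ u) (sym (flow-agree u ag F-old))) (cong (pick w u) (sym (update-same F k k refl))))

      at : ∀ {i} {R : Set} → i < suc k → (i < k → R) → (i ≡ k → R) → R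
      at i< g h with m≤n⇒m<n∨m≡n (≤-pred i<)
      ... | inj₁ lt = g lt
      ... | inj₂ eq = h eq

      al₁≤1 : ∀ e′ → al₁ e′ ≤ 1
      al₁≤1 e′ = update-elim {f = al} (_≤ 1) e′ (λ _ → z≤n) (λ _ → al≤1 e′)

      aw₁≡ : ∀ e′ → 1 ≤ al₁ e′ → aw₁ e′ ≡ e′
      aw₁≡ e′ q with e′ ≟ e
      ... | yes eq = ⊥-elim (≥1⇒≢0 q (update-same al e e′ eq))
      ... | no ne = trans (update-other aw e e′ ne) (aw≡ e′ (subst (1 ≤_) (update-other al e e′ ne) q))

      aw₁≡0 : ∀ e′ → al₁ e′ ≡ 0 → aw₁ e′ ≡ 0
      aw₁≡0 e′ q with e′ ≟ e
      ... | yes eq = update-same aw e e′ eq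
      ... | no ne = trans (update-other aw e e′ ne) (aw≡0 e′ (trans (sym (update-other al e e′ ne)) q))

      F-new : F₁ k ≡ demand n I J X₁ D₁ tl₁ hd₁ F₁ k
      F-new rewrite update-same X k {v} k refl | update-same D k {d} k refl | update-same F k {f} k refl
                  | flow-agree {k} {tl₁} {tl} {F₁} {F} v tl-old F-old | flow-agree {k} {hd₁} {hd} {F₁} {F} v hd-old F-old
                  | sym (IN≡ v) | sym (OUT≡ v) = f≡

      peeled : Peel (suc k) al₁ s′
      peeled = record
        { s0 = trans E.s0 s0 ; src≡ = trans E.a0 src≡ ; dst≡ = trans E.a1 dst≡ ; I≡ = trans E.a2 I≡ ; J≡ = trans E.a3 J≡
        ; state = peel-cong E.X′ E.Q′ E.D′ E.F′ E.N′ E.O′ E.deg′ E.idx′ (record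
          { aw = aw₁ ; al≤1 = al₁≤1 ; aw≡ = aw₁≡ ; aw≡0 = aw₁≡0
          ; deg≡ = subtract (array s 4) al 1 alive deg≡
          ; idx≡ = subtract (array s 5) aw e (aw≡ e (≡1⇒≥1 alive)) idx≡
          ; order = order-snoc order v<n p<n v≢p (fresh touches) (fresh touches-p)
          ; gone = λ i< → at i< (λ lt → n≤0⇒n≡0 (≤-trans (≤-trans (m≤m+n _ _) (≤-reflexive (degree-falls _)))
                     (≤-reflexive (trans (cong (degree polytree al) (X-old lt)) (gone lt)))))
                   (λ { refl → trans (cong (degree polytree al₁) (update-same X k k refl)) gone-v })
          ; back = λ i< → at i< (λ lt → let (e′ , e′< , q , r) = back lt in e′ , e′< , trans (tl-old lt) q , trans (hd-old lt) r)
                   (λ { refl → e , e<m , tl-new , hd-new })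
          ; cover = cover₁
          ; count = trans (sym (+-suc k _)) (trans (cong (k +_) (trans (+-comm 1 _)
                (trans (cong (sum< m al₁ +_) (sym alive)) (trans (sum-update m al 0 e<m) (+-identityʳ _))))) count)
          ; IN≡ = sums IN≡ hd-old (trans h≡ (sym hd-new))
          ; OUT≡ = sums OUT≡ tl-old (trans t≡ (sym tl-new))
          ; F≡ = λ j< → at j< (λ lt → trans (F-old lt) (trans (F≡ lt) (sym (demand-agree {n} {I} {J} X-old (update-agree D k d) tl-old hd-old F-old lt))))
                   (λ { refl → F-new }) }) }
        where
        cover₁ : ∀ {e′} → e′ < m → 1 ≤ al₁ e′ ⊎ (∃[ i ] i < suc k × tl₁ i ≡ src e′ × hd₁ i ≡ dst e′)
        cover₁ {e′} e′< with e′ ≟ e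
        ... | yes refl = inj₂ (k , n<1+n k , tl-new , hd-new)
        ... | no ne with cover e′<
        ...   | inj₁ q = inj₁ (subst (1 ≤_) (sym (update-other al e e′ ne)) q)
        ...   | inj₂ (i , i< , q , r) = inj₂ (i , <-trans i< (n<1+n k) , trans (tl-old i<) q , trans (hd-old i<) r)

  record Peeled (s : State) : Set where
    field
      order : Order n m (array s 6) (array s 7)
      back  : ∀ {i} → i < m → ∃[ e ] e < m × tail-of (array s 6) (array s 7) (array s 8) i ≡ src e
                                            × head-of (array s 6) (array s 7) (array s 8) i ≡ dst e
      cover : ∀ {e} → e < m → ∃[ i ] i < m × tail-of (array s 6) (array s 7) (array s 8) i ≡ src e
                                           × head-of (array s 6) (array s 7) (array s 8) i ≡ dst e
      IN≡   : ∀ v → array s 10 v ≡ flow m (head-of (array s 6) (array s 7) (array s 8)) (array s 9) v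
      OUT≡  : ∀ v → array s 11 v ≡ flow m (tail-of (array s 6) (array s 7) (array s 8)) (array s 9) v
      F≡    : ∀ {j} → j < m → array s 9 j ≡ demand n I J (array s 6) (array s 8)
                (tail-of (array s 6) (array s 7) (array s 8)) (head-of (array s 6) (array s 7) (array s 8)) (array s 9) j

  -- Scalar 2 runs up to `suc n`. The last fetch makes `n` current, which is no vertex; by then the
  -- chain begun at vertex `n - 1` is finished as well, and `seen` speaks of all vertices. The
  -- measure adds the arcs present and the fetches to come.
  record PeelInv (μ : ℕ) (s : State) : Set where
    field
      al    : ℕ → ℕ
      inv   : Peel (scalar s 4) al s
      i≤    : scalar s 2 ≤ suc n
      μ≡    : sum< m al + (suc n ∸ scalar s 2) ≡ μ
      seen  : ∀ {u} → u < scalar s 2 → u ≢ scalar s 3 → array s 4 u ≢ 1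
      idle  : scalar s 2 ≡ suc n → scalar s 3 ≡ n

  peel-body : ∀ μ s → PeelInv μ s → (scalar s 0 + 1) ∸ scalar s 2 ≢ 0 →
    Ends peelBody s (steps peelBody) (λ s′ → ∃[ μ′ ] μ′ < μ × PeelInv μ′ s′)
  peel-body μ s P more = ends-wp peelBody (advance , chop)
    where
    open PeelInv P
    open Peel inv
    i≤n : scalar s 2 ≤ n
    i≤n = ≤-pred (≤∧≢⇒< i≤ (λ eq → more (trans (cong₂ _∸_ (trans (cong (_+ 1) s0) (+-comm n 1)) eq) (n∸n≡0 (suc n)))))
    advance : 1 ≤ (array s 4 (scalar s 3) ∸ 1) + (1 ∸ array s 4 (scalar s 3)) → _
    advance ne = sum< m al + (suc n ∸ (scalar s 2 + 1)) ,
      ≤-trans (+-monoʳ-< (sum< m al) (≤-trans (s≤s (≤-reflexive (cong (suc n ∸_) (+-comm (scalar s 2) 1))))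
        (≤-reflexive (sym (+-∸-assoc 1 i≤n))))) (≤-reflexive μ≡) , record
      { al = al ; inv = record { s0 = s0 ; src≡ = src≡ ; dst≡ = dst≡ ; I≡ = I≡ ; J≡ = J≡ ; state = state }
      ; i≤ = ≤-trans (≤-reflexive (+-comm _ 1)) (s≤s i≤n)
      ; μ≡ = refl
      ; seen = seen′
      ; idle = λ eq → suc-injective (trans (+-comm 1 _) eq) }
      where
      seen′ : ∀ {u} → u < scalar s 2 + 1 → u ≢ scalar s 2 → array s 4 u ≢ 1
      seen′ {u} u< ne′ with u ≟ scalar s 3
      ... | yes refl = ≠-true _ 1 ne
      ... | no ne″ = seen (≤∧≢⇒< (≤-pred (≤-trans u< (≤-reflexive (+-comm _ 1)))) ne′) ne″
    chop : (array s 4 (scalar s 3) ∸ 1) + (1 ∸ array s 4 (scalar s 3)) ≡ 0 → _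
    chop eq = down , up
      where
      v = scalar s 3
      leaf : array s 4 v ≡ 1
      leaf = ≠-false _ 1 eq
      module L = Leaf inv {v} leaf
      result : ∀ {s′ p d f} (dir : (d ≡ 0 × src L.e ≡ p × dst L.e ≡ v) ⊎ (d ≡ 1 × src L.e ≡ v × dst L.e ≡ p))
        (E : Effects s s′ v p d f) f≡ → scalar s′ 2 ≡ scalar s 2 → scalar s′ 3 ≡ p →
        ∃[ μ′ ] μ′ < μ × PeelInv μ′ s′
      result {s′} {p} dir E f≡ e₂ e₃ = _ , ≤-trans (≤-reflexive smaller) (≤-reflexive μ≡) , record
        { al = update al L.e 0 ; inv = subst (λ z → Peel z _ s′) (trans (+-comm 1 _) (sym (Effects.s4 E))) peeled′
        ; i≤ = subst (_≤ suc n) (sym e₂) i≤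
        ; μ≡ = refl
        ; seen = seen′
        ; idle = λ eq′ → ⊥-elim (1+n≰n (≤-trans (≤-reflexive (trans (sym eq′) e₂)) i≤n)) }
        where
        peeled′ = L.peeled dir E f≡
        smaller : suc (sum< m (update al L.e 0) + (suc n ∸ scalar s′ 2)) ≡ sum< m al + (suc n ∸ scalar s 2)
        smaller = cong₂ _+_ (trans (+-comm 1 _) (trans (cong (sum< m (update al L.e 0) +_) (sym L.alive))
            (trans (sum-update m al 0 L.e<m) (+-identityʳ _)))) (cong (suc n ∸_) e₂)
        seen′ : ∀ {u} → u < scalar s′ 2 → u ≢ scalar s′ 3 → array s′ 4 u ≢ 1
        seen′ {u} u< ne eq′ with u ≟ v
        ... | yes refl = ≥1⇒≢0 (≡1⇒≥1 eq′) (trans (Peel.deg≡ peeled′ u) (L.gone-v dir E f≡))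
        -- Degrees fall only at `v` and at the new current vertex `p`.
        ... | no nv = seen (subst (u <_) e₂ u<) nv (trans (deg≡ u) (trans (sym (L.degree-falls dir E f≡ u)) (trans
                (cong₂ (λ a b → a + b) (trans (sym (Peel.deg≡ peeled′ u)) eq′) (off u nv (λ up → ne (trans up (sym e₃)))))
                refl)))
          where
          off : ∀ u → u ≢ v → u ≢ p → pick (src L.e) u 1 + pick (dst L.e) u 1 ≡ 0
          off u nv np = go dir
            where
            go : _ → pick (src L.e) u 1 + pick (dst L.e) u 1 ≡ 0
            go (inj₁ (_ , a , b)) = cong₂ _+_ (pick-other 1 (λ q → np (trans (sym q) a))) (pick-other 1 (λ q → nv (trans (sym q) b)))
            go (inj₂ (_ , a , b)) = cong₂ _+_ (pick-other 1 (λ q → nv (trans (sym q) a))) (pick-other 1 (λ q → np (trans (sym q) b)))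
      values : ∀ {f g} → array s 3 v + array s 11 v ≡ f → array s 2 v + array s 10 v ≡ g →
        scalar s 0 ∸ (scalar s 0 ∸ (f ∸ g)) ≡ n ∸ (n ∸ ((J v + array s 11 v) ∸ (I v + array s 10 v)))
      values refl refl rewrite s0 | I≡ | J≡ = refl
      values′ : ∀ {f g} → array s 3 v + array s 11 v ≡ f → array s 2 v + array s 10 v ≡ g →
        scalar s 0 ∸ (scalar s 0 ∸ (g ∸ f)) ≡ n ∸ (n ∸ ((I v + array s 10 v) ∸ (J v + array s 11 v)))
      values′ refl refl rewrite s0 | I≡ | J≡ = refl
      added : ∀ f y {c} → update f y (f y + update (array s 9) (scalar s 4) c (scalar s 4)) ≡ update f y (f y + c)
      added f y = cong (λ z → update f y (f y + z)) (update-same (array s 9) (scalar s 4) (scalar s 4) refl)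
      down : 1 ≤ (array s 0 L.e ∸ v) + (v ∸ array s 0 L.e) → _
      down ne = result (inj₁ (refl , sym (cong (λ g → g L.e) src≡) , dst-v))
        (record { s0 = refl ; s4 = refl ; a0 = refl ; a1 = refl ; a2 = refl ; a3 = refl
          ; X′ = refl ; Q′ = refl ; D′ = refl ; F′ = refl ; O′ = added (array s 11) _ ; N′ = added (array s 10) _ ; deg′ = refl ; idx′ = refl })
        (values refl refl) refl refl
        where
        dst-v : dst L.e ≡ v
        dst-v with proj₂ (proj₂ L.incident)
        ... | inj₁ (a , _) = ⊥-elim (≠-true _ v ne (trans (cong (λ g → g L.e) src≡) a))
        ... | inj₂ (b , _) = b
      up : (array s 0 L.e ∸ v) + (v ∸ array s 0 L.e) ≡ 0 → _
      up eq = result (inj₂ (refl , src-v , sym (cong (λ g → g L.e) dst≡)))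
        (record { s0 = refl ; s4 = refl ; a0 = refl ; a1 = refl ; a2 = refl ; a3 = refl
          ; X′ = refl ; Q′ = refl ; D′ = refl ; F′ = refl ; O′ = added (array s 11) _ ; N′ = added (array s 10) _ ; deg′ = refl ; idx′ = refl })
        (values′ refl refl) refl refl
        where
        src-v : src L.e ≡ v
        src-v = trans (sym (cong (λ g → g L.e) src≡)) (≠-false _ v eq)

module Preparation {n} {G : Digraph n} (polytree : IsPolytree G) (I J : ℕ → ℕ) where
  open Arcs G
  open Peeling polytree I J
  open PeelLoop polytree I J

  all-present : ℕ → ℕ
  all-present _ = 1

  sum-ones : ∀ k → sum< k all-present ≡ k
  sum-ones zero    = refl
  sum-ones (suc k) = trans (cong (_+ 1) (sum-ones k)) (+-comm k 1)

  peel-start : ∀ {s s′} → Initial s → Initialized m s′ → Framed initialize s s′ →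
    PeelInv (m + suc n) ⟨ update (update (update (scalar s′) 2 0) 3 0) 4 0 , array s′ ⟩
  peel-start {s} {s′} init ready (fA , fS) = record
    { al = all-present
    ; inv = record
      { s0 = trans (fS 0 refl) init.s0 ; src≡ = ready.src≡ ; dst≡ = ready.dst≡
      ; I≡ = trans (fA 2 refl) init.a2 ; J≡ = trans (fA 3 refl) init.a3
      ; state = record
        { aw = λ e → e ; al≤1 = λ _ → ≤-refl ; aw≡ = λ _ _ → refl ; aw≡0 = λ _ ()
        ; deg≡ = ready.degree≡ ; idx≡ = ready.index≡
        ; order = record { X<n = λ () ; Q<n = λ () ; X≢Q = λ () ; X≢X = λ { _ () } ; X≢Q> = λ { _ () } }
        ; gone = λ () ; back = λ () ; cover = λ _ → inj₁ ≤-refl ; count = sum-ones m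
        ; IN≡ = λ v → trans (cong (λ g → g v) (fA 10 refl)) (init.zero-array 10 v (≤ᵇ⇒≤ 4 10 _))
        ; OUT≡ = λ v → trans (cong (λ g → g v) (fA 11 refl)) (init.zero-array 11 v (≤ᵇ⇒≤ 4 11 _))
        ; F≡ = λ () } }
    ; i≤ = z≤n
    ; μ≡ = cong (_+ suc n) (sum-ones m)
    ; seen = λ ()
    ; idle = λ () }
    where
    module init = Initial init
    module ready = Initialized ready

  -- After the scan no vertex has degree one, so `leafless-dead` leaves no arc and all `m` have been
  -- ordered.
  peel-done : ∀ {s μ} → PeelInv μ s → (scalar s 0 + 1) ∸ scalar s 2 ≡ 0 → Peeled s
  peel-done {s} P z = record
    { order = subst (λ k → Order n k (array s 6) (array s 7)) k≡m order
    ; back = λ i< → back (subst (_ <_) (sym k≡m) i<)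
    ; cover = cover′
    ; IN≡ = λ v → trans (IN≡ v) (cong (λ k → flow k (head-of (array s 6) (array s 7) (array s 8)) (array s 9) v) k≡m)
    ; OUT≡ = λ v → trans (OUT≡ v) (cong (λ k → flow k (tail-of (array s 6) (array s 7) (array s 8)) (array s 9) v) k≡m)
    ; F≡ = λ j< → F≡ (subst (_ <_) (sym k≡m) j<) }
    where
    open PeelInv P
    open Peel inv
    i≡ : scalar s 2 ≡ suc n
    i≡ = ≤-antisym i≤ (≤-trans (≤-reflexive (trans (+-comm 1 n) (cong (_+ 1) (sym s0)))) (m∸n≡0⇒m≤n z))
    dead : ∀ {e} → e < m → al e ≡ 0
    dead = leafless-dead polytree al≤1 (λ {v} v< eq → seen (≤-trans (<-trans v< (n<1+n n)) (≤-reflexive (sym i≡)))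
      (λ eq′ → <⇒≢ v< (trans eq′ (idle i≡))) (trans (deg≡ v) eq))
    k≡m : scalar s 4 ≡ m
    k≡m = trans (sym (+-identityʳ _)) (trans (cong (scalar s 4 +_) (sym (sum-zero m dead))) count)
    cover′ : ∀ {e} → e < m → ∃[ i ] i < m × tail-of (array s 6) (array s 7) (array s 8) i ≡ src e
                                          × head-of (array s 6) (array s 7) (array s 8) i ≡ dst e
    cover′ e< with cover e<
    ... | inj₁ p = ⊥-elim (≥1⇒≢0 p (dead e<))
    ... | inj₂ (i , i< , r) = i , subst (i <_) k≡m i< , r

  peel-ends : ∀ {s s′} → Initial s → Initialized m s′ → Framed initialize s s′ →
    Ends peel s′ (2 + (2 + (2 + suc (m + suc n) * (6 + steps peelBody)))) (λ s″ → Peeled s″ × Framed peel s′ s″)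
  peel-ends {s} {s′} init ready fr = ends-framed (ends-seq {P = λ t → t ≡ s₁} (ends-wp (2 ≔ lit 0) refl)
    (λ { _ refl → ends-seq {P = λ t → t ≡ s₂} (ends-wp (3 ≔ lit 0) refl)
    (λ { _ refl → ends-seq {P = λ t → t ≡ s₃} (ends-wp (4 ≔ lit 0) refl)
    (λ { _ refl → ends-weaken ≤-refl (λ t (μ , P , z) → peel-done P z)
      (ends-while PeelInv peel-body (m + suc n) s₃ (peel-start init ready fr)) }) }) }))
    where
    s₁ s₂ s₃ : State
    s₁ = ⟨ update (scalar s′) 2 0 , array s′ ⟩
    s₂ = ⟨ update (scalar s₁) 3 0 , array s′ ⟩
    s₃ = ⟨ update (scalar s₂) 4 0 , array s′ ⟩

  prepare : ∀ {s C c P} → Initial s → (∀ s″ → Peeled s″ → (∀ a → writesA a (initialize ⨾ peel) ≡ false → array s″ a ≡ array s a) →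
      (∀ x → writesS x (initialize ⨾ peel) ≡ false → scalar s″ x ≡ scalar s x) → Ends C s″ c P) →
    Ends (initialize ⨾ peel ⨾ C) s ((2 + suc m * 40) + ((6 + suc (m + suc n) * (6 + steps peelBody)) + c)) P
  prepare {s} init k = ends-seq (initialize-ends init) (λ s′ (ready , fr) →
    ends-seq (peel-ends init ready fr) (λ s″ (done , fA , fS) → k s″ done
      (λ a w → trans (fA a (proj₂ (∨-false {writesA a initialize} w))) (proj₁ fr a (proj₁ (∨-false w))))
      (λ x w → trans (fS x (proj₂ (∨-false {writesS x initialize} w))) (proj₂ fr x (proj₁ (∨-false w))))))

-- Correctness of the greedy labelling

-- One kind of labels: S for tokens of I and their tails t, or T for those of
-- J and their heads.
record Side (k : ℕ) (t h set F lab sat taken : ℕ → ℕ) : Set where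
  field
    new    : ∀ {i} → k ≤ i → lab i ≡ 0
    flows  : ∀ {i} → i < k → 1 ≤ lab i → 1 ≤ F i × 1 ≤ set (t i)
    sat→   : ∀ {u} → 1 ≤ sat u → ∃[ i ] i < k × t i ≡ u × 1 ≤ lab i
    →sat   : ∀ {i} → i < k → 1 ≤ lab i → 1 ≤ sat (t i)
    taken→ : ∀ {w} → 1 ≤ taken w → ∃[ i ] i < k × h i ≡ w × 1 ≤ lab i
    →taken : ∀ {i} → i < k → 1 ≤ lab i → taken (h i) ≡ suc (t i)
    tails  : ∀ {i j} → i < k → j < k → 1 ≤ lab i → 1 ≤ lab j → t i ≡ t j → i ≡ j
    heads  : ∀ {i j} → i < k → j < k → 1 ≤ lab i → 1 ≤ lab j → h i ≡ h j → i ≡ j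

-- The labels of some plan, to be compared with those of the greedy algorithm.
record Star (n m : ℕ) (t h set F : ℕ → ℕ) (L : ℕ → Set) : Set where
  field
    flows : ∀ {i} → i < m → L i → 1 ≤ F i × 1 ≤ set (t i)
    heads : ∀ {i j} → i < m → j < m → L i → L j → h i ≡ h j → i ≡ j
    any   : ∀ {i} → i < m → 1 ≤ F i → 1 ≤ set (t i) → ∃[ i′ ] i′ < m × t i′ ≡ t i × L i′

-- The greedy labels serve whatever the reference labels serve, and they occupy a vertex not yet
-- eliminated only if the reference labels do so too. Hence they never obstruct a later reference
-- label.
record Dominates (k : ℕ) (X t h lab sat : ℕ → ℕ) (L : ℕ → Set) : Set where
  field
    covers : ∀ {i} → i < k → L i → 1 ≤ sat (t i)
    within : ∀ {i} → i < k → 1 ≤ lab i → (∀ {i′} → i′ < k → X i′ ≢ h i) → ∃[ i′ ] i′ < k × h i′ ≡ h i × L i′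

module _ {k : ℕ} {R : ℕ → Set} where
  up-to : (∀ {i} → i < k → R i) → R k → ∀ {i} → i < suc k → R i
  up-to f g {i} i< with m≤n⇒m<n∨m≡n (≤-pred i<)
  ... | inj₁ lt = f lt
  ... | inj₂ refl = g

side-skip : ∀ {k t h set F lab sat taken} → Side k t h set F lab sat taken → Side (suc k) t h set F lab sat taken
side-skip {k} {lab = lab} A = record
  { new = λ p → new (<⇒≤ p)
  ; flows = λ i< p → flows (low i< p) p
  ; sat→ = λ p → let (i , i< , r) = sat→ p in i , <-trans i< (n<1+n k) , r
  ; →sat = λ i< p → →sat (low i< p) p
  ; taken→ = λ p → let (i , i< , r) = taken→ p in i , <-trans i< (n<1+n k) , r
  ; →taken = λ i< p → →taken (low i< p) p
  ; tails = λ i< j< p q → tails (low i< p) (low j< q) p q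
  ; heads = λ i< j< p q → heads (low i< p) (low j< q) p q }
  where
  open Side A
  low : ∀ {i} → i < suc k → 1 ≤ lab i → i < k
  low i< p = up-to {R = λ i → 1 ≤ lab i → i < _} (λ lt _ → lt) (λ q → ⊥-elim (≥1⇒≢0 q (new ≤-refl))) i< p

side-add : ∀ {k t h set F lab sat taken} → Side k t h set F lab sat taken →
  1 ≤ F k → 1 ≤ set (t k) → sat (t k) ≡ 0 → taken (h k) ≡ 0 →
  Side (suc k) t h set F (update lab k 1) (update sat (t k) 1) (update taken (h k) (t k + 1))
side-add {k} {t} {h} {set} {F} {lab} {sat} {taken} A f s z z′ = record
  { new = λ {i} p → trans (update-other lab k i (≢-sym (<⇒≢ p))) (new (<⇒≤ p))
  ; flows = up-to (λ i< p → flows i< (old i< p)) (λ _ → f , s)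
  ; sat→ = sat→′
  ; →sat = up-to (λ i< p → subst (1 ≤_) (sym (update-other sat (t k) _ (λ e → ≥1⇒≢0 (→sat i< (old i< p)) (trans (cong sat e) z)))) (→sat i< (old i< p)))
                 (λ _ → ≤-reflexive (sym (update-same sat (t k) (t k) refl)))
  ; taken→ = taken→′
  ; →taken = up-to (λ i< p → trans (update-other taken (h k) _ (λ e → ≥1⇒≢0 (≤-trans (s≤s z≤n) (≤-reflexive (sym (→taken i< (old i< p))))) (trans (cong taken e) z′))) (→taken i< (old i< p)))
                   (λ _ → trans (update-same taken (h k) (h k) refl) (+-comm (t k) 1))
  ; tails = λ i< j< → pair (λ a b p q e → tails a b p q e)
      (λ a p e → ≥1⇒≢0 (→sat a p) (trans (cong sat e) z)) i< j<
  ; heads = λ i< j< → pair (λ a b p q e → heads a b p q e)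
      (λ a p e → ≥1⇒≢0 (≤-trans (s≤s z≤n) (≤-reflexive (sym (→taken a p)))) (trans (cong taken e) z′)) i< j< }
  where
  open Side A
  old : ∀ {i} → i < k → 1 ≤ update lab k 1 i → 1 ≤ lab i
  old {i} i< p = subst (1 ≤_) (update-other lab k i (<⇒≢ i<)) p
  keep : ∀ {i} → i < k → 1 ≤ lab i → 1 ≤ update lab k 1 i
  keep {i} i< p = subst (1 ≤_) (sym (update-other lab k i (<⇒≢ i<))) p
  sat→′ : ∀ {u} → 1 ≤ update sat (t k) 1 u → ∃[ i ] i < suc k × t i ≡ u × 1 ≤ update lab k 1 i
  sat→′ {u} p with u ≟ t k
  ... | yes e = k , n<1+n k , sym e , ≤-reflexive (sym (update-same lab k k refl))
  ... | no ne with sat→ (subst (1 ≤_) (update-other sat (t k) u ne) p)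
  ...   | i , i< , e , q = i , <-trans i< (n<1+n k) , e , keep i< q
  taken→′ : ∀ {w} → 1 ≤ update taken (h k) (t k + 1) w → ∃[ i ] i < suc k × h i ≡ w × 1 ≤ update lab k 1 i
  taken→′ {w} p with w ≟ h k
  ... | yes e = k , n<1+n k , sym e , ≤-reflexive (sym (update-same lab k k refl))
  ... | no ne with taken→ (subst (1 ≤_) (update-other taken (h k) w ne) p)
  ...   | i , i< , e , q = i , <-trans i< (n<1+n k) , e , keep i< q
  pair : ∀ {g : ℕ → ℕ} → (∀ {i j} → i < k → j < k → 1 ≤ lab i → 1 ≤ lab j → g i ≡ g j → i ≡ j) →
    (∀ {i} → i < k → 1 ≤ lab i → g i ≡ g k → ⊥) →
    ∀ {i j} → i < suc k → j < suc k → 1 ≤ update lab k 1 i → 1 ≤ update lab k 1 j → g i ≡ g j → i ≡ j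
  pair f g {i} {j} i< j< p q e with m≤n⇒m<n∨m≡n (≤-pred i<) | m≤n⇒m<n∨m≡n (≤-pred j<)
  ... | inj₁ a | inj₁ b = f a b (old a p) (old b q) e
  ... | inj₁ a | inj₂ refl = ⊥-elim (g a (old a p) e)
  ... | inj₂ refl | inj₁ b = ⊥-elim (g b (old b q) (sym e))
  ... | inj₂ refl | inj₂ refl = refl

module Domination {n m X Q t h set F L} (O : Order n m X Q)
  (t-later : ∀ {i j} → i < j → j < m → X i ≢ t j) (h-later : ∀ {i j} → i < j → j < m → X i ≢ h j)
  (star : Star n m t h set F L) {k lab sat taken}
  (k< : k < m) (A : Side k t h set F lab sat taken) (dom : Dominates k X t h lab sat L) where
  open Star star
  open Side A using (taken→)
  open Dominates dom

  Within : (ℕ → ℕ) → ℕ → Set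
  Within lab′ i = 1 ≤ lab′ i → (∀ {i′} → i′ < suc k → X i′ ≢ h i) → ∃[ i′ ] i′ < suc k × h i′ ≡ h i × L i′

  live : ∀ lab′ → (∀ {i} → i < k → 1 ≤ lab′ i → 1 ≤ lab i) →
    ∀ {i} → i < k → Within lab′ i
  live lab′ old i< p f with within i< (old i< p) (λ lt → f (<-trans lt (n<1+n k)))
  ... | i′ , i′< , r = i′ , <-trans i′< (n<1+n k) , r

  skip-dominates : Side (suc k) t h set F lab sat taken → (L k → 1 ≤ sat (t k)) → lab k ≡ 0 → Dominates (suc k) X t h lab sat L
  skip-dominates A′ sk z = record
    { covers = up-to covers sk
    ; within = up-to {R = Within lab} (λ i< → live lab (λ _ p → p) i<) (λ p → ⊥-elim (≥1⇒≢0 p z)) }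

  -- An occupied child is eliminated along with arc `k`, so occupying it costs nothing. An occupied
  -- parent is occupied by the reference as well, by the same arc.
  add-dominates : ∀ {lab′} → (∀ {i} → i < k → 1 ≤ lab′ i → 1 ≤ lab i) →
    (h k ≡ X k ⊎ L k) → Dominates (suc k) X t h lab′ (update sat (t k) 1) L
  add-dominates {lab′} old r = record
    { covers = up-to (λ {i} i< l → update-elim {f = sat} {t k} (1 ≤_) (t i) (λ _ → ≤-refl) (λ _ → covers i< l))
        (λ _ → ≤-reflexive (sym (update-same sat (t k) (t k) refl)))
    ; within = up-to {R = Within lab′} (λ i< → live lab′ old i<) (λ _ f → at-k f r) }
    where
    at-k : (∀ {i′} → i′ < suc k → X i′ ≢ h k) → h k ≡ X k ⊎ L k → ∃[ i′ ] i′ < suc k × h i′ ≡ h k × L i′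
    at-k f (inj₁ e) = ⊥-elim (f (n<1+n k) (sym e))
    at-k f (inj₂ l) = k , n<1+n k , refl , l

  not-taken : L k → 1 ≤ taken (h k) → ⊥
  not-taken l p with taken→ p
  ... | i , i< , e , q with within i< q (λ i′< e′ → h-later i′< k< (trans e′ e))
  ...   | i′ , i′< , e′ , l′ = <⇒≢ i′< (heads (<-trans i′< k<) k< l′ l (trans e′ e))

  -- A token on the child that is still waiting must leave along arc k.
  forced : t k ≡ X k → 1 ≤ F k → 1 ≤ set (t k) → sat (t k) ≡ 0 → L k
  forced e f s z with any k< f s
  ... | i , i< , e′ , l with <-cmp i k
  ...   | tri< lt _ _ = ⊥-elim (≥1⇒≢0 (covers lt l) (trans (cong sat e′) z))
  ...   | tri≈ _ refl _ = l
  ...   | tri> _ _ gt = ⊥-elim (t-later gt i< (sym (trans e′ e)))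

guard-true : ∀ set sat taken other f c →
  let _∧_ : ℕ → ℕ → ℕ
      _∧_ = λ a b → a ∸ (a ∸ b) in
  1 ≤ set ∧ ((1 ∸ sat) ∧ ((1 ∸ taken) ∧ (1 ∸ (other ∧ ((1 ∸ (f ∸ 1)) ∧ (c ∸ 1 ∸ 1)))))) →
  1 ≤ set × sat ≡ 0 × taken ≡ 0 × (1 ≤ other → f ≤ 1 → c ≤ 2)
guard-true set sat taken other f c p =
  let (a , p₁) = ∧-true set _ p
      (b , p₂) = ∧-true (1 ∸ sat) _ p₁
      (d , p₃) = ∧-true (1 ∸ taken) _ p₂
      z = not-true _ p₃
  in a , not-true sat b , not-true taken d , λ o f≤ → ≮⇒≥ (λ c> → ∧-false other _ z o (pos f≤ c>))
  where
  pos : f ≤ 1 → 2 < c → 1 ≤ (1 ∸ (f ∸ 1)) ∸ ((1 ∸ (f ∸ 1)) ∸ (c ∸ 1 ∸ 1))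
  pos f≤ c> rewrite m≤n⇒m∸n≡0 f≤ = big c>
    where
    big : ∀ {c} → 2 < c → 1 ≤ 1 ∸ (1 ∸ (c ∸ 1 ∸ 1))
    big {suc (suc (suc c′))} _ = ≤-reflexive (cong (1 ∸_) (sym (0∸n≡0 c′)))
    big {1} (s≤s ())
    big {2} (s≤s (s≤s ()))

guard-false : ∀ set sat taken other f c →
  let _∧_ : ℕ → ℕ → ℕ
      _∧_ = λ a b → a ∸ (a ∸ b) in
  set ∧ ((1 ∸ sat) ∧ ((1 ∸ taken) ∧ (1 ∸ (other ∧ ((1 ∸ (f ∸ 1)) ∧ (c ∸ 1 ∸ 1)))))) ≡ 0 →
  1 ≤ set → sat ≡ 0 → taken ≡ 0 → (1 ≤ other → f ≤ 1 → c ≤ 2) → ⊥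
guard-false set _ _ other f c z s refl refl free = ∧-false set _ z s (≤-reflexive (sym chain))
  where
  B = other ∸ (other ∸ ((1 ∸ (f ∸ 1)) ∸ ((1 ∸ (f ∸ 1)) ∸ (c ∸ 1 ∸ 1))))
  B≡0 : B ≡ 0
  B≡0 with zero⊎pos B
  ... | inj₁ e = e
  ... | inj₂ p with ∧-true other _ p
  ...   | o , p₁ with ∧-true (1 ∸ (f ∸ 1)) (c ∸ 1 ∸ 1) p₁
  ...     | p₂ , p₃ = ⊥-elim (≥1⇒≢0 p₃ (trans (∸-+-assoc c 1 1) (m≤n⇒m∸n≡0 (free o (m∸n≡0⇒m≤n (not-true _ p₂))))))
  chain : 1 ∸ (1 ∸ (1 ∸ (1 ∸ (1 ∸ B)))) ≡ 1
  chain rewrite B≡0 = refl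

-- Both branches keep the verdict of the guard: completeness needs to know that skipping was
-- unavoidable.
data Outcome (k u w c : ℕ) (set F other lab sat taken lab′ sat′ taken′ : ℕ → ℕ) : Set where
  skipped : lab′ ≡ lab → sat′ ≡ sat → taken′ ≡ taken →
    (1 ≤ set u → sat u ≡ 0 → taken w ≡ 0 → (1 ≤ other k → F k ≤ 1 → c ≤ 2) → ⊥) → Outcome k u w c set F other lab sat taken lab′ sat′ taken′
  labelled : lab′ ≡ update lab k 1 → sat′ ≡ update sat u 1 → taken′ ≡ update taken w (u + 1) →
    1 ≤ set u → sat u ≡ 0 → taken w ≡ 0 → (1 ≤ other k → F k ≤ 1 → c ≤ 2) → Outcome k u w c set F other lab sat taken lab′ sat′ taken′

labelS-ends : ∀ s → Ends labelS s (steps labelS) (λ s′ → Outcome (scalar s 2) (scalar s 5) (scalar s 6)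
  (array s 10 (scalar s 6) + array s 11 (scalar s 5)) (array s 2) (array s 9) (array s 13)
  (array s 12) (array s 14) (array s 15) (array s′ 12) (array s′ 14) (array s′ 15))
labelS-ends s = ends-wp labelS
  ( (λ p → let (a , b , c , d) = guard-true _ _ _ _ _ _ p in labelled refl refl refl a b c d)
  , (λ z → skipped refl refl refl (guard-false _ _ _ _ _ _ z)))

labelT-ends : ∀ s → Ends labelT s (steps labelT) (λ s′ → Outcome (scalar s 2) (scalar s 6) (scalar s 5)
  (array s 10 (scalar s 6) + array s 11 (scalar s 5)) (array s 3) (array s 9) (array s 12)
  (array s 13) (array s 16) (array s 17) (array s′ 13) (array s′ 16) (array s′ 17))
labelT-ends s = ends-wp labelT
  ( (λ p → let (a , b , c , d) = guard-true _ _ _ _ _ _ p in labelled refl refl refl a b c d)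
  , (λ z → skipped refl refl refl (guard-false _ _ _ _ _ _ z)))

module LabelStep {n m X Q} (O : Order n m X Q) where

  side-step : ∀ {k c t h set F other lab sat taken lab′ sat′ taken′} → Side k t h set F lab sat taken →
    1 ≤ F k → Outcome k (t k) (h k) c set F other lab sat taken lab′ sat′ taken′ →
    Side (suc k) t h set F lab′ sat′ taken′ × Agree k lab′ lab × (1 ≤ lab′ k → 1 ≤ other k → F k ≤ 1 → c ≤ 2)
  side-step A f (skipped refl refl refl _) = side-skip A , (λ _ → refl) , λ p → ⊥-elim (≥1⇒≢0 p (Side.new A ≤-refl))
  side-step {k} {lab = lab} A f (labelled refl refl refl a b c d) = side-add A f a b c , update-agree lab k 1 , λ _ → d

  dominates-step : ∀ {k c t h set F L other lab sat taken lab′ sat′ taken′} → Side k t h set F lab sat taken →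
    1 ≤ F k → Outcome k (t k) (h k) c set F other lab sat taken lab′ sat′ taken′ → k < m →
    (∀ {i j} → i < j → j < m → X i ≢ t j) → (∀ {i j} → i < j → j < m → X i ≢ h j) →
    Star n m t h set F L → Dominates k X t h lab sat L →
    (L k → 1 ≤ other k → F k ≤ 1 → c ≤ 2) → t k ≡ X k ⊎ h k ≡ X k →
    Dominates (suc k) X t h lab′ sat′ L × (t k ≡ X k → 1 ≤ lab′ k → L k)
  dominates-step {k} {t = t} {h} {L = L} {sat = sat} {taken} A f (skipped refl refl refl no-label) k< tl-later hd-later star dom free side =
    skip-dominates (side-skip A) sk (Side.new A ≤-refl) , λ _ p → ⊥-elim (≥1⇒≢0 p (Side.new A ≤-refl))
    where
    open Domination O tl-later hd-later star k< A dom
    sk : L k → 1 ≤ sat (t k)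
    sk l with zero⊎pos (sat (t k)) | zero⊎pos (taken (h k))
    ... | inj₂ p | _ = p
    ... | inj₁ z | inj₂ p = ⊥-elim (not-taken l p)
    ... | inj₁ z | inj₁ z′ = ⊥-elim (no-label (proj₂ (Star.flows star k< l)) z z′ (free l))
  dominates-step {k} {t = t} {h} {L = L} {lab = lab} A f (labelled refl refl refl a b c d) k< tl-later hd-later star dom free side =
    add-dominates (λ {i} i< p → subst (1 ≤_) (update-other lab k i (<⇒≢ i<)) p) (at side) , λ e _ → forced e f a b
    where
    open Domination O tl-later hd-later star k< A dom
    at : t k ≡ X k ⊎ h k ≡ X k → h k ≡ X k ⊎ L k
    at (inj₁ e) = inj₂ (forced e f a b)
    at (inj₂ e) = inj₁ e

  dominates-idle : ∀ {k t h set F L lab sat taken} → Side k t h set F lab sat taken →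
    F k ≡ 0 → k < m → (∀ {i j} → i < j → j < m → X i ≢ t j) → (∀ {i j} → i < j → j < m → X i ≢ h j) →
    Star n m t h set F L → Dominates k X t h lab sat L → Dominates (suc k) X t h lab sat L
  dominates-idle A z k< tl-later hd-later star dom =
    skip-dominates (side-skip A) (λ l → ⊥-elim (≥1⇒≢0 (proj₁ (Star.flows star k< l)) z)) (Side.new A ≤-refl)
    where open Domination O tl-later hd-later star k< A dom

module LabelLoop {n m X Q} (O : Order n m X Q) (D F IN OUT I J : ℕ → ℕ) where
  open Order O
  open Ends-of O D
  open LabelStep O

  record Stars (LS LT : ℕ → Set) : Set where
    field
      starS : Star n m tl hd I F LS
      starT : Star n m hd tl J F LT
      both  : ∀ {i} → i < m → LS i → LT i → F i ≤ 1 → IN (hd i) + OUT (tl i) ≤ 2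

  Live₁ Live₂ : (ℕ → ℕ) → ℕ → Set
  Live₁ S i = 1 ≤ S i × 1 ≤ I (tl i) × 1 ≤ F i
  Live₂ T i = 1 ≤ T i × 1 ≤ F i

  record LabelsOf (k : ℕ) (S sS tS T sT tT : ℕ → ℕ) : Set where
    field
      sideS : Side k tl hd I F S sS tS
      sideT : Side k hd tl J F T sT tT
      both  : ∀ {i} → i < k → 1 ≤ S i → 1 ≤ T i → F i ≤ 1 → IN (hd i) + OUT (tl i) ≤ 2
      -- The comparison is with arbitrary reference labels; the program runs whether or not any
      -- exist.
      dom   : ∀ S* T* → Stars (Live₁ S*) (Live₂ T*) →
              Dominates k X tl hd S sS (Live₁ S*) × Dominates k X hd tl T sT (Live₂ T*)

  -- The child is at the tail of an upward arc; S comes first there.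
  labels-up : ∀ {k S sS tS T sT tT S′ sS′ tS′ T′ sT′ tT′} → LabelsOf k S sS tS T sT tT → k < m → 1 ≤ F k →
    tl k ≡ X k →
    Outcome k (tl k) (hd k) (IN (hd k) + OUT (tl k)) I F T S sS tS S′ sS′ tS′ →
    Outcome k (hd k) (tl k) (IN (hd k) + OUT (tl k)) J F S′ T sT tT T′ sT′ tT′ →
    LabelsOf (suc k) S′ sS′ tS′ T′ sT′ tT′
  labels-up {k} A k< f up oS oT with side-step (LabelsOf.sideS A) f oS | side-step (LabelsOf.sideT A) f oT
  ... | S₁ , agS , _ | T₁ , agT , lim = record
    { sideS = S₁ ; sideT = T₁
    ; both = up-to (λ i< p q → LabelsOf.both A i< (subst (1 ≤_) (agS i<) p) (subst (1 ≤_) (agT i<) q))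
                   (λ p q → lim q p)
    ; dom = dom′ }
    where
    dom′ : ∀ S* T* → Stars (Live₁ S*) (Live₂ T*) → _
    dom′ S* T* st with LabelsOf.dom A S* T* st
    ... | dS , dT with dominates-step (LabelsOf.sideS A) f oS k< X≢tl X≢hd (Stars.starS st) dS
            (λ _ p → ⊥-elim (≥1⇒≢0 p (Side.new (LabelsOf.sideT A) ≤-refl))) (inj₁ up)
    -- If S was just put on `k`, it was forced, so the reference has it too. Should the reference
    -- also have T there, its own condition `both` satisfies the guard.
    ...   | dS′ , fS = dS′ , proj₁ (dominates-step (LabelsOf.sideT A) f oT k< X≢hd X≢tl (Stars.starT st) dT
            (λ l p → Stars.both st k< (fS up p) l) (inj₂ up))

  -- The child is at the head: with time reversed, S and T exchange their roles.
  labels-down : ∀ {k S sS tS T sT tT S′ sS′ tS′ T′ sT′ tT′} → LabelsOf k S sS tS T sT tT → k < m → 1 ≤ F k →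
    hd k ≡ X k →
    Outcome k (hd k) (tl k) (IN (hd k) + OUT (tl k)) J F S T sT tT T′ sT′ tT′ →
    Outcome k (tl k) (hd k) (IN (hd k) + OUT (tl k)) I F T′ S sS tS S′ sS′ tS′ →
    LabelsOf (suc k) S′ sS′ tS′ T′ sT′ tT′
  labels-down {k} A k< f down oT oS with side-step (LabelsOf.sideS A) f oS | side-step (LabelsOf.sideT A) f oT
  ... | S₁ , agS , lim | T₁ , agT , _ = record
    { sideS = S₁ ; sideT = T₁
    ; both = up-to (λ i< p q → LabelsOf.both A i< (subst (1 ≤_) (agS i<) p) (subst (1 ≤_) (agT i<) q)) lim
    ; dom = dom′ }
    where
    dom′ : ∀ S* T* → Stars (Live₁ S*) (Live₂ T*) → _
    dom′ S* T* st with LabelsOf.dom A S* T* st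
    ... | dS , dT with dominates-step (LabelsOf.sideT A) f oT k< X≢hd X≢tl (Stars.starT st) dT
            (λ _ p → ⊥-elim (≥1⇒≢0 p (Side.new (LabelsOf.sideS A) ≤-refl))) (inj₁ down)
    ...   | dT′ , fT = proj₁ (dominates-step (LabelsOf.sideS A) f oS k< X≢tl X≢hd (Stars.starS st) dS
            (λ l p → Stars.both st k< l (fT down p)) (inj₂ down)) , dT′

  labels-idle : ∀ {k S sS tS T sT tT} → LabelsOf k S sS tS T sT tT → k < m → F k ≡ 0 → LabelsOf (suc k) S sS tS T sT tT
  labels-idle {k} A k< z = record
    { sideS = side-skip sideS ; sideT = side-skip sideT
    ; both = up-to both (λ p → ⊥-elim (≥1⇒≢0 p (Side.new sideS ≤-refl)))
    ; dom = λ S* T* st → let (dS , dT) = dom S* T* st in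
        dominates-idle sideS z k< X≢tl X≢hd (Stars.starS st) dS , dominates-idle sideT z k< X≢hd X≢tl (Stars.starT st) dT }
    where open LabelsOf A

ends-if : ∀ {e C D s b b′ P} → (1 ≤ ⟦ e ⟧ s → Ends C s b P) → (⟦ e ⟧ s ≡ 0 → Ends D s b′ P) →
  Ends (IfNonzero e Then C Else D) s (1 + cost e + (b + b′)) P
ends-if {e} {b = b} {b′} f g with zero⊎pos (⟦ e ⟧ _)
... | inj₁ z = let (t , s′ , d , p , q) = g z in
  _ , s′ , if-zero z d , +-monoʳ-≤ (1 + cost e) (≤-trans p (m≤n+m _ b)) , q
... | inj₂ z = let (t , s′ , d , p , q) = f z in
  _ , s′ , if-nonzero (≥1⇒≢0 z) d , +-monoʳ-≤ (1 + cost e) (≤-trans p (m≤m+n _ b′)) , q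

module LabelProgram {n m X Q} (O : Order n m X Q) (D F IN OUT I J : ℕ → ℕ) where
  open Order O
  open Ends-of O D
  open LabelLoop O D F IN OUT I J

  record Arrays (s : State) : Set where
    field
      I≡   : array s 2 ≡ I
      J≡   : array s 3 ≡ J
      X≡   : array s 6 ≡ X
      Q≡   : array s 7 ≡ Q
      D≡   : array s 8 ≡ D
      F≡   : array s 9 ≡ F
      IN≡  : array s 10 ≡ IN
      OUT≡ : array s 11 ≡ OUT

  arrays-scalar : ∀ {s sc} → Arrays s → Arrays ⟨ sc , array s ⟩
  arrays-scalar A = record { I≡ = I≡ ; J≡ = J≡ ; X≡ = X≡ ; Q≡ = Q≡ ; D≡ = D≡ ; F≡ = F≡ ; IN≡ = IN≡ ; OUT≡ = OUT≡ }
    where open Arrays A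

  Keeps : Cmd → Set
  Keeps C = writesA 2 C ∨ writesA 3 C ∨ writesA 6 C ∨ writesA 7 C ∨ writesA 8 C ∨ writesA 9 C ∨ writesA 10 C ∨ writesA 11 C ≡ false

  arrays-frame : ∀ C {s s′} → Keeps C → (∀ a → writesA a C ≡ false → array s′ a ≡ array s a) → Arrays s → Arrays s′
  arrays-frame C w f A with ∨-false {writesA 2 C} w
  ... | w₂ , v with ∨-false {writesA 3 C} v
  ... | w₃ , v with ∨-false {writesA 6 C} v
  ... | w₆ , v with ∨-false {writesA 7 C} v
  ... | w₇ , v with ∨-false {writesA 8 C} v
  ... | w₈ , v with ∨-false {writesA 9 C} v
  ... | w₉ , v with ∨-false {writesA 10 C} v
  ... | w₁₀ , w₁₁ = record
    { I≡ = trans (f 2 w₂) I≡ ; J≡ = trans (f 3 w₃) J≡ ; X≡ = trans (f 6 w₆) X≡ ; Q≡ = trans (f 7 w₇) Q≡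
    ; D≡ = trans (f 8 w₈) D≡ ; F≡ = trans (f 9 w₉) F≡ ; IN≡ = trans (f 10 w₁₀) IN≡ ; OUT≡ = trans (f 11 w₁₁) OUT≡ }
    where open Arrays A

  Labels : ℕ → State → Set
  Labels k s = LabelsOf k (array s 12) (array s 14) (array s 15) (array s 13) (array s 16) (array s 17)

  labels-cong : ∀ {k a b c d e f a′ b′ c′ d′ e′ f′} → a ≡ a′ → b ≡ b′ → c ≡ c′ → d ≡ d′ → e ≡ e′ → f ≡ f′ →
    LabelsOf k a b c d e f → LabelsOf k a′ b′ c′ d′ e′ f′
  labels-cong refl refl refl refl refl refl p = p

  record Ready (k : ℕ) (s : State) : Set where
    field
      s1 : scalar s 1 ≡ m
      s2 : scalar s 2 ≡ k
      s5 : scalar s 5 ≡ tl k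
      s6 : scalar s 6 ≡ hd k
      ar : Arrays s

  outcomeS : ∀ {k s s′} → Ready k s → Outcome (scalar s 2) (scalar s 5) (scalar s 6)
      (array s 10 (scalar s 6) + array s 11 (scalar s 5)) (array s 2) (array s 9) (array s 13)
      (array s 12) (array s 14) (array s 15) (array s′ 12) (array s′ 14) (array s′ 15) →
    Outcome k (tl k) (hd k) (IN (hd k) + OUT (tl k)) I F (array s 13)
      (array s 12) (array s 14) (array s 15) (array s′ 12) (array s′ 14) (array s′ 15)
  outcomeS r o with Ready.ar r
  ... | record { I≡ = refl ; F≡ = refl ; IN≡ = refl ; OUT≡ = refl } rewrite Ready.s2 r | Ready.s5 r | Ready.s6 r = o

  outcomeT : ∀ {k s s′} → Ready k s → Outcome (scalar s 2) (scalar s 6) (scalar s 5)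
      (array s 10 (scalar s 6) + array s 11 (scalar s 5)) (array s 3) (array s 9) (array s 12)
      (array s 13) (array s 16) (array s 17) (array s′ 13) (array s′ 16) (array s′ 17) →
    Outcome k (hd k) (tl k) (IN (hd k) + OUT (tl k)) J F (array s 12)
      (array s 13) (array s 16) (array s 17) (array s′ 13) (array s′ 16) (array s′ 17)
  outcomeT r o with Ready.ar r
  ... | record { J≡ = refl ; F≡ = refl ; IN≡ = refl ; OUT≡ = refl } rewrite Ready.s2 r | Ready.s5 r | Ready.s6 r = o

  ready-frame : ∀ C {k s s′} → Keeps C → Framed C s s′ → (∀ x → writesS x C ≡ false) → Ready k s → Ready k s′
  ready-frame C w (f , g) ws r = record
    { s1 = trans (g 1 (ws 1)) s1 ; s2 = trans (g 2 (ws 2)) s2 ; s5 = trans (g 5 (ws 5)) s5 ; s6 = trans (g 6 (ws 6)) s6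
    ; ar = arrays-frame C w f ar }
    where open Ready r

  load-ready : ∀ {k s} → scalar s 1 ≡ m → scalar s 2 ≡ k → Arrays s →
    Ends loadEnds s (steps loadEnds) (Ready k)
  load-ready {k} {s} e₁ refl A = ends-wp loadEnds
    ( (λ p → record { s1 = e₁ ; s2 = refl ; s5 = trans (cong (λ g → g k) X≡) (sym (branch-pos (pos p)))
                    ; s6 = trans (cong (λ g → g k) Q≡) (sym (branch-pos (pos p))) ; ar = A′ })
    , (λ z → record { s1 = e₁ ; s2 = refl ; s5 = trans (cong (λ g → g k) Q≡) (sym (branch-zero (zer z)))
                    ; s6 = trans (cong (λ g → g k) X≡) (sym (branch-zero (zer z))) ; ar = A′ }))
    where
    open Arrays A
    pos : 1 ≤ array s 8 k → 1 ≤ D k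
    pos = subst (λ g → 1 ≤ g k) D≡
    zer : array s 8 k ≡ 0 → D k ≡ 0
    zer = subst (λ g → g k ≡ 0) D≡
    A′ : ∀ {sc} → Arrays ⟨ sc , array s ⟩
    A′ = arrays-scalar A

  Labelled : ℕ → State → Set
  Labelled k s = Ready k s × Labels (suc k) s

  outcome-cong : ∀ {k u w c set F other x x′ y y′ z z′ a b d} → x ≡ x′ → y ≡ y′ → z ≡ z′ →
    Outcome k u w c set F other x y z a b d → Outcome k u w c set F other x′ y′ z′ a b d
  outcome-cong refl refl refl o = o

  up-case : ∀ {k s} → k < m → 1 ≤ F k → tl k ≡ X k → Ready k s → Labels k s →
    Ends (labelS ⨾ labelT) s (steps labelS + steps labelT) (Labelled k)
  up-case {k} {s} k< f up r l = ends-seq (ends-framed (labelS-ends s)) (λ s₁ (oS , fr@(fA , _)) →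
    let r₁ = ready-frame labelS refl fr (λ _ → refl) r in
    ends-weaken ≤-refl (λ s₂ (oT , gr@(gA , _)) →
      ready-frame labelT refl gr (λ _ → refl) r₁ ,
      labels-cong (sym (gA 12 refl)) (sym (gA 14 refl)) (sym (gA 15 refl)) refl refl refl
        (labels-up l k< f up (outcomeS {s′ = s₁} r oS)
          (outcome-cong (fA 13 refl) (fA 16 refl) (fA 17 refl) (outcomeT {s′ = s₂} r₁ oT))))
      (ends-framed (labelT-ends s₁)))

  down-case : ∀ {k s} → k < m → 1 ≤ F k → hd k ≡ X k → Ready k s → Labels k s →
    Ends (labelT ⨾ labelS) s (steps labelT + steps labelS) (Labelled k)
  down-case {k} {s} k< f down r l = ends-seq (ends-framed (labelT-ends s)) (λ s₁ (oT , fr@(fA , _)) →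
    let r₁ = ready-frame labelT refl fr (λ _ → refl) r in
    ends-weaken ≤-refl (λ s₂ (oS , gr@(gA , _)) →
      ready-frame labelS refl gr (λ _ → refl) r₁ ,
      labels-cong refl refl refl (sym (gA 13 refl)) (sym (gA 16 refl)) (sym (gA 17 refl))
        (labels-down l k< f down (outcomeT {s′ = s₁} r oT)
          (outcome-cong (fA 12 refl) (fA 14 refl) (fA 15 refl) (outcomeS {s′ = s₂} r₁ oS))))
      (ends-framed (labelS-ends s₁)))

  label-body : ∀ k s → k < m → scalar s 2 ≡ k → scalar s 1 ≡ m → Arrays s × Labels k s →
    Ends labelStep s (steps labelStep) (λ s′ → scalar s′ 2 ≡ suc k × scalar s′ 1 ≡ m × (Arrays s′ × Labels (suc k) s′))
  label-body k s k< e₂ e₁ (A , l) = ends-seq (ends-framed (load-ready e₁ e₂ A)) (λ s₁ (r , (fA , _)) →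
    let open Ready r
        open Arrays ar
        l₁ : Labels k s₁
        l₁ = labels-cong (sym (fA 12 refl)) (sym (fA 14 refl)) (sym (fA 15 refl)) (sym (fA 13 refl)) (sym (fA 16 refl)) (sym (fA 17 refl)) l
        Fk : array s₁ 9 (scalar s₁ 2) ≡ F k
        Fk = cong₂ (λ g i → g i) F≡ s2
        Dk : array s₁ 8 (scalar s₁ 2) ≡ D k
        Dk = cong₂ (λ g i → g i) D≡ s2
    in ends-seq {P = Labelled k}
      (ends-if (λ f → ends-if
          (λ d → up-case k< (subst (1 ≤_) Fk f) (branch-pos (subst (1 ≤_) Dk d)) r l₁)
          (λ d → down-case k< (subst (1 ≤_) Fk f) (branch-zero (trans (sym Dk) d)) r l₁))
        (λ z → ends-wp skip (r , labels-idle l₁ k< (trans (sym Fk) z))))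
      (λ s₂ (r₂ , l₂) → ends-wp (2 ≔ var 2 ⊕ lit 1)
        ( trans (+-comm _ 1) (cong suc (Ready.s2 r₂)) , Ready.s1 r₂
        , arrays-scalar (Ready.ar r₂)
        , l₂)))

  labels-start : ∀ {s} → (∀ a i → 12 ≤ a → array s a i ≡ 0) → Labels 0 s
  labels-start z = record
    { sideS = side0 (λ i → z 12 i (≤ᵇ⇒≤ 12 12 _)) (λ i → z 14 i (≤ᵇ⇒≤ 12 14 _)) (λ i → z 15 i (≤ᵇ⇒≤ 12 15 _))
    ; sideT = side0 (λ i → z 13 i (≤ᵇ⇒≤ 12 13 _)) (λ i → z 16 i (≤ᵇ⇒≤ 12 16 _)) (λ i → z 17 i (≤ᵇ⇒≤ 12 17 _))
    ; both = λ ()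
    ; dom = λ _ _ _ → record { covers = λ () ; within = λ () } , record { covers = λ () ; within = λ () } }
    where
    side0 : ∀ {t h set lab sat taken} → (∀ i → lab i ≡ 0) → (∀ i → sat i ≡ 0) → (∀ i → taken i ≡ 0) → Side 0 t h set F lab sat taken
    side0 a b c = record { new = λ {i} _ → a i ; flows = λ () ; sat→ = λ {u} p → ⊥-elim (≥1⇒≢0 p (b u)) ; →sat = λ ()
      ; taken→ = λ {w} p → ⊥-elim (≥1⇒≢0 p (c w)) ; →taken = λ () ; tails = λ () ; heads = λ () }

  labelling-ends : ∀ {s} → scalar s 1 ≡ m → Arrays s → (∀ a i → 12 ≤ a → array s a i ≡ 0) →
    Ends labelling s (2 + suc m * (4 + steps labelStep)) (λ s′ → Arrays s′ × Labels m s′)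
  labelling-ends {s} e₁ A z = ends-seq {P = λ t → t ≡ ⟨ update (scalar s) 2 0 , array s ⟩} (ends-wp (2 ≔ lit 0) refl)
    (λ { _ refl → ends-for 1 (λ k s → Arrays s × Labels k s) m label-body _ refl e₁
      (arrays-scalar A
      , labels-start {⟨ update (scalar s) 2 0 , array s ⟩} z) })

  -- The conditions of a plan that neither the instance nor peeling and labelling guarantee, hence
  -- those left to be checked.
  record Sound (sS sT : ℕ → ℕ) : Set where
    field
      law     : ∀ {v} → v < n → I v + IN v ≡ J v + OUT v
      servedS : ∀ {v} → v < n → 1 ≤ I v → 1 ≤ OUT v → 1 ≤ sS v
      servedT : ∀ {v} → v < n → 1 ≤ J v → 1 ≤ IN v → 1 ≤ sT v
      still-h : ∀ {i} → i < m → 1 ≤ I (tl i) → 1 ≤ J (tl i) → IN (tl i) ≡ 0 → IN (hd i) + OUT (hd i) ≡ 0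
      still-t : ∀ {i} → i < m → 1 ≤ I (hd i) → 1 ≤ J (hd i) → IN (hd i) ≡ 0 → IN (tl i) + OUT (tl i) ≡ 0

  module _ (I≤1 : ∀ v → I v ≤ 1) (J≤1 : ∀ v → J v ≤ 1)
    (I-free : ∀ {i} → i < m → 1 ≤ I (tl i) → 1 ≤ I (hd i) → ⊥)
    (J-free : ∀ {i} → i < m → 1 ≤ J (tl i) → 1 ≤ J (hd i) → ⊥)
    (IN-sum : ∀ {v} → v < n → IN v ≡ flow m hd F v) (OUT-sum : ∀ {v} → v < n → OUT v ≡ flow m tl F v)
    {S sS tS T sT tT} (L : LabelsOf m S sS tS T sT tT) where
    open LabelsOf L

    F≤IN : ∀ {i} → i < m → F i ≤ IN (hd i)
    F≤IN i< = ≤-trans (≤flow m {hd} {F} i< refl) (≤-reflexive (sym (IN-sum (hd<n i<))))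

    F≤OUT : ∀ {i} → i < m → F i ≤ OUT (tl i)
    F≤OUT i< = ≤-trans (≤flow m {tl} {F} i< refl) (≤-reflexive (sym (OUT-sum (tl<n i<))))

    greedy-plan : Sound sS sT → Plan n m tl hd I J F IN OUT S T
    greedy-plan sound = record
      { I≤1 = I≤1 ; J≤1 = J≤1 ; I-free = I-free ; J-free = J-free ; law = law ; IN-sum = IN-sum ; OUT-sum = OUT-sum
      ; S-head = λ i< j< s s′ _ _ _ _ → Side.heads sideS i< j< s s′
      ; S-tail = λ i< j< s s′ → Side.tails sideS i< j< s s′
      ; S-any = λ v< p o → let (i , i< , e , l) = Side.sat→ sideS (servedS v< p o) in
          i , i< , e , l , proj₁ (Side.flows sideS i< l)
      ; T-target = λ i< l _ → proj₂ (Side.flows sideT i< l)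
      ; T-head = λ i< j< s s′ _ _ → Side.tails sideT i< j< s s′
      ; T-tail = λ i< j< s s′ _ _ → Side.heads sideT i< j< s s′
      ; T-any = λ v< p o → let (i , i< , e , l) = Side.sat→ sideT (servedT v< p o) in
          i , i< , e , l , proj₁ (Side.flows sideT i< l)
      ; both = λ i< s _ l e → two (≤-trans (≤-reflexive (sym e)) (F≤IN i<)) (≤-trans (≤-reflexive (sym e)) (F≤OUT i<))
          (both i< s l (≤-reflexive e))
      ; still-h = still-h ; still-t = still-t }
      where
      open Sound sound
      -- The program tests only the sum; as both terms are at least 1, a sum of at most 2 bounds
      -- each of them.
      two : ∀ {a b} → 1 ≤ a → 1 ≤ b → a + b ≤ 2 → a ≤ 1 × b ≤ 1
      two {a} {b} p q r = +-cancelʳ-≤ 1 a 1 (≤-trans (+-monoʳ-≤ a q) r) , +-cancelˡ-≤ 1 b 1 (≤-trans (+-monoˡ-≤ b p) r)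

    -- The greedy labels serve every vertex that some plan serves.
    plan-sound : ∀ {S* T*} → Plan n m tl hd I J F IN OUT S* T* → Sound sS sT
    plan-sound {S*} {T*} P = record
      { law = P.law
      ; servedS = λ v< p o → let (i , i< , e , s , f) = P.S-any v< p o in
          subst (λ v → 1 ≤ sS v) e (Dominates.covers (proj₁ dom*) i< (s , subst (λ v → 1 ≤ I v) (sym e) p , f))
      ; servedT = λ v< p o → let (i , i< , e , s , f) = P.T-any v< p o in
          subst (λ v → 1 ≤ sT v) e (Dominates.covers (proj₂ dom*) i< (s , f))
      ; still-h = P.still-h ; still-t = P.still-t }
      where
      module P = Plan P
      stars : Stars (Live₁ S*) (Live₂ T*)
      stars = record
        { starS = record
          { flows = λ { _ (s , p , f) → f , p }
          ; heads = λ { i< j< (s , p , f) (s′ , p′ , f′) e → P.S-head i< j< s s′ p p′ f f′ e }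
          ; any = λ {i} i< f p → let (i′ , i′< , e , s , f′) = P.S-any (tl<n i<) p (≤-trans f (F≤OUT i<)) in
              i′ , i′< , e , s , subst (λ v → 1 ≤ I v) (sym e) p , f′ }
        ; starT = record
          { flows = λ { i< (s , f) → f , P.T-target i< s f }
          ; heads = λ { i< j< (s , f) (s′ , f′) e → P.T-tail i< j< s s′ f f′ e }
          ; any = λ {i} i< f p → let (i′ , i′< , e , s , f′) = P.T-any (hd<n i<) p (≤-trans f (F≤IN i<)) in
              i′ , i′< , e , s , f′ }
        ; both = λ { i< (s , p , f) (s′ , _) le →
            let (a , b) = P.both i< s p s′ (≤-antisym le f) in +-mono-≤ a b } }
      dom* = dom S* T* stars

-- Correctness of the final checks

test-sound : ∀ r e → 1 ∸ ((1 ∸ r) ∸ e) ≡ 0 → r ≡ 0 × e ≡ 0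
test-sound r e z with not-false _ z
... | p = not-true r (≤-trans p (m∸n≤m (1 ∸ r) e)) , n≤0⇒n≡0 (≤-pred (≤-trans (+-monoˡ-≤ e p) le))
  where
  le : (1 ∸ r ∸ e) + e ≤ 1
  le with zero⊎pos ((1 ∸ r) ∸ e)
  ... | inj₁ z′ = ⊥-elim (≥1⇒≢0 p z′)
  ... | inj₂ _ = ≤-trans (≤-reflexive (m∸n+n≡m (<⇒≤ (m<n⇒m<1+n′ e (1 ∸ r) p)))) (m∸n≤m 1 r)
    where
    m<n⇒m<1+n′ : ∀ e x → 1 ≤ x ∸ e → e < x
    m<n⇒m<1+n′ e x q = ≰⇒> (λ x≤e → ≥1⇒≢0 q (m≤n⇒m∸n≡0 x≤e))

test-complete : ∀ r e → r ≡ 0 → e ≡ 0 → 1 ∸ ((1 ∸ r) ∸ e) ≡ 0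
test-complete _ _ refl refl = refl

served-sound : ∀ x y z → x ∸ (x ∸ (y ∸ (y ∸ (1 ∸ z)))) ≡ 0 → 1 ≤ x → 1 ≤ y → 1 ≤ z
served-sound x y z e p q with zero⊎pos z
... | inj₂ r = r
... | inj₁ refl = ⊥-elim (∧-false x _ e p (≤-reflexive (sym (m∸[m∸n]≡n q))))

served-complete : ∀ x y z → (1 ≤ x → 1 ≤ y → 1 ≤ z) → x ∸ (x ∸ (y ∸ (y ∸ (1 ∸ z)))) ≡ 0
served-complete x y z f with zero⊎pos (x ∸ (x ∸ (y ∸ (y ∸ (1 ∸ z)))))
... | inj₁ e = e
... | inj₂ p with ∧-true x _ p
...   | px , p′ with ∧-true y _ p′
...     | py , pz = ⊥-elim (≥1⇒≢0 (f px py) (not-true z pz))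

still-sound : ∀ x y z w → x ∸ (x ∸ (y ∸ (y ∸ ((1 ∸ z) ∸ ((1 ∸ z) ∸ w))))) ≡ 0 → 1 ≤ x → 1 ≤ y → z ≡ 0 → w ≡ 0
still-sound x y z w e p q refl with zero⊎pos w
... | inj₁ r = r
... | inj₂ r = ⊥-elim (∧-false x _ e p (≤-trans (≤-reflexive (sym (m∸[m∸n]≡n q))) (∸-monoʳ-≤ y (∸-monoʳ-≤ y (∧-pos r)))))
  where
  ∧-pos : ∀ {w} → 1 ≤ w → 1 ≤ 1 ∸ (1 ∸ w)
  ∧-pos {suc w} _ = ≤-reflexive (cong (1 ∸_) (sym (0∸n≡0 w)))

still-complete : ∀ x y z w → (1 ≤ x → 1 ≤ y → z ≡ 0 → w ≡ 0) → x ∸ (x ∸ (y ∸ (y ∸ ((1 ∸ z) ∸ ((1 ∸ z) ∸ w))))) ≡ 0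
still-complete x y z w f with zero⊎pos (x ∸ (x ∸ (y ∸ (y ∸ ((1 ∸ z) ∸ ((1 ∸ z) ∸ w))))))
... | inj₁ e = e
... | inj₂ p with ∧-true x _ p
...   | px , p′ with ∧-true y _ p′
...     | py , pz with ∧-true (1 ∸ z) w pz
...       | pz′ , pw = ⊥-elim (≥1⇒≢0 pw (f px py (not-true z pz′)))

Records : ℕ → Set → Set
Records r B = (r ≡ 0 → B) × (B → r ≡ 0)

module Checks {n m X Q} (O : Order n m X Q) (D F IN OUT I J sS sT : ℕ → ℕ) where
  open Order O
  open Ends-of O D
  open LabelProgram O D F IN OUT I J

  record Memory (s : State) : Set where
    field
      ar  : Arrays s
      sS≡ : array s 14 ≡ sS
      sT≡ : array s 16 ≡ sT

  memory-scalar : ∀ {s sc} → Memory s → Memory ⟨ sc , array s ⟩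
  memory-scalar M = record { ar = arrays-scalar (Memory.ar M) ; sS≡ = Memory.sS≡ M ; sT≡ = Memory.sT≡ M }

  -- The condition on resting tokens is symmetric in the two ends of an arc, so it is phrased with
  -- child and parent and the direction is not looked up.
  GoodVertex GoodArc : ℕ → Set
  GoodVertex v = I v + IN v ≡ J v + OUT v × (1 ≤ I v → 1 ≤ OUT v → 1 ≤ sS v) × (1 ≤ J v → 1 ≤ IN v → 1 ≤ sT v)
  GoodArc i = (1 ≤ I (X i) → 1 ≤ J (X i) → IN (X i) ≡ 0 → IN (Q i) + OUT (Q i) ≡ 0)
            × (1 ≤ I (Q i) → 1 ≤ J (Q i) → IN (Q i) ≡ 0 → IN (X i) + OUT (X i) ≡ 0)

  GoodVertices GoodArcs : ℕ → Set
  GoodVertices k = ∀ {v} → v < k → GoodVertex v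
  GoodArcs k = ∀ {i} → i < k → GoodArc i

  vertex-body : ∀ k s → k < n → scalar s 2 ≡ k → scalar s 0 ≡ n → Memory s × Records (scalar s 7) (GoodVertices k) × scalar s 1 ≡ m →
    Ends vertexStep s (steps vertexStep) (λ s′ → scalar s′ 2 ≡ suc k × scalar s′ 0 ≡ n × (Memory s′ × Records (scalar s′ 7) (GoodVertices (suc k)) × scalar s′ 1 ≡ m))
  vertex-body k s k< refl e₀ (M , (to , from) , e₁) = ends-wp vertexStep
    (+-comm _ 1 , e₀ , memory-scalar M , (to′ , from′) , e₁)
    where
    open Memory M
    open Arrays ar
    to′ : _ → GoodVertices (suc k)
    to′ z with test-sound _ _ z
    ... | z₁ , c with test-sound _ _ z₁
    ...   | z₂ , b with test-sound _ _ z₂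
    ...     | z₃ , a = up-to {R = GoodVertex} (to z₃)
              (subst₂ _≡_ (cong₂ (λ f g → f k + g k) I≡ IN≡) (cong₂ (λ f g → f k + g k) J≡ OUT≡) (≠-false _ _ a)
              , (λ p q → subst (λ f → 1 ≤ f k) sS≡ (served-sound _ _ _ b (subst (λ f → 1 ≤ f k) (sym I≡) p) (subst (λ f → 1 ≤ f k) (sym OUT≡) q)))
              , (λ p q → subst (λ f → 1 ≤ f k) sT≡ (served-sound _ _ _ c (subst (λ f → 1 ≤ f k) (sym J≡) p) (subst (λ f → 1 ≤ f k) (sym IN≡) q))))
    from′ : GoodVertices (suc k) → _
    from′ g = let (a , b , c) = g (n<1+n k) in
      test-complete _ _ (test-complete _ _ (test-complete _ _ (from (λ v< → g (<-trans v< (n<1+n k))))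
        (≠-zero (subst₂ _≡_ (sym (cong₂ (λ f g → f k + g k) I≡ IN≡)) (sym (cong₂ (λ f g → f k + g k) J≡ OUT≡)) a)))
        (served-complete _ _ _ (λ p q → subst (λ f → 1 ≤ f k) (sym sS≡) (b (subst (λ f → 1 ≤ f k) I≡ p) (subst (λ f → 1 ≤ f k) OUT≡ q)))))
        (served-complete _ _ _ (λ p q → subst (λ f → 1 ≤ f k) (sym sT≡) (c (subst (λ f → 1 ≤ f k) J≡ p) (subst (λ f → 1 ≤ f k) IN≡ q))))
      where
      ≠-zero : ∀ {a b} → a ≡ b → (a ∸ b) + (b ∸ a) ≡ 0
      ≠-zero {a} refl = cong₂ _+_ (n∸n≡0 a) (n∸n≡0 a)

  arc-body : ∀ k s → k < m → scalar s 2 ≡ k → scalar s 1 ≡ m → Memory s × Records (scalar s 7) (GoodVertices n × GoodArcs k) →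
    Ends arcStep s (steps arcStep) (λ s′ → scalar s′ 2 ≡ suc k × scalar s′ 1 ≡ m × (Memory s′ × Records (scalar s′ 7) (GoodVertices n × GoodArcs (suc k))))
  arc-body k s k< refl e₁ (M , (to , from)) = ends-wp arcStep
    (+-comm _ 1 , e₁ , memory-scalar M , (to′ , from′))
    where
    open Memory M
    open Arrays ar
    to′ : _ → GoodVertices n × GoodArcs (suc k)
    to′ z with test-sound _ _ z
    ... | z₁ , b with test-sound _ _ z₁
    ...   | z₂ , a = proj₁ (to z₂) , up-to {R = GoodArc} (proj₂ (to z₂)) (half X≡ Q≡ a , half Q≡ X≡ b)
      where
      half : ∀ {A B A′ B′} → A′ ≡ A → B′ ≡ B → let x = A′ k ; y = B′ k in
        array s 2 x ∸ (array s 2 x ∸ (array s 3 x ∸ (array s 3 x ∸ ((1 ∸ array s 10 x) ∸ ((1 ∸ array s 10 x) ∸ (array s 10 y + array s 11 y)))))) ≡ 0 →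
        1 ≤ I (A k) → 1 ≤ J (A k) → IN (A k) ≡ 0 → IN (B k) + OUT (B k) ≡ 0
      half refl refl c rewrite I≡ | J≡ | IN≡ | OUT≡ = still-sound _ _ _ _ c
    from′ : GoodVertices n × GoodArcs (suc k) → _
    from′ (gv , g) = let (a , b) = g (n<1+n k) in
      test-complete _ _ (test-complete _ _ (from (gv , λ i< → g (<-trans i< (n<1+n k)))) (half X≡ Q≡ a)) (half Q≡ X≡ b)
      where
      half : ∀ {A B A′ B′} → A′ ≡ A → B′ ≡ B → (1 ≤ I (A k) → 1 ≤ J (A k) → IN (A k) ≡ 0 → IN (B k) + OUT (B k) ≡ 0) →
        let x = A′ k ; y = B′ k in
        array s 2 x ∸ (array s 2 x ∸ (array s 3 x ∸ (array s 3 x ∸ ((1 ∸ array s 10 x) ∸ ((1 ∸ array s 10 x) ∸ (array s 10 y + array s 11 y)))))) ≡ 0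
      half refl refl f rewrite I≡ | J≡ | IN≡ | OUT≡ = still-complete _ _ _ _ f

  good⇒sound : GoodVertices n × GoodArcs m → Sound sS sT
  good⇒sound (gv , ga) = record
    { law = λ v< → proj₁ (gv v<) ; servedS = λ v< → proj₁ (proj₂ (gv v<)) ; servedT = λ v< → proj₂ (proj₂ (gv v<))
    ; still-h = λ i< → sh i< ; still-t = λ i< → st i< }
    where
    sh : ∀ {i} → i < m → 1 ≤ I (tl i) → 1 ≤ J (tl i) → IN (tl i) ≡ 0 → IN (hd i) + OUT (hd i) ≡ 0
    sh {i} i< with D i
    ... | zero  = proj₂ (ga i<)
    ... | suc _ = proj₁ (ga i<)
    st : ∀ {i} → i < m → 1 ≤ I (hd i) → 1 ≤ J (hd i) → IN (hd i) ≡ 0 → IN (tl i) + OUT (tl i) ≡ 0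
    st {i} i< with D i
    ... | zero  = proj₁ (ga i<)
    ... | suc _ = proj₂ (ga i<)

  sound⇒good : Sound sS sT → GoodVertices n × GoodArcs m
  sound⇒good S = (λ v< → law v< , servedS v< , servedT v<) , arc
    where
    open Sound S
    arc : GoodArcs m
    arc {i} i< with D i | still-h i< | still-t i<
    ... | zero  | a | b = b , a
    ... | suc _ | a | b = a , b

  checks-end : ∀ {s} → Memory s → scalar s 0 ≡ n → scalar s 1 ≡ m → scalar s 7 ≡ 0 →
    Ends checks s ((2 + suc n * (4 + steps vertexStep)) + ((2 + suc m * (4 + steps arcStep)) + 4))
      (λ s′ → (scalar s′ 0 ≡ 1 × Sound sS sT) ⊎ (scalar s′ 0 ≡ 0 × ¬ Sound sS sT))
  checks-end {s} M e₀ e₁ e₇ = ends-seq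
    (ends-seq {P = λ t → t ≡ ⟨ update (scalar s) 2 0 , array s ⟩} (ends-wp (2 ≔ lit 0) refl)
      (λ { _ refl → ends-for 0 (λ k s → Memory s × Records (scalar s 7) (GoodVertices k) × scalar s 1 ≡ m) n vertex-body _ refl e₀
        (memory-scalar M , ((λ _ → λ ()) , (λ _ → e₇)) , e₁) }))
    (λ s₁ (M₁ , (to , from) , e₁′) → ends-seq
      (ends-seq {P = λ t → t ≡ ⟨ update (scalar s₁) 2 0 , array s₁ ⟩} (ends-wp (2 ≔ lit 0) refl)
        (λ { _ refl → ends-for 1 (λ k s → Memory s × Records (scalar s 7) (GoodVertices n × GoodArcs k)) m arc-body _ refl e₁′
          (memory-scalar M₁ , ((λ z → to z , λ ()) , (λ g → from (proj₁ g)))) }))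
      (λ s₂ (M₂ , (to₂ , from₂)) → ends-wp (0 ≔ lit 1 ⊖ var 7) (answer to₂ from₂)))
    where
    answer : ∀ {r} → (r ≡ 0 → GoodVertices n × GoodArcs m) → (GoodVertices n × GoodArcs m → r ≡ 0) →
      (1 ∸ r ≡ 1 × Sound sS sT) ⊎ (1 ∸ r ≡ 0 × ¬ Sound sS sT)
    answer {zero} to from = inj₁ (refl , good⇒sound (to refl))
    answer {suc r} to from = inj₂ (0∸n≡0 r , λ S → 1+n≢0 (from (sound⇒good S)))

-- Correctness of the walk

Slice : (ℕ → ℕ) → ℕ → List ℕ → ℕ → Set
Slice f lo []       hi = lo ≡ hi
Slice f lo (a ∷ as) hi = f lo ≡ a × Slice f (suc lo) as hi

slice-≤ : ∀ {f lo} as {hi} → Slice f lo as hi → lo ≤ hi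
slice-≤ []       refl    = ≤-refl
slice-≤ (_ ∷ as) (_ , p) = ≤-trans (n≤1+n _) (slice-≤ as p)

slice-below : ∀ {f p x lo} as {hi} → p < lo → Slice f lo as hi → Slice (update f p x) lo as hi
slice-below []       lt p = p
slice-below {f} {p} {x} {lo} (a ∷ as) lt (e , r) =
  trans (update-other f p lo (≢-sym (<⇒≢ lt))) e , slice-below as (<-trans lt (n<1+n lo)) r

slice-front : ∀ {f x lo} as {hi} → Slice f (suc lo) as hi → Slice (update f lo x) lo (x ∷ as) hi
slice-front {f} {lo = lo} as r = update-same f lo lo refl , slice-below as (n<1+n lo) r

slice-back : ∀ {f x lo} as {hi} → Slice f lo as hi → Slice (update f hi x) lo (as ∷ʳ x) (suc hi)
slice-back {f} {lo = lo} [] refl = update-same f lo lo refl , refl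
slice-back {f} {lo = lo} (a ∷ as) {hi} (e , r) =
  trans (update-other f hi lo (<⇒≢ (slice-≤ as r))) e , slice-back as r

same-true : ∀ a b → 1 ≤ 1 ∸ ((a ∸ b) + (b ∸ a)) → a ≡ b
same-true a b p = ≠-false a b (not-true _ p)

same-false : ∀ a b → a ≡ b → 1 ≤ 1 ∸ ((a ∸ b) + (b ∸ a))
same-false a _ refl = ≤-reflexive (cong (1 ∸_) (sym (cong₂ _+_ (n∸n≡0 a) (n∸n≡0 a))))

∧-intro : ∀ {a b} → 1 ≤ a → 1 ≤ b → 1 ≤ a ∸ (a ∸ b)
∧-intro {a} {b} p q with zero⊎pos (a ∸ (a ∸ b))
... | inj₁ z = ⊥-elim (∧-false a b z p q)
... | inj₂ r = r

not-intro : ∀ {a} → (1 ≤ a → ⊥) → 1 ≤ 1 ∸ a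
not-intro {zero}  f = ≤-refl
not-intro {suc a} f = ⊥-elim (f (s≤s z≤n))

∸-pos : ∀ a b → 1 ≤ a ∸ b → b < a
∸-pos a b p = ≰⇒> (λ a≤b → ≥1⇒≢0 p (m≤n⇒m∸n≡0 a≤b))

∸-intro : ∀ {a b} → b < a → 1 ≤ a ∸ b
∸-intro {a} {b} p with zero⊎pos (a ∸ b)
... | inj₁ z = ⊥-elim (1+n≰n (≤-trans p (m∸n≡0⇒m≤n z)))
... | inj₂ r = r

-- Taken records, for each head of an S-label, its tail.
record TakenBy (m : ℕ) (t h S taken : ℕ → ℕ) : Set where
  field
    →taken : ∀ {i} → i < m → 1 ≤ S i → taken (h i) ≡ suc (t i)
    taken→ : ∀ {w} → 1 ≤ taken w → ∃[ i ] i < m × h i ≡ w × 1 ≤ S i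

module Walker {n m X Q D I J F IN OUT S T tS} (O : Order n m X Q)
  (P : Plan n m (tail-of X Q D) (head-of X Q D) I J F IN OUT S T)
  (B : TakenBy m (tail-of X Q D) (head-of X Q D) S tS) where
  open Roots O P public

  -- `k ≤ scalar s 14` reserves a cell for each arc still to come, so a push in front never meets
  -- truncation at 0.
  PathAt : ℕ → State → Set
  PathAt k s = ∃[ as ] First k (scalar s 10) (scalar s 11) (scalar s 12) (scalar s 13) as
    × Slice (array s 18) (scalar s 14) as (scalar s 15) × k ≤ scalar s 14

  Walking : ℕ → State → Set
  Walking k s = (scalar s 16 ≡ 0 × scalar s 14 ≡ scalar s 15 × Idle k) ⊎ (1 ≤ scalar s 16 × PathAt k s)

record Env (m : ℕ) (X Q D I J F IN OUT S T tS : ℕ → ℕ) (s : State) : Set where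
  field
    s1   : scalar s 1 ≡ m
    I≡   : array s 2 ≡ I
    J≡   : array s 3 ≡ J
    X≡   : array s 6 ≡ X
    Q≡   : array s 7 ≡ Q
    D≡   : array s 8 ≡ D
    F≡   : array s 9 ≡ F
    IN≡  : array s 10 ≡ IN
    OUT≡ : array s 11 ≡ OUT
    S≡   : array s 12 ≡ S
    T≡   : array s 13 ≡ T
    tS≡  : array s 15 ≡ tS

module WalkBody {n} (s : State) (O : Order n (scalar s 1) (array s 6) (array s 7))
  (P : Plan n (scalar s 1) (tail-of (array s 6) (array s 7) (array s 8)) (head-of (array s 6) (array s 7) (array s 8))
    (array s 2) (array s 3) (array s 9) (array s 10) (array s 11) (array s 12) (array s 13))
  (B : TakenBy (scalar s 1) (tail-of (array s 6) (array s 7) (array s 8)) (head-of (array s 6) (array s 7) (array s 8))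
    (array s 12) (array s 15)) where
  m : ℕ
  m = scalar s 1
  X Q D I J F IN OUT S T tS : ℕ → ℕ
  X = array s 6
  Q = array s 7
  D = array s 8
  I = array s 2
  J = array s 3
  F = array s 9
  IN = array s 10
  OUT = array s 11
  S = array s 12
  T = array s 13
  tS = array s 15
  open Walker {D = D} {I} {J} {F} {IN} {OUT} {S} {T} {tS} O P B
  open Ends-of O D
  open Order O
  open TakenBy B
  open Plan P using (I≤1)

  Env′ : State → Set
  Env′ s′ = Env m X Q D I J F IN OUT S T tS s′ × scalar s′ 4 ≡ scalar s 4

  env : ∀ {sc pa} → sc 1 ≡ m → Env m X Q D I J F IN OUT S T tS ⟨ sc , update (array s) 18 pa ⟩
  env e = record { s1 = e ; I≡ = refl ; J≡ = refl ; X≡ = refl ; Q≡ = refl ; D≡ = refl ; F≡ = refl ; IN≡ = refl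
    ; OUT≡ = refl ; S≡ = refl ; T≡ = refl ; tS≡ = refl }

  env₀ : ∀ {sc} → sc 1 ≡ m → Env m X Q D I J F IN OUT S T tS ⟨ sc , array s ⟩
  env₀ e = record { s1 = e ; I≡ = refl ; J≡ = refl ; X≡ = refl ; Q≡ = refl ; D≡ = refl ; F≡ = refl ; IN≡ = refl
    ; OUT≡ = refl ; S≡ = refl ; T≡ = refl ; tS≡ = refl }

  j : ℕ
  j = scalar s 4

  module _ (j< : j < m) where
    open ArcCases j<

    root : Walking (suc j) s → Ends walkRoot s (steps walkRoot) (λ s′ → Env′ s′ ×
      ((scalar s′ 16 ≡ 0 × scalar s′ 14 ≡ scalar s′ 15 × Idle j) ⊎ (1 ≤ scalar s′ 16 × PathAt (suc j) s′)))
    root (inj₂ (p , path)) = ends-wp walkRoot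
      ( (λ _ → (env₀ refl , refl) , inj₂ (p , path))
      , (λ z → ⊥-elim (≥1⇒≢0 p z)))
    root (inj₁ (z , e , idle)) = ends-wp walkRoot
      ( (λ p → ⊥-elim (≥1⇒≢0 p z))
      , (λ _ → (λ busy → (env₀ refl , refl) , inj₂ (≤-refl , [] , begin-at busy (zero⊎pos (I q)) , refl , j<))
             , (λ quiet → (env₀ refl , refl) , inj₁ (z , e , λ {i} → idle-step {j} quiet idle {i}))))
      where
      begin-at : 1 ≤ IN q + OUT q → I q ≡ 0 ⊎ 1 ≤ I q → First (suc j) q q (1 ∸ I q) (OUT q) []
      begin-at busy (inj₁ z′) = Root.root-open j< idle busy (≤-reflexive (cong (1 ∸_) (sym z′))) z′
      begin-at busy (inj₂ p) = Root.root-closed j< idle busy (m≤n⇒m∸n≡0 p) p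

    Result : State → Set
    Result s′ = Env′ s′ × Walking j s′

    front-ok : ∀ {so′ as} → First j x (scalar s 11) so′ (scalar s 13) (j ∷ as) →
      Slice (array s 18) (scalar s 14) as (scalar s 15) → suc j ≤ scalar s 14 →
      Slice (update (array s 18) (scalar s 14 ∸ 1) j) (scalar s 14 ∸ 1) (j ∷ as) (scalar s 15) × j ≤ scalar s 14 ∸ 1
    front-ok {as = as} A sl le = go (scalar s 14) sl le
      where
      go : ∀ lo → Slice (array s 18) lo as (scalar s 15) → suc j ≤ lo →
        Slice (update (array s 18) (lo ∸ 1) j) (lo ∸ 1) (j ∷ as) (scalar s 15) × j ≤ lo ∸ 1
      go (suc lo) sl (s≤s le) = slice-front as sl , le

    module _ {as} (A : First (suc j) (scalar s 10) (scalar s 11) (scalar s 12) (scalar s 13) as)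
      (sl : Slice (array s 18) (scalar s 14) as (scalar s 15)) (le : suc j ≤ scalar s 14) (on : 1 ≤ scalar s 16) where

      kept : First j (scalar s 10) (scalar s 11) (scalar s 12) (scalar s 13) as → Result s
      kept A′ = (env₀ refl , refl) , inj₂ (on , as , A′ , sl , <⇒≤ le)

      up-ends : 1 ≤ D j → tl j ≡ x × hd j ≡ q
      up-ends d = branch-pos d , branch-pos d

      down-ends : D j ≡ 0 → hd j ≡ x × tl j ≡ q
      down-ends d = branch-zero d , branch-zero d

      token : 1 ≤ I x → wp walkToken Result s
      token Ix =
        (λ ox →
          (λ p → let (d , s≥) = ∧-true _ _ p ; (up , hj) = up-ends d in
            (λ g → let (so , e) = ∧-true _ _ g
                       A′ = grow-labelled A up hj Ix ox s≥ so (same-true _ _ e) refl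
                       (sl′ , le′) = front-ok A′ sl le
                   in (env refl , refl) , inj₂ (on , j ∷ as , A′ , sl′ , le′))
            , (λ z → kept (stay-labelled A up hj Ix ox s≥ (λ so e → ∧-false _ _ z so (same-false _ _ e)))))
          , (λ z → (env₀ refl , refl) , inj₂ (≤-refl , [] ,
              switch-closed Ix ox (λ e → unlabelled z e) refl ≤-refl , refl , <⇒≤ j<)))
        , (λ z → kept (stay-idle A Ix z))
        where
        unlabelled : D j ∸ (D j ∸ S j) ≡ 0 → tl j ≡ x → S j ≡ 0
        unlabelled z e with zero⊎pos (S j) | zero⊎pos (D j)
        ... | inj₁ r | _ = r
        ... | inj₂ p | inj₂ d = ⊥-elim (∧-false _ _ z d p)
        ... | inj₂ p | inj₁ d = ⊥-elim (X≢Q j< (trans (sym e) (proj₂ (down-ends d))))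

      up : I x ≡ 0 → 1 ≤ D j → wp walkUp Result s
      up Ix d =
        (λ g → let (eo , g₁) = ∧-true _ _ g ; (e , more) = ∧-true _ _ g₁ in
          (env₀ refl , refl) , inj₂ (≤-refl , [] ,
            switch-up A (proj₁ (up-ends d)) (proj₂ (up-ends d)) Ix (not-true _ eo) (same-true _ _ e) (∸-pos _ _ more) ≤-refl ≤-refl ,
            refl , <⇒≤ j<))
        , (λ z → let few = few′ z in
          (λ g → let (so , g₁) = ∧-true _ _ g ; (e , g₂) = ∧-true _ _ g₁ ; (f , g₃) = ∧-true _ _ g₂ ; (c , l) = ∧-true _ _ g₃
                     A′ = grow-up A (proj₁ (up-ends d)) (proj₂ (up-ends d)) Ix few so (same-true _ _ e) f
                            (unclaimed (not-true _ c)) (enters (not-true _ l))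
                     (sl′ , le′) = front-ok A′ sl le
                 in (env refl , refl) , inj₂ (on , j ∷ as , A′ , sl′ , le′))
          , (λ z′ → kept (stay-up A (proj₁ (up-ends d)) (proj₂ (up-ends d)) Ix few (λ so e f → blocked z′ so e f))))
        where
        few′ : _ → scalar s 13 ≡ 0 → scalar s 11 ≡ q → OUT x ≤ F j
        few′ z eo e with zero⊎pos (OUT x ∸ F j)
        ... | inj₁ r = m∸n≡0⇒m≤n r
        ... | inj₂ r = ⊥-elim (∧-false _ _ z (not-intro (λ p → ≥1⇒≢0 p eo)) (∧-intro (same-false _ _ e) r))
        unclaimed : tS q ∸ (tS q ∸ I (tS q ∸ 1)) ≡ 0 → Claimed q → ⊥
        unclaimed z (i , i< , eq , s≥ , p) = ∧-false _ _ z (≤-trans (s≤s z≤n) (≤-reflexive (sym tS-q)))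
          (subst (λ v → 1 ≤ I v) (sym (cong (_∸ 1) tS-q)) p)
          where
          tS-q : tS q ≡ suc (tl i)
          tS-q = trans (cong tS (sym eq)) (→taken i< s≥)
        enters : T j ∸ (T j ∸ ((1 ∸ (F j ∸ 1)) ∸ ((1 ∸ (F j ∸ 1)) ∸ (IN q ∸ 1)))) ≡ 0 → 1 ≤ T j → F j ≤ 1 → IN q ≤ 1
        enters z τ f = ≮⇒≥ (λ lt → ∧-false _ _ z τ (∧-intro (not-intro (λ p → ≥1⇒≢0 p (m≤n⇒m∸n≡0 f))) (∸-intro lt)))
        blocked : _ → 1 ≤ scalar s 12 → scalar s 10 ≡ q → 1 ≤ F j → Claimed q ⊎ (1 ≤ T j × F j ≤ 1 × 2 ≤ IN q)
        blocked z so e f with zero⊎pos (1 ∸ (tS q ∸ (tS q ∸ I (tS q ∸ 1))))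
        ... | inj₁ r with ∧-true (tS q) _ (not-false _ r)
        ...   | t≥ , i≥ with taken→ t≥
        ...     | i , i< , eq , s≥ = inj₁ (i , i< , eq , s≥ ,
                  subst (λ v → 1 ≤ I v) (cong (_∸ 1) (trans (cong tS (sym eq)) (→taken i< s≥))) i≥)
        blocked z so e f | inj₂ r
          with zero⊎pos (1 ∸ (T j ∸ (T j ∸ ((1 ∸ (F j ∸ 1)) ∸ ((1 ∸ (F j ∸ 1)) ∸ (IN q ∸ 1))))))
        ... | inj₂ r′ = ⊥-elim (∧-false _ _ z so (∧-intro (same-false _ _ e) (∧-intro f (∧-intro r r′))))
        ... | inj₁ r′ with ∧-true (T j) _ (not-false _ r′)
        ...   | τ , w with ∧-true (1 ∸ (F j ∸ 1)) _ w
        ...     | w₁ , w₂ = inj₂ (τ , m∸n≡0⇒m≤n (not-true _ w₁) , ∸-pos _ _ w₂)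

      down : I x ≡ 0 → D j ≡ 0 → wp walkDown Result s
      down Ix d =
        (λ Iq →
          (λ g → let (s≥ , e) = ∧-true _ _ g
                     (_ , A′) = grow-token A (proj₁ (down-ends d)) (proj₂ (down-ends d)) Ix Iq s≥ (same-true _ _ e)
                 in (env refl , refl) , inj₂ (on , as ∷ʳ j , A′ ,
                      subst (Slice _ _ _) (+-comm 1 _) (slice-back as sl) , <⇒≤ le))
          , (λ z → kept (stay-token A (proj₁ (down-ends d)) (proj₂ (down-ends d)) Ix Iq
              (λ s≥ e → ∧-false _ _ z s≥ (same-false _ _ e)))))
        , (λ Iq →
          (λ g → let (ox , sp) = ∧-true _ _ g in
            (env₀ refl , refl) , inj₂ (≤-refl , [] ,
              switch-down (proj₁ (down-ends d)) (proj₂ (down-ends d)) Ix Iq ox (≤-trans sp (m∸n≤m _ (J x ∸ (J x ∸ (1 ∸ (T j ∸ (T j ∸ F j)))))))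
                (λ one J≥ → spare sp one J≥) ≤-refl ≤-refl , refl , <⇒≤ j<))
          , (λ z → let nospare = nospare′ z in
            (λ g → let (eo , g₁) = ∧-true _ _ g ; (e , g₂) = ∧-true _ _ g₁ ; (f , l) = ∧-true _ _ g₂
                       A′ = grow-down A (proj₁ (down-ends d)) (proj₂ (down-ends d)) Ix Iq nospare eo (same-true _ _ e) f
                              (λ o → leaves (not-true _ l) o)
                   in (env refl , refl) , inj₂ (on , as ∷ʳ j , A′ ,
                        subst (Slice _ _ _) (+-comm 1 _) (slice-back as sl) , <⇒≤ le))
            , (λ z′ → kept (stay-down A (proj₁ (down-ends d)) (proj₂ (down-ends d)) Ix Iq nospare
                (λ eo e f lv → ∧-false _ _ z′ eo (∧-intro (same-false _ _ e) (∧-intro f (not-intro (λ w →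
                  let (w₁ , w₂) = ∧-true _ _ w in 1+n≰n (≤-trans (∸-pos _ _ w₂) (lv (not-true _ w₁))))))))))))
        where
        reserved : ℕ
        reserved = J x ∸ (J x ∸ (1 ∸ (T j ∸ (T j ∸ F j))))
        spare : 1 ≤ (IN x ∸ F j) ∸ reserved → IN x ∸ F j ≤ 1 → 1 ≤ J x → 1 ≤ T j × 1 ≤ F j
        spare sp one J≥ with zero⊎pos (1 ∸ (T j ∸ (T j ∸ F j)))
        ... | inj₁ r = ∧-true (T j) (F j) (not-false _ r)
        ... | inj₂ r = ⊥-elim (1+n≰n (≤-trans (≤-trans (s≤s (∧-intro {J x} {1 ∸ (T j ∸ (T j ∸ F j))} J≥ r)) (∸-pos _ _ sp)) one))
        nospare′ : _ → 1 ≤ OUT x → Spare → ⊥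
        nospare′ z ox (sp , one) = ∧-false _ _ z ox (∸-intro (more (zero⊎pos reserved)))
          where
          more : reserved ≡ 0 ⊎ 1 ≤ reserved → reserved < IN x ∸ F j
          more (inj₁ r) = subst (_< IN x ∸ F j) (sym r) sp
          more (inj₂ r) with ∧-true (J x) (1 ∸ (T j ∸ (T j ∸ F j))) r
          ... | J≥ , nt = ≤-trans (s≤s (≤-trans (m∸n≤m (J x) (J x ∸ (1 ∸ (T j ∸ (T j ∸ F j))))) (Plan.J≤1 P x))) (≰⇒> (λ le₁ →
                let (τ , f) = one le₁ J≥ in ≥1⇒≢0 (∧-intro τ f) (not-true _ nt)))
        leaves : (1 ∸ OUT x) ∸ ((1 ∸ OUT x) ∸ (OUT q ∸ 1)) ≡ 0 → OUT x ≡ 0 → OUT q ≤ 1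
        leaves z o = ≮⇒≥ (λ lt → ∧-false _ _ z (not-intro (λ p → ≥1⇒≢0 p o)) (∸-intro lt))

      arc : wp walkArc Result s
      arc = (λ _ → (λ Ix → token Ix) , (λ Ix → (λ d → up Ix d) , (λ d → down Ix d)))
          , (λ z → ⊥-elim (≥1⇒≢0 on z))

    arc-none : scalar s 16 ≡ 0 → scalar s 14 ≡ scalar s 15 → Idle j → wp walkArc Result s
    arc-none z e idle = (λ p → ⊥-elim (≥1⇒≢0 p z)) , (λ _ → (env₀ refl , refl) , inj₁ (z , e , λ {i} → idle {i}))

-- The arcs of a path are distinct, so a round makes at most `m` slides and takes linear time.
unique-bounded : ∀ {m} {xs : List ℕ} → All (_< m) xs → Unique xs → length xs ≤ m
unique-bounded {m} {xs} below u = Fin.injective⇒≤ {f = λ i → fromℕ< (All.lookup below (∈-lookup i))}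
  (λ {i} {j} e → lookup-injective u i j (Fin.fromℕ<-injective _ _ _ _ e))

module WalkLoop {n m X Q D I J F IN OUT S T tS} (O : Order n m X Q)
  (P : Plan n m (tail-of X Q D) (head-of X Q D) I J F IN OUT S T)
  (B : TakenBy m (tail-of X Q D) (head-of X Q D) S tS) where
  open Walker O P B public

  Surrounding : State → Set
  Surrounding = Env m X Q D I J F IN OUT S T tS

  Begun : ℕ → State → Set
  Begun j s = (scalar s 16 ≡ 0 × scalar s 14 ≡ scalar s 15 × Idle j) ⊎ (1 ≤ scalar s 16 × PathAt (suc j) s)

  WalkInv : ℕ → State → Set
  WalkInv k s = Surrounding s × scalar s 4 ≡ k × k ≤ m × Walking k s

-- Matching the memory equations against `refl` turns the named functions into the arrays of `s`,
-- which is the setting of `WalkBody`.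
walk-root : ∀ {n m X Q D I J F IN OUT S T tS} (O : Order n m X Q) P B {j} s → let open WalkLoop {D = D} {I} {J} {F} {IN} {OUT} {S} {T} {tS} O P B in
  Surrounding s → scalar s 4 ≡ j → j < m → Walking (suc j) s →
  Ends walkRoot s (steps walkRoot) (λ s′ → (Surrounding s′ × scalar s′ 4 ≡ j) × Begun j s′)
walk-root O P B s record { s1 = refl ; I≡ = refl ; J≡ = refl ; X≡ = refl ; Q≡ = refl ; D≡ = refl ; F≡ = refl
  ; IN≡ = refl ; OUT≡ = refl ; S≡ = refl ; T≡ = refl ; tS≡ = refl } refl j< w = WalkBody.root s O P B j< w

walk-arc : ∀ {n m X Q D I J F IN OUT S T tS} (O : Order n m X Q) P B {j} s → let open WalkLoop {D = D} {I} {J} {F} {IN} {OUT} {S} {T} {tS} O P B in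
  Surrounding s → scalar s 4 ≡ j → j < m → Begun j s →
  Ends walkArc s (steps walkArc) (λ s′ → (Surrounding s′ × scalar s′ 4 ≡ j) × Walking j s′)
walk-arc O P B s record { s1 = refl ; I≡ = refl ; J≡ = refl ; X≡ = refl ; Q≡ = refl ; D≡ = refl ; F≡ = refl
  ; IN≡ = refl ; OUT≡ = refl ; S≡ = refl ; T≡ = refl ; tS≡ = refl } refl j< (inj₁ (z , e , idle)) =
    ends-wp walkArc (WalkBody.arc-none s O P B j< z e (λ {i} → idle {i}))
walk-arc O P B s record { s1 = refl ; I≡ = refl ; J≡ = refl ; X≡ = refl ; Q≡ = refl ; D≡ = refl ; F≡ = refl
  ; IN≡ = refl ; OUT≡ = refl ; S≡ = refl ; T≡ = refl ; tS≡ = refl } refl j< (inj₂ (on , as , A , sl , le)) =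
    ends-wp walkArc (WalkBody.arc s O P B j< A sl le on)

module WalkLoopEnds {n m X Q D I J F IN OUT S T tS} (O : Order n m X Q)
  (P : Plan n m (tail-of X Q D) (head-of X Q D) I J F IN OUT S T)
  (B : TakenBy m (tail-of X Q D) (head-of X Q D) S tS) where
  open WalkLoop O P B public

  env-scalar : ∀ {s sc} → sc 1 ≡ scalar s 1 → Surrounding s → Surrounding ⟨ sc , array s ⟩
  env-scalar e E = record { s1 = trans e s1 ; I≡ = I≡ ; J≡ = J≡ ; X≡ = X≡ ; Q≡ = Q≡ ; D≡ = D≡ ; F≡ = F≡ ; IN≡ = IN≡
    ; OUT≡ = OUT≡ ; S≡ = S≡ ; T≡ = T≡ ; tS≡ = tS≡ }
    where open Env E

  walk-body : ∀ k s → WalkInv k s → scalar s 4 ≢ 0 → Ends walkStep s (steps walkStep) (λ s′ → ∃[ k′ ] k′ < k × WalkInv k′ s′)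
  walk-body zero s (_ , e , _) ne = ⊥-elim (ne e)
  walk-body (suc j) s (E , e , j< , w) _ = ends-seq {P = λ t → t ≡ s₁} (ends-wp (4 ≔ var 4 ⊖ lit 1) refl)
    (λ { _ refl → ends-seq (walk-root O P B s₁ (env-scalar refl E) (cong (_∸ 1) e) j< w)
      (λ s₂ ((E₂ , e₂) , b) → ends-weaken ≤-refl (λ s₃ ((E₃ , e₃) , w₃) → j , ≤-refl , E₃ , e₃ , <⇒≤ j< , w₃)
        (walk-arc O P B s₂ E₂ e₂ j< b)) })
    where
    s₁ : State
    s₁ = ⟨ update (scalar s) 4 (scalar s 4 ∸ 1) , array s ⟩

  walk-ends : ∀ {s} → Surrounding s → scalar s 4 ≡ m → scalar s 14 ≡ scalar s 15 → scalar s 16 ≡ 0 →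
    Ends (WhileNonzero var 4 Do walkStep) s (suc m * (2 + steps walkStep)) (λ s′ → Surrounding s′ × Walking 0 s′)
  walk-ends {s} E e lo z = ends-weaken ≤-refl finish
    (ends-while WalkInv walk-body m s (E , e , ≤-refl , inj₁ (z , lo , λ a b → ⊥-elim (<⇒≱ b a))))
    where
    finish : ∀ s′ → (∃[ k ] WalkInv k s′ × scalar s′ 4 ≡ 0) → Surrounding s′ × Walking 0 s′
    finish s′ (k , (E′ , e′ , _ , w) , z′) with trans (sym e′) z′
    ... | refl = E′ , w

-- Sliding along the path

record MoveAt (m : ℕ) (t h : ℕ → ℕ) (u w : ℕ) (A A′ : ℕ → ℕ) : Set where
  field
    arc   : ∃[ j ] j < m × t j ≡ u × h j ≡ w
    from  : A u ≡ 1
    left  : A′ u ≡ 0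
    to    : A w ≡ 0
    come  : A′ w ≡ 1
    other : ∀ v → v ≢ u → v ≢ w → A v ≡ A′ v

record FreeSet (m : ℕ) (t h A : ℕ → ℕ) : Set where
  field
    ≤1   : ∀ v → A v ≤ 1
    free : ∀ {i} → i < m → 1 ≤ A (t i) → 1 ≤ A (h i) → ⊥

-- `past` is a ghost sequence: memory retains only the present set and the ends of the arcs used.
record History (m : ℕ) (t h I₀ : ℕ → ℕ) (s : State) : Set where
  field
    past  : ℕ → ℕ → ℕ
    valid : ∀ i → i ≤ scalar s 17 → FreeSet m t h (past i)
    start₀ : ∀ v → past 0 v ≡ I₀ v
    now   : ∀ v → past (scalar s 17) v ≡ array s 2 v
    moves : ∀ i → i < scalar s 17 → MoveAt m t h (array s 0 i) (array s 1 i) (past i) (past (suc i))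

history-frame : ∀ {m t h I₀ s s′} → scalar s′ 17 ≡ scalar s 17 → array s′ 0 ≡ array s 0 → array s′ 1 ≡ array s 1 →
  array s′ 2 ≡ array s 2 → History m t h I₀ s → History m t h I₀ s′
history-frame {m} {t} {h} {I₀} {s} {s′} e₀ e₁ e₂ e₃ H = record
  { past = past
  ; valid = λ i le → valid i (subst (i ≤_) e₀ le)
  ; start₀ = start₀
  ; now = λ v → trans (cong (λ c → past c v) e₀) (trans (now v) (cong (λ g → g v) (sym e₃)))
  ; moves = λ i lt → subst₂ (λ f g → MoveAt m t h (f i) (g i) (past i) (past (suc i))) (sym e₁) (sym e₂) (moves i (subst (i <_) e₀ lt)) }
  where open History H

history-snoc : ∀ {m t h I₀ s s′ u w} → History m t h I₀ s →
  scalar s′ 17 ≡ suc (scalar s 17) → array s′ 0 ≡ update (array s 0) (scalar s 17) u →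
  array s′ 1 ≡ update (array s 1) (scalar s 17) w →
  MoveAt m t h u w (array s 2) (array s′ 2) → FreeSet m t h (array s′ 2) → History m t h I₀ s′
history-snoc {m} {t} {h} {I₀} {s} {s′} {u} {w} H e₀ e₁ e₂ mv ok = record
  { past = past′
  ; valid = λ i le → valid′ i (subst (i ≤_) e₀ le)
  ; start₀ = λ v → trans (cong (λ f → f v) (update-other past (suc c) {array s′ 2} 0 (λ ()))) (start₀ v)
  ; now = λ v → trans (cong (λ k → past′ k v) e₀) (cong (λ f → f v) (update-same past (suc c) (suc c) refl))
  ; moves = λ i lt → subst₂ (λ f g → MoveAt m t h (f i) (g i) (past′ i) (past′ (suc i))) (sym e₁) (sym e₂)
      (moves′ i (≤-pred (subst (i <_) e₀ lt))) }
  where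
  open History H
  c = scalar s 17
  past′ : ℕ → ℕ → ℕ
  past′ = update past (suc c) (array s′ 2)
  old : ∀ i → i ≤ c → past′ i ≡ past i
  old i le = update-other past (suc c) i (<⇒≢ (s≤s le))
  valid′ : ∀ i → i ≤ suc c → FreeSet m t h (past′ i)
  valid′ i le with m≤n⇒m<n∨m≡n le
  ... | inj₁ (s≤s lt) = subst (FreeSet m t h) (sym (old i lt)) (valid i lt)
  ... | inj₂ refl = subst (FreeSet m t h) (sym (update-same past (suc c) (suc c) refl)) ok
  moves′ : ∀ i → i ≤ c → MoveAt m t h (update (array s 0) c u i) (update (array s 1) c w i) (past′ i) (past′ (suc i))
  moves′ i le with m≤n⇒m<n∨m≡n le
  ... | inj₁ lt rewrite old i le | old (suc i) lt | update-other (array s 0) c {u} i (<⇒≢ lt) | update-other (array s 1) c {w} i (<⇒≢ lt) = moves i lt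
  ... | inj₂ refl rewrite old c ≤-refl | update-same past (suc c) {array s′ 2} (suc c) refl
                        | update-same (array s 0) c {u} c refl | update-same (array s 1) c {w} c refl = record
    { arc = arc ; from = trans (now u) from ; left = left ; to = trans (now w) to ; come = come
    ; other = λ v a b → trans (now v) (other v a b) }
    where open MoveAt mv

record Static (m : ℕ) (X Q D J S T tS : ℕ → ℕ) (s : State) : Set where
  field
    s1  : scalar s 1 ≡ m
    J≡  : array s 3 ≡ J
    X≡  : array s 6 ≡ X
    Q≡  : array s 7 ≡ Q
    D≡  : array s 8 ≡ D
    S≡  : array s 12 ≡ S
    T≡  : array s 13 ≡ T
    tS≡ : array s 15 ≡ tS

module SlideLoop {n m X Q D I J F IN OUT S T tS} (I₀ : ℕ → ℕ) (O : Order n m X Q)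
  (P : Plan n m (tail-of X Q D) (head-of X Q D) I J F IN OUT S T)
  (B : TakenBy m (tail-of X Q D) (head-of X Q D) S tS)
  {p₀ p₁ so eo as} (A : Walker.First {D = D} {I} {J} {F} {IN} {OUT} {S} {T} O P B 0 p₀ p₁ so eo as) where
  open Walker O P B
  open Ends-of O D
  open Along A
  open Plan P using (I≤1; I-free)
  private module A = First A

  StaticHere : State → Set
  StaticHere = Static m X Q D J S T tS

  -- The token stands at `u` with the arcs `rs` ahead of it. The law and the flow sums hold
  -- throughout, while the remaining conditions of a plan are established anew only when it has
  -- arrived.
  record Sliding (rs : List ℕ) (u : ℕ) (s : State) : Set where
    field
      st     : StaticHere s
      on-u   : On p₀ as u
      slice  : Slice (array s 18) (scalar s 14) rs (scalar s 15)
      path   : Path u rs p₁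
      within : All (λ i → Any (i ≡_) as) rs
      distinct : Unique rs
      here₁  : array s 2 u ≡ 1
      gone₁  : u ≢ p₀ → array s 2 p₀ ≡ 0
      rest₁  : ∀ v → v ≢ u → v ≢ p₀ → array s 2 v ≡ I v
      ahead  : All (λ i → F i ≡ array s 9 i) rs
      used   : ∀ {i} → Any (i ≡_) as → (Any (i ≡_) rs → ⊥) → F i ≡ suc (array s 9 i)
      unused : ∀ {i} → i < m → (Any (i ≡_) as → ⊥) → F i ≡ array s 9 i
      law    : ∀ {v} → v < n → array s 2 v + array s 10 v ≡ J v + array s 11 v
      IN-sum : ∀ {v} → v < n → array s 10 v ≡ flow m hd (array s 9) v
      OUT-sum : ∀ {v} → v < n → array s 11 v ≡ flow m tl (array s 9) v
      hist   : History m tl hd I₀ s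

  record Slid (s s′ : State) (a u w : ℕ) : Set where
    field
      st   : StaticHere s → StaticHere s′
      s14  : scalar s′ 14 ≡ suc (scalar s 14)
      s15  : scalar s′ 15 ≡ scalar s 15
      s17  : scalar s′ 17 ≡ suc (scalar s 17)
      a0   : array s′ 0 ≡ update (array s 0) (scalar s 17) u
      a1   : array s′ 1 ≡ update (array s 1) (scalar s 17) w
      a2   : array s′ 2 ≡ update (update (array s 2) u 0) w 1
      a9   : array s′ 9 ≡ update (array s 9) a (array s 9 a ∸ 1)
      a10  : array s′ 10 ≡ update (array s 10) w (array s 10 w ∸ 1)
      a11  : array s′ 11 ≡ update (array s 11) u (array s 11 u ∸ 1)
      a18  : array s′ 18 ≡ array s 18

  lowered : ∀ {h f g : ℕ → ℕ} {a} → a < m → 1 ≤ f a → (∀ {v} → v < n → g v ≡ flow m h f v) →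
    ∀ {v} → v < n → update g (h a) (g (h a) ∸ 1) v ≡ flow m h (update f a (f a ∸ 1)) v
  lowered {h} {f} {g} {a} a< f≥ g≡ {v} v< with v ≟ h a
  ... | yes refl = trans (update-same g (h a) (h a) refl) (trans (cong (_∸ 1) (trans (g≡ v<)
      (+-cancelʳ-≡ (f a ∸ 1) _ _ (trans (sym (trans (flow-update {h = h} f (h a) (f a ∸ 1) a<)
        (cong (flow m h f (h a) +_) (pick-same {h a} _ refl))))
        (trans (cong (flow m h (update f a (f a ∸ 1)) (h a) +_) (trans (pick-same {h a} _ refl) (sym (m+[n∸m]≡n f≥))))
          (sym (+-assoc (flow m h (update f a (f a ∸ 1)) (h a)) 1 (f a ∸ 1))))))))
      (m+n∸n≡m _ 1))
  ... | no ne = trans (update-other g (h a) v ne) (trans (g≡ v<) (sym (trans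
      (sym (trans (cong (flow m h (update f a (f a ∸ 1)) v +_) (pick-other (f a) (≢-sym ne))) (+-identityʳ _)))
      (trans (flow-update {h = h} f v (f a ∸ 1) a<)
        (trans (cong (flow m h f v +_) (pick-other (f a ∸ 1) (≢-sym ne))) (+-identityʳ _))))))

  slid : ∀ {s s′ a rs u} (L : Sliding (a ∷ rs) u s) → Slid s s′ a (tl a) (hd a) → Sliding rs (hd a) s′
  slid L E with Sliding.path L
  ... | refl ∷ path′ = slid-on L E path′
    where
    slid-on : ∀ {s s′ a rs} (L : Sliding (a ∷ rs) (tl a) s) → Slid s s′ a (tl a) (hd a) → Path (hd a) rs p₁ → Sliding rs (hd a) s′
    slid-on {s} {s′} {a} {rs} L E path′ with L
    ... | record { within = a-on ∷ within ; distinct = a-new ∷ distinct ; slice = (e₁₄ , slice) ; ahead = Fa ∷ ahead } = record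
      { st = E.st L.st
      ; on-u = hd-on a-on
      ; slice = subst₂ (λ f lo → Slice f lo rs (scalar s′ 15)) (sym E.a18) (sym E.s14) (subst (Slice (array s 18) (suc (scalar s 14)) rs) (sym E.s15) slice)
      ; path = path′
      ; within = within
      ; distinct = distinct
      ; here₁ = trans (at E.a2 w) here₂
      ; gone₁ = λ ne → trans (at E.a2 p₀) (gone₂ ne)
      ; rest₁ = λ v a b → trans (at E.a2 v) (rest₂ v a b)
      ; ahead = ahead′ a-new ahead
      ; used = λ {i} on off → used′ on off (i ≟ a)
      ; unused = λ {i} i< off → trans (L.unused i< off) (sym (trans (at E.a9 i) (update-other (array s 9) a i (λ { refl → off a-on }))))
      ; law = λ {v} v< → law′ v v<
      ; IN-sum = λ {v} v< → trans (at E.a10 v) (trans (lowered {hd} a< F≥ L.IN-sum v<) (cong (λ f → flow m hd f v) (sym E.a9)))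
      ; OUT-sum = λ {v} v< → trans (at E.a11 v) (trans (lowered {tl} a< F≥ L.OUT-sum v<) (cong (λ f → flow m tl f v) (sym E.a9)))
      ; hist = history-snoc L.hist E.s17 E.a0 E.a1 step free-set }
      where
      module L = Sliding L
      module E = Slid E
      u = tl a
      w = hd a
      at : ∀ {f g : ℕ → ℕ} → f ≡ g → ∀ v → f v ≡ g v
      at refl v = refl
      a< : a < m
      a< = proj₂ (on-added a-on A.added)
        where
        on-added : ∀ {bs} → Any (a ≡_) bs → All (λ i → 0 ≤ i × i < m) bs → 0 ≤ a × a < m
        on-added (here refl) (p ∷ _) = p
        on-added (there o) (_ ∷ ps) = on-added o ps
      F≥ : 1 ≤ array s 9 a
      F≥ = subst (1 ≤_) Fa (proj₁ (enters-on a-on))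
      u≢w : u ≢ w
      u≢w = tl≢hd a<
      w≢p₀ : w ≢ p₀
      w≢p₀ = go a-on A.simple
        where
        go : ∀ {bs} → Any (a ≡_) bs → All (λ i → hd i ≢ p₀) bs → hd a ≢ p₀
        go (here refl) (p ∷ _) = p
        go (there o) (_ ∷ ps) = go o ps
      Iw : I w ≡ 0
      Iw with zero⊎pos (I w)
      ... | inj₁ z = z
      ... | inj₂ p = ⊥-elim (w≢p₀ (A.alone (hd-on a-on) p))
      next : ℕ → ℕ
      next = update (update (array s 2) u 0) w 1
      here₂ : next w ≡ 1
      here₂ = update-same (update (array s 2) u 0) w w refl
      left₂ : next u ≡ 0
      left₂ = trans (update-other (update (array s 2) u 0) w u u≢w) (update-same (array s 2) u u refl)
      away : ∀ v → v ≢ w → v ≢ u → next v ≡ array s 2 v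
      away v a b = trans (update-other (update (array s 2) u 0) w v a) (update-other (array s 2) u v b)
      gone₂ : w ≢ p₀ → next p₀ ≡ 0
      gone₂ ne with p₀ ≟ u
      ... | yes refl = left₂
      ... | no ne′ = trans (away p₀ (≢-sym ne) ne′) (L.gone₁ (≢-sym ne′))
      rest₂ : ∀ v → v ≢ w → v ≢ p₀ → next v ≡ I v
      rest₂ v a b with v ≟ u
      ... | no ne = trans (away v a ne) (L.rest₁ v ne b)
      ... | yes refl with zero⊎pos (I u)
      ...   | inj₁ z = trans left₂ (sym z)
      ...   | inj₂ p = ⊥-elim (b (A.alone L.on-u p))
      ahead′ : ∀ {bs} → All (a ≢_) bs → All (λ i → F i ≡ array s 9 i) bs → All (λ i → F i ≡ array s′ 9 i) bs
      ahead′ [] [] = []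
      ahead′ {b ∷ _} (ne ∷ nes) (e ∷ es) = trans e (sym (trans (at E.a9 b) (update-other (array s 9) a b (≢-sym ne)))) ∷ ahead′ nes es
      used′ : ∀ {i} → Any (i ≡_) as → (Any (i ≡_) rs → ⊥) → _ → F i ≡ suc (array s′ 9 i)
      used′ {i} on off (yes refl) = trans Fa (trans (sym (m+[n∸m]≡n F≥)) (cong suc (sym (trans (at E.a9 a) (update-same (array s 9) a a refl)))))
      used′ {i} on off (no ne) = trans (L.used on (λ { (here e) → ne e ; (there o) → off o }))
        (cong suc (sym (trans (at E.a9 i) (update-other (array s 9) a i ne))))
      law′ : ∀ v → v < n → array s′ 2 v + array s′ 10 v ≡ J v + array s′ 11 v
      law′ v v< rewrite E.a2 | E.a10 | E.a11 with v ≟ u | v ≟ w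
      ... | yes refl | yes e = ⊥-elim (u≢w e)
      ... | yes refl | no ne = trans (cong₂ _+_ left₂ (update-other (array s 10) w u ne))
            (suc-injective (trans (trans (cong (_+ array s 10 u) (sym L.here₁)) (L.law v<))
              (trans (cong (J u +_) (sym (m+[n∸m]≡n OUT≥))) (trans (+-suc (J u) _)
                (cong (λ z → suc (J u + z)) (sym (update-same (array s 11) u u refl)))))))
            where
            OUT≥ : 1 ≤ array s 11 u
            OUT≥ = ≤-trans F≥ (≤-trans (≤flow m {tl} {array s 9} a< refl) (≤-reflexive (sym (L.OUT-sum v<))))
      ... | no ne | yes refl = trans (cong₂ _+_ here₂ (update-same (array s 10) w w refl))
            (trans (m+[n∸m]≡n IN≥) (trans (trans (cong (_+ array s 10 w) (sym (trans (L.rest₁ w ne w≢p₀) Iw))) (L.law v<))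
              (cong (J w +_) (sym (update-other (array s 11) u w ne)))))
            where
            IN≥ : 1 ≤ array s 10 w
            IN≥ = ≤-trans F≥ (≤-trans (≤flow m {hd} {array s 9} a< refl) (≤-reflexive (sym (L.IN-sum v<))))
      ... | no nu | no nw = trans (cong₂ _+_ (away v nw nu) (update-other (array s 10) w v nw))
            (trans (L.law v<) (cong (J v +_) (sym (update-other (array s 11) u v nu))))
      step : MoveAt m tl hd u w (array s 2) (array s′ 2)
      step = record
        { arc = a , a< , refl , refl
        ; from = L.here₁
        ; left = trans (at E.a2 u) left₂
        ; to = trans (L.rest₁ w (≢-sym u≢w) w≢p₀) Iw
        ; come = trans (at E.a2 w) here₂
        ; other = λ v a b → sym (trans (at E.a2 v) (away v b a)) }
      occupied : ∀ {v} → 1 ≤ array s′ 2 v → v ≡ w ⊎ (1 ≤ I v × v ≢ p₀)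
      occupied {v} p with v ≟ w
      ... | yes e = inj₁ e
      ... | no ne with v ≟ p₀
      ...   | yes refl = ⊥-elim (≥1⇒≢0 p (trans (at E.a2 p₀) (gone₂ w≢p₀)))
      ...   | no ne′ = inj₂ (subst (1 ≤_) (trans (at E.a2 v) (rest₂ v ne ne′)) p , ne′)
      free-set : FreeSet m tl hd (array s′ 2)
      free-set = record { ≤1 = small ; free = free }
        where
        small : ∀ v → array s′ 2 v ≤ 1
        small v with v ≟ w | v ≟ p₀
        ... | yes refl | _ = ≤-reflexive (trans (at E.a2 w) here₂)
        ... | no _ | yes refl = ≤-trans (≤-reflexive (trans (at E.a2 p₀) (gone₂ w≢p₀))) z≤n
        ... | no x | no y = ≤-trans (≤-reflexive (trans (at E.a2 v) (rest₂ v x y))) (I≤1 v)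
        -- A token next to the moving one would be next to the path, hence the token of `p₀`, which
        -- is the moving one itself.
        free : ∀ {i} → i < m → 1 ≤ array s′ 2 (tl i) → 1 ≤ array s′ 2 (hd i) → ⊥
        free i< p q with occupied p | occupied q
        ... | inj₁ e | inj₁ e′ = tl≢hd i< (trans e (sym e′))
        ... | inj₁ e | inj₂ (q′ , ne) = ne (A.alone-h z≤n i< (subst (On p₀ as) (sym e) (hd-on a-on)) q′)
        ... | inj₂ (p′ , ne) | inj₁ e = ne (A.alone-t z≤n i< (subst (On p₀ as) (sym e) (hd-on a-on)) p′)
        ... | inj₂ (p′ , _) | inj₂ (q′ , _) = I-free i< p′ q′

module SlideProgram {n m X Q D I J F IN OUT S T tS} (I₀ : ℕ → ℕ) (O : Order n m X Q)
  (P : Plan n m (tail-of X Q D) (head-of X Q D) I J F IN OUT S T)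
  (B : TakenBy m (tail-of X Q D) (head-of X Q D) S tS)
  {p₀ p₁ so eo as} (A : Walker.First {D = D} {I} {J} {F} {IN} {OUT} {S} {T} O P B 0 p₀ p₁ so eo as) where
  open Walker O P B
  open Ends-of O D
  open Along A
  open SlideLoop I₀ O P B A

  raw-up : ∀ s → 1 ≤ array s 8 (array s 18 (scalar s 14)) → Ends slideStep s (steps slideStep) (λ s′ →
    Slid s s′ (array s 18 (scalar s 14)) (array s 6 (array s 18 (scalar s 14))) (array s 7 (array s 18 (scalar s 14))))
  raw-up s d = ends-wp slideStep
    ( (λ _ → record { st = λ st → let open Static st in record { s1 = s1 ; J≡ = J≡ ; X≡ = X≡ ; Q≡ = Q≡ ; D≡ = D≡ ; S≡ = S≡ ; T≡ = T≡ ; tS≡ = tS≡ }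
        ; s14 = +-comm _ 1 ; s15 = refl ; s17 = +-comm _ 1 ; a0 = refl ; a1 = refl ; a2 = refl ; a9 = refl ; a10 = refl ; a11 = refl ; a18 = refl })
    , (λ z → ⊥-elim (≥1⇒≢0 d z)))

  raw-down : ∀ s → array s 8 (array s 18 (scalar s 14)) ≡ 0 → Ends slideStep s (steps slideStep) (λ s′ →
    Slid s s′ (array s 18 (scalar s 14)) (array s 7 (array s 18 (scalar s 14))) (array s 6 (array s 18 (scalar s 14))))
  raw-down s d = ends-wp slideStep
    ( (λ p → ⊥-elim (≥1⇒≢0 p d))
    , (λ _ → record { st = λ st → let open Static st in record { s1 = s1 ; J≡ = J≡ ; X≡ = X≡ ; Q≡ = Q≡ ; D≡ = D≡ ; S≡ = S≡ ; T≡ = T≡ ; tS≡ = tS≡ }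
        ; s14 = +-comm _ 1 ; s15 = refl ; s17 = +-comm _ 1 ; a0 = refl ; a1 = refl ; a2 = refl ; a9 = refl ; a10 = refl ; a11 = refl ; a18 = refl }))

  slid-cong : ∀ {s s′ a a′ u u′ w w′} → a ≡ a′ → u ≡ u′ → w ≡ w′ → Slid s s′ a u w → Slid s s′ a′ u′ w′
  slid-cong refl refl refl E = E

  slide-step : ∀ {s a rs u} → Sliding (a ∷ rs) u s → Ends slideStep s (steps slideStep) (Sliding rs (hd a))
  slide-step {s} {a} L with zero⊎pos (D a)
  ... | inj₂ d = ends-weaken ≤-refl (λ s′ E → slid L (slid-cong e₁
      (trans (cong₂ (λ f i → f i) X≡ e₁) (sym (branch-pos d))) (trans (cong₂ (λ f i → f i) Q≡ e₁) (sym (branch-pos d))) E))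
      (raw-up s (subst (1 ≤_) (sym (cong₂ (λ f i → f i) D≡ e₁)) d))
    where
    open Static (Sliding.st L)
    e₁ = proj₁ (Sliding.slice L)
  ... | inj₁ z = ends-weaken ≤-refl (λ s′ E → slid L (slid-cong e₁
      (trans (cong₂ (λ f i → f i) Q≡ e₁) (sym (branch-zero z))) (trans (cong₂ (λ f i → f i) X≡ e₁) (sym (branch-zero z))) E))
      (raw-down s (trans (cong₂ (λ f i → f i) D≡ e₁) z))
    where
    open Static (Sliding.st L)
    e₁ = proj₁ (Sliding.slice L)

  SlideInv : ℕ → State → Set
  SlideInv k s = ∃[ rs ] ∃[ u ] Sliding rs u s × length rs ≡ k

  slide-body : ∀ k s → SlideInv k s → scalar s 15 ∸ scalar s 14 ≢ 0 →
    Ends slideStep s (steps slideStep) (λ s′ → ∃[ k′ ] k′ < k × SlideInv k′ s′)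
  slide-body k s ([] , u , L , refl) ne = ⊥-elim (ne (trans (cong (scalar s 15 ∸_) (Sliding.slice L)) (n∸n≡0 (scalar s 15))))
  slide-body k s (a ∷ rs , u , L , refl) ne = ends-weaken ≤-refl (λ s′ L′ → length rs , ≤-refl , rs , hd a , L′ , refl) (slide-step L)

  slides-end : ∀ {s} → Sliding as p₀ s → length as ≤ m →
    Ends (WhileNonzero var 15 ⊖ var 14 Do slideStep) s (suc m * (4 + steps slideStep)) (Sliding [] p₁)
  slides-end {s} L le = ends-weaken (*-monoˡ-≤ (4 + steps slideStep) (s≤s le)) finish
    (ends-while SlideInv slide-body (length as) s (as , p₀ , L , refl))
    where
    finish : ∀ s′ → (∃[ k ] SlideInv k s′ × scalar s′ 15 ∸ scalar s′ 14 ≡ 0) → Sliding [] p₁ s′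
    finish s′ (_ , (a ∷ rs , u , L , _) , z) = ⊥-elim (1+n≰n (≤-trans (slice-≤ rs (proj₂ (Sliding.slice L))) (m∸n≡0⇒m≤n z)))
    finish s′ (_ , ([] , u , L , _) , z) with Sliding.path L
    ... | [] = L

-- The rounds of the construction

module Rounds {n m X Q D} {J S T tS : ℕ → ℕ} (I₀ : ℕ → ℕ) (O : Order n m X Q)
  (B : TakenBy m (tail-of X Q D) (head-of X Q D) S tS) where
  open Ends-of O D

  CurrentPlan : State → Set
  CurrentPlan s = Plan n m tl hd (array s 2) J (array s 9) (array s 10) (array s 11) S T

  -- The measure exceeds the number of tokens still to move by one, so that even the round which
  -- finds nothing to do lowers it, to 0.
  record RoundInv (k : ℕ) (s : State) : Set where
    field
      st     : Static m X Q D J S T tS s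
      plan   : CurrentPlan s
      hist   : History m tl hd I₀ s
      status : (scalar s 16 ≡ 0 × (∀ {i} → i < m → array s 9 i ≡ 0))
             ⊎ (1 ≤ scalar s 16 × k ≡ suc (sum< n (movable (array s 2) (array s 11))))

  plan-cong : ∀ {I I′ F F′ N N′ U U′} → I ≡ I′ → F ≡ F′ → N ≡ N′ → U ≡ U′ → Plan n m tl hd I J F N U S T → Plan n m tl hd I′ J F′ N′ U′ S T
  plan-cong refl refl refl refl P = P

  round-cost : ℕ
  round-cost = 2 + (2 + (2 + (2 + (suc m * (2 + steps walkStep) + suc m * (4 + steps slideStep)))))

  round-body : ∀ k s → RoundInv k s → scalar s 16 ≢ 0 → Ends round s round-cost (λ s′ → ∃[ k′ ] k′ < k × RoundInv k′ s′)
  round-body k s R on with RoundInv.status R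
  ... | inj₁ (z , _) = ⊥-elim (on z)
  ... | inj₂ (_ , refl) = ends-seq {P = _≡ s₁} (ends-wp (16 ≔ lit 0) refl) (λ { _ refl →
      ends-seq {P = _≡ s₂} (ends-wp (14 ≔ lit 0) refl) (λ { _ refl →
      ends-seq {P = _≡ s₃} (ends-wp (15 ≔ lit 0) refl) (λ { _ refl →
      ends-seq {P = _≡ s₄} (ends-wp (4 ≔ var 1) refl) (λ { _ refl →
      ends-seq (ends-framed (walk-ends surroundings s1 refl refl)) walked }) }) }) })
    where
    open RoundInv R
    open Static st
    s₁ s₂ s₃ s₄ : State
    s₁ = ⟨ update (scalar s) 16 0 , array s ⟩
    s₂ = ⟨ update (scalar s₁) 14 0 , array s ⟩
    s₃ = ⟨ update (scalar s₂) 15 0 , array s ⟩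
    s₄ = ⟨ update (scalar s₃) 4 (scalar s 1) , array s ⟩
    open WalkLoopEnds O plan B
    surroundings : Surrounding s₄
    surroundings = record { s1 = s1 ; I≡ = refl ; J≡ = J≡ ; X≡ = X≡ ; Q≡ = Q≡ ; D≡ = D≡ ; F≡ = refl ; IN≡ = refl
      ; OUT≡ = refl ; S≡ = S≡ ; T≡ = T≡ ; tS≡ = tS≡ }
    Result : State → Set
    Result s′ = ∃[ k′ ] k′ < suc (sum< n (movable (array s 2) (array s 11))) × RoundInv k′ s′
    walked : ∀ s₅ → (Surrounding s₅ × Walking 0 s₅) × Framed (WhileNonzero var 4 Do walkStep) s₄ s₅ →
      Ends (WhileNonzero var 15 ⊖ var 14 Do slideStep) s₅ (suc m * (4 + steps slideStep)) Result
    walked s₅ ((E , w) , fA , fS) = go w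
      where
      module E = Env E
      static : Static m X Q D J S T tS s₅
      static = record { s1 = E.s1 ; J≡ = E.J≡ ; X≡ = E.X≡ ; Q≡ = E.Q≡ ; D≡ = E.D≡ ; S≡ = E.S≡ ; T≡ = E.T≡ ; tS≡ = E.tS≡ }
      history : History m tl hd I₀ s₅
      history = history-frame (fS 17 refl) (fA 0 refl) (fA 1 refl) (fA 2 refl) hist
      plan₅ : CurrentPlan s₅
      plan₅ = plan-cong (sym E.I≡) (sym E.F≡) (sym E.IN≡) (sym E.OUT≡) plan
      at : ∀ {f g : ℕ → ℕ} → f ≡ g → ∀ v → f v ≡ g v
      at refl v = refl
      go : Walking 0 s₅ → Ends (WhileNonzero var 15 ⊖ var 14 Do slideStep) s₅ (suc m * (4 + steps slideStep)) Result
      -- No path began, so every parent is idle and the flow is used up. The two path indices agree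
      -- and no slide is made.
      go (inj₁ (z , e , idle)) = _ , s₅ , while-zero (trans (cong (_∸ scalar s₅ 14) (sym e)) (n∸n≡0 (scalar s₅ 14))) ,
        ≤-trans (m≤m+n 4 _) (m≤m+n (4 + steps slideStep) _) , 0 , s≤s z≤n , record
          { st = static ; plan = plan₅ ; hist = history
          ; status = inj₁ (z , λ {i} i< → trans (at E.F≡ i) (idle-F {0} (λ {i} → idle {i}) z≤n i<)) }
      go (inj₂ (on′ , as , A , sl , _)) = ends-weaken ≤-refl finish (ends-framed (slides-end begin-slide
          (unique-bounded (All.map proj₂ (First.added A)) (First.distinct A))))
        where
        open SlideProgram {D = D} {J = J} {S = S} {T} {tS} I₀ O plan B A
        open SlideLoop I₀ O plan B A
        open Along A
        module A = First A
        self : ∀ {bs : List ℕ} → All (λ i → Any (i ≡_) bs) bs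
        self = All.tabulate (λ o → o)
        begin-slide : Sliding as (scalar s₅ 10) s₅
        begin-slide = record
          { st = static ; on-u = inj₁ refl ; slice = sl ; path = A.path
          ; within = self ; distinct = A.distinct
          ; here₁ = trans (at E.I≡ _) (≤-antisym (Plan.I≤1 plan _) (A.closed so≡0))
          ; gone₁ = λ ne → ⊥-elim (ne refl)
          ; rest₁ = λ v _ _ → at E.I≡ v
          ; ahead = All.tabulate (λ {i} _ → sym (at E.F≡ i))
          ; used = λ o f → ⊥-elim (f o)
          ; unused = λ {i} _ _ → sym (at E.F≡ i)
          ; law = Plan.law plan₅ ; IN-sum = Plan.IN-sum plan₅ ; OUT-sum = Plan.OUT-sum plan₅
          ; hist = history }
        finish : ∀ s′ → Sliding [] (scalar s₅ 11) s′ × Framed (WhileNonzero var 15 ⊖ var 14 Do slideStep) s₅ s′ → Result s′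
        finish s′ (L , gA , gS) = _ , s≤s fewer-movable , record
          { st = L.st ; plan = plan′ ; hist = L.hist
          ; status = inj₂ (subst (1 ≤_) (sym (gS 16 refl)) on′ , refl) }
          where
          module L = Sliding L
          open After {array s′ 2} {array s′ 9} {array s′ 10} {array s′ 11} (L.gone₁ p₁≢p₀) L.here₁
            (λ v a b → L.rest₁ v b a) (λ o → L.used o (λ ())) L.unused L.law L.IN-sum L.OUT-sum

  -- At most `n` tokens have to move; one more round finds nothing to do, and one more test ends the
  -- loop.
  rounds-end : ∀ {s} → RoundInv (suc (sum< n (movable (array s 2) (array s 11)))) s →
    Ends (WhileNonzero var 16 Do round) s (suc (suc n) * (2 + round-cost))
      (λ s′ → CurrentPlan s′ × History m tl hd I₀ s′ × (∀ {i} → i < m → array s′ 9 i ≡ 0))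
  rounds-end {s} R = ends-weaken (*-monoˡ-≤ (2 + round-cost) (s≤s (s≤s (sum-bound n (movable≤1 (array s 2) (array s 11)))))) finish
    (ends-while RoundInv round-body _ s R)
    where
    finish : ∀ s′ → (∃[ k ] RoundInv k s′ × scalar s′ 16 ≡ 0) → CurrentPlan s′ × History m tl hd I₀ s′ × (∀ {i} → i < m → array s′ 9 i ≡ 0)
    finish s′ (k , R′ , z) with RoundInv.status R′
    ... | inj₁ (_ , f) = RoundInv.plan R′ , RoundInv.hist R′ , f
    ... | inj₂ (p , _) = ⊥-elim (≥1⇒≢0 p z)

-- Sets and their characteristic functions

χ : ∀ {n} → Subset n → ℕ → ℕ
χ I = entry (indicator I)

χ≤1 : ∀ {n} (I : Subset n) v → χ I v ≤ 1
χ≤1 []          v       = z≤n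
χ≤1 (true ∷ I)  zero    = ≤-refl
χ≤1 (false ∷ I) zero    = z≤n
χ≤1 (_ ∷ I)     (suc v) = χ≤1 I v

χ-outside : ∀ {n} (I : Subset n) {v} → n ≤ v → χ I v ≡ 0
χ-outside []      _       = refl
χ-outside (_ ∷ I) (s≤s p) = χ-outside I p

χ-∈ : ∀ {n} {I : Subset n} {v} → v ∈ˢ I → χ I (toℕ v) ≡ 1
χ-∈ here      = refl
χ-∈ (there p) = χ-∈ p

χ-∋ : ∀ {n} {I : Subset n} {v} → 1 ≤ χ I (toℕ v) → v ∈ˢ I
χ-∋ {I = true ∷ I}  {fzero}  _ = here
χ-∋ {I = _ ∷ I}     {fsuc v} p = there (χ-∋ {I = I} {v} p)

χ-∉ : ∀ {n} {I : Subset n} {v} → v ∉ˢ I → χ I (toℕ v) ≡ 0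
χ-∉ {I = I} {v} p with zero⊎pos (χ I (toℕ v))
... | inj₁ z = z
... | inj₂ q = ⊥-elim (p (χ-∋ q))

─-∉ : ∀ {n} (p q : Subset n) {x} → x ∈ˢ p ─ q → x ∈ˢ q → ⊥
─-∉ (_ ∷ p) (true ∷ q) {fzero} () here
─-∉ (_ ∷ p) (_ ∷ q) (there a) (there b) = ─-∉ p q a b

toSet : ∀ {n} → (ℕ → ℕ) → Subset n
toSet A = tabulate (λ v → 0 <ᵇ A (toℕ v))

toSet-∈ : ∀ {n} A {v : Fin n} → v ∈ˢ toSet A → 1 ≤ A (toℕ v)
toSet-∈ A {v} p = <ᵇ⇒< 0 _ (subst True (sym (trans (sym (lookup∘tabulate _ v)) ([]=⇒lookup p))) _)

toSet-∋ : ∀ {n} A {v : Fin n} → 1 ≤ A (toℕ v) → v ∈ˢ toSet A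
toSet-∋ A {v} p = lookup⇒[]= v _ (trans (lookup∘tabulate _ v) (pos p))
  where
  pos : ∀ {x} → 1 ≤ x → (0 <ᵇ x) ≡ true
  pos (s≤s _) = refl

toSet-χ : ∀ {n A} {I : Subset n} → (∀ v → v < n → A v ≡ χ I v) → toSet A ≡ I
toSet-χ {A = A} {I} e = ⊆-antisym
  (λ {v} p → χ-∋ (subst (1 ≤_) (e (toℕ v) (Fin.toℕ<n v)) (toSet-∈ A p)))
  (λ {v} p → toSet-∋ A (≤-reflexive (sym (trans (e (toℕ v) (Fin.toℕ<n v)) (χ-∈ p)))))

-- Arcs are numbered by their place in the elimination order instead of the input order.
record Enumerates {n} (G : Digraph n) (m : ℕ) (t h : ℕ → ℕ) : Set where
  field
    index : ∀ {u v} → (u , v) ∈ arcs G → ∃[ i ] i < m × t i ≡ toℕ u × h i ≡ toℕ v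
    arc   : ∀ {i} → i < m → ∃[ u ] ∃[ v ] (u , v) ∈ arcs G × t i ≡ toℕ u × h i ≡ toℕ v

module Boundary {n} {G : Digraph n} {m t h} (E : Enumerates G m t h) (Γ : Graph n m t h) where
  open Enumerates E

  independent⇒free : ∀ {I} → Independent G I → ∀ {i} → i < m → 1 ≤ χ I (t i) → 1 ≤ χ I (h i) → ⊥
  independent⇒free {I} ind i< p q with arc i<
  ... | u , v , a , e , e′ = ind u v (χ-∋ (subst (λ x → 1 ≤ χ I x) e p)) (χ-∋ (subst (λ x → 1 ≤ χ I x) e′ q)) (inj₁ a)

  free⇒independent : ∀ {A} → (∀ {i} → i < m → 1 ≤ A (t i) → 1 ≤ A (h i) → ⊥) → Independent G (toSet A)
  free⇒independent {A} free u v p q (inj₁ a) with index a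
  ... | i , i< , e , e′ = free i< (subst (λ x → 1 ≤ A x) (sym e) (toSet-∈ A p)) (subst (λ x → 1 ≤ A x) (sym e′) (toSet-∈ A q))
  free⇒independent {A} free u v p q (inj₂ a) with index a
  ... | i , i< , e , e′ = free i< (subst (λ x → 1 ≤ A x) (sym e) (toSet-∈ A q)) (subst (λ x → 1 ≤ A x) (sym e′) (toSet-∈ A p))

  slide⇒move : ∀ {u v I I′} → Slide G (u , v) I I′ → ∃[ j ] j < m × Move j t h (χ I) (χ I′)
  slide⇒move {u} {v} {I} {I′} (a , e₁ , e₂) with index a
  ... | j , j< , tu , hv = j , j< , record
    { from = trans (cong (χ I) tu) (χ-∈ (p─q⊆p I I′ u∈))
    ; left = trans (cong (χ I′) tu) (χ-∉ (─-∉ I I′ u∈))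
    ; to = trans (cong (χ I) hv) (χ-∉ (─-∉ I′ I v∈))
    ; come = trans (cong (χ I′) hv) (χ-∈ (p─q⊆p I′ I v∈))
    ; other = other }
    where
    u∈ : u ∈ˢ I ─ I′
    u∈ = subst (u ∈ˢ_) (sym e₁) (x∈⁅x⁆ u)
    v∈ : v ∈ˢ I′ ─ I
    v∈ = subst (v ∈ˢ_) (sym e₂) (x∈⁅x⁆ v)
    at : ∀ w → toℕ w ≢ t j → toℕ w ≢ h j → χ I (toℕ w) ≡ χ I′ (toℕ w)
    at w a b with w ∈? I | w ∈? I′
    ... | yes p | yes q = trans (χ-∈ p) (sym (χ-∈ q))
    ... | no p | no q = trans (χ-∉ p) (sym (χ-∉ q))
    ... | yes p | no q = ⊥-elim (a (trans (cong toℕ (x∈⁅y⁆⇒x≡y u (subst (w ∈ˢ_) e₁ (x∈p∧x∉q⇒x∈p─q p q)))) (sym tu)))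
    ... | no p | yes q = ⊥-elim (b (trans (cong toℕ (x∈⁅y⁆⇒x≡y v (subst (w ∈ˢ_) e₂ (x∈p∧x∉q⇒x∈p─q q p)))) (sym hv)))
    other : ∀ w → w ≢ t j → w ≢ h j → χ I w ≡ χ I′ w
    other w a b with w <? n
    ... | no ge = trans (χ-outside I (≮⇒≥ ge)) (sym (χ-outside I′ (≮⇒≥ ge)))
    ... | yes lt = subst (λ x → χ I x ≡ χ I′ x) (Fin.toℕ-fromℕ< lt)
          (at (fromℕ< lt) (λ e → a (trans (sym (Fin.toℕ-fromℕ< lt)) e)) (λ e → b (trans (sym (Fin.toℕ-fromℕ< lt)) e)))

  move⇒slide : ∀ {u v A A′} → MoveAt m t h (toℕ u) (toℕ v) A A′ → Slide G (u , v) (toSet A) (toSet A′)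
  move⇒slide {u} {v} {A} {A′} M = on-arc arcM , ⊆-antisym leaving (entering u A A′ from left) , ⊆-antisym coming (entering v A′ A come to)
    where
    open MoveAt M renaming (arc to arcM)
    on-arc : _ → (u , v) ∈ arcs G
    on-arc (j , j< , e , e′) with arc j<
    ... | u′ , v′ , a , f , f′ = subst₂ (λ x y → (x , y) ∈ arcs G) (Fin.toℕ-injective (trans (sym f) e)) (Fin.toℕ-injective (trans (sym f′) e′)) a
    entering : ∀ w (B B′ : ℕ → ℕ) → B (toℕ w) ≡ 1 → B′ (toℕ w) ≡ 0 → ⁅ w ⁆ ⊆ (toSet B ─ toSet B′)
    entering w B B′ p q {x} o rewrite x∈⁅y⁆⇒x≡y w o =
      x∈p∧x∉q⇒x∈p─q (toSet-∋ B (≡1⇒≥1 p)) (λ o′ → ≥1⇒≢0 (toSet-∈ B′ o′) q)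
    leaving : (toSet A ─ toSet A′) ⊆ ⁅ u ⁆
    leaving {w} o with w Fin.≟ u | w Fin.≟ v
    ... | yes refl | _ = x∈⁅x⁆ u
    ... | no _ | yes refl = ⊥-elim (≥1⇒≢0 (toSet-∈ A (p─q⊆p (toSet A) (toSet A′) o)) to)
    ... | no a | no b = ⊥-elim (─-∉ (toSet A) (toSet A′) o (toSet-∋ A′ (subst (1 ≤_)
            (other (toℕ w) (λ e → a (Fin.toℕ-injective e)) (λ e → b (Fin.toℕ-injective e))) (toSet-∈ A (p─q⊆p (toSet A) (toSet A′) o)))))
    coming : (toSet A′ ─ toSet A) ⊆ ⁅ v ⁆
    coming {w} o with w Fin.≟ v | w Fin.≟ u
    ... | yes refl | _ = x∈⁅x⁆ v
    ... | no _ | yes refl = ⊥-elim (≥1⇒≢0 (toSet-∈ A′ (p─q⊆p (toSet A′) (toSet A) o)) left)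
    ... | no a | no b = ⊥-elim (─-∉ (toSet A′) (toSet A) o (toSet-∋ A (subst (1 ≤_)
            (sym (other (toℕ w) (λ e → b (Fin.toℕ-injective e)) (λ e → a (Fin.toℕ-injective e)))) (toSet-∈ A′ (p─q⊆p (toSet A′) (toSet A) o)))))

  Planned : (I J : ℕ → ℕ) → ℕ → Set
  Planned I J ℓ = ∃[ F ] ∃[ IN ] ∃[ OUT ] ∃[ S ] ∃[ T ] Plan n m t h I J F IN OUT S T × sum< m F ≡ ℓ

  -- The empty sequence has the plan without flow. Each slide put in front adds one unit to one arc,
  -- so the total flow counts the slides.
  planned : ∀ ℓ (As : Fin (suc ℓ) → Subset n) (mv : Fin ℓ → Fin n × Fin n) → (∀ i → Independent G (As i)) →
    (∀ i → Slide G (mv i) (As (inject₁ i)) (As (fsuc i))) → Planned (χ (As fzero)) (χ (As (fromℕ ℓ))) ℓ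
  planned zero As mv ind sl = _ , _ , _ , _ , _ ,
    plan-final Γ (χ≤1 (As fzero)) (independent⇒free (ind fzero)) , sum-zero m (λ _ → refl)
  planned (suc ℓ) As mv ind sl with planned ℓ (λ i → As (fsuc i)) (λ i → mv (fsuc i)) (λ i → ind (fsuc i)) (λ i → sl (fsuc i))
                                | slide⇒move {proj₁ (mv fzero)} {proj₂ (mv fzero)} (sl fzero)
  ... | F , _ , _ , _ , _ , P , e | j , j< , M = _ , _ , _ , _ , _ , Back.plan ,
        +-cancelʳ-≡ (F j) _ _ (trans (sum-update m F (suc (F j)) j<) (trans (+-suc (sum< m F) (F j)) (cong (λ z → suc z + F j) e)))
    where module Back = Backward Γ P j< M (χ≤1 (As fzero)) (independent⇒free (ind fzero))

-- The flow is determined by the two sets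

plan-agree : ∀ {n m t h I J F F′ IN IN′ OUT OUT′ S T} → Graph n m t h →
  (∀ {i} → i < m → F′ i ≡ F i) → (∀ {v} → v < n → IN′ v ≡ flow m h F′ v) → (∀ {v} → v < n → OUT′ v ≡ flow m t F′ v) →
  Plan n m t h I J F IN OUT S T → Plan n m t h I J F′ IN′ OUT′ S T
plan-agree {n} {m} {t} {h} {I} {J} {F} {F′} {IN} {IN′} {OUT} {OUT′} Γ f eIN eOUT P = record
  { I≤1 = I≤1 ; J≤1 = J≤1 ; I-free = I-free ; J-free = J-free
  ; law = λ {v} v< → trans (cong (I v +_) (inn v<)) (trans (law v<) (cong (J v +_) (sym (out v<))))
  ; IN-sum = eIN ; OUT-sum = eOUT
  ; S-head = λ i< j< s s′ p p′ q q′ → S-head i< j< s s′ p p′ (to i< q) (to j< q′)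
  ; S-tail = S-tail
  ; S-any = λ v< p o → let (i , i< , e , s , q) = S-any v< p (subst (1 ≤_) (out v<) o) in i , i< , e , s , subst (1 ≤_) (sym (f i<)) q
  ; T-target = λ i< s q → T-target i< s (to i< q)
  ; T-head = λ i< j< s s′ q q′ → T-head i< j< s s′ (to i< q) (to j< q′)
  ; T-tail = λ i< j< s s′ q q′ → T-tail i< j< s s′ (to i< q) (to j< q′)
  ; T-any = λ v< p o → let (i , i< , e , s , q) = T-any v< p (subst (1 ≤_) (inn v<) o) in i , i< , e , s , subst (1 ≤_) (sym (f i<)) q
  ; both = λ i< s p s′ e → let (a , b) = both i< s p s′ (trans (sym (f i<)) e) in
      ≤-trans (≤-reflexive (inn (h<n i<))) a , ≤-trans (≤-reflexive (out (t<n i<))) b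
  ; still-h = λ i< p q e → trans (cong₂ _+_ (inn (h<n i<)) (out (h<n i<))) (still-h i< p q (trans (sym (inn (t<n i<))) e))
  ; still-t = λ i< p q e → trans (cong₂ _+_ (inn (t<n i<)) (out (t<n i<))) (still-t i< p q (trans (sym (inn (h<n i<))) e)) }
  where
  open Plan P
  open Graph Γ
  inn : ∀ {v} → v < n → IN′ v ≡ IN v
  inn {v} v< = trans (eIN v<) (trans (sum-cong m (λ {i} i< → cong (pick (h i) v) (f i<))) (sym (IN-sum v<)))
  out : ∀ {v} → v < n → OUT′ v ≡ OUT v
  out {v} v< = trans (eOUT v<) (trans (sum-cong m (λ {i} i< → cong (pick (t i) v) (f i<))) (sym (OUT-sum v<)))
  to : ∀ {i} → i < m → 1 ≤ F′ i → 1 ≤ F i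
  to i< = subst (1 ≤_) (f i<)

-- Strong induction along the elimination order: in the law at `X j` every term except the flow of
-- `j` is known, and `flow-bounded` shows that the cap changes nothing.
demand-unique : ∀ {n m X Q D I J F F*} (O : Order n m X Q) → (let open Ends-of O D) →
  (∀ v → I v ≤ 1) → (∀ v → J v ≤ 1) → Conserved I J F* →
  (∀ {j} → j < m → F j ≡ demand n I J X D tl hd F j) → ∀ {j} → j < m → F j ≡ F* j
demand-unique {n} {m} {X} {Q} {D} {I} {J} {F} {F*} O I≤1 J≤1 c F≡ {j} = <-rec (λ j → j < m → F j ≡ F* j) found j
  where
  open Ends-of O D
  open Order O
  found : ∀ j → (∀ {i} → i < j → i < m → F i ≡ F* i) → j < m → F j ≡ F* j
  found j ih j< = trans (F≡ j<) (trans (cong₂ (λ a b → n ∸ (n ∸ branch (D j) ((J x + b) ∸ (I x + a)) ((I x + a) ∸ (J x + b))))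
      (low hd) (low tl)) (trans (cong (λ z → n ∸ (n ∸ z)) (exact (D j) refl)) (m∸[m∸n]≡n (flow-bounded I≤1 J≤1 c j<))))
    where
    x = X j
    low : ∀ h → flow j h F x ≡ flow j h F* x
    low h = sum-cong j (λ {i} i<j → cong (pick (h i) x) (ih i<j (<-trans i<j j<)))
    a b : ℕ
    a = I x + flow j hd F* x
    b = J x + flow j tl F* x
    balance : a + pick (hd j) x (F* j) ≡ b + pick (tl j) x (F* j)
    balance = trans (+-assoc (I x) _ _) (trans (trans (cong (I x +_) (sym (flow-at-child {hd} {F*} X≢hd j<)))
      (trans (c (X<n j<)) (cong (J x +_) (flow-at-child {tl} {F*} X≢tl j<)))) (sym (+-assoc (J x) _ _)))
    exact : ∀ d → D j ≡ d → branch (D j) (b ∸ a) (a ∸ b) ≡ F* j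
    exact d e with D j | balance
    ... | zero | bal = trans (cong (_∸ a) (sym (trans (cong (a +_) (sym (pick-same {x} (F* j) refl)))
            (trans bal (trans (cong (b +_) (pick-other (F* j) (≢-sym (X≢Q j<)))) (+-identityʳ b)))))) (m+n∸m≡n a (F* j))
    ... | suc _ | bal = trans (cong (_∸ b) (trans (sym (+-identityʳ a)) (trans (cong (a +_) (sym (pick-other (F* j) (≢-sym (X≢Q j<)))))
            (trans bal (cong (b +_) (pick-same {x} (F* j) refl)))))) (m+n∸m≡n b (F* j))

ends-elim : ∀ {C s b P} {R : Set} → Ends C s b P → (∀ s′ → P s′ → R) → R
ends-elim (_ , s′ , _ , _ , p) k = k s′ p

entry-≤ : ∀ {A : Set} {b} (f : A → ℕ) → (∀ a → f a ≤ b) → ∀ xs i → entry (map f xs) i ≤ b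
entry-≤ f p []       i       = z≤n
entry-≤ f p (x ∷ xs) zero    = p x
entry-≤ f p (x ∷ xs) (suc i) = entry-≤ f p xs i

-- Assembling the two algorithms

prepareTime : ℕ → ℕ → ℕ → ℕ
prepareTime n m c = (2 + suc m * 40) +
  ((6 + suc (m + suc n) * (6 + steps peelBody)) + ((2 + suc m * (4 + steps labelStep)) + c))

decideTime constructTime roundTime : ℕ → ℕ → ℕ
decideTime n m = prepareTime n m ((2 + suc n * (4 + steps vertexStep)) + ((2 + suc m * (4 + steps arcStep)) + 4))
roundTime n m = 2 + (2 + (2 + (2 + (suc m * (2 + steps walkStep) + suc m * (4 + steps slideStep)))))
constructTime n m = prepareTime n m (2 + (2 + (suc (suc n) * (2 + roundTime n m) + 2)))

module Solve {n} (Ξ : Instance n) (polytree : IsPolytree (graph Ξ)) where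
  I J : ℕ → ℕ
  I = χ (source Ξ)
  J = χ (target Ξ)
  open Arcs (graph Ξ)
  open Peeling polytree I J
  open PeelLoop polytree I J
  open Preparation polytree I J

  initial : Initial (input Ξ)
  initial = record { s0 = refl ; s1 = refl ; a0 = refl ; a1 = refl ; a2 = refl ; a3 = refl
    ; zero-array = λ { (suc (suc (suc (suc a)))) i (s≤s (s≤s (s≤s (s≤s _)))) → refl } }

  module At (s : State) (pd : Peeled s) where
    open Peeled pd
    X Q D F IN OUT : ℕ → ℕ
    X = array s 6
    Q = array s 7
    D = array s 8
    F = array s 9
    IN = array s 10
    OUT = array s 11
    open Ends-of order D

    Γ : Graph n m tl hd
    Γ = record { t<n = tl<n ; h<n = hd<n ; t≢h = tl≢hd }

    enumerates : Enumerates (graph Ξ) m tl hd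
    enumerates = record
      { index = λ o → let (e , e< , p , q) = arc-index o ; (i , i< , p′ , q′) = cover e< in i , i< , trans p′ p , trans q′ q
      ; arc = λ i< → let (e , e< , p , q) = back i< ; a = arc-at e< in
          _ , _ , ArcAt.arc a , trans p (ArcAt.srce a) , trans q (ArcAt.dste a) }
    open Boundary enumerates Γ public

    I-free : ∀ {i} → i < m → 1 ≤ I (tl i) → 1 ≤ I (hd i) → ⊥
    I-free = independent⇒free (source-independent Ξ)

    J-free : ∀ {i} → i < m → 1 ≤ J (tl i) → 1 ≤ J (hd i) → ⊥
    J-free = independent⇒free (target-independent Ξ)

    -- The flow of a sequence obeys the law, so it is the computed one, whichever sequence is given.
    sequence-plan : ∀ {ℓ} → ReconfigurationSequence Ξ ℓ → ∃[ S ] ∃[ T ] Plan n m tl hd I J F IN OUT S T × sum< m F ≡ ℓ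
    sequence-plan {ℓ} R = go (subst₂ (λ A B → Planned (χ A) (χ B) ℓ) (start R) (end R)
        (planned ℓ (sets R) (move R) (independent R) (slide R)))
      where
      go : Planned I J ℓ → _
      go (F* , IN* , OUT* , S , T , P , e) = S , T , plan-agree Γ same (λ {v} _ → IN≡ v) (λ {v} _ → OUT≡ v) P ,
        trans (sum-cong m same) e
        where
        same : ∀ {i} → i < m → F i ≡ F* i
        same = demand-unique {D = D} {I} {J} {F} {F*} order (χ≤1 (source Ξ)) (χ≤1 (target Ξ))
          (λ {v} v< → trans (cong (I v +_) (sym (Plan.IN-sum P v<))) (trans (Plan.law P v<) (cong (J v +_) (Plan.OUT-sum P v<)))) F≡

    module _ {s′ : State} {S T : ℕ → ℕ} (P : Plan n m tl hd (array s′ 2) J (array s′ 9) (array s′ 10) (array s′ 11) S T)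
      (H : History m tl hd I s′) (done : ∀ {i} → i < m → array s′ 9 i ≡ 0) where
      open History H

      arrived : ∀ v → v < n → past (scalar s′ 17) v ≡ χ (target Ξ) v
      arrived v v< = trans (now v) (trans (sym (+-identityʳ _)) (trans (cong (array s′ 2 v +_) (sym (zero-flow {hd} (Plan.IN-sum P v<))))
        (trans (Plan.law P v<) (trans (cong (J v +_) (zero-flow {tl} (Plan.OUT-sum P v<))) (+-identityʳ _)))))
        where
        zero-flow : ∀ {h x} → x ≡ flow m h (array s′ 9) v → x ≡ 0
        zero-flow {h} e = trans e (sum-zero m (λ {i} i< → n≤0⇒n≡0 (≤-trans (pick-≤ (h i) v _) (≤-reflexive (done i<)))))

      record Step (i : ℕ) : Set where
        field
          u v  : Fin n
          u≡   : array s′ 0 i ≡ toℕ u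
          v≡   : array s′ 1 i ≡ toℕ v

      at : ∀ {i} → i < scalar s′ 17 → Step i
      at i< with MoveAt.arc (moves _ i<)
      ... | j , j< , e , e′ = record { u = fromℕ< (tl<n j<) ; v = fromℕ< (hd<n j<)
        ; u≡ = trans (sym e) (sym (Fin.toℕ-fromℕ< (tl<n j<))) ; v≡ = trans (sym e′) (sym (Fin.toℕ-fromℕ< (hd<n j<))) }

      sequence : ReconfigurationSequence Ξ (scalar s′ 17)
      sequence = record
        { sets = λ i → toSet (past (toℕ i))
        ; independent = λ i → free⇒independent {past (toℕ i)} (FreeSet.free (valid (toℕ i) (≤-pred (Fin.toℕ<n i))))
        ; start = toSet-χ (λ v _ → start₀ v)
        ; end = trans (cong (λ k → toSet (past k)) (Fin.toℕ-fromℕ (scalar s′ 17))) (toSet-χ arrived)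
        ; move = λ i → Step.u (at (Fin.toℕ<n i)) , Step.v (at (Fin.toℕ<n i))
        ; slide = λ i → let lt = Fin.toℕ<n i ; u = Step.u (at lt) ; v = Step.v (at lt) in
            move⇒slide {u} {v} {past (toℕ (inject₁ i))} {past (suc (toℕ i))}
              (subst (λ k → MoveAt m tl hd (toℕ u) (toℕ v) (past k) (past (suc (toℕ i)))) (sym (Fin.toℕ-inject₁ i))
                (subst₂ (λ a b → MoveAt m tl hd a b (past (toℕ i)) (past (suc (toℕ i)))) (Step.u≡ (at lt)) (Step.v≡ (at lt))
                  (moves (toℕ i) lt))) }

      sequence-output : OutputsSequence Ξ ⟨ update (scalar s′) 0 (scalar s′ 17) , array s′ ⟩
      sequence-output = scalar s′ 17 , sequence , refl ,
        λ i → Step.u≡ (at (Fin.toℕ<n i)) , Step.v≡ (at (Fin.toℕ<n i))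

    open LabelProgram order D F IN OUT I J public

    module Labelled-at {s₃ : State} (ar : Arrays s₃) (L : Labels m s₃) where
      S T tS : ℕ → ℕ
      S = array s₃ 12
      T = array s₃ 13
      tS = array s₃ 15

      greedy : Sound (array s₃ 14) (array s₃ 16) → Plan n m tl hd I J F IN OUT S T
      greedy = greedy-plan (χ≤1 (source Ξ)) (χ≤1 (target Ξ)) I-free J-free (λ {v} _ → IN≡ v) (λ {v} _ → OUT≡ v) L

      reconfigurable⇒sound : Reconfigurable Ξ → Sound (array s₃ 14) (array s₃ 16)
      reconfigurable⇒sound (ℓ , R) = let (_ , _ , P , _) = sequence-plan R in
        plan-sound (χ≤1 (source Ξ)) (χ≤1 (target Ξ)) I-free J-free (λ {v} _ → IN≡ v) (λ {v} _ → OUT≡ v) L P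

      taken-by : TakenBy m tl hd S tS
      taken-by = record { →taken = Side.→taken (LabelsOf.sideS L) ; taken→ = Side.taken→ (LabelsOf.sideS L) }
        where open LabelLoop order D F IN OUT I J

      open Rounds {D = D} {J} {S} {T} {tS} I order taken-by public

      s₄ : State
      s₄ = ⟨ update (update (scalar s₃) 17 0) 16 1 , array s₃ ⟩

      rounds-start : scalar s₃ 1 ≡ m → Sound (array s₃ 14) (array s₃ 16) →
        RoundInv (suc (sum< n (movable (array s₄ 2) (array s₄ 11)))) s₄
      rounds-start e sound = record
        { st = record { s1 = e ; J≡ = A.J≡ ; X≡ = A.X≡ ; Q≡ = A.Q≡ ; D≡ = A.D≡ ; S≡ = refl ; T≡ = refl ; tS≡ = refl }
        ; plan = plan-cong (sym A.I≡) (sym A.F≡) (sym A.IN≡) (sym A.OUT≡) (greedy sound)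
        ; hist = record { past = λ _ → I ; valid = λ _ _ → record { ≤1 = χ≤1 (source Ξ) ; free = I-free }
            ; start₀ = λ _ → refl ; now = λ v → cong (λ f → f v) (sym A.I≡) ; moves = λ _ () }
        ; status = inj₂ (≤-refl , refl) }
        where module A = Arrays ar

      -- The sequence is extracted from a run of the constructing loop, started in the memory that
      -- `decide` has reached; `decide` itself does not perform that loop.
      sound⇒reconfigurable : scalar s₃ 1 ≡ m → Sound (array s₃ 14) (array s₃ 16) → Reconfigurable Ξ
      sound⇒reconfigurable e sound = ends-elim (rounds-end (rounds-start e sound))
        (λ s₅ (P , H , done) → scalar s₅ 17 , sequence {s₅} P H done)

  later-zero : ∀ a → 12 ≤ a → writesA a (initialize ⨾ peel) ≡ false
  later-zero _ (s≤s (s≤s (s≤s (s≤s (s≤s (s≤s (s≤s (s≤s (s≤s (s≤s (s≤s (s≤s _)))))))))))) = refl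

  with-labels : ∀ {C c P} → (∀ s₂ (pd : Peeled s₂) s₃ → At.Arrays s₂ pd s₃ → At.Labels s₂ pd m s₃ →
      (∀ x → writesS x (initialize ⨾ peel) ≡ false → writesS x labelling ≡ false → scalar s₃ x ≡ scalar (input Ξ) x) → Ends C s₃ c P) →
    Ends (initialize ⨾ peel ⨾ labelling ⨾ C) (input Ξ) (prepareTime n m c) P
  with-labels k = prepare initial (λ s₂ pd fA fS → ends-seq (ends-framed
    (At.labelling-ends s₂ pd (fS 1 refl) (record { I≡ = fA 2 refl ; J≡ = fA 3 refl ; X≡ = refl ; Q≡ = refl ; D≡ = refl
      ; F≡ = refl ; IN≡ = refl ; OUT≡ = refl })
      (λ a i p → trans (cong (λ f → f i) (fA a (later-zero a p))) (Initial.zero-array initial a i (≤-trans (≤ᵇ⇒≤ 4 12 _) p)))))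
    (λ s₃ ((ar , L) , (gA , gS)) → k s₂ pd s₃ ar L (λ x w w′ → trans (gS x w′) (fS x w))))

  -- The elimination order is taken from the final memory of a peeling run.
  m≤n : m ≤ n
  m≤n = ends-elim (prepare {C = skip} {P = Peeled} initial (λ s pd _ _ → ends-wp skip pd))
    (λ s pd → Ends-of.m≤n (Peeled.order pd) (array s 8))

  -- Both lengths are the total of the same computed flow.
  lengths : ∀ {ℓ ℓ′} → ReconfigurationSequence Ξ ℓ → ReconfigurationSequence Ξ ℓ′ → ℓ ≡ ℓ′
  lengths R R′ = ends-elim (prepare {C = skip} {P = Peeled} initial (λ s pd _ _ → ends-wp skip pd))
    (λ s pd → trans (sym (proj₂ (proj₂ (proj₂ (At.sequence-plan s pd R))))) (proj₂ (proj₂ (proj₂ (At.sequence-plan s pd R′)))))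

  decide-ends : Ends decide (input Ξ) (decideTime n m) (AnswersReconfigurability Ξ)
  decide-ends = with-labels (λ s₂ pd s₃ ar L fS → ends-weaken ≤-refl (answers s₂ pd s₃ ar L (fS 1 refl refl))
    (Checks.checks-end (Peeled.order pd) (array s₂ 8) (array s₂ 9) (array s₂ 10) (array s₂ 11) I J (array s₃ 14) (array s₃ 16)
      (record { ar = ar ; sS≡ = refl ; sT≡ = refl }) (fS 0 refl refl) (fS 1 refl refl) (fS 7 refl refl)))
    where
    answers : ∀ s₂ pd s₃ ar L → scalar s₃ 1 ≡ m → ∀ s₄ →
      (scalar s₄ 0 ≡ 1 × At.Sound s₂ pd (array s₃ 14) (array s₃ 16)) ⊎ (scalar s₄ 0 ≡ 0 × ¬ At.Sound s₂ pd (array s₃ 14) (array s₃ 16)) →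
      AnswersReconfigurability Ξ s₄
    answers s₂ pd s₃ ar L e s₄ (inj₁ (p , sound)) = inj₁ (p , At.Labelled-at.sound⇒reconfigurable s₂ pd ar L e sound)
    answers s₂ pd s₃ ar L e s₄ (inj₂ (p , ¬sound)) = inj₂ (p , λ r → ¬sound (At.Labelled-at.reconfigurable⇒sound s₂ pd ar L r))

  construct-ends : Reconfigurable Ξ → Ends construct (input Ξ) (constructTime n m) (OutputsSequence Ξ)
  construct-ends r = with-labels (λ s₂ pd s₃ ar L fS → run s₂ pd s₃ ar L (fS 1 refl refl))
    where
    run : ∀ s₂ pd s₃ ar L → scalar s₃ 1 ≡ m → Ends _ s₃ _ (OutputsSequence Ξ)
    run s₂ pd s₃ ar L e = ends-seq {P = _≡ ⟨ update (scalar s₃) 17 0 , array s₃ ⟩} (ends-wp (17 ≔ lit 0) refl) (λ { _ refl →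
      ends-seq {P = _≡ s₄} (ends-wp (16 ≔ lit 1) refl) (λ { _ refl →
      ends-seq (rounds-end (rounds-start e (reconfigurable⇒sound r))) (λ s₅ (P , H , done) →
      ends-wp (0 ≔ var 17) (sequence-output {s₅} P H done)) }) })
      where
      open At s₂ pd
      open Labelled-at ar L

  input-scalar : 1 ≤ n → ∀ x → scalar (input Ξ) x ≤ n
  input-scalar p 0 = ≤-refl
  input-scalar p 1 = m≤n
  input-scalar p (suc (suc _)) = z≤n

  input-array : 1 ≤ n → ∀ a i → array (input Ξ) a i ≤ n
  input-array p 0 = entry-≤ _ (λ a → <⇒≤ (Fin.toℕ<n (proj₁ a))) (arcs (graph Ξ))
  input-array p 1 = entry-≤ _ (λ a → <⇒≤ (Fin.toℕ<n (proj₂ a))) (arcs (graph Ξ))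
  input-array p 2 i = ≤-trans (χ≤1 (source Ξ) i) p
  input-array p 3 i = ≤-trans (χ≤1 (target Ξ) i) p
  input-array p (suc (suc (suc (suc _)))) i = z≤n

-- Linear and quadratic time bounds

-- Bounds are composed along the shape of the time functions, so the constants need not be written
-- out.
Linear Quadratic : (ℕ → ℕ → ℕ) → Set
Linear    f = ∃[ c ] (∀ n m → 1 ≤ n → m ≤ n → f n m ≤ c * n)
Quadratic f = ∃[ c ] (∀ n m → 1 ≤ n → m ≤ n → f n m ≤ c * (n * n))

linear-const : ∀ k → Linear (λ _ _ → k)
linear-const k = k , λ n m p _ → m≤m*n k n {{>-nonZero p}}

linear-+ : ∀ {f g} → Linear f → Linear g → Linear (λ n m → f n m + g n m)
linear-+ (a , p) (b , q) = a + b , λ n m x y →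
  ≤-trans (+-mono-≤ (p n m x y) (q n m x y)) (≤-reflexive (sym (*-distribʳ-+ n a b)))

linear-* : ∀ {f} → Linear f → ∀ c → Linear (λ n m → f n m * c)
linear-* (a , p) c = a * c , λ n m x y → ≤-trans (*-monoˡ-≤ c (p n m x y))
  (≤-reflexive (trans (*-assoc a n c) (trans (cong (a *_) (*-comm n c)) (sym (*-assoc a c n)))))

linear-n : Linear (λ n _ → n)
linear-n = 1 , λ n _ _ _ → ≤-reflexive (sym (*-identityˡ n))

linear-m : Linear (λ _ m → m)
linear-m = 1 , λ n _ _ y → ≤-trans y (≤-reflexive (sym (*-identityˡ n)))

linear-suc : ∀ {f} → Linear f → Linear (λ n m → suc (f n m))
linear-suc = linear-+ (linear-const 1)

linear⇒quadratic : ∀ {f} → Linear f → Quadratic f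
linear⇒quadratic (a , p) = a , λ n m x y → ≤-trans (p n m x y) (*-monoʳ-≤ a (m≤m*n n n {{>-nonZero x}}))

quadratic-+ : ∀ {f g} → Quadratic f → Quadratic g → Quadratic (λ n m → f n m + g n m)
quadratic-+ (a , p) (b , q) = a + b , λ n m x y →
  ≤-trans (+-mono-≤ (p n m x y) (q n m x y)) (≤-reflexive (sym (*-distribʳ-+ (n * n) a b)))

quadratic-* : ∀ {f g} → Linear f → Linear g → Quadratic (λ n m → f n m * g n m)
quadratic-* (a , p) (b , q) = a * b , λ n m x y → ≤-trans (*-mono-≤ (p n m x y) (q n m x y))
  (≤-reflexive ([m*n]*[o*p]≡[m*o]*[n*p] a n b n))

abstract
  decide-linear : Linear decideTime
  decide-linear = linear-+ (linear-+ (linear-const 2) (linear-* (linear-suc linear-m) 40))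
    (linear-+ (linear-+ (linear-const 6) (linear-* (linear-suc (linear-+ linear-m (linear-suc linear-n))) (6 + steps peelBody)))
    (linear-+ (linear-+ (linear-const 2) (linear-* (linear-suc linear-m) (4 + steps labelStep)))
    (linear-+ (linear-+ (linear-const 2) (linear-* (linear-suc linear-n) (4 + steps vertexStep)))
    (linear-+ (linear-+ (linear-const 2) (linear-* (linear-suc linear-m) (4 + steps arcStep))) (linear-const 4)))))

  round-linear : Linear roundTime
  round-linear = linear-+ (linear-const 2) (linear-+ (linear-const 2) (linear-+ (linear-const 2) (linear-+ (linear-const 2)
    (linear-+ (linear-* (linear-suc linear-m) (2 + steps walkStep)) (linear-* (linear-suc linear-m) (4 + steps slideStep))))))

  construct-quadratic : Quadratic constructTime
  construct-quadratic = quadratic-+ (linear⇒quadratic (linear-+ (linear-const 2) (linear-* (linear-suc linear-m) 40)))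
    (quadratic-+ (linear⇒quadratic (linear-+ (linear-const 6) (linear-* (linear-suc (linear-+ linear-m (linear-suc linear-n))) (6 + steps peelBody))))
    (quadratic-+ (linear⇒quadratic (linear-+ (linear-const 2) (linear-* (linear-suc linear-m) (4 + steps labelStep))))
    (quadratic-+ (linear⇒quadratic (linear-const 2)) (quadratic-+ (linear⇒quadratic (linear-const 2))
    (quadratic-+ (quadratic-* (linear-suc (linear-suc linear-n)) (linear-+ (linear-const 2) round-linear)) (linear⇒quadratic (linear-const 2)))))))

c₁ c₂ : ℕ
c₁ = proj₁ decide-linear
c₂ = proj₁ construct-quadratic

module Bounded {n} (X : Instance n) (polytree : IsPolytree (graph X)) where
  open Solve X polytree

  1≤n : 1 ≤ n
  1≤n = >-nonZero⁻¹ n {{IsPolytree.nonempty polytree}}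

  decides : HaltsWithin (suc n ^ (2 * c₁ + 8)) (c₁ * n) decide (input X) (AnswersReconfigurability X)
  decides = halts-within {c = c₁} decide-tame 1≤n (input-scalar 1≤n) (input-array 1≤n) (*-monoʳ-≤ c₁ (m≤m*n n n {{>-nonZero 1≤n}}))
    (ends-weaken (proj₂ decide-linear n _ 1≤n m≤n) (λ _ p → p) decide-ends)

  constructs : Reconfigurable X → HaltsWithin (suc n ^ (2 * c₂ + 8)) (c₂ * (n * n)) construct (input X) (OutputsSequence X)
  constructs r = halts-within {c = c₂} construct-tame 1≤n (input-scalar 1≤n) (input-array 1≤n) ≤-refl
    (ends-weaken (proj₂ construct-quadratic n _ 1≤n m≤n) (λ _ p → p) (construct-ends r))

theorem4p1 : (Σ[ C ∈ Cmd ] Σ[ k ∈ ℕ ] Σ[ c ∈ ℕ ]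
    (∀ n (X : Instance n) → IsPolytree (graph X) →
    HaltsWithin (suc n ^ k) (c * n) C (input X) (AnswersReconfigurability X)))
    ×
    (∀ n (X : Instance n) → IsPolytree (graph X) →
    ∀ ℓ ℓ′ → ReconfigurationSequence X ℓ → ReconfigurationSequence X ℓ′ → ℓ ≡ ℓ′)
    ×
    (Σ[ C ∈ Cmd ] Σ[ k ∈ ℕ ] Σ[ c ∈ ℕ ]
    (∀ n (X : Instance n) → IsPolytree (graph X) → Reconfigurable X →
    HaltsWithin (suc n ^ k) (c * (n * n)) C (input X) (OutputsSequence X)))
theorem4p1 =
  ( decide , 2 * c₁ + 8 , c₁ , λ n X polytree → Bounded.decides X polytree)
  , (λ n X polytree ℓ ℓ′ → Solve.lengths X polytree)
  , ( construct , 2 * c₂ + 8 , c₂ , λ n X polytree → Bounded.constructs X polytree)
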